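{- Almost all triple systems with vertex set $[n]$ and independent neighborhoods are semi-bipartite. More precisely, writing $I(n)$ for the number of triple systems on vertex set $[n]$ with independent neighborhoods and $S(n)$ for the number of semi-bipartite triple systems on vertex set $[n]$, there is a constant $C$ such that for all sufficiently large $n$ $$(1+2^{ -4n})\,S(n) \;<\; I(n) \;<\; (1+C\cdot 2^{ -n/10})\,S(n).$$
   Context: A triple system (3-graph) on vertex set $[n]=\{1,\dots,n\}$ is a set $\mathcal{H}$ of 3-element subsets (edges) of $[n]$; all triple systems counted are labeled. For vertices $x,y$, the neighborhood of the pair $\{x,y\}$ is $\{z : \{x,y,z\}\in\mathcal{H}\}$. A set of vertices is independent if it contains no edge of $\mathcal{H}$. $\mathcal{H}$ has independent neighborhoods if for every pair $x,y$ the neighborhood of $\{x,y\}$ is independent. $\mathcal{H}$ is semi-bipartite if there is an ordered partition $(X,Y)$ of its vertex set such that every edge has exactly two vertices in $X$ (equivalently exactly one vertex in $Y$). -}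

module Defs where

open import Data.Nat using (ℕ; zero; suc; _+_)
open import Data.Fin using (Fin)
open import Data.Fin.Properties using (_<?_; _≟_; any?; all?)
open import Data.Fin.Subset using (Subset; _∈_; inside; outside)
open import Data.Fin.Subset.Properties using (_∈?_; anySubset?)
open import Data.Vec using (_∷_; [])
open import Data.List using (List; length; lookup; allFin; concatMap; map; filter)
open import Data.Product using (_×_; _,_; ∃-syntax)
open import Data.Sum using (_⊎_)
open import Relation.Nullary using (¬_; Dec; yes; no; does)
open import Relation.Nullary.Decidable using (_×-dec_; _⊎-dec_; _→-dec_; ¬?)
open import Relation.Binary.PropositionalEquality using (_≡_; _≢_)
open import Data.Nat.Properties using () renaming (_≟_ to _≟ℕ_)
open import Data.Bool using (if_then_else_)

-- All strictly increasing triples (i , j , k), i < j < k, of vertices: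
-- these are in bijection with the 3-element subsets of [n].
allTriples : (n : ℕ) → List (Fin n × Fin n × Fin n)
allTriples n =
  concatMap (λ i → concatMap (λ j → map (λ k → (i , j , k)) (allFin n)) (allFin n)) (allFin n)

Triples : (n : ℕ) → List (Fin n × Fin n × Fin n)
Triples n = filter (λ { (i , j , k) → (i <? j) ×-dec (j <? k) }) (allTriples n)

N3 : ℕ → ℕ
N3 n = length (Triples n)

-- A triple system on [n]: a set of 3-element subsets of [n], i.e. a subset
-- of the list of all 3-element subsets.
TripleSystem : ℕ → Set
TripleSystem n = Subset (N3 n)

_∈₃_ : ∀ {n} → Fin n → Fin n × Fin n × Fin n → Set
a ∈₃ (i , j , k) = (a ≡ i) ⊎ (a ≡ j) ⊎ (a ≡ k)

-- {a , b , c} is an edge of H: a, b, c are distinct and the 3-set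
-- {a , b , c} is (as a set) one of the triples chosen by H.
Edge : ∀ n → TripleSystem n → Fin n → Fin n → Fin n → Set
Edge n H a b c =
  (a ≢ b) × (b ≢ c) × (a ≢ c) ×
  ∃[ p ] (p ∈ H × a ∈₃ lookup (Triples n) p × b ∈₃ lookup (Triples n) p × c ∈₃ lookup (Triples n) p)

IndependentNeighborhoods : ∀ n → TripleSystem n → Set
IndependentNeighborhoods n H =
  (x y a b c : Fin n) → Edge n H x y a → Edge n H x y b → Edge n H x y c → ¬ Edge n H a b c

[_∈_] : ∀ {n} → Fin n → Subset n → ℕ
[ a ∈ X ] = if does (a ∈? X) then 1 else 0

SemiBipartite : ∀ n → TripleSystem n → Set
SemiBipartite n H =
  ∃[ X ] ((a b c : Fin n) → Edge n H a b c → [ a ∈ X ] + [ b ∈ X ] + [ c ∈ X ] ≡ 2)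

∈₃? : ∀ {n} (a : Fin n) t → Dec (a ∈₃ t)
∈₃? a (i , j , k) = (a ≟ i) ⊎-dec ((a ≟ j) ⊎-dec (a ≟ k))

Edge? : ∀ n (H : TripleSystem n) a b c → Dec (Edge n H a b c)
Edge? n H a b c =
  ¬? (a ≟ b) ×-dec ¬? (b ≟ c) ×-dec ¬? (a ≟ c) ×-dec
  any? (λ p → (p ∈? H) ×-dec ∈₃? a (lookup (Triples n) p) ×-dec
              ∈₃? b (lookup (Triples n) p) ×-dec ∈₃? c (lookup (Triples n) p))

IndependentNeighborhoods? : ∀ n (H : TripleSystem n) → Dec (IndependentNeighborhoods n H)
IndependentNeighborhoods? n H =
  all? λ x → all? λ y → all? λ a → all? λ b → all? λ c →
    Edge? n H x y a →-dec (Edge? n H x y b →-dec (Edge? n H x y c →-dec ¬? (Edge? n H a b c)))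

SemiBipartite? : ∀ n (H : TripleSystem n) → Dec (SemiBipartite n H)
SemiBipartite? n H = anySubset? λ X →
  all? λ a → all? λ b → all? λ c →
    Edge? n H a b c →-dec (([ a ∈ X ] + [ b ∈ X ] + [ c ∈ X ]) ≟ℕ 2)

count : (m : ℕ) (P : Subset m → Set) → ((s : Subset m) → Dec (P s)) → ℕ
count zero P P? with P? []
... | yes _ = 1
... | no _ = 0
count (suc m) P P? =
  count m (λ s → P (inside ∷ s)) (λ s → P? (inside ∷ s)) +
  count m (λ s → P (outside ∷ s)) (λ s → P? (outside ∷ s))

I : ℕ → ℕ
I n = count (N3 n) (IndependentNeighborhoods n) (IndependentNeighborhoods? n)

S : ℕ → ℕ
S n = count (N3 n) (SemiBipartite n) (SemiBipartite? n)

{-# OPTIONS --safe #-}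
-- Upper bound. A container lemma covers all systems with independent neighbourhoods by 2^O(n²) containers with few
-- copies of F, the configuration of an edge inside a neighbourhood, and a flag algebra certificate shows that a
-- container of density near 4/9 is nearly semi-bipartite; sparser ones hold too few systems to matter. For a best
-- partition X, Y, either some vertex has a link that lies, up to few errors, in a set of at most (2/9 - ε) n² pairs
-- decodable from O(n log n) bits and the rest of the system, and such systems are negligible by induction on n, or all
-- edges meet X in one or two vertices and the set G of pairs in X × Y that lie in an edge with two vertices in Y has
-- small degrees. Each pair of G then costs about 2n/3 free triples, and |G| ≥ 2 outweighs the 2^n choices of X.
-- Lower bound. Take an optimal partition, an edge {x, y, y′} with y, y′ in Y, and six edges that exclude every
-- partition; all but 2n + O(1) of the triples with two vertices in X remain free.
module Submission where

open import Defs
open import Data.Nat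
open import Data.Nat.Properties hiding (_≟_; _≤?_; _<?_)
open import Data.Nat.Tactic.RingSolver using (solve-∀)
open import Data.Bool using (Bool; true; false; _∧_; _∨_; not; if_then_else_; T; _xor_)
open import Data.Bool.Properties using (∧-comm; ∧-assoc; ∨-comm; ∧-zeroʳ; ∧-identityʳ; ∨-zeroʳ; not-involutive)
open import Data.Fin using (Fin; zero; suc; toℕ; fromℕ<; punchIn; punchOut; _↑ˡ_; _↑ʳ_; splitAt)
import Data.Fin.Properties as Finₚ
open import Data.Fin.Subset using (Subset; ∣_∣)
import Data.Fin.Subset.Properties as Subₚ
open import Data.Vec using (Vec; []; _∷_) renaming (lookup to lookupᵥ; tabulate to tabulateᵥ)
import Data.Vec.Properties as Vecₚ
open import Data.List using (List; []; _∷_; length; map; concatMap; filter; allFin; _++_) renaming (lookup to lookupₗ)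
import Data.List.Properties as Listₚ
open import Data.List.Membership.Propositional using () renaming (_∈_ to _∈ₗ_)
import Data.List.Membership.Propositional.Properties as Memₚ
open import Data.List.Relation.Unary.Any using (Any; here; there)
open import Data.List.Relation.Unary.All using (All; []; _∷_)
import Data.List.Relation.Unary.All as All
open import Data.Product using (Σ; _×_; _,_; proj₁; proj₂; ∃; ∃-syntax)
open import Data.Sum using (_⊎_; inj₁; inj₂)
open import Data.Empty using (⊥; ⊥-elim)
open import Data.Unit using (⊤; tt)
open import Function using (_∘_; id; case_of_)
open import Relation.Nullary using (¬_; Dec; yes; no; does; contradiction)
open import Relation.Nullary.Decidable using (dec-true; dec-false)
open import Relation.Binary.PropositionalEquality using (_≡_; _≢_; refl; sym; trans; cong; cong₂; subst; subst₂; module ≡-Reasoning)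
import Data.List.Relation.Unary.Unique.Propositional as Unique
import Data.List.Relation.Unary.Unique.Propositional.Properties as Uniqueₚ
import Data.List.Relation.Unary.AllPairs as AllPairs
import Data.List.Relation.Unary.AllPairs.Properties as AllPairsₚ
import Data.List.Relation.Unary.All.Properties as Allₚ
import Data.List.Relation.Unary.Any as Any
import Data.List.Relation.Unary.Any.Properties as Anyₚ
open import Relation.Nullary.Decidable using (_×-dec_; ¬?)
open import Relation.Binary.Definitions using (tri<; tri≈; tri>)

-- Ratios are written without fractions: `D * a ≤ b` stands for a ≤ b/D. A bound on a number of
-- systems is a list of that length containing them all. The containers are sets of vertices, one
-- for each neighbourhood. How many different ones occur is bounded independently of n, so naming
-- one for every pair takes O(n²) bits, little on the scale n³ of `largest`. A deviant vertex is
-- hard to treat because its link has to be confined by data that do not involve its own edges. Each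
-- kind of deviation lets F-freeness expel n²/D pairs from the link, and the expelled pairs are
-- found without looking at the vertex. This leaves `I` (n - 1) choices for the rest and 2^((2/9 -
-- ε) n²) for the link, while `largest` grows by about 2n²/9. Hence even the crude hypothesis
-- `I n ≤ 2 ^ (C + (2 * n + largest n))` suffices, with a `C` that the induction step preserves. The
-- rate 1/10 is limited by systems with two crossing pairs: they lose about 4n/3 free triples
-- against n bits for X, and the remaining n/3 must pay for all entropy terms. The estimates keep
-- 20n/128, which exceeds n/10.

-- Finite sums over `Fin n`, their exchange and averaging.

module Sums where
 𝟙 : Bool → ℕ
 𝟙 true  = 1
 𝟙 false = 0

 +-interchange : ∀ a b c d → (a + b) + (c + d) ≡ (a + c) + (b + d)
 +-interchange = solve-∀

 abstract
   ∑ : ∀ {n} → (Fin n → ℕ) → ℕ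
   ∑ {zero}  f = 0
   ∑ {suc n} f = f zero + ∑ (f ∘ suc)

   ∑-cong : ∀ {n} {f g : Fin n → ℕ} → (∀ i → f i ≡ g i) → ∑ f ≡ ∑ g
   ∑-cong {zero}  e = refl
   ∑-cong {suc n} e = cong₂ _+_ (e zero) (∑-cong (e ∘ suc))

   ∑-mono : ∀ {n} {f g : Fin n → ℕ} → (∀ i → f i ≤ g i) → ∑ f ≤ ∑ g
   ∑-mono {zero}  e = z≤n
   ∑-mono {suc n} e = +-mono-≤ (e zero) (∑-mono (e ∘ suc))

   ∑-+ : ∀ {n} (f g : Fin n → ℕ) → ∑ (λ i → f i + g i) ≡ ∑ f + ∑ g
   ∑-+ {zero}  f g = refl
   ∑-+ {suc n} f g = trans (cong (f zero + g zero +_) (∑-+ (f ∘ suc) (g ∘ suc)))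
                           (+-interchange (f zero) (g zero) (∑ (f ∘ suc)) (∑ (g ∘ suc)))

   ∑-*ˡ : ∀ {n} k (f : Fin n → ℕ) → ∑ (λ i → k * f i) ≡ k * ∑ f
   ∑-*ˡ {zero}  k f = sym (*-zeroʳ k)
   ∑-*ˡ {suc n} k f = trans (cong (k * f zero +_) (∑-*ˡ k (f ∘ suc))) (sym (*-distribˡ-+ k _ _))

   ∑-const : ∀ {n} k → ∑ {n} (λ _ → k) ≡ n * k
   ∑-const {zero}  k = refl
   ∑-const {suc n} k = cong (k +_) (∑-const {n} k)

   ∑-zero : ∀ {n} {f : Fin n → ℕ} → (∀ i → f i ≡ 0) → ∑ f ≡ 0
   ∑-zero {n} e = trans (∑-cong e) (trans (∑-const {n} 0) (*-zeroʳ n))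

   ∑-swap : ∀ {m n} (f : Fin m → Fin n → ℕ) → ∑ (λ i → ∑ (f i)) ≡ ∑ (λ j → ∑ (λ i → f i j))
   ∑-swap {zero}  {n} f = sym (∑-zero {n} (λ _ → refl))
   ∑-swap {suc m} {n} f = trans (cong (∑ (f zero) +_) (∑-swap (f ∘ suc)))
                                (sym (∑-+ (f zero) (λ j → ∑ (λ i → f (suc i) j))))

   term≤∑ : ∀ {n} (f : Fin n → ℕ) i → f i ≤ ∑ f
   term≤∑ f zero    = m≤m+n _ _
   term≤∑ f (suc i) = ≤-trans (term≤∑ (f ∘ suc) i) (m≤n+m _ _)

   ∑-<⇒∃ : ∀ {n} (f g : Fin n → ℕ) → ∑ f < ∑ g → ∃[ i ] f i < g i
   ∑-<⇒∃ {zero} f g ()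
   ∑-<⇒∃ {suc n} f g lt with f zero Data.Nat.<? g zero
   ... | yes p = zero , p
   ... | no ¬p = let i , q = ∑-<⇒∃ (f ∘ suc) (g ∘ suc)
                               (+-cancelˡ-< (f zero) _ _ (<-≤-trans lt (+-monoˡ-≤ _ (≮⇒≥ ¬p))))
                 in suc i , q

   ∑-unfold : ∀ {n} (f : Fin (suc n) → ℕ) → ∑ f ≡ f zero + ∑ (f ∘ suc)
   ∑-unfold f = refl

   ∑-empty : (f : Fin 0 → ℕ) → ∑ f ≡ 0
   ∑-empty f = refl

 ∑-*ʳ : ∀ {n} k (f : Fin n → ℕ) → ∑ (λ i → f i * k) ≡ ∑ f * k
 ∑-*ʳ k f = trans (∑-cong (λ i → *-comm (f i) k)) (trans (∑-*ˡ k f) (*-comm k (∑ f)))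

 ∑-≤const : ∀ {n} {f : Fin n → ℕ} k → (∀ i → f i ≤ k) → ∑ f ≤ n * k
 ∑-≤const {n} k e = ≤-trans (∑-mono e) (≤-reflexive (∑-const {n} k))

 ∑-suc : ∀ {n} (g : Fin n → ℕ) → ∑ (suc ∘ g) ≡ n + ∑ g
 ∑-suc {n} g = trans (∑-+ (λ _ → 1) g) (cong (_+ ∑ g) (trans (∑-const {n} 1) (*-identityʳ n)))

 -- Adding one to every term of `g` makes the inequality strict, because the index set is nonempty.
 ∑-≤⇒∃ : ∀ {n} (f g : Fin (suc n) → ℕ) → ∑ f ≤ ∑ g → ∃[ i ] f i ≤ g i
 ∑-≤⇒∃ {n} f g le =
   let i , q = ∑-<⇒∃ f (suc ∘ g) (subst (suc (∑ f) ≤_) (sym (∑-suc g)) (s≤s (≤-trans le (m≤n+m (∑ g) n))))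
   in i , s≤s⁻¹ q

 𝟙≤1 : ∀ b → 𝟙 b ≤ 1
 𝟙≤1 true  = ≤-refl
 𝟙≤1 false = z≤n

 𝟙-∧ : ∀ a b → 𝟙 (a ∧ b) ≡ 𝟙 a * 𝟙 b
 𝟙-∧ true  b = sym (+-identityʳ (𝟙 b))
 𝟙-∧ false b = refl

 𝟙-∨ : ∀ a b → 𝟙 (a ∨ b) ≤ 𝟙 a + 𝟙 b
 𝟙-∨ true  b = s≤s z≤n
 𝟙-∨ false b = ≤-refl

 𝟙-split : ∀ a b → 𝟙 a ≡ 𝟙 (a ∧ b) + 𝟙 (a ∧ not b)
 𝟙-split true  true  = refl
 𝟙-split true  false = refl
 𝟙-split false _     = refl

 𝟙-mono : ∀ {a b} → (a ≡ true → b ≡ true) → 𝟙 a ≤ 𝟙 b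
 𝟙-mono {true}  f rewrite f refl = ≤-refl
 𝟙-mono {false} f = z≤n

 𝟙*-mono : ∀ {b m n} → (b ≡ true → m ≤ n) → 𝟙 b * m ≤ 𝟙 b * n
 𝟙*-mono {true}  f = *-monoʳ-≤ 1 (f refl)
 𝟙*-mono {false} f = z≤n

 ∧-true : ∀ {a b} → a ∧ b ≡ true → a ≡ true × b ≡ true
 ∧-true {true} {true} _ = refl , refl

 bool-case : ∀ {A : Set} b → (b ≡ true → A) → (b ≡ false → A) → A
 bool-case true  f g = f refl
 bool-case false f g = g refl

 ∧-false : ∀ {a b} → a ∧ b ≡ false → a ≡ false ⊎ b ≡ false
 ∧-false {false} _ = inj₁ refl
 ∧-false {true}  e = inj₂ e

 ∧-intro : ∀ {a b} → a ≡ true → b ≡ true → a ∧ b ≡ true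
 ∧-intro refl refl = refl

 bool-ext : ∀ {a b} → (a ≡ true → b ≡ true) → (b ≡ true → a ≡ true) → a ≡ b
 bool-ext {true}  f g = sym (f refl)
 bool-ext {false} {true}  f g = g refl
 bool-ext {false} {false} f g = refl

 not-true : ∀ {a} → not a ≡ true → a ≡ false
 not-true {false} _ = refl

 ¬true⇒false : ∀ {a} → ¬ (a ≡ true) → a ≡ false
 ¬true⇒false {true}  f = ⊥-elim (f refl)
 ¬true⇒false {false} f = refl

 true≢false : ∀ {a} → a ≡ true → a ≡ false → ⊥
 true≢false refl ()

 ≤ᵇ-true : ∀ {m n} → (m ≤ᵇ n) ≡ true → m ≤ n
 ≤ᵇ-true {m} {n} e = ≤ᵇ⇒≤ m n (subst T (sym e) tt)

 ≤ᵇ-intro : ∀ {m n} → m ≤ n → (m ≤ᵇ n) ≡ true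
 ≤ᵇ-intro {m} {n} p with m ≤ᵇ n | ≤⇒≤ᵇ p
 ... | true | _ = refl

 ≤ᵇ-false : ∀ {m n} → (m ≤ᵇ n) ≡ false → n < m
 ≤ᵇ-false {m} {n} e = ≰⇒> (λ p → true≢false (≤ᵇ-intro p) e)

 ∣_∣ₚ : ∀ {n} → (Fin n → Bool) → ℕ
 ∣ A ∣ₚ = ∑ (λ i → 𝟙 (A i))

 ∣∣ₚ-≤ : ∀ {n} (A : Fin n → Bool) → ∣ A ∣ₚ ≤ n
 ∣∣ₚ-≤ {n} A = ≤-trans (∑-≤const 1 (λ i → 𝟙≤1 (A i))) (≤-reflexive (*-identityʳ n))

 ∑² : ∀ {n} → (Fin n → Fin n → ℕ) → ℕ
 ∑² f = ∑ (λ a → ∑ (f a))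

 ∑³ : ∀ {n} → (Fin n → Fin n → Fin n → ℕ) → ℕ
 ∑³ f = ∑ (λ a → ∑² (f a))

 ∑²-mono : ∀ {n} {f g : Fin n → Fin n → ℕ} → (∀ a b → f a b ≤ g a b) → ∑² f ≤ ∑² g
 ∑²-mono h = ∑-mono (λ a → ∑-mono (h a))

 ∑²-cong : ∀ {n} {f g : Fin n → Fin n → ℕ} → (∀ a b → f a b ≡ g a b) → ∑² f ≡ ∑² g
 ∑²-cong h = ∑-cong (λ a → ∑-cong (h a))

 ∑²-+ : ∀ {n} (f g : Fin n → Fin n → ℕ) → ∑² (λ a b → f a b + g a b) ≡ ∑² f + ∑² g
 ∑²-+ f g = trans (∑-cong (λ a → ∑-+ (f a) (g a))) (∑-+ _ _)

 ∑²-*ˡ : ∀ {n} k (f : Fin n → Fin n → ℕ) → ∑² (λ a b → k * f a b) ≡ k * ∑² f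
 ∑²-*ˡ k f = trans (∑-cong (λ a → ∑-*ˡ k (f a))) (∑-*ˡ k _)

 ∑³-mono : ∀ {n} {f g : Fin n → Fin n → Fin n → ℕ} → (∀ a b c → f a b c ≤ g a b c) → ∑³ f ≤ ∑³ g
 ∑³-mono h = ∑-mono (λ a → ∑²-mono (h a))

 ∑³-cong : ∀ {n} {f g : Fin n → Fin n → Fin n → ℕ} → (∀ a b c → f a b c ≡ g a b c) → ∑³ f ≡ ∑³ g
 ∑³-cong h = ∑-cong (λ a → ∑²-cong (h a))

 ∑³-+ : ∀ {n} (f g : Fin n → Fin n → Fin n → ℕ) → ∑³ (λ a b c → f a b c + g a b c) ≡ ∑³ f + ∑³ g
 ∑³-+ f g = trans (∑-cong (λ a → ∑²-+ (f a) (g a))) (∑-+ _ _)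

 ∑³-*ˡ : ∀ {n} k (f : Fin n → Fin n → Fin n → ℕ) → ∑³ (λ a b c → k * f a b c) ≡ k * ∑³ f
 ∑³-*ˡ k f = trans (∑-cong (λ a → ∑²-*ˡ k (f a))) (∑-*ˡ k _)

 ∑²-prod : ∀ {n} (f g : Fin n → ℕ) → ∑² (λ a b → f a * g b) ≡ ∑ f * ∑ g
 ∑²-prod f g = trans (∑-cong (λ a → ∑-*ˡ (f a) g)) (∑-*ʳ (∑ g) f)

 ∑²-≤const : ∀ {n} {f : Fin n → Fin n → ℕ} k → (∀ a b → f a b ≤ k) → ∑² f ≤ n * n * k
 ∑²-≤const {n} k h = ≤-trans (∑-≤const (n * k) (λ a → ∑-≤const k (h a))) (≤-reflexive (sym (*-assoc n n k)))

open Sums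

-- Containers for families of independent sets.

cub : ℕ → ℕ
cub n = n * n * n

module Container {n : ℕ} (h : Fin n → Fin n → Fin n → Bool) (D : ℕ) where

  edgesIn : (Fin n → Bool) → ℕ
  edgesIn K = ∑³ (λ a b c → 𝟙 ((K a ∧ K b) ∧ (K c ∧ h a b c)))

  Sparse : (Fin n → Bool) → Set
  Sparse K = D * edgesIn K ≤ cub n

  Indep : (Fin n → Bool) → Set
  Indep N = ∀ a b c → N a ≡ true → N b ≡ true → N c ≡ true → h a b c ≡ true → ⊥

  module Heavy (K : Fin n → Bool) where
    codeg : Fin n → Fin n → ℕ
    codeg a b = ∑ (λ c → 𝟙 (K c ∧ h a b c))

    -- A dense `K` has average codegree above n/D. A heavy pair reaches half of this average, and a
    -- vertex of `Vh` reaches half of the average heavy degree that results.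
    hv : Fin n → Fin n → Bool
    hv a b = (K a ∧ K b) ∧ (n ≤ᵇ 2 * D * codeg a b)

    hdeg : Fin n → ℕ
    hdeg a = ∑ (λ b → 𝟙 (hv a b))

    Vh : Fin n → Bool
    Vh a = K a ∧ (n ≤ᵇ 4 * D * hdeg a)

    -- The pairs that are not heavy carry at most half of the edges that density provides, and a
    -- heavy pair carries at most n of them.
    heavy-pairs : cub n < D * edgesIn K → n * n ≤ 2 * D * ∑² (λ a b → 𝟙 (hv a b))
    heavy-pairs dense = *-cancelʳ-≤ _ _ n ⦃ nz ⦄ (+-cancelʳ-≤ (cub n) _ _ (begin
        n * n * n + cub n ≤⟨ +-mono-≤ (<⇒≤ dense) (<⇒≤ dense) ⟩
        D * edgesIn K + D * edgesIn K ≡⟨ e₁ D (edgesIn K) ⟩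
        2 * D * edgesIn K ≡⟨ cong (2 * D *_) (∑²-cong inner) ⟩
        2 * D * ∑² (λ a b → 𝟙 (K a ∧ K b) * codeg a b) ≡⟨ sym (∑²-*ˡ (2 * D) _) ⟩
        ∑² (λ a b → 2 * D * (𝟙 (K a ∧ K b) * codeg a b)) ≤⟨ ∑²-mono pt ⟩
        ∑² (λ a b → 2 * D * n * 𝟙 (hv a b) + n) ≡⟨ ∑²-+ _ _ ⟩
        ∑² (λ a b → 2 * D * n * 𝟙 (hv a b)) + ∑² {n} (λ _ _ → n) ≤⟨ +-mono-≤ (≤-reflexive (∑²-*ˡ (2 * D * n) _)) (∑²-≤const n (λ _ _ → ≤-refl)) ⟩
        2 * D * n * ∑² (λ a b → 𝟙 (hv a b)) + cub n ≡⟨ cong (_+ cub n) (e₂ D n _) ⟩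
        2 * D * ∑² (λ a b → 𝟙 (hv a b)) * n + cub n ∎))
      where
      open ≤-Reasoning
      e₁ : ∀ D e → D * e + D * e ≡ 2 * D * e
      e₁ = solve-∀
      e₂ : ∀ D n s → 2 * D * n * s ≡ 2 * D * s * n
      e₂ = solve-∀
      nz : NonZero n
      nz = ≢-nonZero λ { refl → ≤⇒≯ (≤-reflexive (trans (cong (D *_) (∑-empty _)) (*-zeroʳ D))) (<-≤-trans (s≤s z≤n) dense) }
      inner : ∀ a b → ∑ (λ c → 𝟙 ((K a ∧ K b) ∧ (K c ∧ h a b c))) ≡ 𝟙 (K a ∧ K b) * codeg a b
      inner a b = trans (∑-cong (λ c → 𝟙-∧ (K a ∧ K b) (K c ∧ h a b c))) (∑-*ˡ (𝟙 (K a ∧ K b)) _)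
      pt : ∀ a b → 2 * D * (𝟙 (K a ∧ K b) * codeg a b) ≤ 2 * D * n * 𝟙 (hv a b) + n
      pt a b with K a ∧ K b
      ... | false = ≤-trans (≤-reflexive (*-zeroʳ (2 * D))) z≤n
      ... | true with n ≤ᵇ 2 * D * codeg a b in q
      ...   | true = ≤-trans (≤-trans (*-monoʳ-≤ (2 * D) (≤-trans (≤-reflexive (+-identityʳ _)) (∣∣ₚ-≤ _))) (≤-reflexive (sym (*-identityʳ _)))) (m≤m+n _ n)
      ...   | false = ≤-trans (≤-reflexive (cong (2 * D *_) (+-identityʳ (codeg a b)))) (≤-trans (<⇒≤ (≤ᵇ-false q)) (m≤n+m n _))

    hdeg-outside : ∀ a → K a ≡ false → hdeg a ≡ 0
    hdeg-outside a ka = ∑-zero (λ b → cong 𝟙 (outside-hv b))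
      where
      outside-hv : ∀ b → hv a b ≡ false
      outside-hv b rewrite ka = refl

    heavy-vertices : cub n < D * edgesIn K → n ≤ 4 * D * ∣ Vh ∣ₚ
    heavy-vertices dense with n Data.Nat.≟ 0
    ... | yes refl = z≤n
    ... | no n≢0 = *-cancelʳ-≤ _ _ n ⦃ ≢-nonZero n≢0 ⦄ (+-cancelʳ-≤ (n * n) _ _ (begin
        n * n + n * n ≤⟨ +-mono-≤ (heavy-pairs dense) (heavy-pairs dense) ⟩
        2 * D * ∑² (λ a b → 𝟙 (hv a b)) + 2 * D * ∑² (λ a b → 𝟙 (hv a b)) ≡⟨ e₁ D _ ⟩
        4 * D * ∑ hdeg ≡⟨ sym (∑-*ˡ (4 * D) hdeg) ⟩
        ∑ (λ a → 4 * D * hdeg a) ≤⟨ ∑-mono pt ⟩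
        ∑ (λ a → 4 * D * n * 𝟙 (Vh a) + n) ≡⟨ ∑-+ _ _ ⟩
        ∑ (λ a → 4 * D * n * 𝟙 (Vh a)) + ∑ {n} (λ _ → n) ≡⟨ cong₂ _+_ (∑-*ˡ (4 * D * n) _) (∑-const {n} n) ⟩
        4 * D * n * ∣ Vh ∣ₚ + n * n ≡⟨ cong (_+ n * n) (e₂ D n _) ⟩
        4 * D * ∣ Vh ∣ₚ * n + n * n ∎))
      where
      open ≤-Reasoning
      e₁ : ∀ D s → 2 * D * s + 2 * D * s ≡ 4 * D * s
      e₁ = solve-∀
      e₂ : ∀ D n s → 4 * D * n * s ≡ 4 * D * s * n
      e₂ = solve-∀
      pt : ∀ a → 4 * D * hdeg a ≤ 4 * D * n * 𝟙 (Vh a) + n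
      pt a with Vh a in q
      ... | true = ≤-trans (≤-trans (*-monoʳ-≤ (4 * D) (∣∣ₚ-≤ _)) (≤-reflexive (sym (*-identityʳ _)))) (m≤m+n _ n)
      ... | false with ∧-false {K a} q
      ...   | inj₁ ka = ≤-trans (≤-reflexive (trans (cong (4 * D *_) (hdeg-outside a ka)) (*-zeroʳ (4 * D)))) z≤n
      ...   | inj₂ r = ≤-trans (<⇒≤ (≤ᵇ-false r)) (m≤n+m n _)

    module _ (e : ℕ) where
      t₁ : (Fin n → Bool) → Fin n → Fin n → Bool
      t₁ N a b = hv a b ∧ (N a ∧ N b)

      t₂ : (Fin n → Bool) → Fin n → Bool
      t₂ N a = (Vh a ∧ N a) ∧ (e * ∑ (λ b → 𝟙 (N b ∧ hv a b)) ≤ᵇ n)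

      t₃ : (Fin n → Bool) → Bool
      t₃ N = e * ∑ (λ a → 𝟙 (N a ∧ Vh a)) ≤ᵇ n

      -- Either N has many heavy pairs, or it nearly avoids the heavy vertices, or many heavy vertices
      -- of N have few heavy neighbours in N.
      options : 1 ≤ e → ∀ N → n * n ≤ e * e * ∑² (λ a b → 𝟙 (t₁ N a b) + (𝟙 (t₂ N a) + 𝟙 (t₃ N)))
      options 1≤e N with t₃ N in q
      ... | true = begin
          n * n ≡⟨ sym (*-identityʳ (n * n)) ⟩
          n * n * 1 ≡⟨ cong (_* 1) (cong (n *_) (sym (*-identityʳ n))) ⟩
          n * (n * 1) * 1 ≡⟨ *-identityʳ _ ⟩
          n * (n * 1) ≡⟨ sym (trans (∑-cong (λ a → ∑-const {n} 1)) (∑-const {n} (n * 1))) ⟩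
          ∑² {n} (λ _ _ → 1) ≤⟨ ∑²-mono (λ a b → ≤-trans (m≤n+m 1 (𝟙 (t₂ N a))) (m≤n+m _ (𝟙 (t₁ N a b)))) ⟩
          tot ≡⟨ sym (*-identityˡ tot) ⟩
          1 * tot ≤⟨ *-monoˡ-≤ tot (*-mono-≤ 1≤e 1≤e) ⟩
          e * e * tot ∎
        where
        open ≤-Reasoning
        tot = ∑² (λ a b → 𝟙 (t₁ N a b) + (𝟙 (t₂ N a) + 1))
      ... | false = begin
          n * n ≤⟨ *-monoʳ-≤ n (<⇒≤ (≤ᵇ-false q)) ⟩
          n * (e * ∑ (λ a → 𝟙 (N a ∧ Vh a))) ≡⟨ x₁ n e _ ⟩
          e * (n * ∑ (λ a → 𝟙 (N a ∧ Vh a))) ≡⟨ cong (e *_) (sym (∑-*ˡ n _)) ⟩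
          e * ∑ (λ a → n * 𝟙 (N a ∧ Vh a)) ≤⟨ *-monoʳ-≤ e (∑-mono pt) ⟩
          e * ∑ (λ a → e * ∑ (λ b → 𝟙 (t₁ N a b) + (𝟙 (t₂ N a) + 0))) ≡⟨ cong (e *_) (∑-*ˡ e _) ⟩
          e * (e * tot) ≡⟨ sym (*-assoc e e tot) ⟩
          e * e * tot ∎
        where
        open ≤-Reasoning
        tot = ∑² (λ a b → 𝟙 (t₁ N a b) + (𝟙 (t₂ N a) + 0))
        x₁ : ∀ n e s → n * (e * s) ≡ e * (n * s)
        x₁ = solve-∀
        pt : ∀ a → n * 𝟙 (N a ∧ Vh a) ≤ e * ∑ (λ b → 𝟙 (t₁ N a b) + (𝟙 (t₂ N a) + 0))
        pt a with N a in na | Vh a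
        ... | false | _ = ≤-trans (≤-reflexive (*-zeroʳ n)) z≤n
        ... | true | false = ≤-trans (≤-reflexive (*-zeroʳ n)) z≤n
        ... | true | true with e * ∑ (λ b → 𝟙 (N b ∧ hv a b)) ≤ᵇ n in r
        ...   | true = begin
            n * 1 ≡⟨ sym (∑-const {n} 1) ⟩
            ∑ {n} (λ _ → 1) ≤⟨ ∑-mono {n} (λ b → m≤n+m 1 (𝟙 (hv a b ∧ N b))) ⟩
            ∑ (λ b → 𝟙 (hv a b ∧ N b) + 1) ≡⟨ sym (*-identityˡ _) ⟩
            1 * ∑ (λ b → 𝟙 (hv a b ∧ N b) + 1) ≤⟨ *-monoˡ-≤ (∑ (λ b → 𝟙 (hv a b ∧ N b) + 1)) 1≤e ⟩
            e * ∑ (λ b → 𝟙 (hv a b ∧ N b) + 1) ∎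
        ...   | false = begin
            n * 1 ≡⟨ *-identityʳ n ⟩
            n ≤⟨ <⇒≤ (≤ᵇ-false r) ⟩
            e * ∑ (λ b → 𝟙 (N b ∧ hv a b)) ≤⟨ *-monoʳ-≤ e (∑-mono (λ b → ≤-trans (≤-reflexive (cong 𝟙 (∧-comm (N b) (hv a b)))) (m≤m+n _ 0))) ⟩
            e * ∑ (λ b → 𝟙 (hv a b ∧ N b) + 0) ∎

  -- One deletion step for a whole family of independent sets at once. The same piece `Del` of `K`
  -- is removed for every covered pair, and the covered pairs are a fraction of `Q` that does not
  -- depend on n. This is what keeps the number of containers bounded.
  record Split (N : Fin n → Fin n → Fin n → Bool) (e : ℕ) (K : Fin n → Bool) (Q : Fin n → Fin n → Bool) : Set where
    field
      Del   : Fin n → Bool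
      cov   : Fin n → Fin n → Bool
      Del⊂K : ∀ v → Del v ≡ true → K v ≡ true
      large : n ≤ 4 * D * ∣ Del ∣ₚ
      small : ∀ x y → cov x y ≡ true → e * ∑ (λ v → 𝟙 (N x y v ∧ Del v)) ≤ n
      many  : ∑² (λ x y → 𝟙 (Q x y)) ≤ 3 * (e * e) * ∑² (λ x y → 𝟙 (Q x y ∧ cov x y))

  three-ways : ∀ q k A B C → q ≤ k * (A + (B + C)) → q ≤ 3 * k * A ⊎ (q ≤ 3 * k * B ⊎ q ≤ 3 * k * C)
  three-ways q k A B C le with q Data.Nat.≤? 3 * k * A | q Data.Nat.≤? 3 * k * B | q Data.Nat.≤? 3 * k * C
  ... | yes p | _ | _ = inj₁ p
  ... | no _ | yes p | _ = inj₂ (inj₁ p)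
  ... | no _ | no _ | yes p = inj₂ (inj₂ p)
  ... | no a | no b | no c = contradiction lt (<-irrefl refl)
    where
    x : ∀ k A B C → 3 * k * A + (3 * k * B + 3 * k * C) ≡ 3 * (k * (A + (B + C)))
    x = solve-∀
    y : ∀ q → q + (q + q) ≡ 3 * q
    y = solve-∀
    lt : 3 * q < 3 * q
    lt = ≤-<-trans (*-monoʳ-≤ 3 le) (subst₂ _<_ (x k A B C) (y q) (+-mono-< (≰⇒> a) (+-mono-< (≰⇒> b) (≰⇒> c))))

∑²-swap : ∀ {n} (f : Fin n → Fin n → Fin n → Fin n → ℕ) →
          ∑² (λ x y → ∑² (λ a b → f x y a b)) ≡ ∑² (λ a b → ∑² (λ x y → f x y a b))
∑²-swap f = trans (∑-cong (λ x → ∑-swap (λ y a → ∑ (f x y a))))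
           (trans (∑-swap (λ x a → ∑ (λ y → ∑ (f x y a))))
                  (∑-cong (λ a → trans (∑-cong (λ x → ∑-swap (λ y b → f x y a b)))
                                       (∑-swap (λ x b → ∑ (λ y → f x y a b))))))

∑²-≤⇒∃ : ∀ {n} → n ≢ 0 → (f g : Fin n → Fin n → ℕ) → ∑² f ≤ ∑² g → ∃[ a ] ∃[ b ] f a b ≤ g a b
∑²-≤⇒∃ {zero}  n≢0 f g le = ⊥-elim (n≢0 refl)
∑²-≤⇒∃ {suc n} n≢0 f g le = let a , p = ∑-≤⇒∃ (λ a → ∑ (f a)) (λ a → ∑ (g a)) le
                                b , q = ∑-≤⇒∃ (f a) (g a) p
                            in a , b , q

module _ {n : ℕ} (h : Fin n → Fin n → Fin n → Bool) (D : ℕ) where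
  open Container h D

  -- Averaging `options` over `Q` yields vertices a₀, b₀ and a single alternative that serves a
  -- fraction 1/(3e²) of `Q`. In the first alternative independence is used: a set that contains the
  -- heavy pair a₀ b₀ misses its whole neighbourhood. In the other two the deleted set is nearly
  -- avoided by definition.
  split : ∀ (N : Fin n → Fin n → Fin n → Bool) e K Q → 1 ≤ e → (∀ x y → Indep (N x y)) →
          cub n < D * edgesIn K → Split N e K Q
  split N e K Q 1≤e ind dense = let a₀ , b₀ , q₀ = found in pick a₀ b₀ (three-ways _ (e * e) (A a₀ b₀) (B a₀) C q₀)
    where
    open Heavy K
    n≢0 : n ≢ 0
    n≢0 refl = ≤⇒≯ (≤-reflexive (trans (cong (D *_) (∑-empty _)) (*-zeroʳ D))) (<-≤-trans (s≤s z≤n) dense)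
    ∣Q∣ = ∑² (λ x y → 𝟙 (Q x y))
    A : Fin n → Fin n → ℕ
    A a b = ∑² (λ x y → 𝟙 (Q x y ∧ t₁ e (N x y) a b))
    B : Fin n → ℕ
    B a = ∑² (λ x y → 𝟙 (Q x y ∧ t₂ e (N x y) a))
    C = ∑² (λ x y → 𝟙 (Q x y ∧ t₃ e (N x y)))
    u : Fin n → Fin n → Fin n → Fin n → ℕ
    u x y a b = 𝟙 (t₁ e (N x y) a b) + (𝟙 (t₂ e (N x y) a) + 𝟙 (t₃ e (N x y)))
    x₂ : ∀ q k s → q * (k * s) ≡ k * (q * s)
    x₂ = solve-∀
    dist : ∀ q a b c → 𝟙 q * (𝟙 a + (𝟙 b + 𝟙 c)) ≡ 𝟙 (q ∧ a) + (𝟙 (q ∧ b) + 𝟙 (q ∧ c))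
    dist true  a b c = +-identityʳ _
    dist false a b c = refl
    avg : ∑² {n} (λ a b → ∣Q∣) ≤ ∑² (λ a b → e * e * (A a b + (B a + C)))
    avg = begin
      ∑² {n} (λ a b → ∣Q∣) ≤⟨ ∑²-≤const ∣Q∣ (λ _ _ → ≤-refl) ⟩
      n * n * ∣Q∣ ≡⟨ sym (∑²-*ˡ (n * n) _) ⟩
      ∑² (λ x y → n * n * 𝟙 (Q x y)) ≤⟨ ∑²-mono (λ x y → ≤-trans (≤-reflexive (*-comm (n * n) (𝟙 (Q x y)))) (*-monoʳ-≤ (𝟙 (Q x y)) (options e 1≤e (N x y)))) ⟩
      ∑² (λ x y → 𝟙 (Q x y) * (e * e * ∑² (u x y))) ≡⟨ ∑²-cong (λ x y → x₂ (𝟙 (Q x y)) (e * e) _) ⟩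
      ∑² (λ x y → e * e * (𝟙 (Q x y) * ∑² (u x y))) ≡⟨ ∑²-*ˡ (e * e) _ ⟩
      e * e * ∑² (λ x y → 𝟙 (Q x y) * ∑² (u x y)) ≡⟨ cong (e * e *_) (∑²-cong (λ x y → sym (∑²-*ˡ (𝟙 (Q x y)) (u x y)))) ⟩
      e * e * ∑² (λ x y → ∑² (λ a b → 𝟙 (Q x y) * u x y a b)) ≡⟨ cong (e * e *_) (∑²-swap _) ⟩
      e * e * ∑² (λ a b → ∑² (λ x y → 𝟙 (Q x y) * u x y a b)) ≡⟨ cong (e * e *_) (∑²-cong (λ a b → ∑²-cong (λ x y → dist (Q x y) (t₁ e (N x y) a b) (t₂ e (N x y) a) (t₃ e (N x y))))) ⟩
      e * e * ∑² (λ a b → ∑² (λ x y → 𝟙 (Q x y ∧ t₁ e (N x y) a b) + (𝟙 (Q x y ∧ t₂ e (N x y) a) + 𝟙 (Q x y ∧ t₃ e (N x y)))))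
        ≡⟨ cong (e * e *_) (∑²-cong (λ a b → trans (∑²-+ _ _) (cong (A a b +_) (∑²-+ _ _)))) ⟩
      e * e * ∑² (λ a b → A a b + (B a + C)) ≡⟨ sym (∑²-*ˡ (e * e) _) ⟩
      ∑² (λ a b → e * e * (A a b + (B a + C))) ∎
      where open ≤-Reasoning
    found : ∃[ a ] ∃[ b ] ∣Q∣ ≤ e * e * (A a b + (B a + C))
    found = ∑²-≤⇒∃ n≢0 _ _ avg
    none : ∀ (f : Fin n → Bool) → (∀ v → f v ≡ true → ⊥) → e * ∑ (λ v → 𝟙 (f v)) ≤ n
    none f emp = ≤-trans (≤-reflexive (trans (cong (e *_) (∑-zero (λ v → cong 𝟙 (¬true⇒false (emp v))))) (*-zeroʳ e))) z≤n
    4D≥2D : ∀ s → n ≤ 2 * D * s → n ≤ 4 * D * s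
    4D≥2D s p = ≤-trans p (*-monoˡ-≤ s (*-monoˡ-≤ D {2} {4} (s≤s (s≤s z≤n))))
    -- If a₀ or the pair a₀ b₀ is not heavy, the alternative applies to no pair at all. Then `Q`
    -- itself is empty and any large deletion will do.
    vacuous : ∀ k (f : Fin n → Fin n → Bool) → (∀ x y → f x y ≡ true → ⊥) →
              ∣Q∣ ≤ k * ∑² (λ x y → 𝟙 (Q x y ∧ f x y)) → Split N e K Q
    vacuous k f emp p = record
      { Del = Vh ; cov = λ _ _ → false ; Del⊂K = λ v → proj₁ ∘ ∧-true
      ; large = heavy-vertices dense ; small = λ x y ()
      ; many = ≤-trans p (≤-trans (≤-reflexive (trans (cong (k *_) (∑-zero (λ x → ∑-zero (λ y →
          cong 𝟙 (¬true⇒false (λ m → emp x y (proj₂ (∧-true {Q x y} m)))))))) (*-zeroʳ k))) z≤n) }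
    pick : ∀ a₀ b₀ → ∣Q∣ ≤ 3 * (e * e) * A a₀ b₀ ⊎ (∣Q∣ ≤ 3 * (e * e) * B a₀ ⊎ ∣Q∣ ≤ 3 * (e * e) * C) → Split N e K Q
    pick a₀ b₀ (inj₁ p) = bool-case (hv a₀ b₀)
      (λ r → record
        { Del = λ c → K c ∧ h a₀ b₀ c
        ; cov = λ x y → t₁ e (N x y) a₀ b₀
        ; Del⊂K = λ v → proj₁ ∘ ∧-true
        ; large = 4D≥2D _ (≤ᵇ-true (proj₂ (∧-true {K a₀ ∧ K b₀} r)))
        ; small = λ x y c → none _ (λ v m → let nv , dv = ∧-true {N x y v} m
                                                na , nb = ∧-true {N x y a₀} (proj₂ (∧-true {hv a₀ b₀} c))
                                            in ind x y a₀ b₀ v na nb nv (proj₂ (∧-true {K v} dv)))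
        ; many = p })
      (λ r → vacuous (3 * (e * e)) (λ x y → t₁ e (N x y) a₀ b₀) (λ x y m → true≢false (proj₁ (∧-true {hv a₀ b₀} m)) r) p)
    pick a₀ b₀ (inj₂ (inj₁ p)) = bool-case (Vh a₀)
      (λ r → record
        { Del = hv a₀
        ; cov = λ x y → t₂ e (N x y) a₀
        ; Del⊂K = λ v m → proj₂ (∧-true {K a₀} (proj₁ (∧-true m)))
        ; large = ≤ᵇ-true (proj₂ (∧-true {K a₀} r))
        ; small = λ x y c → ≤ᵇ-true (proj₂ (∧-true {Vh a₀ ∧ N x y a₀} c))
        ; many = p })
      (λ r → vacuous (3 * (e * e)) (λ x y → t₂ e (N x y) a₀) (λ x y m → true≢false (proj₁ (∧-true {Vh a₀} (proj₁ (∧-true {Vh a₀ ∧ N x y a₀} m)))) r) p)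
    pick a₀ b₀ (inj₂ (inj₂ p)) = record
      { Del = Vh
      ; cov = λ x y → t₃ e (N x y)
      ; Del⊂K = λ v → proj₁ ∘ ∧-true
      ; large = heavy-vertices dense
      ; small = λ x y c → ≤ᵇ-true c
      ; many = p }

module _ {n : ℕ} (N : Fin n → Fin n → Fin n → Bool) where
  loss : ∀ {M} → (K : Fin n → Bool) (Q : Fin n → Fin n → Bool) (Ks : Fin M → Fin n → Bool) (φ : Fin n → Fin n → Fin M) → ℕ
  loss K Q Ks φ = ∑² (λ x y → 𝟙 (Q x y) * ∑ (λ v → 𝟙 ((N x y v ∧ K v) ∧ not (Ks (φ x y) v))))

module _ {n : ℕ} (h : Fin n → Fin n → Fin n → Bool) (D : ℕ) where
  open Container h D

  Covered : ℕ → (Fin n → Fin n → Fin n → Bool) → (Fin n → Bool) → (Fin n → Fin n → Bool) → (ℕ → Set) → Set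
  Covered M N K Q P = Σ (Fin (suc M) → Fin n → Bool) λ Ks → Σ (Fin n → Fin n → Fin (suc M)) λ φ →
                      (∀ i → Sparse (Ks i)) × P (loss N K Q Ks φ)

-- The bound of the inner greedy loop after j picks: deletions, recursive calls, unresolved pairs.
Budget : (e θ D″ n q j : ℕ) → ℕ → Set
Budget e θ D″ n q j l = Σ ℕ λ E₁ → Σ ℕ λ E₂ → Σ ℕ λ E₃ →
  l ≤ E₁ + (E₂ + E₃) × e * E₁ ≤ n * q × D″ * E₂ ≤ j * cub n × θ * E₃ ≤ cub n

-- The size of `K` is measured in units of n/4D, the least size of a deletion, so `t` bounds the
-- depth of the recursion. The number `M` is chosen before n.
Tree : (D t D′ : ℕ) → Set
Tree D t D′ = Σ ℕ λ M → ∀ n (h : Fin n → Fin n → Fin n → Bool) (N : Fin n → Fin n → Fin n → Bool) →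
  (∀ x y → Container.Indep h D (N x y)) → ∀ K Q → 4 * D * ∣ K ∣ₚ ≤ t * n →
  Covered h D M N K Q (λ l → D′ * l ≤ cub n)

merge : ∀ {A : Set} {M₁ M₂} → (Fin M₁ → A) → (Fin M₂ → A) → Fin (M₁ + M₂) → A
merge {M₁ = M₁} f g i = Data.Sum.[ f , g ]′ (splitAt M₁ i)
  where import Data.Sum

merge-ˡ : ∀ {A : Set} {M₁ M₂} (f : Fin M₁ → A) (g : Fin M₂ → A) i → merge f g (i ↑ˡ M₂) ≡ f i
merge-ˡ {M₁ = M₁} {M₂} f g i rewrite Finₚ.splitAt-↑ˡ M₁ i M₂ = refl

merge-ʳ : ∀ {A : Set} {M₁ M₂} (f : Fin M₁ → A) (g : Fin M₂ → A) i → merge f g (M₁ ↑ʳ i) ≡ g i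
merge-ʳ {M₁ = M₁} {M₂} f g i rewrite Finₚ.splitAt-↑ʳ M₁ M₂ i = refl

merge-all : ∀ {A : Set} {P : A → Set} {M₁ M₂} (f : Fin M₁ → A) (g : Fin M₂ → A) →
            (∀ i → P (f i)) → (∀ i → P (g i)) → ∀ i → P (merge f g i)
merge-all {M₁ = M₁} f g p q i with splitAt M₁ i
... | inj₁ j = p j
... | inj₂ j = q j

route : ∀ {M₁ M₂} → Bool → Fin M₁ → Fin M₂ → Fin (M₁ + M₂)
route {M₁} {M₂} true  i j = i ↑ˡ M₂
route {M₁} {M₂} false i j = M₁ ↑ʳ j

module _ {n : ℕ} where
  ∣∣ₚ-split : (A B : Fin n → Bool) → (∀ v → B v ≡ true → A v ≡ true) →
             ∣ A ∣ₚ ≡ ∣ (λ v → A v ∧ not (B v)) ∣ₚ + ∣ B ∣ₚ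
  ∣∣ₚ-split A B sub = trans (∑-cong pt) (∑-+ _ _)
    where
    pt : ∀ v → 𝟙 (A v) ≡ 𝟙 (A v ∧ not (B v)) + 𝟙 (B v)
    pt v with A v | B v | sub v
    ... | true  | true  | _ = refl
    ... | true  | false | _ = refl
    ... | false | true  | f = case f refl of λ ()
    ... | false | false | _ = refl

  ∑²-split : (Q c : Fin n → Fin n → Bool) →
             ∑² (λ x y → 𝟙 (Q x y)) ≡ ∑² (λ x y → 𝟙 (Q x y ∧ c x y)) + ∑² (λ x y → 𝟙 (Q x y ∧ not (c x y)))
  ∑²-split Q c = trans (∑²-cong (λ x y → 𝟙-split (Q x y) (c x y))) (∑²-+ _ _)

  loss-empty : (N : Fin n → Fin n → Fin n → Bool) (K : Fin n → Bool) (Q : Fin n → Fin n → Bool) → ∀ {M} Ks φ →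
               loss N {M} K Q Ks φ ≤ n * ∑² (λ x y → 𝟙 (Q x y))
  loss-empty N K Q Ks φ = ≤-trans (∑²-mono (λ x y → ≤-trans (*-monoʳ-≤ (𝟙 (Q x y)) (∣∣ₚ-≤ _)) (≤-reflexive (*-comm _ n))))
                                  (≤-reflexive (∑²-*ˡ n _))

  -- A covered pair loses what its set has in `Del`, and beyond that only what the recursion on the
  -- rest of `K` loses. An uncovered pair is passed on with `K` unchanged.
  loss-merge : (N : Fin n → Fin n → Fin n → Bool) (K Del : Fin n → Bool) (Q c : Fin n → Fin n → Bool) →
    ∀ {M₁ M₂} (Ks₁ : Fin M₁ → Fin n → Bool) (Ks₂ : Fin M₂ → Fin n → Bool) φ₁ φ₂ →
    loss N K Q (merge Ks₁ Ks₂) (λ x y → route (c x y) (φ₁ x y) (φ₂ x y)) ≤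
      ∑² (λ x y → 𝟙 (Q x y ∧ c x y) * ∑ (λ v → 𝟙 (N x y v ∧ Del v)))
      + (loss N (λ v → K v ∧ not (Del v)) (λ x y → Q x y ∧ c x y) Ks₁ φ₁
      + loss N K (λ x y → Q x y ∧ not (c x y)) Ks₂ φ₂)
  loss-merge N K Del Q c Ks₁ Ks₂ φ₁ φ₂ =
    ≤-trans (∑²-mono pt) (≤-reflexive (trans (∑²-+ _ _) (cong (∑² (λ x y → 𝟙 (Q x y ∧ c x y) * ∑ (λ v → 𝟙 (N x y v ∧ Del v))) +_) (∑²-+ _ _))))
    where
    bits : ∀ a k d s → 𝟙 ((a ∧ k) ∧ not s) ≤ 𝟙 (a ∧ d) + 𝟙 ((a ∧ (k ∧ not d)) ∧ not s)
    bits false k d s = z≤n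
    bits true  false d s = z≤n
    bits true  true  false s = ≤-refl
    bits true  true  true  s = ≤-trans (𝟙≤1 (not s)) (s≤s z≤n)
    pt : ∀ x y → 𝟙 (Q x y) * ∑ (λ v → 𝟙 ((N x y v ∧ K v) ∧ not (merge Ks₁ Ks₂ (route (c x y) (φ₁ x y) (φ₂ x y)) v)))
         ≤ 𝟙 (Q x y ∧ c x y) * ∑ (λ v → 𝟙 (N x y v ∧ Del v))
         + (𝟙 (Q x y ∧ c x y) * ∑ (λ v → 𝟙 ((N x y v ∧ (K v ∧ not (Del v))) ∧ not (Ks₁ (φ₁ x y) v)))
         + 𝟙 (Q x y ∧ not (c x y)) * ∑ (λ v → 𝟙 ((N x y v ∧ K v) ∧ not (Ks₂ (φ₂ x y) v))))
    pt x y with Q x y | c x y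
    ... | false | _     = z≤n
    ... | true  | true  = ≤-trans (≤-reflexive (+-identityʳ _)) (≤-trans
          (∑-mono (λ v → ≤-trans (≤-reflexive (cong (λ s → 𝟙 ((N x y v ∧ K v) ∧ not (s v))) (merge-ˡ Ks₁ Ks₂ (φ₁ x y)))) (bits (N x y v) (K v) (Del v) _)))
          (≤-reflexive (trans (∑-+ {n} _ _) (e₁ (∑ (λ v → 𝟙 (N x y v ∧ Del v))) (∑ (λ v → 𝟙 ((N x y v ∧ (K v ∧ not (Del v))) ∧ not (Ks₁ (φ₁ x y) v))))))))
      where
      e₁ : ∀ a b → a + b ≡ a + 0 + (b + 0 + 0)
      e₁ = solve-∀
    ... | true  | false = *-monoʳ-≤ 1 (≤-reflexive (∑-cong (λ v → cong (λ s → 𝟙 ((N x y v ∧ K v) ∧ not (s v))) (merge-ʳ {M₁ = _} Ks₁ Ks₂ (φ₂ x y)))))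

empty-sparse : ∀ {n} h D → Container.Sparse {n} h D (λ _ → false)
empty-sparse h D = ≤-trans (≤-reflexive (trans (cong (D *_) (∑-zero (λ a → ∑-zero (λ b → ∑-zero (λ c → refl))))) (*-zeroʳ D))) z≤n

module TreeStep (D t : ℕ) (rec : ∀ D′ → Tree D t D′) (e θ τ D″ : ℕ) (1≤e : 1 ≤ e) (1≤θ : 1 ≤ θ) (τ≡ : τ ≡ 3 * (e * e) * θ) where
  -- The number of unsettled pairs is measured in units of n²/τ. While at least n²/θ pairs remain,
  -- every split settles at least one unit, so `j` bounds the number of splits still to come.
  Inner : ℕ → Set
  Inner j = Σ ℕ λ M → ∀ n (h : Fin n → Fin n → Fin n → Bool) (N : Fin n → Fin n → Fin n → Bool) →
    (∀ x y → Container.Indep h D (N x y)) → ∀ K Q → 4 * D * ∣ K ∣ₚ ≤ suc t * n →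
    cub n < D * Container.edgesIn h D K → τ * ∑² (λ x y → 𝟙 (Q x y)) ≤ j * (n * n) →
    Covered h D M N K Q (Budget e θ D″ n (∑² (λ x y → 𝟙 (Q x y))) j)

  -- Fewer than n²/θ pairs can be given the empty container: even if each of them loses all n
  -- vertices, the total stays below n³/θ.
  leaf : ∀ {n} (h : Fin n → Fin n → Fin n → Bool) N K Q j M → θ * ∑² (λ x y → 𝟙 (Q x y)) < n * n →
         Covered h D M N K Q (Budget e θ D″ n (∑² (λ x y → 𝟙 (Q x y))) j)
  leaf {n} h N K Q j M lt = (λ _ _ → false) , (λ _ _ → zero) , (λ _ → empty-sparse h D) ,
    0 , 0 , n * q , loss-empty N K Q {suc M} (λ _ _ → false) (λ _ _ → zero) , z' e (n * q) , z' D″ _ , le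
    where
    q = ∑² (λ x y → 𝟙 (Q x y))
    z' : ∀ k m → k * 0 ≤ m
    z' k m = ≤-trans (≤-reflexive (*-zeroʳ k)) z≤n
    x₁ : ∀ θ n q → θ * (n * q) ≡ n * (θ * q)
    x₁ = solve-∀
    le : θ * (n * q) ≤ cub n
    le = ≤-trans (≤-reflexive (x₁ θ n q)) (≤-trans (*-monoʳ-≤ n (<⇒≤ lt)) (≤-reflexive (sym (*-assoc n n n))))

  module Combine {n} (h : Fin n → Fin n → Fin n → Bool) (N : Fin n → Fin n → Fin n → Bool) (K : Fin n → Bool) (Q : Fin n → Fin n → Bool)
                 (j : ℕ) (sp : Container.Split h D N e K Q) where
    open Container.Split sp
    q q₁ q₂ : ℕ
    q  = ∑² (λ x y → 𝟙 (Q x y))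
    q₁ = ∑² (λ x y → 𝟙 (Q x y ∧ cov x y))
    q₂ = ∑² (λ x y → 𝟙 (Q x y ∧ not (cov x y)))
    K′ : Fin n → Bool
    K′ v = K v ∧ not (Del v)
    open ≤-Reasoning

    q-split : q ≡ q₁ + q₂
    q-split = ∑²-split Q cov

    small′ : 4 * D * ∣ K ∣ₚ ≤ suc t * n → 4 * D * ∣ K′ ∣ₚ ≤ t * n
    small′ szK = +-cancelˡ-≤ n _ _ (begin
      n + 4 * D * ∣ K′ ∣ₚ ≤⟨ +-monoˡ-≤ _ large ⟩
      4 * D * ∣ Del ∣ₚ + 4 * D * ∣ K′ ∣ₚ ≡⟨ sym (*-distribˡ-+ (4 * D) ∣ Del ∣ₚ ∣ K′ ∣ₚ) ⟩
      4 * D * (∣ Del ∣ₚ + ∣ K′ ∣ₚ) ≡⟨ cong (4 * D *_) (trans (+-comm ∣ Del ∣ₚ _) (sym (∣∣ₚ-split K Del Del⊂K))) ⟩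
      4 * D * ∣ K ∣ₚ ≤⟨ szK ⟩
      n + t * n ∎)

    progress : n * n ≤ θ * q → n * n ≤ τ * q₁
    progress r = begin
      n * n ≤⟨ r ⟩
      θ * q ≤⟨ *-monoʳ-≤ θ many ⟩
      θ * (3 * (e * e) * q₁) ≡⟨ x₁ θ (3 * (e * e)) q₁ ⟩
      3 * (e * e) * θ * q₁ ≡⟨ cong (_* q₁) (sym τ≡) ⟩
      τ * q₁ ∎
      where
      x₁ : ∀ θ k q → θ * (k * q) ≡ k * θ * q
      x₁ = solve-∀

    few′ : n * n ≤ θ * q → τ * q ≤ suc j * (n * n) → τ * q₂ ≤ j * (n * n)
    few′ r few = +-cancelˡ-≤ (n * n) _ _ (begin
      n * n + τ * q₂ ≤⟨ +-monoˡ-≤ _ (progress r) ⟩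
      τ * q₁ + τ * q₂ ≡⟨ sym (*-distribˡ-+ τ q₁ q₂) ⟩
      τ * (q₁ + q₂) ≡⟨ cong (τ *_) (sym q-split) ⟩
      τ * q ≤⟨ few ⟩
      n * n + j * (n * n) ∎)

    X₁ : ℕ
    X₁ = ∑² (λ x y → 𝟙 (Q x y ∧ cov x y) * ∑ (λ v → 𝟙 (N x y v ∧ Del v)))

    eX : e * X₁ ≤ n * q₁
    eX = begin
      e * X₁ ≡⟨ sym (∑²-*ˡ e _) ⟩
      ∑² (λ x y → e * (𝟙 (Q x y ∧ cov x y) * ∑ (λ v → 𝟙 (N x y v ∧ Del v)))) ≤⟨ ∑²-mono (λ x y → ≤-trans (≤-reflexive (x₁ e (𝟙 (Q x y ∧ cov x y)) _))
           (≤-trans (𝟙*-mono {Q x y ∧ cov x y} (λ m → small x y (proj₂ (∧-true {Q x y} m)))) (≤-reflexive (*-comm _ n)))) ⟩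
      ∑² (λ x y → n * 𝟙 (Q x y ∧ cov x y)) ≡⟨ ∑²-*ˡ n _ ⟩
      n * q₁ ∎
      where
      x₁ : ∀ e i s → e * (i * s) ≡ i * (e * s)
      x₁ = solve-∀

    bound₁ : ∀ E₁ → e * E₁ ≤ n * q₂ → e * (X₁ + E₁) ≤ n * q
    bound₁ E₁ b = begin
      e * (X₁ + E₁) ≡⟨ *-distribˡ-+ e X₁ E₁ ⟩
      e * X₁ + e * E₁ ≤⟨ +-mono-≤ eX b ⟩
      n * q₁ + n * q₂ ≡⟨ trans (sym (*-distribˡ-+ n q₁ q₂)) (cong (n *_) (sym q-split)) ⟩
      n * q ∎

    regroup : ∀ a b c d e → a + (b + (c + (d + e))) ≡ (a + c) + ((b + d) + e)
    regroup = solve-∀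

    total : ∀ {l l₁ l₂} E₁ E₂ E₃ → l ≤ X₁ + (l₁ + l₂) → l₂ ≤ E₁ + (E₂ + E₃) → l ≤ (X₁ + E₁) + ((l₁ + E₂) + E₃)
    total {l} {l₁} {l₂} E₁ E₂ E₃ p r = begin
      l ≤⟨ p ⟩
      X₁ + (l₁ + l₂) ≤⟨ +-monoʳ-≤ X₁ (+-monoʳ-≤ l₁ r) ⟩
      X₁ + (l₁ + (E₁ + (E₂ + E₃))) ≡⟨ regroup X₁ l₁ E₁ E₂ E₃ ⟩
      (X₁ + E₁) + ((l₁ + E₂) + E₃) ∎

    combine : ∀ {M₁ M₂} → Covered h D M₁ N K′ (λ x y → Q x y ∧ cov x y) (λ l → D″ * l ≤ cub n) →
              Covered h D M₂ N K (λ x y → Q x y ∧ not (cov x y)) (Budget e θ D″ n q₂ j) →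
              Covered h D (M₁ + suc M₂) N K Q (Budget e θ D″ n q (suc j))
    combine (Ks₁ , φ₁ , sp₁ , b) (Ks₂ , φ₂ , sp₂ , E₁ , E₂ , E₃ , le , b₁ , b₂ , b₃) =
      merge Ks₁ Ks₂ , (λ x y → route (cov x y) (φ₁ x y) (φ₂ x y)) , merge-all {P = Container.Sparse h D} Ks₁ Ks₂ sp₁ sp₂ ,
      X₁ + E₁ , loss N K′ (λ x y → Q x y ∧ cov x y) Ks₁ φ₁ + E₂ , E₃ ,
      total E₁ E₂ E₃ (loss-merge N K Del Q cov Ks₁ Ks₂ φ₁ φ₂) le , bound₁ E₁ b₁ ,
      ≤-trans (≤-reflexive (*-distribˡ-+ D″ _ E₂)) (+-mono-≤ b b₂) , b₃

  inner : ∀ j → Inner j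
  inner zero = 0 , λ n h N ind K Q small dense few → leaf h N K Q 0 0 (go n h K dense Q few)
    where
    go : ∀ n h (K : Fin n → Bool) → cub n < D * Container.edgesIn h D K → ∀ (Q : Fin n → Fin n → Bool) →
         τ * ∑² (λ x y → 𝟙 (Q x y)) ≤ 0 → θ * ∑² (λ x y → 𝟙 (Q x y)) < n * n
    go zero h K dense Q few = contradiction dense (≤⇒≯ (≤-reflexive (trans (cong (D *_) (∑-empty _)) (*-zeroʳ D))))
    go (suc n) h K dense Q few = ≤-<-trans (≤-trans (*-monoˡ-≤ q θ≤τ) few) (s≤s z≤n)
      where
      q = ∑² (λ x y → 𝟙 (Q x y))
      θ≤τ : θ ≤ τ
      θ≤τ = subst (θ ≤_) (sym τ≡) (≤-trans (≤-reflexive (sym (*-identityˡ θ))) (*-monoˡ-≤ θ (*-mono-≤ {1} {3} (s≤s z≤n) (*-mono-≤ 1≤e 1≤e))))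
  inner (suc j) = proj₁ (rec D″) + suc (proj₁ (inner j)) , body
    where
    body : ∀ n (h : Fin n → Fin n → Fin n → Bool) (N : Fin n → Fin n → Fin n → Bool) →
      (∀ x y → Container.Indep h D (N x y)) → ∀ K Q → 4 * D * ∣ K ∣ₚ ≤ suc t * n →
      cub n < D * Container.edgesIn h D K → τ * ∑² (λ x y → 𝟙 (Q x y)) ≤ suc j * (n * n) →
      Covered h D (proj₁ (rec D″) + suc (proj₁ (inner j))) N K Q (Budget e θ D″ n (∑² (λ x y → 𝟙 (Q x y))) (suc j))
    body n h N ind K Q szK dense few = bool-case (n * n ≤ᵇ θ * ∑² (λ x y → 𝟙 (Q x y)))
      (λ r → let sp = split h D N e K Q 1≤e ind dense
                 open Combine h N K Q j sp
             in combine (proj₂ (rec D″) n h N ind K′ (λ x y → Q x y ∧ Container.Split.cov sp x y) (small′ szK))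
                        (proj₂ (inner j) n h N ind K (λ x y → Q x y ∧ not (Container.Split.cov sp x y)) szK dense (few′ (≤ᵇ-true r) few)))
      (λ r → leaf h N K Q (suc j) _ (≤ᵇ-false r))

module TreeEnd (D t : ℕ) (rec : ∀ D′ → Tree D t D′) (D′ e τ : ℕ) (e≡ : e ≡ suc (3 * D′)) (τ≡ : τ ≡ 3 * (e * e) * e) where
  1≤e : 1 ≤ e
  1≤e = subst (1 ≤_) (sym e≡) (s≤s z≤n)

  instance
    τ-nonZero : NonZero τ
    τ-nonZero = >-nonZero (subst (1 ≤_) (sym τ≡) (*-mono-≤ {1} {3 * (e * e)} (*-mono-≤ {1} {3} (s≤s z≤n) (*-mono-≤ 1≤e 1≤e)) 1≤e))

  -- Each of the three sources of loss may use a third of n³/D′, whence the 3. The recursive calls,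
  -- at most τ of them, share one such third, whence the τ.
  D″ : ℕ
  D″ = τ * (3 * D′)

  open TreeStep D t rec e e τ D″ 1≤e 1≤e τ≡

  inner-τ : Inner τ
  inner-τ = inner τ

  M = proj₁ inner-τ
  body : ∀ n (h : Fin n → Fin n → Fin n → Bool) (N : Fin n → Fin n → Fin n → Bool) →
    (∀ x y → Container.Indep h D (N x y)) → ∀ K Q → 4 * D * ∣ K ∣ₚ ≤ suc t * n →
    Covered h D M N K Q (λ l → D′ * l ≤ cub n)
  body n h N ind K Q szK with D * Container.edgesIn h D K Data.Nat.≤? cub n
  ... | yes sp = (λ _ → K) , (λ _ _ → zero) , (λ _ → sp) , loss-self
    where
    bits : ∀ a k → (a ∧ k) ∧ not k ≡ false
    bits false k = refl
    bits true false = refl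
    bits true true = refl
    loss-self : D′ * loss N {suc M} K Q (λ _ → K) (λ _ _ → zero) ≤ cub n
    loss-self = ≤-trans (≤-reflexive (trans (cong (D′ *_) (∑-zero (λ x → ∑-zero (λ y →
      trans (cong (𝟙 (Q x y) *_) (∑-zero (λ v → cong 𝟙 (bits (N x y v) (K v))))) (*-zeroʳ (𝟙 (Q x y))))))) (*-zeroʳ D′))) z≤n
  ... | no dense = let Ks , φ , sp , E₁ , E₂ , E₃ , le , b₁ , b₂ , b₃ = proj₂ inner-τ n h N ind K Q szK (≰⇒> dense) few
                   in Ks , φ , sp , finish (loss N K Q Ks φ) E₁ E₂ E₃ le b₁ b₂ b₃
    where
    q = ∑² (λ x y → 𝟙 (Q x y))
    q≤ : q ≤ n * n
    q≤ = ≤-trans (∑²-≤const 1 (λ x y → 𝟙≤1 (Q x y))) (≤-reflexive (*-identityʳ _))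
    few : τ * q ≤ τ * (n * n)
    few = *-monoʳ-≤ τ q≤
    open ≤-Reasoning
    finish : ∀ l E₁ E₂ E₃ → l ≤ E₁ + (E₂ + E₃) → e * E₁ ≤ n * q → D″ * E₂ ≤ τ * cub n → e * E₃ ≤ cub n → D′ * l ≤ cub n
    finish l E₁ E₂ E₃ le b₁ b₂ b₃ = *-cancelˡ-≤ 3 (begin
      3 * (D′ * l) ≤⟨ *-monoʳ-≤ 3 (*-monoʳ-≤ D′ le) ⟩
      3 * (D′ * (E₁ + (E₂ + E₃))) ≡⟨ x₁ D′ E₁ E₂ E₃ ⟩
      3 * D′ * E₁ + (3 * D′ * E₂ + 3 * D′ * E₃) ≤⟨ +-mono-≤ (≤-trans (*-monoˡ-≤ E₁ 3D≤e) c₁) (+-mono-≤ c₂ (≤-trans (*-monoˡ-≤ E₃ 3D≤e) b₃)) ⟩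
      cub n + (cub n + cub n) ≡⟨ x₂ (cub n) ⟩
      3 * cub n ∎)
      where
      x₁ : ∀ d a b c → 3 * (d * (a + (b + c))) ≡ 3 * d * a + (3 * d * b + 3 * d * c)
      x₁ = solve-∀
      x₂ : ∀ c → c + (c + c) ≡ 3 * c
      x₂ = solve-∀
      3D≤e : 3 * D′ ≤ e
      3D≤e = subst (3 * D′ ≤_) (sym e≡) (n≤1+n _)
      c₁ : e * E₁ ≤ cub n
      c₁ = ≤-trans b₁ (≤-trans (*-monoʳ-≤ n q≤) (≤-reflexive (sym (*-assoc n n n))))
      c₂ : 3 * D′ * E₂ ≤ cub n
      c₂ = *-cancelˡ-≤ τ (≤-trans (≤-reflexive (sym (*-assoc τ (3 * D′) E₂))) b₂)

-- At `t = 0` the set `K` cannot be dense, since a split would delete at least n/4D vertices from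
-- it; so `K` is its own container.
tree : ∀ D t D′ → Tree D t D′
tree D zero D′ = 0 , body
  where
  body : ∀ n (h : Fin n → Fin n → Fin n → Bool) (N : Fin n → Fin n → Fin n → Bool) →
    (∀ x y → Container.Indep h D (N x y)) → ∀ K Q → 4 * D * ∣ K ∣ₚ ≤ 0 * n →
    Covered h D 0 N K Q (λ l → D′ * l ≤ cub n)
  body n h N ind K Q szK with D * Container.edgesIn h D K Data.Nat.≤? cub n
  ... | yes sp = (λ _ → K) , (λ _ _ → zero) , (λ _ → sp) , loss-self N K Q D′
    where
    loss-self : ∀ N K Q D′ → D′ * loss N {1} K Q (λ _ → K) (λ _ _ → zero) ≤ cub n
    loss-self N K Q D′ = ≤-trans (≤-reflexive (trans (cong (D′ *_) (∑-zero (λ x → ∑-zero (λ y →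
      trans (cong (𝟙 (Q x y) *_) (∑-zero (λ v → cong 𝟙 (bits (N x y v) (K v))))) (*-zeroʳ (𝟙 (Q x y))))))) (*-zeroʳ D′))) z≤n
      where
      bits : ∀ a k → (a ∧ k) ∧ not k ≡ false
      bits false k = refl
      bits true false = refl
      bits true true = refl
  ... | no dense = contradiction szK (<⇒≱ (<-≤-trans (s≤s z≤n) (≤-trans n≥1 (≤-trans large (*-monoʳ-≤ (4 * D) (∑-mono (λ v → 𝟙-mono (Del⊂K v))))))))
    where
    open Container.Split (split h D N 1 K Q ≤-refl ind (≰⇒> dense))
    n≥1 : 1 ≤ n
    n≥1 = n≢0⇒n>0 (λ { refl → contradiction (≤-reflexive (trans (cong (D *_) (∑-empty _)) (*-zeroʳ D))) (<⇒≱ (≰⇒> dense)) })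
tree D (suc t) D′ = conclude (suc (3 * D′)) _ refl refl
  where
  conclude : ∀ e τ → e ≡ suc (3 * D′) → τ ≡ 3 * (e * e) * e → Tree D (suc t) D′
  conclude e τ e≡ τ≡ = TreeEnd.M D t (tree D t) D′ e τ e≡ τ≡ , TreeEnd.body D t (tree D t) D′ e τ e≡ τ≡

-- From containers of neighbourhoods to containers of triple systems.

module Cuts where
 record Sym₃ {n} (c : Fin n → Fin n → Fin n → Bool) : Set where
   field
     s₁₂ : ∀ x y z → c x y z ≡ c y x z
     s₂₃ : ∀ x y z → c x y z ≡ c x z y
   s₁₃ : ∀ x y z → c x y z ≡ c z y x
   s₁₃ x y z = trans (s₁₂ x y z) (trans (s₂₃ y x z) (s₁₂ y z x))
   rot : ∀ x y z → c x y z ≡ c y z x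
   rot x y z = trans (s₁₂ x y z) (s₂₃ y x z)
   rot′ : ∀ x y z → c x y z ≡ c z x y
   rot′ x y z = trans (s₂₃ x y z) (s₁₂ x z y)

 F-free : ∀ {n} → (Fin n → Fin n → Fin n → Bool) → Set
 F-free h = ∀ x y a b c → h x y a ≡ true → h x y b ≡ true → h x y c ≡ true → h a b c ≡ true → ⊥

 ∑³-s₁₂ : ∀ {n} (f : Fin n → Fin n → Fin n → ℕ) → ∑³ (λ a b c → f b a c) ≡ ∑³ f
 ∑³-s₁₂ f = ∑-swap (λ a b → ∑ (f b a))

 ∑³-s₂₃ : ∀ {n} (f : Fin n → Fin n → Fin n → ℕ) → ∑³ (λ a b c → f a c b) ≡ ∑³ f
 ∑³-s₂₃ f = ∑-cong (λ a → ∑-swap (λ b c → f a c b))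

 ∑³-swap² : ∀ {n} (f : Fin n → Fin n → Fin n → Fin n → Fin n → ℕ) →
            ∑³ (λ a b c → ∑² (f a b c)) ≡ ∑² (λ d e → ∑³ (λ a b c → f a b c d e))
 ∑³-swap² f = trans (∑-cong (λ a → ∑²-swap (f a)))
             (trans (∑-swap (λ a d → ∑ (λ e → ∑² (λ b c → f a b c d e))))
                    (∑-cong (λ d → ∑-swap (λ a e → ∑² (λ b c → f a b c d e)))))

 -- The copies of F, counted as ordered tuples that may degenerate. The count vanishes for an F-free
 -- system, while for a container it can only be made small.
 F-count : ∀ {n} → (Fin n → Fin n → Fin n → Bool) → ℕ
 F-count c = ∑² (λ d e → ∑³ (λ x y z → 𝟙 ((c d e x ∧ (c d e y ∧ c d e z)) ∧ c x y z)))

 -- The container: triples whose three pairs allow the third vertex and that lie in few of the sets k d e.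
 module Cut {n M : ℕ} (D₁ : ℕ) (Ks : Fin M → Fin n → Bool) (φ : Fin n → Fin n → Fin M) where
   k : Fin n → Fin n → Fin n → Bool
   k x y v = Ks (φ x y) v

   inK : Fin n → Fin n → Fin n → ℕ
   inK a b c = ∑² (λ d e → 𝟙 (k d e a ∧ (k d e b ∧ k d e c)))

   crowded : Fin n → Fin n → Fin n → Bool
   crowded a b c = n * n ≤ᵇ D₁ * inK a b c

   allowed : Fin n → Fin n → Fin n → Bool
   allowed a b c = k a b c ∧ (k b a c ∧ (k a c b ∧ (k c a b ∧ (k b c a ∧ k c b a))))

   cut : Fin n → Fin n → Fin n → Bool
   cut a b c = allowed a b c ∧ not (crowded a b c)

   ∧6 : ∀ {p q r s t u} → p ∧ (q ∧ (r ∧ (s ∧ (t ∧ u)))) ≡ true →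
        p ≡ true × q ≡ true × r ≡ true × s ≡ true × t ≡ true × u ≡ true
   ∧6 {true} {true} {true} {true} {true} {true} _ = refl , refl , refl , refl , refl , refl

   ∧6-intro : ∀ {p q r s t u} → p ≡ true → q ≡ true → r ≡ true → s ≡ true → t ≡ true → u ≡ true → p ∧ (q ∧ (r ∧ (s ∧ (t ∧ u)))) ≡ true
   ∧6-intro refl refl refl refl refl refl = refl

   swap-xy : ∀ x y z → x ∧ (y ∧ z) ≡ y ∧ (x ∧ z)
   swap-xy x y z = trans (sym (∧-assoc x y z)) (trans (cong (_∧ z) (∧-comm x y)) (∧-assoc y x z))

   cut-sym : Sym₃ cut
   cut-sym = record
     { s₁₂ = λ a b c → cong₂ _∧_ (bool-ext (f₁₂ a b c) (f₁₂ b a c))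
               (cong (λ m → not (n * n ≤ᵇ D₁ * m)) (∑²-cong (λ d e → cong 𝟙 (swap-xy (k d e a) (k d e b) (k d e c)))))
     ; s₂₃ = λ a b c → cong₂ _∧_ (bool-ext (f₂₃ a b c) (f₂₃ a c b))
               (cong (λ m → not (n * n ≤ᵇ D₁ * m)) (∑²-cong (λ d e → cong (λ s → 𝟙 (k d e a ∧ s)) (∧-comm (k d e b) (k d e c))))) }
     where
     f₁₂ : ∀ a b c → allowed a b c ≡ true → allowed b a c ≡ true
     f₁₂ a b c m = let p , q , r , s , t , u = ∧6 {k a b c} {k b a c} {k a c b} {k c a b} {k b c a} {k c b a} m in ∧6-intro {k b a c} {k a b c} {k b c a} {k c b a} {k a c b} {k c a b} q p t u r s
     f₂₃ : ∀ a b c → allowed a b c ≡ true → allowed a c b ≡ true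
     f₂₃ a b c m = let p , q , r , s , t , u = ∧6 {k a b c} {k b a c} {k a c b} {k c a b} {k b c a} {k c b a} m in ∧6-intro {k a c b} {k c a b} {k a b c} {k b a c} {k c b a} {k b c a} r s p q u t

   -- In a copy of F the set of the pair (d, e) contains the edge x y z. A triple that is not
   -- crowded lies in fewer than n²/D₁ of these sets, so each triple takes part in few copies.
   cut-F-count : D₁ * F-count cut ≤ n * n * cub n
   cut-F-count = begin
     D₁ * F-count cut ≤⟨ *-monoʳ-≤ D₁ (∑²-mono (λ d e → ∑³-mono (λ x y z → pt d e x y z))) ⟩
     D₁ * ∑² (λ d e → ∑³ (λ x y z → 𝟙 (cut x y z) * 𝟙 (k d e x ∧ (k d e y ∧ k d e z)))) ≡⟨ cong (D₁ *_) (sym (∑³-swap² (λ x y z d e → 𝟙 (cut x y z) * 𝟙 (k d e x ∧ (k d e y ∧ k d e z))))) ⟩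
     D₁ * ∑³ (λ x y z → ∑² (λ d e → 𝟙 (cut x y z) * 𝟙 (k d e x ∧ (k d e y ∧ k d e z)))) ≡⟨ cong (D₁ *_) (∑³-cong (λ x y z → ∑²-*ˡ (𝟙 (cut x y z)) _)) ⟩
     D₁ * ∑³ (λ x y z → 𝟙 (cut x y z) * inK x y z) ≡⟨ sym (∑³-*ˡ D₁ _) ⟩
     ∑³ (λ x y z → D₁ * (𝟙 (cut x y z) * inK x y z)) ≤⟨ ∑³-mono bound ⟩
     ∑³ {n} (λ x y z → n * n) ≤⟨ ∑-≤const (n * n * (n * n)) (λ a → ∑²-≤const (n * n) (λ _ _ → ≤-refl)) ⟩
     n * (n * n * (n * n)) ≡⟨ x₁ n ⟩
     n * n * cub n ∎
     where
     open ≤-Reasoning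
     x₁ : ∀ n → n * (n * n * (n * n)) ≡ n * n * (n * n * n)
     x₁ = solve-∀
     pt : ∀ d e x y z → 𝟙 ((cut d e x ∧ (cut d e y ∧ cut d e z)) ∧ cut x y z) ≤ 𝟙 (cut x y z) * 𝟙 (k d e x ∧ (k d e y ∧ k d e z))
     pt d e x y z = ≤-trans (𝟙-mono {_} {cut x y z ∧ (k d e x ∧ (k d e y ∧ k d e z))} (λ m →
         let p , q = ∧-true {cut d e x ∧ (cut d e y ∧ cut d e z)} m
             px , pyz = ∧-true {cut d e x} p
             py , pz = ∧-true {cut d e y} pyz
             g : ∀ v → cut d e v ≡ true → k d e v ≡ true
             g v r = proj₁ (∧-true {k d e v} (proj₁ (∧-true {allowed d e v} r)))
         in ∧-intro q (∧-intro (g x px) (∧-intro (g y py) (g z pz))))) (≤-reflexive (𝟙-∧ (cut x y z) _))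
     bound : ∀ x y z → D₁ * (𝟙 (cut x y z) * inK x y z) ≤ n * n
     bound x y z with cut x y z in r
     ... | false = ≤-trans (≤-reflexive (*-zeroʳ D₁)) z≤n
     ... | true = ≤-trans (≤-reflexive (cong (D₁ *_) (+-identityʳ _)))
                   (<⇒≤ (≤ᵇ-false (not-true (proj₂ (∧-true {allowed x y z} r)))))

 module _ {n : ℕ} (h : Fin n → Fin n → Fin n → Bool) (hs : Sym₃ h) (D₁ D₂ : ℕ) (1≤D₁ : 1 ≤ D₁) where
   open Sym₃ hs

   private
     D = 2 * (D₁ * D₂)

   -- An edge outside the cut is missed by a container in one of its six orders, or it is crowded.
   -- The first kind costs six times the loss. For the second, the n² containers are sparse and
   -- together hold few edges, while every crowded edge is held by at least n²/D₁ of them.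
   cut-error : ∀ {M} (Ks : Fin M → Fin n → Bool) φ → (∀ i → Container.Sparse h D (Ks i)) →
     12 * D₂ * loss h (λ _ → true) (λ _ _ → true) Ks φ ≤ cub n →
     D₂ * ∑³ (λ a b c → 𝟙 (h a b c ∧ not (Cut.cut D₁ Ks φ a b c))) ≤ cub n
   cut-error {M} Ks φ sparse lossy = *-cancelˡ-≤ 2 (begin
     2 * (D₂ * ∑³ (λ a b c → 𝟙 (h a b c ∧ not (cut a b c)))) ≤⟨ *-monoʳ-≤ 2 (*-monoʳ-≤ D₂ total) ⟩
     2 * (D₂ * (6 * L + Cr)) ≡⟨ x₁ D₂ L Cr ⟩
     12 * D₂ * L + 2 * D₂ * Cr ≤⟨ +-mono-≤ lossy′ crowd ⟩
     cub n + cub n ≡⟨ x₂ (cub n) ⟩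
     2 * cub n ∎)
     where
     open ≤-Reasoning
     open Cut D₁ Ks φ
     x₁ : ∀ d l c → 2 * (d * (6 * l + c)) ≡ 12 * d * l + 2 * d * c
     x₁ = solve-∀
     x₂ : ∀ c → c + c ≡ 2 * c
     x₂ = solve-∀
     miss : Fin n → Fin n → Fin n → ℕ
     miss a b c = 𝟙 (h a b c ∧ not (k a b c))
     L = ∑³ miss
     Cr = ∑³ (λ a b c → 𝟙 (h a b c ∧ crowded a b c))
     lossy′ : 12 * D₂ * L ≤ cub n
     lossy′ = ≤-trans (*-monoʳ-≤ (12 * D₂) (≤-reflexive (∑²-cong (λ a b → trans (∑-cong (λ c → cong (λ s → 𝟙 (s ∧ not (k a b c))) (sym (∧-identityʳ (h a b c))))) (sym (+-identityʳ _)))))) lossy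
     bits : ∀ h p q r s t u w → 𝟙 (h ∧ not ((p ∧ (q ∧ (r ∧ (s ∧ (t ∧ u))))) ∧ not w)) ≤
       (𝟙 (h ∧ not p) + (𝟙 (h ∧ not q) + (𝟙 (h ∧ not r) + (𝟙 (h ∧ not s) + (𝟙 (h ∧ not t) + 𝟙 (h ∧ not u)))))) + 𝟙 (h ∧ w)
     bits false p q r s t u w = z≤n
     bits true false q r s t u w = s≤s z≤n
     bits true true false r s t u w = s≤s z≤n
     bits true true true false s t u w = s≤s z≤n
     bits true true true true false t u w = s≤s z≤n
     bits true true true true true false u w = s≤s z≤n
     bits true true true true true true false w = s≤s z≤n
     bits true true true true true true true false = z≤n
     bits true true true true true true true true = s≤s z≤n
     total : ∑³ (λ a b c → 𝟙 (h a b c ∧ not (cut a b c))) ≤ 6 * L + Cr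
     total = begin
       ∑³ (λ a b c → 𝟙 (h a b c ∧ not (cut a b c)))
         ≤⟨ ∑³-mono (λ a b c → bits (h a b c) (k a b c) (k b a c) (k a c b) (k c a b) (k b c a) (k c b a) (crowded a b c)) ⟩
       ∑³ (λ a b c → (𝟙 (h a b c ∧ not (k a b c)) + (𝟙 (h a b c ∧ not (k b a c)) + (𝟙 (h a b c ∧ not (k a c b)) + (𝟙 (h a b c ∧ not (k c a b)) + (𝟙 (h a b c ∧ not (k b c a)) + 𝟙 (h a b c ∧ not (k c b a))))))) + 𝟙 (h a b c ∧ crowded a b c))
         ≡⟨ trans (∑³-+ _ _) (cong (_+ Cr) (trans (sum6 _ _ _ _ _ _) (cong (L +_) (cong₂ _+_ e₂ (cong₂ _+_ e₃ (cong₂ _+_ e₄ (cong₂ _+_ e₅ e₆))))))) ⟩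
       (L + (L + (L + (L + (L + L))))) + Cr ≡⟨ cong (_+ Cr) (x₃ L) ⟩
       6 * L + Cr ∎
       where
       x₃ : ∀ l → l + (l + (l + (l + (l + l)))) ≡ 6 * l
       x₃ = solve-∀
       P₁ : (π : (Fin n → Fin n → Fin n → Bool) → Fin n → Fin n → Fin n → Bool) → (∀ a b c → h a b c ≡ π h a b c) →
            ∑³ (λ a b c → 𝟙 (π h a b c ∧ not (π k a b c))) ≡ L →
            ∑³ (λ a b c → 𝟙 (h a b c ∧ not (π k a b c))) ≡ L
       P₁ π e q = trans (∑³-cong (λ a b c → cong (λ s → 𝟙 (s ∧ not (π k a b c))) (e a b c))) q
       e₂ = P₁ (λ f a b c → f b a c) s₁₂ (∑³-s₁₂ miss)
       e₃ = P₁ (λ f a b c → f a c b) s₂₃ (∑³-s₂₃ miss)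
       e₄ = P₁ (λ f a b c → f c a b) rot′ (trans (∑³-s₂₃ (λ a b c → miss b a c)) (∑³-s₁₂ miss))
       e₅ = P₁ (λ f a b c → f b c a) rot (trans (∑³-s₁₂ (λ a b c → miss a c b)) (∑³-s₂₃ miss))
       e₆ = P₁ (λ f a b c → f c b a) s₁₃ (trans (∑³-s₁₂ (λ a b c → miss c a b)) (trans (∑³-s₂₃ (λ a b c → miss b a c)) (∑³-s₁₂ miss)))
       sum6 : ∀ (f₁ f₂ f₃ f₄ f₅ f₆ : Fin n → Fin n → Fin n → ℕ) →
         ∑³ (λ a b c → f₁ a b c + (f₂ a b c + (f₃ a b c + (f₄ a b c + (f₅ a b c + f₆ a b c))))) ≡
         ∑³ f₁ + (∑³ f₂ + (∑³ f₃ + (∑³ f₄ + (∑³ f₅ + ∑³ f₆))))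
       sum6 f₁ f₂ f₃ f₄ f₅ f₆ = trans (∑³-+ _ _) (cong (∑³ f₁ +_) (trans (∑³-+ _ _) (cong (∑³ f₂ +_)
         (trans (∑³-+ _ _) (cong (∑³ f₃ +_) (trans (∑³-+ _ _) (cong (∑³ f₄ +_) (∑³-+ _ _))))))))
     crowd : 2 * D₂ * Cr ≤ cub n
     crowd with n Data.Nat.≟ 0
     ... | yes refl = ≤-trans (≤-reflexive (trans (cong (2 * D₂ *_) (∑-empty _)) (*-zeroʳ (2 * D₂)))) z≤n
     ... | no n≢0 = *-cancelˡ-≤ (D₁ * (n * n)) ⦃ m*n≢0 D₁ (n * n) ⦃ >-nonZero 1≤D₁ ⦄ ⦃ m*n≢0 n n ⦃ ≢-nonZero n≢0 ⦄ ⦃ ≢-nonZero n≢0 ⦄ ⦄ ⦄ (begin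
       D₁ * (n * n) * (2 * D₂ * Cr) ≡⟨ y₁ D₁ (n * n) D₂ Cr ⟩
       D * (n * n * Cr) ≡⟨ cong (D *_) (sym (∑³-*ˡ (n * n) _)) ⟩
       D * ∑³ (λ a b c → n * n * 𝟙 (h a b c ∧ crowded a b c)) ≤⟨ *-monoʳ-≤ D (∑³-mono pt) ⟩
       D * ∑³ (λ a b c → D₁ * ∑² (λ d e → 𝟙 ((k d e a ∧ k d e b) ∧ (k d e c ∧ h a b c)))) ≡⟨ cong (D *_) (trans (∑³-*ˡ D₁ _) (cong (D₁ *_) (∑³-swap² _))) ⟩
       D * (D₁ * ∑² (λ d e → Container.edgesIn h D (Ks (φ d e)))) ≡⟨ y₂ D D₁ _ ⟩
       D₁ * (D * ∑² (λ d e → Container.edgesIn h D (Ks (φ d e)))) ≡⟨ cong (D₁ *_) (sym (∑²-*ˡ D _)) ⟩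
       D₁ * ∑² (λ d e → D * Container.edgesIn h D (Ks (φ d e))) ≤⟨ *-monoʳ-≤ D₁ (∑²-≤const (cub n) (λ d e → sparse (φ d e))) ⟩
       D₁ * (n * n * cub n) ≡⟨ sym (*-assoc D₁ (n * n) (cub n)) ⟩
       D₁ * (n * n) * cub n ∎)
       where
       y₁ : ∀ D₁ m D₂ c → D₁ * m * (2 * D₂ * c) ≡ 2 * (D₁ * D₂) * (m * c)
       y₁ = solve-∀
       y₂ : ∀ a b c → a * (b * c) ≡ b * (a * c)
       y₂ = solve-∀
       bb : ∀ h a b c → h ≡ true → 𝟙 (a ∧ (b ∧ c)) ≡ 𝟙 ((a ∧ b) ∧ (c ∧ h))
       bb _ false b c refl = refl
       bb _ true false c refl = refl
       bb _ true true false refl = refl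
       bb _ true true true refl = refl
       pt : ∀ a b c → n * n * 𝟙 (h a b c ∧ crowded a b c) ≤ D₁ * ∑² (λ d e → 𝟙 ((k d e a ∧ k d e b) ∧ (k d e c ∧ h a b c)))
       pt a b c = bool-case (h a b c ∧ crowded a b c)
         (λ m → let p , q = ∧-true {h a b c} m in
           ≤-trans (≤-reflexive (trans (cong (λ s → n * n * 𝟙 s) m) (*-identityʳ (n * n))))
             (≤-trans (≤ᵇ-true {n * n} {D₁ * inK a b c} q) (*-monoʳ-≤ D₁ (≤-reflexive (∑²-cong (λ d e → bb (h a b c) (k d e a) (k d e b) (k d e c) p))))))
         (λ m → ≤-trans (≤-reflexive (trans (cong (λ s → n * n * 𝟙 s) m) (*-zeroʳ (n * n)))) z≤n)

 record Contained {n} (h : Fin n → Fin n → Fin n → Bool) (M D₁ D₂ : ℕ) : Set where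
   field
     Ks    : Fin (suc M) → Fin n → Bool
     φ     : Fin n → Fin n → Fin (suc M)
     error : D₂ * ∑³ (λ a b c → 𝟙 (h a b c ∧ not (Cut.cut D₁ Ks φ a b c))) ≤ cub n

 -- The recursion starts with all vertices, which is size `4 * D` in its units. The factor 12
 -- consists of the six orders of a triple and of a 2 for the half of the error granted to the loss.
 container : ∀ D₁ D₂ → 1 ≤ D₁ → Σ ℕ λ M → ∀ {n} (h : Fin n → Fin n → Fin n → Bool) → Sym₃ h → F-free h → Contained h M D₁ D₂
 container D₁ D₂ 1≤D₁ = M , body
   where
   D = 2 * (D₁ * D₂)
   tr = tree D (4 * D) (12 * D₂)
   M = proj₁ tr
   body : ∀ {n} (h : Fin n → Fin n → Fin n → Bool) → Sym₃ h → F-free h → Contained h M D₁ D₂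
   body {n} h hs ff =
     let Ks , φ , sp , l = proj₂ tr n h h (λ x y a b c p q r s → ff x y a b c p q r s) (λ _ → true) (λ _ _ → true) (*-monoʳ-≤ (4 * D) (∣∣ₚ-≤ (λ _ → true)))
     in record { Ks = Ks ; φ = φ ; error = cut-error h hs D₁ D₂ 1≤D₁ Ks φ sp l }

open Cuts

-- The flag algebra certificate on five vertices.

module FlagAlgebra where
 -- A pattern records the colours of five vertices and which of their ten triples are present.
 Pattern : Set
 Pattern = (a₁ a₂ a₃ a₄ a₅ b₁₂₃ b₁₂₄ b₁₂₅ b₁₃₄ b₁₃₅ b₁₄₅ b₂₃₄ b₂₃₅ b₂₄₅ b₃₄₅ : Bool) → ℕ

 sw₁ : Pattern → Pattern
 sw₁ g a₁ a₂ a₃ a₄ a₅ b₁₂₃ b₁₂₄ b₁₂₅ b₁₃₄ b₁₃₅ b₁₄₅ b₂₃₄ b₂₃₅ b₂₄₅ b₃₄₅ = g a₂ a₁ a₃ a₄ a₅ b₁₂₃ b₁₂₄ b₁₂₅ b₂₃₄ b₂₃₅ b₂₄₅ b₁₃₄ b₁₃₅ b₁₄₅ b₃₄₅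

 sw₂ : Pattern → Pattern
 sw₂ g a₁ a₂ a₃ a₄ a₅ b₁₂₃ b₁₂₄ b₁₂₅ b₁₃₄ b₁₃₅ b₁₄₅ b₂₃₄ b₂₃₅ b₂₄₅ b₃₄₅ = g a₁ a₃ a₂ a₄ a₅ b₁₂₃ b₁₃₄ b₁₃₅ b₁₂₄ b₁₂₅ b₁₄₅ b₂₃₄ b₂₃₅ b₃₄₅ b₂₄₅

 sw₃ : Pattern → Pattern
 sw₃ g a₁ a₂ a₃ a₄ a₅ b₁₂₃ b₁₂₄ b₁₂₅ b₁₃₄ b₁₃₅ b₁₄₅ b₂₃₄ b₂₃₅ b₂₄₅ b₃₄₅ = g a₁ a₂ a₄ a₃ a₅ b₁₂₄ b₁₂₃ b₁₂₅ b₁₃₄ b₁₄₅ b₁₃₅ b₂₃₄ b₂₄₅ b₂₃₅ b₃₄₅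

 sw₄ : Pattern → Pattern
 sw₄ g a₁ a₂ a₃ a₄ a₅ b₁₂₃ b₁₂₄ b₁₂₅ b₁₃₄ b₁₃₅ b₁₄₅ b₂₃₄ b₂₃₅ b₂₄₅ b₃₄₅ = g a₁ a₂ a₃ a₅ a₄ b₁₂₃ b₁₂₅ b₁₂₄ b₁₃₅ b₁₃₄ b₁₄₅ b₂₃₅ b₂₃₄ b₂₄₅ b₃₄₅

 act : List (Fin 4) → Pattern → Pattern
 act [] g = g
 act (zero ∷ w) g = sw₁ (act w g)
 act (suc zero ∷ w) g = sw₂ (act w g)
 act (suc (suc zero) ∷ w) g = sw₃ (act w g)
 act (suc (suc (suc zero)) ∷ w) g = sw₄ (act w g)

 -- Permuting the five places does not change a sum over all five-tuples. An inequality between sums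
 -- of patterns therefore follows if it holds pointwise after each pattern is replaced by the sum of
 -- its images.
 symmetrise : List (List (Fin 4)) → Pattern → Pattern
 symmetrise [] g a₁ a₂ a₃ a₄ a₅ b₁₂₃ b₁₂₄ b₁₂₅ b₁₃₄ b₁₃₅ b₁₄₅ b₂₃₄ b₂₃₅ b₂₄₅ b₃₄₅ = 0
 symmetrise (w ∷ ws) g a₁ a₂ a₃ a₄ a₅ b₁₂₃ b₁₂₄ b₁₂₅ b₁₃₄ b₁₃₅ b₁₄₅ b₂₃₄ b₂₃₅ b₂₄₅ b₃₄₅ = act w g a₁ a₂ a₃ a₄ a₅ b₁₂₃ b₁₂₄ b₁₂₅ b₁₃₄ b₁₃₅ b₁₄₅ b₂₃₄ b₂₃₅ b₂₄₅ b₃₄₅ + symmetrise ws g a₁ a₂ a₃ a₄ a₅ b₁₂₃ b₁₂₄ b₁₂₅ b₁₃₄ b₁₃₅ b₁₄₅ b₂₃₄ b₂₃₅ b₂₄₅ b₃₄₅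

 private
   s₁ s₂ s₃ s₄ : Fin 4
   s₁ = zero
   s₂ = suc zero
   s₃ = suc (suc zero)
   s₄ = suc (suc (suc zero))

 -- Representatives of S₅ modulo the subgroup generated by (2 3) and (4 5), as words in adjacent transpositions.
 cosets : List (List (Fin 4))
 cosets = ([]) ∷ (s₁ ∷ []) ∷ (s₃ ∷ []) ∷ (s₁ ∷ s₃ ∷ []) ∷ (s₂ ∷ s₁ ∷ []) ∷
          (s₂ ∷ s₃ ∷ []) ∷ (s₄ ∷ s₃ ∷ []) ∷ (s₁ ∷ s₂ ∷ s₃ ∷ []) ∷ (s₁ ∷ s₄ ∷ s₃ ∷ []) ∷ (s₂ ∷ s₁ ∷ s₃ ∷ []) ∷
          (s₂ ∷ s₄ ∷ s₃ ∷ []) ∷ (s₃ ∷ s₂ ∷ s₁ ∷ []) ∷ (s₁ ∷ s₂ ∷ s₁ ∷ s₃ ∷ []) ∷ (s₁ ∷ s₂ ∷ s₄ ∷ s₃ ∷ []) ∷ (s₂ ∷ s₁ ∷ s₄ ∷ s₃ ∷ []) ∷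
          (s₂ ∷ s₃ ∷ s₂ ∷ s₁ ∷ []) ∷ (s₃ ∷ s₂ ∷ s₄ ∷ s₃ ∷ []) ∷ (s₄ ∷ s₃ ∷ s₂ ∷ s₁ ∷ []) ∷ (s₁ ∷ s₂ ∷ s₁ ∷ s₄ ∷ s₃ ∷ []) ∷ (s₁ ∷ s₂ ∷ s₃ ∷ s₂ ∷ s₁ ∷ []) ∷
          (s₁ ∷ s₃ ∷ s₂ ∷ s₄ ∷ s₃ ∷ []) ∷ (s₂ ∷ s₄ ∷ s₃ ∷ s₂ ∷ s₁ ∷ []) ∷ (s₃ ∷ s₂ ∷ s₁ ∷ s₄ ∷ s₃ ∷ []) ∷ (s₁ ∷ s₂ ∷ s₄ ∷ s₃ ∷ s₂ ∷ s₁ ∷ []) ∷ (s₁ ∷ s₃ ∷ s₂ ∷ s₁ ∷ s₄ ∷ s₃ ∷ []) ∷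
          (s₂ ∷ s₁ ∷ s₃ ∷ s₂ ∷ s₄ ∷ s₃ ∷ []) ∷ (s₃ ∷ s₂ ∷ s₄ ∷ s₃ ∷ s₂ ∷ s₁ ∷ []) ∷ (s₁ ∷ s₃ ∷ s₂ ∷ s₄ ∷ s₃ ∷ s₂ ∷ s₁ ∷ []) ∷ (s₂ ∷ s₁ ∷ s₃ ∷ s₂ ∷ s₁ ∷ s₄ ∷ s₃ ∷ []) ∷ (s₂ ∷ s₁ ∷ s₃ ∷ s₂ ∷ s₄ ∷ s₃ ∷ s₂ ∷ s₁ ∷ []) ∷ []

 -- The weights were found by linear programming, the squares by rounding a semidefinite programme.
 pairWeight₀ : (p q r s pqr pqs prs qrs : Bool) → ℕ
 pairWeight₀ false false false false false false false true = 740
 pairWeight₀ false false false false false true false true = 1680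
 pairWeight₀ false false false false true true false true = 240
 pairWeight₀ false false false true false false false true = 500
 pairWeight₀ false false false true false true false true = 2200
 pairWeight₀ false false false true true false false false = 260
 pairWeight₀ false false false true true false false true = 760
 pairWeight₀ false false true true false false false false = 2880
 pairWeight₀ false false true true false false false true = 1880
 pairWeight₀ false false true true false true false true = 3380
 pairWeight₀ false false true true false true true true = 2680
 pairWeight₀ false false true true true true false true = 2140
 pairWeight₀ false false true true true true true true = 260
 pairWeight₀ false true false false false false false false = 380
 pairWeight₀ false true false false false false true true = 200
 pairWeight₀ false true false false false true false false = 380
 pairWeight₀ false true false false false true false true = 260
 pairWeight₀ false true false false false true true false = 920
 pairWeight₀ false true false false false true true true = 340
 pairWeight₀ false true false false true true false false = 1420
 pairWeight₀ false true false false true true false true = 1380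
 pairWeight₀ false true false false true true true false = 300
 pairWeight₀ false true false false true true true true = 380
 pairWeight₀ false true false true false false false false = 300
 pairWeight₀ false true false true false false false true = 80
 pairWeight₀ false true false true false false true false = 1560
 pairWeight₀ false true false true false true false false = 1620
 pairWeight₀ false true false true false true false true = 1420
 pairWeight₀ false true false true false true true false = 4900
 pairWeight₀ false true false true true false false true = 1760
 pairWeight₀ false true false true true false true false = 740
 pairWeight₀ false true false true true false true true = 1900
 pairWeight₀ false true false true true true false true = 160
 pairWeight₀ false true true true false false false false = 1960
 pairWeight₀ false true true true false false true false = 2520
 pairWeight₀ false true true true false true false false = 2320
 pairWeight₀ false true true true false true true false = 3160
 pairWeight₀ false true true true true true false false = 3420
 pairWeight₀ false true true true true true true false = 4560
 pairWeight₀ _ _ _ _ _ _ _ _ = 0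

 orElse : ℕ → ℕ → ℕ
 orElse zero    n = n
 orElse (suc m) n = suc m

 -- The table lists representatives for the exchanges of p with q and of r with s. An unlisted entry
 -- is 0 there, so the first nonzero of the four images is the weight.
 pairWeight : (p q r s pqr pqs prs qrs : Bool) → ℕ
 pairWeight p q r s pqr pqs prs qrs =
   orElse (pairWeight₀ p q r s pqr pqs prs qrs) (orElse (pairWeight₀ q p r s pqr pqs qrs prs)
     (orElse (pairWeight₀ p q s r pqs pqr prs qrs) (pairWeight₀ q p s r pqs pqr qrs prs)))

 -- A square: its weight and the positive and negative parts of a linear form, as tables indexed by four bits.
 Pair : Set → Set
 Pair A = A × A

 Table : Set
 Table = Pair (Pair (Pair (Pair ℕ)))

 pick : {A : Set} → Bool → Pair A → A
 pick false = proj₁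
 pick true  = proj₂

 at : Table → (x y z w : Bool) → ℕ
 at t x y z w = pick w (pick z (pick y (pick x t)))

 record Square : Set where
   constructor square
   field
     weight  : ℕ
     pos neg : Table

 squaresABB⁻ : List Square
 squaresABB⁻ = square 120 ((((0 , 0) , (0 , 1)) , ((3 , 0) , (0 , 0))) , (((0 , 0) , (0 , 2)) , ((5 , 0) , (0 , 0)))) ((((0 , 0) , (3 , 0)) , ((0 , 1) , (0 , 0))) , (((0 , 0) , (5 , 0)) , ((0 , 2) , (0 , 0)))) ∷
   square 200 ((((0 , 0) , (0 , 0)) , ((0 , 0) , (1 , 4))) , (((0 , 0) , (0 , 2)) , ((0 , 2) , (0 , 2)))) ((((0 , 1) , (1 , 0)) , ((1 , 0) , (0 , 0))) , (((5 , 1) , (1 , 0)) , ((1 , 0) , (0 , 0)))) ∷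
   square 195 ((((0 , 0) , (0 , 2)) , ((0 , 2) , (0 , 2))) , (((3 , 0) , (0 , 0)) , ((0 , 0) , (2 , 3)))) ((((4 , 0) , (1 , 0)) , ((1 , 0) , (1 , 0))) , (((0 , 2) , (2 , 2)) , ((2 , 2) , (0 , 0)))) ∷ []

 squaresABB⁺ : List Square
 squaresABB⁺ = square 215 ((((2 , 0) , (3 , 0)) , ((3 , 0) , (0 , 0))) , (((1 , 2) , (1 , 0)) , ((1 , 0) , (0 , 0)))) ((((0 , 4) , (0 , 1)) , ((0 , 1) , (0 , 1))) , (((0 , 0) , (0 , 0)) , ((0 , 0) , (4 , 5)))) ∷
   square 200 ((((0 , 0) , (0 , 1)) , ((0 , 1) , (3 , 1))) , (((0 , 0) , (2 , 1)) , ((2 , 1) , (0 , 5)))) ((((1 , 5) , (0 , 0)) , ((0 , 0) , (0 , 0))) , (((1 , 4) , (0 , 0)) , ((0 , 0) , (1 , 0)))) ∷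
   square 330 ((((0 , 0) , (0 , 0)) , ((2 , 1) , (0 , 0))) , (((0 , 0) , (0 , 0)) , ((5 , 0) , (0 , 0)))) ((((0 , 0) , (2 , 1)) , ((0 , 0) , (0 , 0))) , (((0 , 0) , (5 , 0)) , ((0 , 0) , (0 , 0)))) ∷
   square 20 ((((0 , 1) , (0 , 2)) , ((0 , 2) , (0 , 5))) , (((3 , 3) , (0 , 3)) , ((0 , 3) , (0 , 4)))) ((((3 , 0) , (4 , 0)) , ((4 , 0) , (0 , 0))) , (((0 , 0) , (2 , 0)) , ((2 , 0) , (5 , 0)))) ∷
   square 200 ((((0 , 0) , (0 , 0)) , ((0 , 0) , (1 , 5))) , (((0 , 0) , (0 , 0)) , ((0 , 0) , (1 , 4)))) ((((0 , 3) , (1 , 0)) , ((1 , 0) , (0 , 0))) , (((1 , 2) , (1 , 0)) , ((1 , 0) , (0 , 0)))) ∷ []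

 squaresAAB : List Square
 squaresAAB = square 170 ((((2 , 0) , (0 , 0)) , ((0 , 0) , (0 , 5))) , (((1 , 0) , (0 , 0)) , ((0 , 0) , (0 , 0)))) ((((0 , 3) , (3 , 1)) , ((0 , 0) , (0 , 0))) , (((0 , 0) , (0 , 0)) , ((0 , 0) , (0 , 0)))) ∷
   square 185 ((((0 , 1) , (1 , 1)) , ((0 , 0) , (0 , 0))) , (((0 , 1) , (1 , 3)) , ((0 , 0) , (0 , 0)))) ((((0 , 0) , (0 , 0)) , ((6 , 1) , (1 , 0))) , (((1 , 0) , (0 , 0)) , ((0 , 0) , (0 , 0)))) ∷ []

 squaresB : List Square
 squaresB = square 35 ((((4 , 0) , (0 , 0)) , ((4 , 0) , (0 , 0))) , (((4 , 0) , (0 , 0)) , ((0 , 0) , (0 , 0)))) ((((0 , 0) , (4 , 0)) , ((0 , 0) , (1 , 0))) , (((0 , 0) , (1 , 0)) , ((0 , 0) , (5 , 0)))) ∷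
   square 40 ((((4 , 0) , (0 , 0)) , ((1 , 0) , (0 , 0))) , (((1 , 0) , (0 , 0)) , ((0 , 0) , (0 , 0)))) ((((0 , 0) , (0 , 0)) , ((0 , 0) , (2 , 0))) , (((0 , 0) , (2 , 0)) , ((1 , 0) , (2 , 0)))) ∷ []

 squaresA : List Square
 squaresA = square 48 ((((0 , 0) , (0 , 0)) , ((2 , 0) , (0 , 0))) , (((2 , 0) , (0 , 0)) , ((5 , 0) , (0 , 0)))) ((((0 , 0) , (3 , 0)) , ((0 , 0) , (5 , 0))) , (((0 , 0) , (5 , 0)) , ((0 , 0) , (0 , 0)))) ∷ []

 -- The product w (f p - f q)(g p - g q), expanded; `form⁺` holds its positive terms and `form⁻` the
 -- negative ones, so that nonnegativity of a square can be stated without subtraction.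
 form⁺ : Square → (f g : Table → ℕ) → ℕ
 form⁺ (square w p q) f g = w * (f p * g p + f q * g q)

 form⁻ : Square → (f g : Table → ℕ) → ℕ
 form⁻ (square w p q) f g = w * (f p * g q + f q * g p)

 Σform : (Square → ℕ) → List Square → ℕ
 Σform F [] = 0
 Σform F (s ∷ ss) = F s + Σform F ss

 when : Bool → ℕ → ℕ
 when true  m = m
 when false m = 0

 -- The triple (1,2,3) with vertex 1 labelled, extended by 4 and by 5 (first three lists), and the pairs (2,3), (4,5)
 -- in the link of 1 (last two lists).
 squares : (Square → (f g : Table → ℕ) → ℕ) → Pattern
 squares F a₁ a₂ a₃ a₄ a₅ b₁₂₃ b₁₂₄ b₁₂₅ b₁₃₄ b₁₃₅ b₁₄₅ b₂₃₄ b₂₃₅ b₂₄₅ b₃₄₅ =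
   (when ((a₁ ∧ not a₂) ∧ (not a₃ ∧ not b₁₂₃)) (Σform (λ s → F s (λ t → at t a₄ b₁₂₄ b₁₃₄ b₂₃₄) (λ t → at t a₅ b₁₂₅ b₁₃₅ b₂₃₅)) squaresABB⁻)
   + (when ((a₁ ∧ not a₂) ∧ (not a₃ ∧ b₁₂₃)) (Σform (λ s → F s (λ t → at t a₄ b₁₂₄ b₁₃₄ b₂₃₄) (λ t → at t a₅ b₁₂₅ b₁₃₅ b₂₃₅)) squaresABB⁺)
   + when ((not a₁ ∧ a₂) ∧ (a₃ ∧ b₁₂₃)) (Σform (λ s → F s (λ t → at t a₄ b₂₃₄ b₁₂₄ b₁₃₄) (λ t → at t a₅ b₂₃₅ b₁₂₅ b₁₃₅)) squaresAAB)))
   + (when (not a₁) (Σform (λ s → F s (λ t → at t a₂ a₃ b₁₂₃ false) (λ t → at t a₄ a₅ b₁₄₅ false)) squaresB)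
   + when a₁ (Σform (λ s → F s (λ t → at t a₂ a₃ b₁₂₃ false) (λ t → at t a₄ a₅ b₁₄₅ false)) squaresA))

 two : Bool → Bool → Bool → Bool
 two true  b c = b xor c
 two false b c = b ∧ c

 -- Here 2700 : 1200 = 9 : 4, so at edge density 4/9 these two terms cancel and 7 times the bad
 -- triples remains, bounded by the errors. The terms with `pairWeight` compare the codegree of the
 -- pair {2, 3} with the size of the colour class; vertex 1 runs over either. The forbidden patterns
 -- are F and an edge inside the class.
 upper lower forbidden : Pattern
 upper a₁ a₂ a₃ a₄ a₅ b₁₂₃ b₁₂₄ b₁₂₅ b₁₃₄ b₁₃₅ b₁₄₅ b₂₃₄ b₂₃₅ b₂₄₅ b₃₄₅ =
   (pairWeight a₂ a₃ a₄ a₅ b₂₃₄ b₂₃₅ b₂₄₅ b₃₄₅ * 𝟙 a₁ + (2700 * 𝟙 b₁₂₃ + 7 * 𝟙 (b₁₂₃ ∧ not (two a₁ a₂ a₃))))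
   + squares form⁺ a₁ a₂ a₃ a₄ a₅ b₁₂₃ b₁₂₄ b₁₂₅ b₁₃₄ b₁₃₅ b₁₄₅ b₂₃₄ b₂₃₅ b₂₄₅ b₃₄₅
 lower a₁ a₂ a₃ a₄ a₅ b₁₂₃ b₁₂₄ b₁₂₅ b₁₃₄ b₁₃₅ b₁₄₅ b₂₃₄ b₂₃₅ b₂₄₅ b₃₄₅ =
   (pairWeight a₂ a₃ a₄ a₅ b₂₃₄ b₂₃₅ b₂₄₅ b₃₄₅ * 𝟙 b₁₂₃ + 1200) + squares form⁻ a₁ a₂ a₃ a₄ a₅ b₁₂₃ b₁₂₄ b₁₂₅ b₁₃₄ b₁₃₅ b₁₄₅ b₂₃₄ b₂₃₅ b₂₄₅ b₃₄₅
 forbidden a₁ a₂ a₃ a₄ a₅ b₁₂₃ b₁₂₄ b₁₂₅ b₁₃₄ b₁₃₅ b₁₄₅ b₂₃₄ b₂₃₅ b₂₄₅ b₃₄₅ = 𝟙 ((b₁₂₃ ∧ (b₂₃₄ ∧ b₂₃₅)) ∧ b₁₄₅) + 𝟙 (((a₁ ∧ a₂) ∧ a₃) ∧ b₁₂₃)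

 Pred : ℕ → Set
 Pred zero    = Bool
 Pred (suc k) = Bool → Pred k

 everywhere : ∀ k → Pred k → Bool
 everywhere zero    b = b
 everywhere (suc k) p = everywhere k (p true) ∧ everywhere k (p false)

 Holds : ∀ k → Pred k → Set
 Holds zero    b = b ≡ true
 Holds (suc k) p = ∀ b → Holds k (p b)

 everywhere-sound : ∀ k p → everywhere k p ≡ true → Holds k p
 everywhere-sound zero    b e = e
 everywhere-sound (suc k) p e true  = everywhere-sound k (p true) (proj₁ (∧-true e))
 everywhere-sound (suc k) p e false = everywhere-sound k (p false) (proj₂ (∧-true {everywhere k (p true)} e))

 occurs : List (List (Fin 4)) → Pattern → Pred 15
 occurs [] g a₁ a₂ a₃ a₄ a₅ b₁₂₃ b₁₂₄ b₁₂₅ b₁₃₄ b₁₃₅ b₁₄₅ b₂₃₄ b₂₃₅ b₂₄₅ b₃₄₅ = false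
 occurs (w ∷ ws) g a₁ a₂ a₃ a₄ a₅ b₁₂₃ b₁₂₄ b₁₂₅ b₁₃₄ b₁₃₅ b₁₄₅ b₂₃₄ b₂₃₅ b₂₄₅ b₃₄₅ = (1 ≤ᵇ act w g a₁ a₂ a₃ a₄ a₅ b₁₂₃ b₁₂₄ b₁₂₅ b₁₃₄ b₁₃₅ b₁₄₅ b₂₃₄ b₂₃₅ b₂₄₅ b₃₄₅) ∨ occurs ws g a₁ a₂ a₃ a₄ a₅ b₁₂₃ b₁₂₄ b₁₂₅ b₁₃₄ b₁₃₅ b₁₄₅ b₂₃₄ b₂₃₅ b₂₄₅ b₃₄₅

 -- A pattern in which a forbidden configuration occurs is exempt. The exemption is paid for later,
 -- by a multiple of the number of forbidden configurations.
 inequality : List (List (Fin 4)) → (f u l : Pattern) → Pred 15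
 inequality ws f u l a₁ a₂ a₃ a₄ a₅ b₁₂₃ b₁₂₄ b₁₂₅ b₁₃₄ b₁₃₅ b₁₄₅ b₂₃₄ b₂₃₅ b₂₄₅ b₃₄₅ = occurs ws f a₁ a₂ a₃ a₄ a₅ b₁₂₃ b₁₂₄ b₁₂₅ b₁₃₄ b₁₃₅ b₁₄₅ b₂₃₄ b₂₃₅ b₂₄₅ b₃₄₅ ∨ (symmetrise ws u a₁ a₂ a₃ a₄ a₅ b₁₂₃ b₁₂₄ b₁₂₅ b₁₃₄ b₁₃₅ b₁₄₅ b₂₃₄ b₂₃₅ b₂₄₅ b₃₄₅ ≤ᵇ symmetrise ws l a₁ a₂ a₃ a₄ a₅ b₁₂₃ b₁₂₄ b₁₂₅ b₁₃₄ b₁₃₅ b₁₄₅ b₂₃₄ b₂₃₅ b₂₄₅ b₃₄₅)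

open FlagAlgebra

-- Summing patterns over five-tuples of vertices.

module FlagSums where
 ∑⁵ : ∀ {n} → (Fin n → Fin n → Fin n → Fin n → Fin n → ℕ) → ℕ
 ∑⁵ f = ∑ (λ x → ∑² (λ y z → ∑² (f x y z)))

 ∑⁵-mono : ∀ {n} {f g : Fin n → Fin n → Fin n → Fin n → Fin n → ℕ} → (∀ x y z u v → f x y z u v ≤ g x y z u v) → ∑⁵ f ≤ ∑⁵ g
 ∑⁵-mono h = ∑-mono (λ x → ∑²-mono (λ y z → ∑²-mono (h x y z)))

 ∑⁵-cong : ∀ {n} {f g : Fin n → Fin n → Fin n → Fin n → Fin n → ℕ} → (∀ x y z u v → f x y z u v ≡ g x y z u v) → ∑⁵ f ≡ ∑⁵ g
 ∑⁵-cong h = ∑-cong (λ x → ∑²-cong (λ y z → ∑²-cong (h x y z)))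

 ∑⁵-+ : ∀ {n} (f g : Fin n → Fin n → Fin n → Fin n → Fin n → ℕ) → ∑⁵ (λ x y z u v → f x y z u v + g x y z u v) ≡ ∑⁵ f + ∑⁵ g
 ∑⁵-+ f g = trans (∑-cong (λ x → trans (∑²-cong (λ y z → ∑²-+ (f x y z) (g x y z))) (∑²-+ _ _))) (∑-+ _ _)

 ∑⁵-*ˡ : ∀ {n} k (f : Fin n → Fin n → Fin n → Fin n → Fin n → ℕ) → ∑⁵ (λ x y z u v → k * f x y z u v) ≡ k * ∑⁵ f
 ∑⁵-*ˡ k f = trans (∑-cong (λ x → trans (∑²-cong (λ y z → ∑²-*ˡ k (f x y z))) (∑²-*ˡ k _))) (∑-*ˡ k _)

 ∑⁵-zero : ∀ {n} → ∑⁵ {n} (λ _ _ _ _ _ → 0) ≡ 0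
 ∑⁵-zero = ∑-zero (λ _ → ∑-zero (λ _ → ∑-zero (λ _ → ∑-zero (λ _ → ∑-zero (λ _ → refl)))))

 ∑²-const : ∀ {n} k → ∑² {n} (λ _ _ → k) ≡ n * n * k
 ∑²-const {n} k = trans (∑-cong (λ _ → ∑-const {n} k)) (trans (∑-const {n} (n * k)) (sym (*-assoc n n k)))

 ∑⁵-outer : ∀ {n} (f : Fin n → Fin n → Fin n → ℕ) → ∑⁵ (λ x y z _ _ → f x y z) ≡ n * n * ∑³ f
 ∑⁵-outer {n} f = trans (∑-cong (λ x → trans (∑²-cong (λ y z → ∑²-const (f x y z))) (∑²-*ˡ (n * n) (f x)))) (∑-*ˡ (n * n) _)

 ∑⁵-sw₁ : ∀ {n} (f : Fin n → Fin n → Fin n → Fin n → Fin n → ℕ) → ∑⁵ (λ x y z u v → f y x z u v) ≡ ∑⁵ f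
 ∑⁵-sw₁ f = ∑-swap (λ x y → ∑ (λ z → ∑² (f y x z)))

 ∑⁵-sw₂ : ∀ {n} (f : Fin n → Fin n → Fin n → Fin n → Fin n → ℕ) → ∑⁵ (λ x y z u v → f x z y u v) ≡ ∑⁵ f
 ∑⁵-sw₂ f = ∑-cong (λ x → ∑-swap (λ y z → ∑² (f x z y)))

 ∑⁵-sw₃ : ∀ {n} (f : Fin n → Fin n → Fin n → Fin n → Fin n → ℕ) → ∑⁵ (λ x y z u v → f x y u z v) ≡ ∑⁵ f
 ∑⁵-sw₃ f = ∑-cong (λ x → ∑-cong (λ y → ∑-swap (λ z u → ∑ (f x y u z))))

 ∑⁵-sw₄ : ∀ {n} (f : Fin n → Fin n → Fin n → Fin n → Fin n → ℕ) → ∑⁵ (λ x y z u v → f x y z v u) ≡ ∑⁵ f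
 ∑⁵-sw₄ f = ∑-cong (λ x → ∑²-cong (λ y z → ∑-swap (λ u v → f x y z v u)))

 private
   cong6 : ∀ {A : Set} (f : Bool → Bool → Bool → Bool → Bool → Bool → A) {a b c d e g a′ b′ c′ d′ e′ g′ : Bool} →
           a ≡ a′ → b ≡ b′ → c ≡ c′ → d ≡ d′ → e ≡ e′ → g ≡ g′ → f a b c d e g ≡ f a′ b′ c′ d′ e′ g′
   cong6 f refl refl refl refl refl refl = refl

 module Patterns {n : ℕ} (A : Fin n → Bool) (c : Fin n → Fin n → Fin n → Bool) (cs : Sym₃ c) where
   open Sym₃ cs

   ev : Pattern → Fin n → Fin n → Fin n → Fin n → Fin n → ℕ
   ev g x y z u v = g (A x) (A y) (A z) (A u) (A v)
     (c x y z) (c x y u) (c x y v) (c x z u) (c x z v) (c x u v) (c y z u) (c y z v) (c y u v) (c z u v)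

   ev-sw₁ : ∀ g x y z u v → ev (sw₁ g) x y z u v ≡ ev g y x z u v
   ev-sw₁ g x y z u v = cong6 (λ a b d _ _ _ → g (A y) (A x) (A z) (A u) (A v) a b d (c y z u) (c y z v) (c y u v) (c x z u) (c x z v) (c x u v) (c z u v))
     (s₁₂ x y z) (s₁₂ x y u) (s₁₂ x y v) (refl {x = true}) (refl {x = true}) (refl {x = true})

   ev-sw₂ : ∀ g x y z u v → ev (sw₂ g) x y z u v ≡ ev g x z y u v
   ev-sw₂ g x y z u v = cong6 (λ a b d _ _ _ → g (A x) (A z) (A y) (A u) (A v) a (c x z u) (c x z v) (c x y u) (c x y v) (c x u v) b d (c z u v) (c y u v))
     (s₂₃ x y z) (s₁₂ y z u) (s₁₂ y z v) (refl {x = true}) (refl {x = true}) (refl {x = true})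

   ev-sw₃ : ∀ g x y z u v → ev (sw₃ g) x y z u v ≡ ev g x y u z v
   ev-sw₃ g x y z u v = cong6 (λ a b d _ _ _ → g (A x) (A y) (A u) (A z) (A v) (c x y u) (c x y z) (c x y v) a (c x u v) (c x z v) b (c y u v) (c y z v) d)
     (s₂₃ x z u) (s₂₃ y z u) (s₁₂ z u v) (refl {x = true}) (refl {x = true}) (refl {x = true})

   ev-sw₄ : ∀ g x y z u v → ev (sw₄ g) x y z u v ≡ ev g x y z v u
   ev-sw₄ g x y z u v = cong6 (λ a b d _ _ _ → g (A x) (A y) (A z) (A v) (A u) (c x y z) (c x y v) (c x y u) (c x z v) (c x z u) a (c y z v) (c y z u) b d)
     (s₂₃ x u v) (s₂₃ y u v) (s₂₃ z u v) (refl {x = true}) (refl {x = true}) (refl {x = true})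

   ∑-act : ∀ w g → ∑⁵ (ev (act w g)) ≡ ∑⁵ (ev g)
   ∑-act [] g = refl
   ∑-act (zero ∷ w) g = trans (∑⁵-cong (ev-sw₁ (act w g))) (trans (∑⁵-sw₁ (ev (act w g))) (∑-act w g))
   ∑-act (suc zero ∷ w) g = trans (∑⁵-cong (ev-sw₂ (act w g))) (trans (∑⁵-sw₂ (ev (act w g))) (∑-act w g))
   ∑-act (suc (suc zero) ∷ w) g = trans (∑⁵-cong (ev-sw₃ (act w g))) (trans (∑⁵-sw₃ (ev (act w g))) (∑-act w g))
   ∑-act (suc (suc (suc zero)) ∷ w) g = trans (∑⁵-cong (ev-sw₄ (act w g))) (trans (∑⁵-sw₄ (ev (act w g))) (∑-act w g))

   ∑-symmetrise : ∀ ws g → ∑⁵ (ev (symmetrise ws g)) ≡ length ws * ∑⁵ (ev g)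
   ∑-symmetrise [] g = ∑⁵-zero
   ∑-symmetrise (w ∷ ws) g = trans (∑⁵-+ (ev (act w g)) (ev (symmetrise ws g))) (cong₂ _+_ (∑-act w g) (∑-symmetrise ws g))

 amgm : ∀ a b → a * b + b * a ≤ a * a + b * b
 amgm a b with ≤-total a b
 ... | inj₁ p = subst (λ b → a * b + b * a ≤ a * a + b * b) (m+[n∸m]≡n p) (≤-trans (m≤m+n _ ((b ∸ a) * (b ∸ a))) (≤-reflexive (e a (b ∸ a))))
   where
   e : ∀ a d → a * (a + d) + (a + d) * a + d * d ≡ a * a + (a + d) * (a + d)
   e = solve-∀
 ... | inj₂ p = subst (λ a → a * b + b * a ≤ a * a + b * b) (m+[n∸m]≡n p) (≤-trans (m≤m+n _ ((a ∸ b) * (a ∸ b))) (≤-reflexive (e b (a ∸ b))))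
   where
   e : ∀ b d → (b + d) * b + b * (b + d) + d * d ≡ (b + d) * (b + d) + b * b
   e = solve-∀

 -- With F and G the sums of `f` and `g`, this is (F - G)² ≥ 0.
 square-≥0 : ∀ {n} (f g : Fin n → ℕ) → ∑² (λ u v → f u * g v + g u * f v) ≤ ∑² (λ u v → f u * f v + g u * g v)
 square-≥0 f g = begin
   ∑² (λ u v → f u * g v + g u * f v) ≡⟨ trans (∑²-+ _ _) (cong₂ _+_ (∑²-prod f g) (∑²-prod g f)) ⟩
   F * G + G * F ≤⟨ amgm F G ⟩
   F * F + G * G ≡⟨ sym (trans (∑²-+ _ _) (cong₂ _+_ (∑²-prod f f) (∑²-prod g g))) ⟩
   ∑² (λ u v → f u * f v + g u * g v) ∎
   where
   open ≤-Reasoning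
   F = ∑ f
   G = ∑ g

open FlagSums

module FlagIdentities where
 occurs-sound : ∀ ws g a₁ a₂ a₃ a₄ a₅ b₁₂₃ b₁₂₄ b₁₂₅ b₁₃₄ b₁₃₅ b₁₄₅ b₂₃₄ b₂₃₅ b₂₄₅ b₃₄₅ →
   occurs ws g a₁ a₂ a₃ a₄ a₅ b₁₂₃ b₁₂₄ b₁₂₅ b₁₃₄ b₁₃₅ b₁₄₅ b₂₃₄ b₂₃₅ b₂₄₅ b₃₄₅ ≡ true →
   1 ≤ symmetrise ws g a₁ a₂ a₃ a₄ a₅ b₁₂₃ b₁₂₄ b₁₂₅ b₁₃₄ b₁₃₅ b₁₄₅ b₂₃₄ b₂₃₅ b₂₄₅ b₃₄₅
 occurs-sound (w ∷ ws) g a₁ a₂ a₃ a₄ a₅ b₁₂₃ b₁₂₄ b₁₂₅ b₁₃₄ b₁₃₅ b₁₄₅ b₂₃₄ b₂₃₅ b₂₄₅ b₃₄₅ e = bool-case (1 ≤ᵇ m)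
   (λ p → ≤-trans (≤ᵇ-true p) (m≤m+n m _))
   (λ p → ≤-trans (occurs-sound ws g a₁ a₂ a₃ a₄ a₅ b₁₂₃ b₁₂₄ b₁₂₅ b₁₃₄ b₁₃₅ b₁₄₅ b₂₃₄ b₂₃₅ b₂₄₅ b₃₄₅ (∨-right p e)) (m≤n+m _ m))
   where
   m = act w g a₁ a₂ a₃ a₄ a₅ b₁₂₃ b₁₂₄ b₁₂₅ b₁₃₄ b₁₃₅ b₁₄₅ b₂₃₄ b₂₃₅ b₂₄₅ b₃₄₅
   ∨-right : ∀ {a b} → a ≡ false → a ∨ b ≡ true → b ≡ true
   ∨-right refl e = e

 Bounded : ℕ → Pattern → Set
 Bounded L g = ∀ a₁ a₂ a₃ a₄ a₅ b₁₂₃ b₁₂₄ b₁₂₅ b₁₃₄ b₁₃₅ b₁₄₅ b₂₃₄ b₂₃₅ b₂₄₅ b₃₄₅ →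
   g a₁ a₂ a₃ a₄ a₅ b₁₂₃ b₁₂₄ b₁₂₅ b₁₃₄ b₁₃₅ b₁₄₅ b₂₃₄ b₂₃₅ b₂₄₅ b₃₄₅ ≤ L

 act-bounded : ∀ {L} w g → Bounded L g → Bounded L (act w g)
 act-bounded [] g b = b
 act-bounded (zero ∷ w) g b a₁ a₂ a₃ a₄ a₅ b₁₂₃ b₁₂₄ b₁₂₅ b₁₃₄ b₁₃₅ b₁₄₅ b₂₃₄ b₂₃₅ b₂₄₅ b₃₄₅ = act-bounded w g b _ _ _ _ _ _ _ _ _ _ _ _ _ _ _
 act-bounded (suc zero ∷ w) g b a₁ a₂ a₃ a₄ a₅ b₁₂₃ b₁₂₄ b₁₂₅ b₁₃₄ b₁₃₅ b₁₄₅ b₂₃₄ b₂₃₅ b₂₄₅ b₃₄₅ = act-bounded w g b _ _ _ _ _ _ _ _ _ _ _ _ _ _ _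
 act-bounded (suc (suc zero) ∷ w) g b a₁ a₂ a₃ a₄ a₅ b₁₂₃ b₁₂₄ b₁₂₅ b₁₃₄ b₁₃₅ b₁₄₅ b₂₃₄ b₂₃₅ b₂₄₅ b₃₄₅ = act-bounded w g b _ _ _ _ _ _ _ _ _ _ _ _ _ _ _
 act-bounded (suc (suc (suc zero)) ∷ w) g b a₁ a₂ a₃ a₄ a₅ b₁₂₃ b₁₂₄ b₁₂₅ b₁₃₄ b₁₃₅ b₁₄₅ b₂₃₄ b₂₃₅ b₂₄₅ b₃₄₅ = act-bounded w g b _ _ _ _ _ _ _ _ _ _ _ _ _ _ _

 symmetrise-bounded : ∀ {L} ws g → Bounded L g → Bounded (length ws * L) (symmetrise ws g)
 symmetrise-bounded [] g b a₁ a₂ a₃ a₄ a₅ b₁₂₃ b₁₂₄ b₁₂₅ b₁₃₄ b₁₃₅ b₁₄₅ b₂₃₄ b₂₃₅ b₂₄₅ b₃₄₅ = z≤n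
 symmetrise-bounded (w ∷ ws) g b a₁ a₂ a₃ a₄ a₅ b₁₂₃ b₁₂₄ b₁₂₅ b₁₃₄ b₁₃₅ b₁₄₅ b₂₃₄ b₂₃₅ b₂₄₅ b₃₄₅ =
   +-mono-≤ (act-bounded w g b a₁ a₂ a₃ a₄ a₅ b₁₂₃ b₁₂₄ b₁₂₅ b₁₃₄ b₁₃₅ b₁₄₅ b₂₃₄ b₂₃₅ b₂₄₅ b₃₄₅)
            (symmetrise-bounded ws g b a₁ a₂ a₃ a₄ a₅ b₁₂₃ b₁₂₄ b₁₂₅ b₁₃₄ b₁₃₅ b₁₄₅ b₂₃₄ b₂₃₅ b₂₄₅ b₃₄₅)

 pairWeight-bound : ∀ p q r s t u v w → pairWeight p q r s t u v w ≤ 5000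
 pairWeight-bound p q r s t u v w = ≤ᵇ-true (everywhere-sound 8 (λ p q r s t u v w → pairWeight p q r s t u v w ≤ᵇ 5000) refl p q r s t u v w)

 entries-bounded : Table → Bool
 entries-bounded t = everywhere 4 (λ x y z w → at t x y z w ≤ᵇ 6)

 -- The entries of the tables are at most 6, so `form⁺` is at most 6 · 6 + 6 · 6 = 72 times the
 -- weight.
 Σform-bound : ∀ ss (f g : Table → ℕ) → (∀ t → entries-bounded t ≡ true → f t ≤ 6) → (∀ t → entries-bounded t ≡ true → g t ≤ 6) →
   All (λ s → entries-bounded (Square.pos s) ≡ true × entries-bounded (Square.neg s) ≡ true) ss →
   Σform (λ s → form⁺ s f g) ss ≤ 72 * Σform Square.weight ss
 Σform-bound [] f g bf bg [] = z≤n
 Σform-bound (square w p q ∷ ss) f g bf bg ((bp , bq) ∷ b) = ≤-trans (+-mono-≤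
     (≤-trans (*-monoʳ-≤ w (+-mono-≤ (*-mono-≤ (bf p bp) (bg p bp)) (*-mono-≤ (bf q bq) (bg q bq)))) (≤-reflexive (*-comm w 72)))
     (Σform-bound ss f g bf bg b))
   (≤-reflexive (sym (*-distribˡ-+ 72 w (Σform Square.weight ss))))

 at-bound : ∀ x y z w t → entries-bounded t ≡ true → at t x y z w ≤ 6
 at-bound x y z w t e = ≤ᵇ-true (everywhere-sound 4 (λ x y z w → at t x y z w ≤ᵇ 6) e x y z w)

 when-bound : ∀ b {m L} → m ≤ L → when b m ≤ L
 when-bound true  p = p
 when-bound false p = z≤n

 upper-bounded : Bounded 1000000 upper
 upper-bounded a₁ a₂ a₃ a₄ a₅ b₁₂₃ b₁₂₄ b₁₂₅ b₁₃₄ b₁₃₅ b₁₄₅ b₂₃₄ b₂₃₅ b₂₄₅ b₃₄₅ = ≤-trans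
   (+-mono-≤ (+-mono-≤ (*-mono-≤ (pairWeight-bound a₂ a₃ a₄ a₅ b₂₃₄ b₂₃₅ b₂₄₅ b₃₄₅) (𝟙≤1 a₁)) (+-mono-≤ (*-monoʳ-≤ 2700 (𝟙≤1 b₁₂₃)) (*-monoʳ-≤ 7 (𝟙≤1 (b₁₂₃ ∧ not (two a₁ a₂ a₃))))))
     (+-mono-≤ (+-mono-≤ (when-bound ((a₁ ∧ not a₂) ∧ (not a₃ ∧ not b₁₂₃)) (Σform-bound squaresABB⁻ _ _ (at-bound a₄ b₁₂₄ b₁₃₄ b₂₃₄) (at-bound a₅ b₁₂₅ b₁₃₅ b₂₃₅) ((refl , refl) ∷ (refl , refl) ∷ (refl , refl) ∷ [])))
       (+-mono-≤ (when-bound ((a₁ ∧ not a₂) ∧ (not a₃ ∧ b₁₂₃)) (Σform-bound squaresABB⁺ _ _ (at-bound a₄ b₁₂₄ b₁₃₄ b₂₃₄) (at-bound a₅ b₁₂₅ b₁₃₅ b₂₃₅) ((refl , refl) ∷ (refl , refl) ∷ (refl , refl) ∷ (refl , refl) ∷ (refl , refl) ∷ [])))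
       (when-bound ((not a₁ ∧ a₂) ∧ (a₃ ∧ b₁₂₃)) (Σform-bound squaresAAB _ _ (at-bound a₄ b₂₃₄ b₁₂₄ b₁₃₄) (at-bound a₅ b₂₃₅ b₁₂₅ b₁₃₅) ((refl , refl) ∷ (refl , refl) ∷ [])))))
     (+-mono-≤ (when-bound (not a₁) (Σform-bound squaresB _ _ (at-bound a₂ a₃ b₁₂₃ false) (at-bound a₄ a₅ b₁₄₅ false) ((refl , refl) ∷ (refl , refl) ∷ [])))
       (when-bound a₁ (Σform-bound squaresA _ _ (at-bound a₂ a₃ b₁₂₃ false) (at-bound a₄ a₅ b₁₄₅ false) ((refl , refl) ∷ []))))))
   (≤ᵇ-true {_} {1000000} refl)

 -- Abstract, so that the computation behind it is not repeated whenever the type occurs in a context.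
 abstract
   Certifies : List (List (Fin 4)) → (f u l : Pattern) → Set
   Certifies ws f u l = everywhere 15 (inequality ws f u l) ≡ true

   certify : ∀ {ws f u l} → everywhere 15 (inequality ws f u l) ≡ true → Certifies ws f u l
   certify e = e

   certified : ∀ {ws f u l} → Certifies ws f u l → Holds 15 (inequality ws f u l)
   certified {ws} {f} {u} {l} e = everywhere-sound 15 (inequality ws f u l) e

 module Pointwise (ws : List (List (Fin 4))) (f u l : Pattern) (L : ℕ)
   (ok : Certifies ws f u l) (bound : Bounded L u) where

   -- If a forbidden configuration occurs, its term with coefficient `length ws * L` alone exceeds
   -- everything that `u` can contribute; otherwise the certificate applies.
   pointwise : ∀ a₁ a₂ a₃ a₄ a₅ b₁₂₃ b₁₂₄ b₁₂₅ b₁₃₄ b₁₃₅ b₁₄₅ b₂₃₄ b₂₃₅ b₂₄₅ b₃₄₅ →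
     symmetrise ws u a₁ a₂ a₃ a₄ a₅ b₁₂₃ b₁₂₄ b₁₂₅ b₁₃₄ b₁₃₅ b₁₄₅ b₂₃₄ b₂₃₅ b₂₄₅ b₃₄₅ ≤ symmetrise ws l a₁ a₂ a₃ a₄ a₅ b₁₂₃ b₁₂₄ b₁₂₅ b₁₃₄ b₁₃₅ b₁₄₅ b₂₃₄ b₂₃₅ b₂₄₅ b₃₄₅
     + length ws * L * symmetrise ws f a₁ a₂ a₃ a₄ a₅ b₁₂₃ b₁₂₄ b₁₂₅ b₁₃₄ b₁₃₅ b₁₄₅ b₂₃₄ b₂₃₅ b₂₄₅ b₃₄₅
   pointwise a₁ a₂ a₃ a₄ a₅ b₁₂₃ b₁₂₄ b₁₂₅ b₁₃₄ b₁₃₅ b₁₄₅ b₂₃₄ b₂₃₅ b₂₄₅ b₃₄₅ =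
     decide (occurs ws f a₁ a₂ a₃ a₄ a₅ b₁₂₃ b₁₂₄ b₁₂₅ b₁₃₄ b₁₃₅ b₁₄₅ b₂₃₄ b₂₃₅ b₂₄₅ b₃₄₅)
       (certified {ws} {f} {u} {l} ok a₁ a₂ a₃ a₄ a₅ b₁₂₃ b₁₂₄ b₁₂₅ b₁₃₄ b₁₃₅ b₁₄₅ b₂₃₄ b₂₃₅ b₂₄₅ b₃₄₅)
       (symmetrise-bounded ws u bound a₁ a₂ a₃ a₄ a₅ b₁₂₃ b₁₂₄ b₁₂₅ b₁₃₄ b₁₃₅ b₁₄₅ b₂₃₄ b₂₃₅ b₂₄₅ b₃₄₅)
       (occurs-sound ws f a₁ a₂ a₃ a₄ a₅ b₁₂₃ b₁₂₄ b₁₂₅ b₁₃₄ b₁₃₅ b₁₄₅ b₂₃₄ b₂₃₅ b₂₄₅ b₃₄₅)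
     where
     decide : ∀ o {u l L f} → o ∨ (u ≤ᵇ l) ≡ true → u ≤ L → (o ≡ true → 1 ≤ f) → u ≤ l + L * f
     decide true  {u} {l} {L} {f} _ b p = ≤-trans b (≤-trans (≤-trans (≤-reflexive (sym (*-identityʳ L))) (*-monoʳ-≤ L (p refl))) (m≤n+m _ l))
     decide false {u} {l} e b p = ≤-trans (≤ᵇ-true e) (m≤m+n l _)

   module _ {n : ℕ} (A : Fin n → Bool) (c : Fin n → Fin n → Fin n → Bool) (cs : Sym₃ c) where
     open Patterns A c cs

     summed : ∀ K → length ws * L ≡ K → NonZero (length ws) → ∑⁵ (ev u) ≤ ∑⁵ (ev l) + K * ∑⁵ (ev f)
     summed K refl nz = *-cancelˡ-≤ k ⦃ nz ⦄ (begin
       k * ∑⁵ (ev u) ≡⟨ sym (∑-symmetrise ws u) ⟩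
       ∑⁵ (ev (symmetrise ws u)) ≤⟨ ∑⁵-mono (λ x y z u v → pointwise _ _ _ _ _ _ _ _ _ _ _ _ _ _ _) ⟩
       ∑⁵ (λ x y z u v → ev (symmetrise ws l) x y z u v + k * L * ev (symmetrise ws f) x y z u v) ≡⟨ ∑⁵-+ _ _ ⟩
       ∑⁵ (ev (symmetrise ws l)) + ∑⁵ (λ x y z u v → k * L * ev (symmetrise ws f) x y z u v) ≡⟨ cong₂ _+_ (∑-symmetrise ws l) (trans (∑⁵-*ˡ (k * L) _) (cong (k * L *_) (∑-symmetrise ws f))) ⟩
       k * ∑⁵ (ev l) + k * L * (k * ∑⁵ (ev f)) ≡⟨ e k (∑⁵ (ev l)) L (∑⁵ (ev f)) ⟩
       k * (∑⁵ (ev l) + k * L * ∑⁵ (ev f)) ∎)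
       where
       open ≤-Reasoning
       k = length ws
       e : ∀ k a L b → k * a + k * L * (k * b) ≡ k * (a + k * L * b)
       e = solve-∀

open FlagIdentities

∑-max : ∀ {n} (f : Fin (suc n) → ℕ) → ∃[ i ] (∀ j → f j ≤ f i)
∑-max {zero} f = zero , λ { zero → ≤-refl }
∑-max {suc n} f with ∑-max (f ∘ suc)
... | i , p with ≤-total (f zero) (f (suc i))
...   | inj₁ q = suc i , λ { zero → q ; (suc j) → p j }
...   | inj₂ q = zero , λ { zero → ≤-refl ; (suc j) → ≤-trans (p j) q }

∑-swap²ˡ : ∀ {n} (f : Fin n → Fin n → Fin n → ℕ) → ∑ (λ x → ∑² (f x)) ≡ ∑² (λ y z → ∑ (λ x → f x y z))
∑-swap²ˡ f = trans (∑-swap (λ x y → ∑ (f x y))) (∑-cong (λ y → ∑-swap (λ x z → f x y z)))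

∑⁵-rotate : ∀ {n} (f : Fin n → Fin n → Fin n → Fin n → Fin n → ℕ) →
            ∑⁵ f ≡ ∑² (λ y z → ∑² (λ u v → ∑ (λ x → f x y z u v)))
∑⁵-rotate f = trans (∑-swap²ˡ (λ x y z → ∑² (f x y z))) (∑²-cong (λ y z → ∑-swap²ˡ (λ x u v → f x y z u v)))

square-≥0² : ∀ {n} (f g : Fin n → Fin n → ℕ) →
  ∑² (λ y z → ∑² (λ u v → f y z * g u v + g y z * f u v)) ≤ ∑² (λ y z → ∑² (λ u v → f y z * f u v + g y z * g u v))
square-≥0² {n} f g = begin
  ∑² (λ y z → ∑² (λ u v → f y z * g u v + g y z * f u v)) ≡⟨ split₂ f g g f ⟩
  ∑² f * ∑² g + ∑² g * ∑² f ≤⟨ amgm (∑² f) (∑² g) ⟩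
  ∑² f * ∑² f + ∑² g * ∑² g ≡⟨ sym (split₂ f f g g) ⟩
  ∑² (λ y z → ∑² (λ u v → f y z * f u v + g y z * g u v)) ∎
  where
  open ≤-Reasoning
  ∑²-*ʳ : ∀ k (f : Fin n → Fin n → ℕ) → ∑² (λ a b → f a b * k) ≡ ∑² f * k
  ∑²-*ʳ k f = trans (∑²-cong (λ a b → *-comm (f a b) k)) (trans (∑²-*ˡ k f) (*-comm k (∑² f)))
  split₂ : ∀ (p q r s : Fin n → Fin n → ℕ) → ∑² (λ y z → ∑² (λ u v → p y z * q u v + r y z * s u v)) ≡ ∑² p * ∑² q + ∑² r * ∑² s
  split₂ p q r s = trans (∑²-cong (λ y z → trans (∑²-+ _ _) (cong₂ _+_ (∑²-*ˡ (p y z) q) (∑²-*ˡ (r y z) s))))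
                         (trans (∑²-+ _ _) (cong₂ _+_ (∑²-*ʳ (∑² q) p) (∑²-*ʳ (∑² s) r)))

module _ {n : ℕ} where
  Σform-≥0 : ∀ ss (F : Table → Fin n → ℕ) →
    ∑² (λ u v → Σform (λ s → form⁻ s (λ t → F t u) (λ t → F t v)) ss) ≤ ∑² (λ u v → Σform (λ s → form⁺ s (λ t → F t u) (λ t → F t v)) ss)
  Σform-≥0 [] F = ≤-refl
  Σform-≥0 (square w p q ∷ ss) F = subst₂ _≤_ (sym (∑²-+ _ _)) (sym (∑²-+ _ _))
    (+-mono-≤ (subst₂ _≤_ (sym (∑²-*ˡ w _)) (sym (∑²-*ˡ w _)) (*-monoʳ-≤ w (square-≥0 (F p) (F q)))) (Σform-≥0 ss F))

  Σform-≥0² : ∀ ss (F : Table → Fin n → Fin n → ℕ) →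
    ∑² (λ y z → ∑² (λ u v → Σform (λ s → form⁻ s (λ t → F t y z) (λ t → F t u v)) ss)) ≤ ∑² (λ y z → ∑² (λ u v → Σform (λ s → form⁺ s (λ t → F t y z) (λ t → F t u v)) ss))
  Σform-≥0² [] F = ≤-refl
  Σform-≥0² (square w p q ∷ ss) F = subst₂ _≤_ (sym (comb _ _)) (sym (comb _ _))
    (+-mono-≤ (*-monoʳ-≤ w (square-≥0² (F p) (F q))) (Σform-≥0² ss F))
    where
    comb : ∀ (f g : Fin n → Fin n → Fin n → Fin n → ℕ) →
      ∑² (λ y z → ∑² (λ u v → w * f y z u v + g y z u v)) ≡ w * ∑² (λ y z → ∑² (f y z)) + ∑² (λ y z → ∑² (g y z))
    comb f g = trans (∑²-cong (λ y z → trans (∑²-+ _ _) (cong (_+ ∑² (g y z)) (∑²-*ˡ w _)))) (trans (∑²-+ _ _) (cong (_+ ∑² (λ y z → ∑² (g y z))) (∑²-*ˡ w _)))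

  when-≤ : ∀ b {f g : Fin n → Fin n → ℕ} → ∑² f ≤ ∑² g → ∑² (λ u v → when b (f u v)) ≤ ∑² (λ u v → when b (g u v))
  when-≤ true  p = p
  when-≤ false p = ≤-refl

  when-≤² : ∀ b {f g : Fin n → Fin n → Fin n → Fin n → ℕ} → ∑² (λ y z → ∑² (f y z)) ≤ ∑² (λ y z → ∑² (g y z)) →
            ∑² (λ y z → ∑² (λ u v → when b (f y z u v))) ≤ ∑² (λ y z → ∑² (λ u v → when b (g y z u v)))
  when-≤² true  p = p
  when-≤² false p = ≤-refl

  module Flag (A : Fin n → Bool) (c : Fin n → Fin n → Fin n → Bool) (cs : Sym₃ c) where
    open Patterns A c cs
    open Sym₃ cs

    sum5 : ∀ (f₁ f₂ f₃ f₄ f₅ : Fin n → Fin n → Fin n → Fin n → Fin n → ℕ) →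
      ∑⁵ (λ x y z u v → (f₁ x y z u v + (f₂ x y z u v + f₃ x y z u v)) + (f₄ x y z u v + f₅ x y z u v))
      ≡ (∑⁵ f₁ + (∑⁵ f₂ + ∑⁵ f₃)) + (∑⁵ f₄ + ∑⁵ f₅)
    sum5 f₁ f₂ f₃ f₄ f₅ = trans (∑⁵-+ _ _) (cong₂ _+_ (trans (∑⁵-+ _ _) (cong (∑⁵ f₁ +_) (∑⁵-+ _ _))) (∑⁵-+ _ _))

    -- Once the labelled vertices are fixed, a table becomes a function of one further vertex, or of
    -- one further pair. The form is then summed over two independent copies of that vertex or pair
    -- and becomes a perfect square.
    squares-≥0 : ∑⁵ (ev (squares form⁻)) ≤ ∑⁵ (ev (squares form⁺))
    squares-≥0 = subst₂ _≤_ (sym (sum5 _ _ _ _ _)) (sym (sum5 _ _ _ _ _))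
      (+-mono-≤ (+-mono-≤ (inner (λ x y z → (A x ∧ not (A y)) ∧ (not (A z) ∧ not (c x y z))) squaresABB⁻ (λ x y z t u → at t (A u) (c x y u) (c x z u) (c y z u)))
                (+-mono-≤ (inner (λ x y z → (A x ∧ not (A y)) ∧ (not (A z) ∧ c x y z)) squaresABB⁺ (λ x y z t u → at t (A u) (c x y u) (c x z u) (c y z u)))
                          (inner (λ x y z → (not (A x) ∧ A y) ∧ (A z ∧ c x y z)) squaresAAB (λ x y z t u → at t (A u) (c y z u) (c x y u) (c x z u)))))
                (+-mono-≤ (outer (λ x → not (A x)) squaresB (λ x t y z → at t (A y) (A z) (c x y z) false))
                          (outer A squaresA (λ x t y z → at t (A y) (A z) (c x y z) false))))
      where
      inner : ∀ (b : Fin n → Fin n → Fin n → Bool) ss (F : Fin n → Fin n → Fin n → Table → Fin n → ℕ) →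
        ∑⁵ (λ x y z u v → when (b x y z) (Σform (λ s → form⁻ s (λ t → F x y z t u) (λ t → F x y z t v)) ss)) ≤
        ∑⁵ (λ x y z u v → when (b x y z) (Σform (λ s → form⁺ s (λ t → F x y z t u) (λ t → F x y z t v)) ss))
      inner b ss F = ∑-mono (λ x → ∑²-mono (λ y z → when-≤ (b x y z) (Σform-≥0 ss (F x y z))))
      outer : ∀ (b : Fin n → Bool) ss (F : Fin n → Table → Fin n → Fin n → ℕ) →
        ∑⁵ (λ x y z u v → when (b x) (Σform (λ s → form⁻ s (λ t → F x t y z) (λ t → F x t u v)) ss)) ≤
        ∑⁵ (λ x y z u v → when (b x) (Σform (λ s → form⁺ s (λ t → F x t y z) (λ t → F x t u v)) ss))
      outer b ss F = ∑-mono (λ x → when-≤² (b x) (Σform-≥0² ss (F x)))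

    Wt : Fin n → Fin n → Fin n → Fin n → ℕ
    Wt y z u v = pairWeight (A y) (A z) (A u) (A v) (c y z u) (c y z v) (c y u v) (c z u v)

    bad-triples : ℕ
    bad-triples = ∑³ (λ x y z → 𝟙 (c x y z ∧ not (two (A x) (A y) (A z))))

    inside-triples : ℕ
    inside-triples = ∑³ (λ x y z → 𝟙 (((A x ∧ A y) ∧ A z) ∧ c x y z))

    upper-sum : ∑⁵ (ev upper) ≡ (∑⁵ (λ x y z u v → Wt y z u v * 𝟙 (A x)) + (2700 * (n * n * ∑³ (λ x y z → 𝟙 (c x y z))) + 7 * (n * n * bad-triples))) + ∑⁵ (ev (squares form⁺))
    upper-sum = trans (∑⁵-+ _ _) (cong (_+ ∑⁵ (ev (squares form⁺))) (trans (∑⁵-+ _ _) (cong (∑⁵ (λ x y z u v → Wt y z u v * 𝟙 (A x)) +_)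
      (trans (∑⁵-+ _ _) (cong₂ _+_ (trans (∑⁵-*ˡ 2700 _) (cong (2700 *_) (∑⁵-outer (λ x y z → 𝟙 (c x y z)))))
                                   (trans (∑⁵-*ˡ 7 _) (cong (7 *_) (∑⁵-outer (λ x y z → 𝟙 (c x y z ∧ not (two (A x) (A y) (A z))))))))))))

    lower-sum : ∑⁵ (ev lower) ≡ (∑⁵ (λ x y z u v → Wt y z u v * 𝟙 (c x y z)) + n * n * (n * (n * n * 1200))) + ∑⁵ (ev (squares form⁻))
    lower-sum = trans (∑⁵-+ _ _) (cong (_+ ∑⁵ (ev (squares form⁻))) (trans (∑⁵-+ _ _) (cong (∑⁵ (λ x y z u v → Wt y z u v * 𝟙 (c x y z)) +_)
      (trans (∑⁵-outer (λ x y z → 1200)) (cong (n * n *_) (trans (∑-cong (λ x → ∑²-const 1200)) (∑-const {n} _)))))))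

    forbidden-sum : ∑⁵ (ev forbidden) ≡ F-count c + n * n * inside-triples
    forbidden-sum = trans (∑⁵-+ _ _) (cong₂ _+_ F-part (∑⁵-outer (λ x y z → 𝟙 (((A x ∧ A y) ∧ A z) ∧ c x y z))))
      where
      F-part : ∑⁵ (λ x y z u v → 𝟙 ((c x y z ∧ (c y z u ∧ c y z v)) ∧ c x u v)) ≡ F-count c
      F-part = trans (∑⁵-cong (λ x y z u v → cong (λ s → 𝟙 ((s ∧ (c y z u ∧ c y z v)) ∧ c x u v)) (rot x y z)))
                     (∑-swap²ˡ (λ x y z → ∑² (λ u v → 𝟙 ((c y z x ∧ (c y z u ∧ c y z v)) ∧ c x u v))))

    -- Pairs of larger codegree than |A| are exceptional.
    codegree-step : (ng : Fin n → Fin n → Bool) → (∀ y z → ng y z ≡ false → ∣ c y z ∣ₚ ≤ ∣ A ∣ₚ) →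
      ∑⁵ (λ x y z u v → Wt y z u v * 𝟙 (c x y z)) ≤ ∑⁵ (λ x y z u v → Wt y z u v * 𝟙 (A x)) + n * n * (5000 * n) * ∑² (λ y z → 𝟙 (ng y z))
    codegree-step ng ok = begin
      ∑⁵ (λ x y z u v → Wt y z u v * 𝟙 (c x y z)) ≡⟨ ∑⁵-rotate _ ⟩
      ∑² (λ y z → ∑² (λ u v → ∑ (λ x → Wt y z u v * 𝟙 (c x y z)))) ≤⟨ ∑²-mono (λ y z → ∑²-mono (λ u v → pt y z u v)) ⟩
      ∑² (λ y z → ∑² (λ u v → ∑ (λ x → Wt y z u v * 𝟙 (A x)) + 5000 * n * 𝟙 (ng y z))) ≡⟨ ∑²-cong (λ y z → trans (∑²-+ _ _) (cong (∑² (λ u v → ∑ (λ x → Wt y z u v * 𝟙 (A x))) +_) (∑²-const (5000 * n * 𝟙 (ng y z))))) ⟩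
      ∑² (λ y z → ∑² (λ u v → ∑ (λ x → Wt y z u v * 𝟙 (A x))) + n * n * (5000 * n * 𝟙 (ng y z))) ≡⟨ ∑²-+ _ _ ⟩
      ∑² (λ y z → ∑² (λ u v → ∑ (λ x → Wt y z u v * 𝟙 (A x)))) + ∑² (λ y z → n * n * (5000 * n * 𝟙 (ng y z)))
        ≡⟨ cong₂ _+_ (sym (∑⁵-rotate (λ x y z u v → Wt y z u v * 𝟙 (A x)))) (trans (∑²-cong (λ y z → sym (*-assoc (n * n) (5000 * n) (𝟙 (ng y z))))) (∑²-*ˡ (n * n * (5000 * n)) _)) ⟩
      ∑⁵ (λ x y z u v → Wt y z u v * 𝟙 (A x)) + n * n * (5000 * n) * ∑² (λ y z → 𝟙 (ng y z)) ∎
      where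
      open ≤-Reasoning
      pt : ∀ y z u v → ∑ (λ x → Wt y z u v * 𝟙 (c x y z)) ≤ ∑ (λ x → Wt y z u v * 𝟙 (A x)) + 5000 * n * 𝟙 (ng y z)
      pt y z u v = begin
        ∑ (λ x → w * 𝟙 (c x y z)) ≡⟨ trans (∑-*ˡ w _) (cong (w *_) (∑-cong (λ x → cong 𝟙 (rot x y z)))) ⟩
        w * ∣ c y z ∣ₚ ≤⟨ bool-case (ng y z) exceptional normal ⟩
        w * ∣ A ∣ₚ + 5000 * n * 𝟙 (ng y z) ≡⟨ cong (_+ 5000 * n * 𝟙 (ng y z)) (sym (∑-*ˡ w _)) ⟩
        ∑ (λ x → w * 𝟙 (A x)) + 5000 * n * 𝟙 (ng y z) ∎
        where
        w = Wt y z u v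
        normal : ng y z ≡ false → w * ∣ c y z ∣ₚ ≤ w * ∣ A ∣ₚ + 5000 * n * 𝟙 (ng y z)
        normal r = ≤-trans (*-monoʳ-≤ w (ok y z r)) (m≤m+n _ _)
        exceptional : ng y z ≡ true → w * ∣ c y z ∣ₚ ≤ w * ∣ A ∣ₚ + 5000 * n * 𝟙 (ng y z)
        exceptional r = ≤-trans (*-mono-≤ (pairWeight-bound (A y) (A z) (A u) (A v) (c y z u) (c y z v) (c y u v) (c z u v)) (∣∣ₚ-≤ (c y z)))
          (≤-trans (≤-reflexive (sym (trans (cong (λ b → 5000 * n * 𝟙 b) r) (*-identityʳ (5000 * n))))) (m≤n+m _ (w * ∣ A ∣ₚ)))

-- Stability at edge density 4/9.

module FlagStability where
 ∑²-<⇒∃ : ∀ {n} (f g : Fin n → Fin n → ℕ) → ∑² f < ∑² g → ∃[ a ] ∃[ b ] f a b < g a b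
 ∑²-<⇒∃ f g lt = let a , p = ∑-<⇒∃ (λ a → ∑ (f a)) (λ a → ∑ (g a)) lt
                     b , q = ∑-<⇒∃ (f a) (g a) p
                 in a , b , q

 abstract
   -- The penalty is the number of permutations times the bound on `upper`. In `K₀`, 5000 pays for
   -- exceptional pairs, 300 for the missing density, and the two penalties for copies of F and for
   -- edges inside the colour class.
   penalty K₀ : ℕ
   penalty = 30000000
   K₀ = 60005300

   penalty≡ : length cosets * 1000000 ≡ penalty
   penalty≡ = refl

   K₀≡ : 5000 + 300 + (penalty + penalty) ≡ K₀
   K₀≡ = refl

   2≤K₀ : 2 ≤ K₀
   2≤K₀ = ≤ᵇ-true {2} {K₀} refl

 K₀-nonZero : NonZero K₀
 K₀-nonZero = >-nonZero (≤-trans (s≤s z≤n) 2≤K₀)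

 -- The final bookkeeping: everything but the bad triples cancels up to error terms.
 flag-arithmetic : ∀ (w b k n D err U Uc V B Sp Sm Fc AA nn cc g : ℕ) →
   U + (b * 9 * (nn * V) + 7 * (nn * B)) + Sp ≤ (Uc + nn * (n * (nn * (b * 4))) + Sm) + k * (Fc + nn * AA) →
   Uc ≤ U + nn * (w * n) * g → Sm ≤ Sp → 4 * cc ≤ 9 * V + err → n * nn ≡ cc → D * g ≤ nn → D * err ≤ cc → D * AA ≤ cc → D * Fc ≤ nn * cc →
   nn * (D * (7 * B)) ≤ nn * ((w + b + (k + k)) * cc)
 flag-arithmetic w b k n D err U Uc V B Sp Sm Fc AA nn cc g main cod sq den ncc dg derr dA dF = +-cancelˡ-≤ (D * (U + (b * 9 * (nn * V) + Sp))) _ _ (begin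
   D * (U + (b * 9 * (nn * V) + Sp)) + nn * (D * (7 * B)) ≡⟨ y₁ b D U V Sp nn B ⟩
   D * (U + (b * 9 * (nn * V) + 7 * (nn * B)) + Sp) ≤⟨ *-monoʳ-≤ D main ⟩
   D * ((Uc + nn * (n * (nn * (b * 4))) + Sm) + k * (Fc + nn * AA)) ≤⟨ *-monoʳ-≤ D (+-monoˡ-≤ _ (+-mono-≤ (+-mono-≤ cod dense′) sq)) ⟩
   D * (((U + nn * (w * n) * g) + nn * (b * (9 * V + err)) + Sp) + k * (Fc + nn * AA)) ≡⟨ y₂ w b k D U nn n g V err Sp Fc AA ⟩
   D * (U + (b * 9 * (nn * V) + Sp)) + (nn * (w * n) * (D * g) + nn * (b * (D * err)) + k * (D * Fc + nn * (D * AA)))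
     ≤⟨ +-monoʳ-≤ (D * (U + (b * 9 * (nn * V) + Sp))) (+-mono-≤ (+-mono-≤ (*-monoʳ-≤ (nn * (w * n)) dg) (*-monoʳ-≤ nn (*-monoʳ-≤ b derr))) (*-monoʳ-≤ k (+-mono-≤ dF (*-monoʳ-≤ nn dA)))) ⟩
   D * (U + (b * 9 * (nn * V) + Sp)) + (nn * (w * n) * nn + nn * (b * cc) + k * (nn * cc + nn * cc)) ≡⟨ cong (D * (U + (b * 9 * (nn * V) + Sp)) +_) (trans (cong (λ s → s + nn * (b * cc) + k * (nn * cc + nn * cc)) (trans (y₄ w nn n) (cong (λ s → nn * (w * s)) ncc))) (y₃ w b k nn cc)) ⟩
   D * (U + (b * 9 * (nn * V) + Sp)) + nn * ((w + b + (k + k)) * cc) ∎)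
   where
   open ≤-Reasoning
   y₁ : ∀ b D U V Sp nn B → D * (U + (b * 9 * (nn * V) + Sp)) + nn * (D * (7 * B)) ≡ D * (U + (b * 9 * (nn * V) + 7 * (nn * B)) + Sp)
   y₁ = solve-∀
   y₂ : ∀ w b k D U nn n g V err Sp Fc AA → D * (((U + nn * (w * n) * g) + nn * (b * (9 * V + err)) + Sp) + k * (Fc + nn * AA)) ≡
     D * (U + (b * 9 * (nn * V) + Sp)) + (nn * (w * n) * (D * g) + nn * (b * (D * err)) + k * (D * Fc + nn * (D * AA)))
   y₂ = solve-∀
   y₃ : ∀ w b k nn cc → nn * (w * cc) + nn * (b * cc) + k * (nn * cc + nn * cc) ≡ nn * ((w + b + (k + k)) * cc)
   y₃ = solve-∀
   y₄ : ∀ w nn n → nn * (w * n) * nn ≡ nn * (w * (n * nn))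
   y₄ = solve-∀
   y₅ : ∀ b nn n → nn * (n * (nn * (b * 4))) ≡ nn * (b * (4 * (n * nn)))
   y₅ = solve-∀
   dense′ : nn * (n * (nn * (b * 4))) ≤ nn * (b * (9 * V + err))
   dense′ = ≤-trans (≤-reflexive (trans (y₅ b nn n) (cong (λ s → nn * (b * (4 * s))) ncc))) (*-monoʳ-≤ nn (*-monoʳ-≤ b den))

 ∑-max′ : ∀ {n} → n ≢ 0 → (f : Fin n → ℕ) → ∃[ i ] (∀ j → f j ≤ f i)
 ∑-max′ {zero}  n≢0 f = ⊥-elim (n≢0 refl)
 ∑-max′ {suc n} n≢0 f = ∑-max f

 module FlagTheorem {n : ℕ} (n≢0 : n ≢ 0) (c : Fin n → Fin n → Fin n → Bool) (cs : Sym₃ c) (D : ℕ) (2≤D : 2 ≤ D)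
   (certificate : Certifies cosets forbidden upper lower)
   (few : D * D * F-count c ≤ n * n * cub n)
   (err : ℕ) (dense : 4 * cub n ≤ 9 * ∑³ (λ x y z → 𝟙 (c x y z)) + err) (small-err : D * err ≤ cub n) where

   open ≤-Reasoning

   instance
     n-nonZero : NonZero n
     n-nonZero = ≢-nonZero n≢0
     nn-nonZero : NonZero (n * n)
     nn-nonZero = m*n≢0 n n
     D-nonZero : NonZero D
     D-nonZero = >-nonZero (≤-trans (s≤s z≤n) 2≤D)

   clash : Fin n → Fin n → ℕ
   clash y z = ∑³ (λ a b d → 𝟙 ((c y z a ∧ (c y z b ∧ c y z d)) ∧ c a b d))

   -- The colour class will be a neighbourhood, and the certificate needs it to span few edges, so
   -- only pairs with this property may compete for it.
   good ng : Fin n → Fin n → Bool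
   good y z = D * clash y z ≤ᵇ cub n
   ng y z = not (good y z)

   ∣ng∣ : ℕ
   ∣ng∣ = ∑² (λ y z → 𝟙 (ng y z))

   -- An exceptional pair lies in more than n³/D copies of F, and there are only n⁵/D² copies. This
   -- is why the hypothesis `few` has D squared.
   few-ng : D * ∣ng∣ ≤ n * n
   few-ng = *-cancelˡ-≤ (cub n * D) (begin
     cub n * D * (D * ∣ng∣) ≡⟨ x₁ (cub n) D ∣ng∣ ⟩
     D * D * (cub n * ∣ng∣) ≡⟨ cong (D * D *_) (sym (∑²-*ˡ (cub n) _)) ⟩
     D * D * ∑² (λ y z → cub n * 𝟙 (ng y z)) ≤⟨ *-monoʳ-≤ (D * D) (∑²-mono pt) ⟩
     D * D * ∑² (λ y z → D * clash y z) ≡⟨ cong (D * D *_) (∑²-*ˡ D clash) ⟩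
     D * D * (D * F-count c) ≡⟨ x₂ D (F-count c) ⟩
     D * (D * D * F-count c) ≤⟨ *-monoʳ-≤ D few ⟩
     D * (n * n * cub n) ≡⟨ x₃ D (n * n) (cub n) ⟩
     cub n * D * (n * n) ∎)
     where
     x₁ : ∀ c d g → c * d * (d * g) ≡ d * d * (c * g)
     x₁ = solve-∀
     x₂ : ∀ d f → d * d * (d * f) ≡ d * (d * d * f)
     x₂ = solve-∀
     x₃ : ∀ d m c → d * (m * c) ≡ c * d * m
     x₃ = solve-∀
     instance
       cub-nonZero : NonZero (cub n * D)
       cub-nonZero = m*n≢0 (cub n) D ⦃ m*n≢0 (n * n) n ⦄
     pt : ∀ y z → cub n * 𝟙 (ng y z) ≤ D * clash y z
     pt y z = bool-case (good y z)
       (λ r → ≤-trans (≤-reflexive (trans (cong (λ b → cub n * 𝟙 (not b)) r) (*-zeroʳ (cub n)))) z≤n)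
       (λ r → ≤-trans (≤-reflexive (trans (cong (λ b → cub n * 𝟙 (not b)) r) (*-identityʳ (cub n)))) (<⇒≤ (≤ᵇ-false r)))

   some-good : ∃[ y ] ∃[ z ] good y z ≡ true
   some-good = let y , z , p = ∑²-<⇒∃ (λ y z → 𝟙 (ng y z)) (λ _ _ → 1) lt in y , z , conv (good y z) p
     where
     conv : ∀ b → 𝟙 (not b) < 1 → b ≡ true
     conv true  _ = refl
     conv false (s≤s ())
     double : 2 * ∣ng∣ ≤ n * n
     double = ≤-trans (*-monoˡ-≤ ∣ng∣ 2≤D) few-ng
     half : ∀ a b → 2 * a ≤ b → 0 < b → a < b
     half zero b _ p = p
     half (suc a) b q _ = <-≤-trans (m<m+n (suc a) (s≤s z≤n)) q
     lt : ∣ng∣ < ∑² {n} (λ _ _ → 1)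
     lt = subst (∣ng∣ <_) (sym (trans (∑²-const {n} 1) (*-identityʳ (n * n)))) (half ∣ng∣ (n * n) double (>-nonZero⁻¹ (n * n)))

   -- The successor lets a good pair with empty neighbourhood still beat every exceptional pair, so
   -- that the maximum is attained at a good one.
   score : Fin n → Fin n → ℕ
   score y z = 𝟙 (good y z) * suc ∣ c y z ∣ₚ

   best : ∃[ y ] ∃[ z ] (∀ y′ z′ → score y′ z′ ≤ score y z)
   best = let y , p = ∑-max′ n≢0 (λ y → score y (proj₁ (∑-max′ n≢0 (score y))))
          in y , proj₁ (∑-max′ n≢0 (score y)) , λ y′ z′ → ≤-trans (proj₂ (∑-max′ n≢0 (score y′)) z′) (p y′)

   -- In the extremal system the pairs across the partition have the largest codegree, and their
   -- neighbourhood is X up to a vertex. A good pair of largest codegree thus proposes the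
   -- partition.
   module Best (y₀ z₀ : Fin n) (top : ∀ y z → score y z ≤ score y₀ z₀) where
     A : Fin n → Bool
     A = c y₀ z₀

     good₀ : good y₀ z₀ ≡ true
     good₀ = let y , z , p = some-good in bool-case (good y₀ z₀) id
       (λ r → ⊥-elim (≤⇒≯ (≤-trans (top y z) (≤-reflexive (cong (λ b → 𝟙 b * suc ∣ A ∣ₚ) r)))
                 (subst (λ b → 1 ≤ 𝟙 b * suc ∣ c y z ∣ₚ) (sym p) (s≤s z≤n))))

     maximal : ∀ y z → ng y z ≡ false → ∣ c y z ∣ₚ ≤ ∣ A ∣ₚ
     maximal y z r = s≤s⁻¹ (scored {good y z} {good y₀ z₀} (unnot r) good₀ (top y z))
       where
       unnot : ∀ {b} → not b ≡ false → b ≡ true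
       unnot {true} _ = refl
       scored : ∀ {b b′ k l} → b ≡ true → b′ ≡ true → 𝟙 b * k ≤ 𝟙 b′ * l → k ≤ l
       scored {k = k} {l} refl refl p = subst₂ _≤_ (+-identityʳ k) (+-identityʳ l) p

     open Flag A c cs
     open Patterns A c cs
     open Pointwise cosets forbidden upper lower 1000000 certificate upper-bounded

     few-inside : D * inside-triples ≤ cub n
     few-inside = ≤-trans (*-monoʳ-≤ D (≤-reflexive (∑³-cong (λ x y z → cong (λ b → 𝟙 (b ∧ c x y z)) (∧-assoc (A x) (A y) (A z)))))) (≤ᵇ-true good₀)

     main-inequality : ∑⁵ (ev upper) ≤ ∑⁵ (ev lower) + penalty * ∑⁵ (ev forbidden)
     main-inequality = summed A c cs penalty penalty≡ _

     result : D * (7 * bad-triples) ≤ K₀ * cub n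
     result = *-cancelˡ-≤ (n * n) (subst (λ K → n * n * (D * (7 * bad-triples)) ≤ n * n * (K * cub n)) K₀≡
       (flag-arithmetic 5000 300 penalty n D err
         (∑⁵ (λ x y z u v → Wt y z u v * 𝟙 (A x))) (∑⁵ (λ x y z u v → Wt y z u v * 𝟙 (c x y z))) (∑³ (λ x y z → 𝟙 (c x y z))) bad-triples
         (∑⁵ (ev (squares form⁺))) (∑⁵ (ev (squares form⁻))) (F-count c) inside-triples (n * n) (cub n) ∣ng∣
         (subst₂ _≤_ upper-sum (cong₂ _+_ lower-sum (cong (penalty *_) forbidden-sum)) main-inequality)
         (codegree-step ng maximal) squares-≥0 dense (sym (*-assoc n n n)) few-ng small-err few-inside
         (≤-trans (*-monoˡ-≤ (F-count c) (m≤m*n D D)) few)))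

 flag-stability : Certifies cosets forbidden upper lower → ∀ E → 1 ≤ E → ∀ {n} (c : Fin n → Fin n → Fin n → Bool) → Sym₃ c →
   K₀ * E * (K₀ * E) * F-count c ≤ n * n * cub n →
   ∀ err → 4 * cub n ≤ 9 * ∑³ (λ x y z → 𝟙 (c x y z)) + err → K₀ * E * err ≤ cub n →
   Σ (Fin n → Bool) λ A → E * ∑³ (λ x y z → 𝟙 (c x y z ∧ not (two (A x) (A y) (A z)))) ≤ cub n
 flag-stability cert E 1≤E {zero} c cs few err dense small = (λ _ → false) , ≤-trans (≤-reflexive (trans (cong (E *_) (∑-empty _)) (*-zeroʳ E))) z≤n
 flag-stability cert E 1≤E {n@(suc _)} c cs few err dense small = nonempty c cs few err dense small (λ ())
   where
   nonempty : ∀ {n} (c : Fin n → Fin n → Fin n → Bool) → Sym₃ c → K₀ * E * (K₀ * E) * F-count c ≤ n * n * cub n →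
     ∀ err → 4 * cub n ≤ 9 * ∑³ (λ x y z → 𝟙 (c x y z)) + err → K₀ * E * err ≤ cub n → n ≢ 0 →
     Σ (Fin n → Bool) λ A → E * ∑³ (λ x y z → 𝟙 (c x y z ∧ not (two (A x) (A y) (A z)))) ≤ cub n
   nonempty {n} c cs few err dense small n≢0 =
     let y₀ , z₀ , top = FlagTheorem.best n≢0 c cs (K₀ * E) 2≤ cert few err dense small
     in FlagTheorem.Best.A n≢0 c cs (K₀ * E) 2≤ cert few err dense small y₀ z₀ top , finish _ _ (FlagTheorem.Best.result n≢0 c cs (K₀ * E) 2≤ cert few err dense small y₀ z₀ top)
     where
     2≤ : 2 ≤ K₀ * E
     2≤ = ≤-trans (≤-trans 2≤K₀ (≤-reflexive (sym (*-identityʳ K₀)))) (*-monoʳ-≤ K₀ 1≤E)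
     finish : ∀ b c → K₀ * E * (7 * b) ≤ K₀ * c → E * b ≤ c
     finish b c p = *-cancelˡ-≤ K₀ ⦃ K₀-nonZero ⦄ (≤-trans (≤-trans (≤-reflexive (sym (*-assoc K₀ E b))) (*-monoʳ-≤ (K₀ * E) (m≤n*m b 7))) p)

open FlagStability

-- Triple systems as symmetric Boolean predicates.

module Edges where
 does-sound : ∀ {P : Set} (d : Dec P) → does d ≡ true → P
 does-sound (yes p) _ = p

 lookup-injective : ∀ {A : Set} {xs : List A} → Unique.Unique xs → ∀ i j → lookupₗ xs i ≡ lookupₗ xs j → i ≡ j
 lookup-injective (_ AllPairs.∷ _)  zero    zero    e = refl
 lookup-injective (p AllPairs.∷ _)  zero    (suc j) e = ⊥-elim (All.lookup p (Memₚ.∈-lookup j) e)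
 lookup-injective (p AllPairs.∷ _)  (suc i) zero    e = ⊥-elim (All.lookup p (Memₚ.∈-lookup i) (sym e))
 lookup-injective (_ AllPairs.∷ ps) (suc i) (suc j) e = cong suc (lookup-injective ps i j e)

 concatMap-unique : ∀ {B : Set} {n} (f : Fin n → List B) (g : B → Fin n) → (∀ i → Unique.Unique (f i)) →
                    (∀ i x → x ∈ₗ f i → g x ≡ i) → Unique.Unique (concatMap f (allFin n))
 concatMap-unique {n = n} f g u d = Uniqueₚ.concat⁺ (Allₚ.map⁺ (Allₚ.tabulate⁺ u))
   (AllPairsₚ.map⁺ (AllPairs.map (λ {i} {j} i≢j → λ { (p , q) → i≢j (trans (sym (d i _ p)) (d j _ q)) }) (Uniqueₚ.allFin⁺ n)))

 module _ {n : ℕ} where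
   private
     row : Fin n → Fin n → List (Fin n × Fin n × Fin n)
     row i j = map (λ k → (i , j , k)) (allFin n)

     in-row : ∀ i j x → x ∈ₗ row i j → proj₁ x ≡ i × proj₁ (proj₂ x) ≡ j
     in-row i j x m with Memₚ.∈-map⁻ _ m
     ... | k , _ , refl = refl , refl

     in-rows : ∀ i x → x ∈ₗ concatMap (row i) (allFin n) → proj₁ x ≡ i
     in-rows i x m with Memₚ.∈-concat⁻′ (map (row i) (allFin n)) m
     ... | xs , p , q with Memₚ.∈-map⁻ (row i) q
     ...   | j , _ , refl = proj₁ (in-row i j x p)

     unique-rows : ∀ i → Unique.Unique (concatMap (row i) (allFin n))
     unique-rows i = concatMap-unique (row i) (proj₁ ∘ proj₂) (λ j → Uniqueₚ.map⁺ (λ { refl → refl }) (Uniqueₚ.allFin⁺ n))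
                       (λ j x m → proj₂ (in-row i j x m))

   Triples-unique : Unique.Unique (Triples n)
   Triples-unique = Uniqueₚ.filter⁺ _ (concatMap-unique (λ i → concatMap (row i) (allFin n)) proj₁ unique-rows in-rows)

   all∈allTriples : ∀ i j k → (i , j , k) ∈ₗ allTriples n
   all∈allTriples i j k = Memₚ.∈-concat⁺′ (Memₚ.∈-concat⁺′ (Memₚ.∈-map⁺ (λ k → (i , j , k)) (Memₚ.∈-allFin k)) (Memₚ.∈-map⁺ (row i) (Memₚ.∈-allFin j)))
                           (Memₚ.∈-map⁺ (λ i → concatMap (row i) (allFin n)) (Memₚ.∈-allFin i))

 _<ᵇᶠ_ : ∀ {n} → Fin n → Fin n → Bool
 i <ᵇᶠ j = does (i Finₚ.<? j)

 sorted : ∀ {n} → Fin n → Fin n → Fin n → Bool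
 sorted i j k = (i <ᵇᶠ j) ∧ (j <ᵇᶠ k)

 module _ {n : ℕ} where
   triple : Fin (N3 n) → Fin n × Fin n × Fin n
   triple = lookupₗ (Triples n)

   triple-sorted : ∀ p → let i , j , k = triple p in i Data.Fin.< j × j Data.Fin.< k
   triple-sorted p = proj₂ (Memₚ.∈-filter⁻ _ {xs = allTriples n} (Memₚ.∈-lookup p))

   position : ∀ i j k → i Data.Fin.< j → j Data.Fin.< k → ∃[ p ] triple p ≡ (i , j , k)
   position i j k lt lt′ = Any.index m , sym (Anyₚ.lookup-index m)
     where
     m : (i , j , k) ∈ₗ Triples n
     m = Memₚ.∈-filter⁺ _ (all∈allTriples i j k) (lt , lt′)

   abstract
     E : TripleSystem n → Fin n → Fin n → Fin n → Bool
     E H a b c = does (Edge? n H a b c)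

     E⇒ : ∀ H a b c → E H a b c ≡ true → Edge n H a b c
     E⇒ H a b c e = does-sound (Edge? n H a b c) e

     ⇒E : ∀ H a b c → Edge n H a b c → E H a b c ≡ true
     ⇒E H a b c p = dec-true (Edge? n H a b c) p

   E-s₁₂ : ∀ H a b c → E H a b c ≡ true → E H b a c ≡ true
   E-s₁₂ H a b c e = let a≢b , b≢c , a≢c , p , m , x , y , z = E⇒ H a b c e
                     in ⇒E H b a c (a≢b ∘ sym , a≢c , b≢c , p , m , y , x , z)

   E-s₂₃ : ∀ H a b c → E H a b c ≡ true → E H a c b ≡ true
   E-s₂₃ H a b c e = let a≢b , b≢c , a≢c , p , m , x , y , z = E⇒ H a b c e
                     in ⇒E H a c b (a≢c , b≢c ∘ sym , a≢b , p , m , x , z , y)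

   E-sym : ∀ H → Sym₃ (E H)
   E-sym H = record { s₁₂ = λ a b c → bool-ext (E-s₁₂ H a b c) (E-s₁₂ H b a c)
                    ; s₂₃ = λ a b c → bool-ext (E-s₂₃ H a b c) (E-s₂₃ H a c b) }

   E-irrefl : ∀ H a c → E H a a c ≡ false
   E-irrefl H a c = ¬true⇒false (λ e → proj₁ (E⇒ H a a c e) refl)

   private
     same : ∀ {i j k i′ j′ k′ : Fin n} → i Data.Fin.< j → j Data.Fin.< k → i′ Data.Fin.< j′ → j′ Data.Fin.< k′ →
            i ∈₃ (i′ , j′ , k′) → j ∈₃ (i′ , j′ , k′) → k ∈₃ (i′ , j′ , k′) → (i , j , k) ≡ (i′ , j′ , k′)
     same p q p′ q′ (inj₁ refl) (inj₁ refl) z = ⊥-elim (<-irrefl refl p)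
     same p q p′ q′ (inj₁ refl) (inj₂ (inj₁ refl)) (inj₁ refl) = ⊥-elim (<-irrefl refl (<-trans p q))
     same p q p′ q′ (inj₁ refl) (inj₂ (inj₁ refl)) (inj₂ (inj₁ refl)) = ⊥-elim (<-irrefl refl q)
     same p q p′ q′ (inj₁ refl) (inj₂ (inj₁ refl)) (inj₂ (inj₂ refl)) = refl
     same p q p′ q′ (inj₁ refl) (inj₂ (inj₂ refl)) (inj₁ refl) = ⊥-elim (<-irrefl refl (<-trans p q))
     same p q p′ q′ (inj₁ refl) (inj₂ (inj₂ refl)) (inj₂ (inj₁ refl)) = ⊥-elim (<-irrefl refl (<-trans q q′))
     same p q p′ q′ (inj₁ refl) (inj₂ (inj₂ refl)) (inj₂ (inj₂ refl)) = ⊥-elim (<-irrefl refl q)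
     same p q p′ q′ (inj₂ (inj₁ refl)) (inj₁ refl) z = ⊥-elim (<-irrefl refl (<-trans p p′))
     same p q p′ q′ (inj₂ (inj₁ refl)) (inj₂ (inj₁ refl)) z = ⊥-elim (<-irrefl refl p)
     same p q p′ q′ (inj₂ (inj₁ refl)) (inj₂ (inj₂ refl)) (inj₁ refl) = ⊥-elim (<-irrefl refl (<-trans q (<-trans p′ q′)))
     same p q p′ q′ (inj₂ (inj₁ refl)) (inj₂ (inj₂ refl)) (inj₂ (inj₁ refl)) = ⊥-elim (<-irrefl refl (<-trans q q′))
     same p q p′ q′ (inj₂ (inj₁ refl)) (inj₂ (inj₂ refl)) (inj₂ (inj₂ refl)) = ⊥-elim (<-irrefl refl q)
     same p q p′ q′ (inj₂ (inj₂ refl)) (inj₁ refl) z = ⊥-elim (<-irrefl refl (<-trans p (<-trans p′ q′)))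
     same p q p′ q′ (inj₂ (inj₂ refl)) (inj₂ (inj₁ refl)) z = ⊥-elim (<-irrefl refl (<-trans p q′))
     same p q p′ q′ (inj₂ (inj₂ refl)) (inj₂ (inj₂ refl)) z = ⊥-elim (<-irrefl refl p)

   -- Every listed triple is increasing and is listed once, so the underlying 3-set determines the
   -- position and no other position can account for the edge.
   E-at : ∀ H p → let i , j , k = triple p in lookupᵥ H p ≡ E H i j k
   E-at H p = bool-ext fwd bwd
     where
     i = proj₁ (triple p)
     j = proj₁ (proj₂ (triple p))
     k = proj₂ (proj₂ (triple p))
     i<j = proj₁ (triple-sorted p)
     j<k = proj₂ (triple-sorted p)
     fwd : lookupᵥ H p ≡ true → E H i j k ≡ true
     fwd e = ⇒E H i j k ((λ q → <-irrefl (cong toℕ q) i<j) , (λ q → <-irrefl (cong toℕ q) j<k) , (λ q → <-irrefl (cong toℕ q) (<-trans i<j j<k)) ,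
               p , Vecₚ.lookup⇒[]= p H e , inj₁ refl , inj₂ (inj₁ refl) , inj₂ (inj₂ refl))
     bwd : E H i j k ≡ true → lookupᵥ H p ≡ true
     bwd e = let _ , _ , _ , p′ , m , x , y , z = E⇒ H i j k e
                 i′<j′ , j′<k′ = triple-sorted p′
                 p≡p′ = lookup-injective Triples-unique p p′ (same i<j j<k i′<j′ j′<k′ x y z)
             in subst (λ p → lookupᵥ H p ≡ true) (sym p≡p′) (Vecₚ.[]=⇒lookup m)

   system : (Fin n → Fin n → Fin n → Bool) → TripleSystem n
   system w = tabulateᵥ (λ p → let i , j , k = triple p in w i j k)

   module _ (w : Fin n → Fin n → Fin n → Bool) (ws : Sym₃ w) where
     open Sym₃ ws
     private
       perm : ∀ {a b c i j k : Fin n} → a ≢ b → b ≢ c → a ≢ c → a ∈₃ (i , j , k) → b ∈₃ (i , j , k) → c ∈₃ (i , j , k) → w i j k ≡ w a b c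
       perm a≢b b≢c a≢c (inj₁ refl) (inj₁ refl) z = ⊥-elim (a≢b refl)
       perm a≢b b≢c a≢c (inj₁ refl) (inj₂ (inj₁ refl)) (inj₁ refl) = ⊥-elim (a≢c refl)
       perm a≢b b≢c a≢c (inj₁ refl) (inj₂ (inj₁ refl)) (inj₂ (inj₁ refl)) = ⊥-elim (b≢c refl)
       perm a≢b b≢c a≢c (inj₁ refl) (inj₂ (inj₁ refl)) (inj₂ (inj₂ refl)) = refl
       perm a≢b b≢c a≢c (inj₁ refl) (inj₂ (inj₂ refl)) (inj₁ refl) = ⊥-elim (a≢c refl)
       perm a≢b b≢c a≢c (inj₁ refl) (inj₂ (inj₂ refl)) (inj₂ (inj₁ refl)) = s₂₃ _ _ _
       perm a≢b b≢c a≢c (inj₁ refl) (inj₂ (inj₂ refl)) (inj₂ (inj₂ refl)) = ⊥-elim (b≢c refl)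
       perm a≢b b≢c a≢c (inj₂ (inj₁ refl)) (inj₁ refl) (inj₁ refl) = ⊥-elim (b≢c refl)
       perm a≢b b≢c a≢c (inj₂ (inj₁ refl)) (inj₁ refl) (inj₂ (inj₁ refl)) = ⊥-elim (a≢c refl)
       perm a≢b b≢c a≢c (inj₂ (inj₁ refl)) (inj₁ refl) (inj₂ (inj₂ refl)) = s₁₂ _ _ _
       perm a≢b b≢c a≢c (inj₂ (inj₁ refl)) (inj₂ (inj₁ refl)) z = ⊥-elim (a≢b refl)
       perm a≢b b≢c a≢c (inj₂ (inj₁ refl)) (inj₂ (inj₂ refl)) (inj₁ refl) = rot _ _ _
       perm a≢b b≢c a≢c (inj₂ (inj₁ refl)) (inj₂ (inj₂ refl)) (inj₂ (inj₁ refl)) = ⊥-elim (a≢c refl)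
       perm a≢b b≢c a≢c (inj₂ (inj₁ refl)) (inj₂ (inj₂ refl)) (inj₂ (inj₂ refl)) = ⊥-elim (b≢c refl)
       perm a≢b b≢c a≢c (inj₂ (inj₂ refl)) (inj₁ refl) (inj₁ refl) = ⊥-elim (b≢c refl)
       perm a≢b b≢c a≢c (inj₂ (inj₂ refl)) (inj₁ refl) (inj₂ (inj₁ refl)) = rot′ _ _ _
       perm a≢b b≢c a≢c (inj₂ (inj₂ refl)) (inj₁ refl) (inj₂ (inj₂ refl)) = ⊥-elim (a≢c refl)
       perm a≢b b≢c a≢c (inj₂ (inj₂ refl)) (inj₂ (inj₁ refl)) (inj₁ refl) = s₁₃ _ _ _
       perm a≢b b≢c a≢c (inj₂ (inj₂ refl)) (inj₂ (inj₁ refl)) (inj₂ (inj₁ refl)) = ⊥-elim (b≢c refl)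
       perm a≢b b≢c a≢c (inj₂ (inj₂ refl)) (inj₂ (inj₁ refl)) (inj₂ (inj₂ refl)) = ⊥-elim (a≢c refl)
       perm a≢b b≢c a≢c (inj₂ (inj₂ refl)) (inj₂ (inj₂ refl)) z = ⊥-elim (a≢b refl)

       value : ∀ p → let i , j , k = triple p in lookupᵥ (system w) p ≡ w i j k
       value p = Vecₚ.lookup∘tabulate _ p

       Sorts : Fin n → Fin n → Fin n → Set
       Sorts a b c = Σ (Fin n) λ i → Σ (Fin n) λ j → Σ (Fin n) λ k → i Data.Fin.< j × j Data.Fin.< k × a ∈₃ (i , j , k) × b ∈₃ (i , j , k) × c ∈₃ (i , j , k)

       flip : ∀ {a b : Fin n} → a ≢ b → ¬ (a Data.Fin.< b) → b Data.Fin.< a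
       flip a≢b ¬p = ≤∧≢⇒< (≮⇒≥ ¬p) (λ q → a≢b (Finₚ.toℕ-injective (sym q)))

       sort : ∀ a b c → a ≢ b → b ≢ c → a ≢ c → Sorts a b c
       sort a b c a≢b b≢c a≢c with a Finₚ.<? b | b Finₚ.<? c | a Finₚ.<? c
       ... | yes p | yes q | _     = a , b , c , p , q , inj₁ refl , inj₂ (inj₁ refl) , inj₂ (inj₂ refl)
       ... | yes p | no ¬q | yes r = a , c , b , r , flip b≢c ¬q , inj₁ refl , inj₂ (inj₂ refl) , inj₂ (inj₁ refl)
       ... | yes p | no ¬q | no ¬r = c , a , b , flip a≢c ¬r , p , inj₂ (inj₁ refl) , inj₂ (inj₂ refl) , inj₁ refl
       ... | no ¬p | yes q | yes r = b , a , c , flip a≢b ¬p , r , inj₂ (inj₁ refl) , inj₁ refl , inj₂ (inj₂ refl)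
       ... | no ¬p | yes q | no ¬r = b , c , a , q , flip a≢c ¬r , inj₂ (inj₂ refl) , inj₁ refl , inj₂ (inj₁ refl)
       ... | no ¬p | no ¬q | _     = c , b , a , flip b≢c ¬q , flip a≢b ¬p , inj₂ (inj₂ refl) , inj₂ (inj₁ refl) , inj₁ refl

     E-system⇒ : ∀ a b c → E (system w) a b c ≡ true → w a b c ≡ true
     E-system⇒ a b c e = let a≢b , b≢c , a≢c , p , m , x , y , z = E⇒ (system w) a b c e
                         in trans (sym (perm a≢b b≢c a≢c x y z)) (trans (sym (value p)) (Vecₚ.[]=⇒lookup m))

     ⇒E-system : ∀ a b c → a ≢ b → b ≢ c → a ≢ c → w a b c ≡ true → E (system w) a b c ≡ true
     ⇒E-system a b c a≢b b≢c a≢c e with sort a b c a≢b b≢c a≢c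
     ... | i , j , k , lt , lt′ , x , y , z with position i j k lt lt′
     ...   | p , q = ⇒E (system w) a b c (a≢b , b≢c , a≢c , p ,
               Vecₚ.lookup⇒[]= p (system w) (trans (value p) (trans (cong (λ { (i , j , k) → w i j k }) q) (trans (perm a≢b b≢c a≢c x y z) e))) ,
               subst (a ∈₃_) (sym q) x , subst (b ∈₃_) (sym q) y , subst (c ∈₃_) (sym q) z)

open Edges

-- Counting 3-sets, and families of sets with few errors.

sumₗ : ∀ {A : Set} → (A → ℕ) → List A → ℕ
sumₗ f [] = 0
sumₗ f (x ∷ xs) = f x + sumₗ f xs

sumₗ-++ : ∀ {A : Set} (f : A → ℕ) xs ys → sumₗ f (xs ++ ys) ≡ sumₗ f xs + sumₗ f ys
sumₗ-++ f [] ys = refl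
sumₗ-++ f (x ∷ xs) ys = trans (cong (f x +_) (sumₗ-++ f xs ys)) (sym (+-assoc (f x) _ _))

sumₗ-concatMap : ∀ {A B : Set} (f : B → ℕ) (g : A → List B) xs → sumₗ f (concatMap g xs) ≡ sumₗ (λ x → sumₗ f (g x)) xs
sumₗ-concatMap f g [] = refl
sumₗ-concatMap f g (x ∷ xs) = trans (sumₗ-++ f (g x) (concatMap g xs)) (cong (sumₗ f (g x) +_) (sumₗ-concatMap f g xs))

sumₗ-map : ∀ {A B : Set} (f : B → ℕ) (g : A → B) xs → sumₗ f (map g xs) ≡ sumₗ (f ∘ g) xs
sumₗ-map f g [] = refl
sumₗ-map f g (x ∷ xs) = cong (f (g x) +_) (sumₗ-map f g xs)

sumₗ-tabulate : ∀ {A : Set} {n} (f : A → ℕ) (g : Fin n → A) → sumₗ f (Data.List.tabulate g) ≡ ∑ (f ∘ g)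
sumₗ-tabulate {n = zero}  f g = sym (∑-empty _)
sumₗ-tabulate {n = suc n} f g = trans (cong (f (g zero) +_) (sumₗ-tabulate f (g ∘ suc))) (sym (∑-unfold (f ∘ g)))

sumₗ-filter : ∀ {A : Set} {P : A → Set} (P? : ∀ x → Dec (P x)) (f : A → Bool) xs →
              sumₗ (𝟙 ∘ f) (filter P? xs) ≡ sumₗ (λ x → 𝟙 (does (P? x) ∧ f x)) xs
sumₗ-filter P? f [] = refl
sumₗ-filter P? f (x ∷ xs) with does (P? x)
... | true  = cong (𝟙 (f x) +_) (sumₗ-filter P? f xs)
... | false = sumₗ-filter P? f xs

∑-lookup : ∀ {A : Set} (f : A → ℕ) xs → ∑ (λ p → f (lookupₗ xs p)) ≡ sumₗ f xs
∑-lookup f [] = ∑-empty _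
∑-lookup f (x ∷ xs) = trans (∑-unfold _) (cong (f x +_) (∑-lookup f xs))

-- For symmetric `w` this counts every 3-set once, whereas `∑³` counts it six times and adds the
-- degenerate triples.
T₃ : ∀ {n} → (Fin n → Fin n → Fin n → Bool) → ℕ
T₃ w = ∑³ (λ i j k → 𝟙 (sorted i j k ∧ w i j k))

sumₗ-cong : ∀ {A : Set} {f g : A → ℕ} xs → (∀ x → f x ≡ g x) → sumₗ f xs ≡ sumₗ g xs
sumₗ-cong [] e = refl
sumₗ-cong (x ∷ xs) e = cong₂ _+_ (e x) (sumₗ-cong xs e)

∑-triple : ∀ {n} (w : Fin n → Fin n → Fin n → Bool) → ∑ (λ p → 𝟙 (let i , j , k = triple {n} p in w i j k)) ≡ T₃ w
∑-triple {n} w = trans (∑-lookup (λ { (i , j , k) → 𝟙 (w i j k) }) (Triples n))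
  (trans (sumₗ-filter _ (λ { (i , j , k) → w i j k }) (allTriples n))
  (trans (sumₗ-concatMap {B = Fin n × Fin n × Fin n} h _ (allFin n)) (trans (sumₗ-tabulate _ id) (∑-cong λ i →
   trans (sumₗ-concatMap {B = Fin n × Fin n × Fin n} h _ (allFin n)) (trans (sumₗ-tabulate _ id) (∑-cong λ j →
   trans (sumₗ-map h _ (allFin n)) (sumₗ-tabulate _ id)))))))
  where
  h : Fin n × Fin n × Fin n → ℕ
  h (i , j , k) = 𝟙 (sorted i j k ∧ w i j k)

-- What is known about a triple before the system is counted: its status is prescribed, it is open
-- at the price of one bit, or it is an edge only exceptionally. Exceptions are paid for by `Bin`
-- instead of a power of two.
data Kind : Set where
  fixed    : Bool → Kind
  free err : Kind

isFree isErr : Kind → Bool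
isFree free = true
isFree _    = false
isErr err = true
isErr _   = false

#free #err : ∀ {m} → Vec Kind m → ℕ
#free κ = ∑ (λ p → 𝟙 (isFree (lookupᵥ κ p)))
#err  κ = ∑ (λ p → 𝟙 (isErr (lookupᵥ κ p)))

errors : ∀ {m} → Vec Kind m → Vec Bool m → ℕ
errors κ s = ∑ (λ p → 𝟙 (isErr (lookupᵥ κ p) ∧ lookupᵥ s p))

Agrees : ∀ {m} → Vec Kind m → Vec Bool m → Set
Agrees κ s = ∀ p b → lookupᵥ κ p ≡ fixed b → lookupᵥ s p ≡ b

family : ∀ {m} → Vec Kind m → ℕ → List (Vec Bool m)
family [] k = [] ∷ []
family (fixed b ∷ κ) k = map (b ∷_) (family κ k)
family (free ∷ κ) k = map (true ∷_) (family κ k) ++ map (false ∷_) (family κ k)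
family (err ∷ κ) zero = map (false ∷_) (family κ zero)
family (err ∷ κ) (suc k) = map (false ∷_) (family κ (suc k)) ++ map (true ∷_) (family κ k)

∈-++ˡ : ∀ {A : Set} {x : A} {xs ys} → x ∈ₗ xs → x ∈ₗ xs ++ ys
∈-++ˡ = Memₚ.∈-++⁺ˡ

∈-++ʳ : ∀ {A : Set} {x : A} xs {ys} → x ∈ₗ ys → x ∈ₗ xs ++ ys
∈-++ʳ xs = Memₚ.∈-++⁺ʳ xs

family-complete : ∀ {m} (κ : Vec Kind m) k s → Agrees κ s → errors κ s ≤ k → s ∈ₗ family κ k
family-complete [] k [] a e = here refl
family-complete (fixed b ∷ κ) k (x ∷ s) a e with a zero b refl
... | refl = Memₚ.∈-map⁺ (b ∷_) (family-complete κ k s (λ p → a (suc p)) (≤-trans (≤-reflexive (sym (∑-unfold _))) e))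
family-complete (free ∷ κ) k (true ∷ s) a e = ∈-++ˡ (Memₚ.∈-map⁺ (true ∷_) (family-complete κ k s (λ p → a (suc p)) (≤-trans (≤-reflexive (sym (∑-unfold _))) e)))
family-complete (free ∷ κ) k (false ∷ s) a e = ∈-++ʳ (map (true ∷_) (family κ k)) (Memₚ.∈-map⁺ (false ∷_) (family-complete κ k s (λ p → a (suc p)) (≤-trans (≤-reflexive (sym (∑-unfold _))) e)))
family-complete (err ∷ κ) zero (true ∷ s) a e = contradiction (≤-trans (≤-reflexive (sym (∑-unfold _))) e) λ ()
family-complete (err ∷ κ) zero (false ∷ s) a e = Memₚ.∈-map⁺ (false ∷_) (family-complete κ zero s (λ p → a (suc p)) (≤-trans (≤-reflexive (sym (∑-unfold _))) e))
family-complete (err ∷ κ) (suc k) (false ∷ s) a e = ∈-++ˡ (Memₚ.∈-map⁺ (false ∷_) (family-complete κ (suc k) s (λ p → a (suc p)) (≤-trans (≤-reflexive (sym (∑-unfold _))) e)))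
family-complete (err ∷ κ) (suc k) (true ∷ s) a e = ∈-++ʳ (map (false ∷_) (family κ (suc k))) (Memₚ.∈-map⁺ (true ∷_) (family-complete κ k s (λ p → a (suc p)) (s≤s⁻¹ (≤-trans (≤-reflexive (sym (∑-unfold _))) e))))

-- The number of subsets of size at most k of an r-element set, by Pascal's rule.
Bin : ℕ → ℕ → ℕ
Bin zero    k       = 1
Bin (suc r) zero    = Bin r zero
Bin (suc r) (suc k) = Bin r (suc k) + Bin r k

family-length : ∀ {m} (κ : Vec Kind m) k → length (family κ k) ≡ 2 ^ #free κ * Bin (#err κ) k
family-length [] k rewrite ∑-empty (λ p → 𝟙 (isFree (lookupᵥ [] p))) | ∑-empty (λ p → 𝟙 (isErr (lookupᵥ [] p))) = refl
family-length (fixed b ∷ κ) k rewrite ∑-unfold (λ p → 𝟙 (isFree (lookupᵥ (fixed b ∷ κ) p))) | ∑-unfold (λ p → 𝟙 (isErr (lookupᵥ (fixed b ∷ κ) p)))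
  = trans (Listₚ.length-map (b ∷_) (family κ k)) (family-length κ k)
family-length (free ∷ κ) k rewrite ∑-unfold (λ p → 𝟙 (isFree (lookupᵥ (free ∷ κ) p))) | ∑-unfold (λ p → 𝟙 (isErr (lookupᵥ (free ∷ κ) p)))
  = trans (Listₚ.length-++ (map (true ∷_) (family κ k))) (trans (cong₂ _+_ (trans (Listₚ.length-map (true ∷_) (family κ k)) (family-length κ k)) (trans (Listₚ.length-map (false ∷_) (family κ k)) (family-length κ k)))
     (e (2 ^ #free κ) (Bin (#err κ) k)))
  where
  e : ∀ a b → a * b + a * b ≡ 2 * a * b
  e = solve-∀
family-length (err ∷ κ) zero rewrite ∑-unfold (λ p → 𝟙 (isFree (lookupᵥ (err ∷ κ) p))) | ∑-unfold (λ p → 𝟙 (isErr (lookupᵥ (err ∷ κ) p)))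
  = trans (Listₚ.length-map (false ∷_) (family κ zero)) (family-length κ zero)
family-length (err ∷ κ) (suc k) rewrite ∑-unfold (λ p → 𝟙 (isFree (lookupᵥ (err ∷ κ) p))) | ∑-unfold (λ p → 𝟙 (isErr (lookupᵥ (err ∷ κ) p)))
  = trans (Listₚ.length-++ (map (false ∷_) (family κ (suc k)))) (trans (cong₂ _+_ (trans (Listₚ.length-map (false ∷_) (family κ (suc k))) (family-length κ (suc k))) (trans (Listₚ.length-map (true ∷_) (family κ k)) (family-length κ k)))
     (sym (*-distribˡ-+ (2 ^ #free κ) _ _)))

Bin-mono : ∀ {r r′} k → r ≤ r′ → Bin r k ≤ Bin r′ k
Bin-mono {zero} {zero} k p = ≤-refl
Bin-mono {zero} {suc r′} zero p = Bin-mono {zero} {r′} zero z≤n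
Bin-mono {zero} {suc r′} (suc k) p = ≤-trans (Bin-mono {zero} {r′} (suc k) z≤n) (m≤m+n _ _)
Bin-mono {suc r} {suc r′} zero (s≤s p) = Bin-mono zero p
Bin-mono {suc r} {suc r′} (suc k) (s≤s p) = +-mono-≤ (Bin-mono (suc k) p) (Bin-mono k p)

-- The exponential moment bound: weighting an i-element subset by q^(k - i) gives at most q^k (1 +
-- 1/q)^r in total, and every subset that is counted has weight at least 1.
Bin-bound : ∀ q r k → Bin r k * q ^ r ≤ suc q ^ r * q ^ k ⊎ q ≡ 0
Bin-bound zero r k = inj₂ refl
Bin-bound q@(suc _) r k = inj₁ (go r k)
  where
  open ≤-Reasoning
  1≤q^ : ∀ k → 1 ≤ q ^ k
  1≤q^ k = m^n>0 q k
  go : ∀ r k → Bin r k * q ^ r ≤ suc q ^ r * q ^ k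
  go zero k = ≤-trans (1≤q^ k) (≤-reflexive (sym (*-identityˡ _)))
  go (suc r) zero = begin
    Bin r zero * (q * q ^ r) ≡⟨ e₁ (Bin r zero) q (q ^ r) ⟩
    q * (Bin r zero * q ^ r) ≤⟨ *-mono-≤ (n≤1+n q) (go r zero) ⟩
    suc q * (suc q ^ r * q ^ zero) ≡⟨ sym (*-assoc (suc q) (suc q ^ r) _) ⟩
    suc q * suc q ^ r * q ^ zero ∎
    where
    e₁ : ∀ b q p → b * (q * p) ≡ q * (b * p)
    e₁ = solve-∀
  go (suc r) (suc k) = begin
    (Bin r (suc k) + Bin r k) * (q * q ^ r) ≡⟨ e₁ (Bin r (suc k)) (Bin r k) q (q ^ r) ⟩
    q * (Bin r (suc k) * q ^ r) + q * (Bin r k * q ^ r) ≤⟨ +-mono-≤ (*-monoʳ-≤ q (go r (suc k))) (*-monoʳ-≤ q (go r k)) ⟩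
    q * (suc q ^ r * (q * q ^ k)) + q * (suc q ^ r * q ^ k) ≡⟨ e₂ q (suc q ^ r) (q ^ k) ⟩
    suc q * suc q ^ r * (q * q ^ k) ∎
    where
    e₁ : ∀ a b q p → (a + b) * (q * p) ≡ q * (a * p) + q * (b * p)
    e₁ = solve-∀
    e₂ : ∀ q s p → q * (s * (q * p)) + q * (s * p) ≡ suc q * s * (q * p)
    e₂ = solve-∀

-- Bernoulli's inequality in the form (1 + 1/2d)^d ≤ 2.
bernoulli : ∀ d → suc (2 * d) ^ d ≤ 2 * (2 * d) ^ d
bernoulli zero = s≤s z≤n
bernoulli d@(suc _) = *-cancelʳ-≤ _ _ (suc d) (begin
  suc q ^ d * suc d ≡⟨ cong (suc q ^ d *_) (sym (trans (cong (_∸ d) (x₁ d)) (m+n∸n≡m (suc d) d))) ⟩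
  suc q ^ d * (suc q ∸ d) ≤⟨ go d (≤-trans (m≤m+n d (d + 0)) (n≤1+n q)) ⟩
  q ^ d * suc q ≤⟨ *-monoʳ-≤ (q ^ d) (≤-trans (n≤1+n _) (≤-reflexive (x₂ d))) ⟩
  q ^ d * (2 * suc d) ≡⟨ x₃ (q ^ d) (suc d) ⟩
  2 * q ^ d * suc d ∎)
  where
  open ≤-Reasoning
  q = 2 * d
  x₁ : ∀ d → suc (2 * d) ≡ suc d + d
  x₁ = solve-∀
  x₂ : ∀ d → suc (suc (2 * d)) ≡ 2 * suc d
  x₂ = solve-∀
  x₃ : ∀ a b → a * (2 * b) ≡ 2 * a * b
  x₃ = solve-∀
  go : ∀ j → j ≤ suc q → suc q ^ j * (suc q ∸ j) ≤ q ^ j * suc q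
  go zero p = ≤-refl
  go (suc j) (s≤s p) = begin
    suc q * suc q ^ j * (q ∸ j) ≡⟨ y₁ (suc q) (suc q ^ j) (q ∸ j) ⟩
    suc q ^ j * (suc q * (q ∸ j)) ≤⟨ *-monoʳ-≤ (suc q ^ j) step ⟩
    suc q ^ j * ((suc q ∸ j) * q) ≡⟨ sym (*-assoc (suc q ^ j) _ q) ⟩
    suc q ^ j * (suc q ∸ j) * q ≤⟨ *-monoˡ-≤ q (go j (≤-trans p (n≤1+n q))) ⟩
    q ^ j * suc q * q ≡⟨ y₂ (q ^ j) (suc q) q ⟩
    q * q ^ j * suc q ∎
    where
    y₁ : ∀ a b c → a * b * c ≡ b * (a * c)
    y₁ = solve-∀
    y₂ : ∀ a b c → a * b * c ≡ c * a * b
    y₂ = solve-∀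
    step : suc q * (q ∸ j) ≤ (suc q ∸ j) * q
    step = begin
      (q ∸ j) + q * (q ∸ j) ≤⟨ +-monoˡ-≤ _ (m∸n≤m q j) ⟩
      q + q * (q ∸ j) ≡⟨ sym (*-suc q (q ∸ j)) ⟩
      q * suc (q ∸ j) ≡⟨ cong (q *_) (sym (+-∸-assoc 1 p)) ⟩
      q * (suc q ∸ j) ≡⟨ *-comm q _ ⟩
      (suc q ∸ j) * q ∎

power-* : ∀ t a b → (a * b) ^ t ≡ a ^ t * b ^ t
power-* zero a b = refl
power-* (suc t) a b = trans (cong (a * b *_) (power-* t a b)) (e a b (a ^ t) (b ^ t))
  where
  e : ∀ a b x y → a * b * (x * y) ≡ a * x * (b * y)
  e = solve-∀

-- With d = 2^j, subsets of density 1/E of a set of r ≤ d t elements are few: at most 2^(t + (j+1)k).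
Bin-≤ : ∀ j r t k → r ≤ 2 ^ j * t → Bin r k ≤ 2 ^ (t + suc j * k)
Bin-≤ j r t k le = ≤-trans (Bin-mono k le) (*-cancelʳ-≤ _ _ (q ^ (d * t)) (begin
  Bin (d * t) k * q ^ (d * t) ≤⟨ core ⟩
  suc q ^ (d * t) * q ^ k ≡⟨ cong (_* q ^ k) (sym (^-*-assoc (suc q) d t)) ⟩
  (suc q ^ d) ^ t * q ^ k ≤⟨ *-monoˡ-≤ (q ^ k) (^-monoˡ-≤ t (bernoulli d)) ⟩
  (2 * q ^ d) ^ t * q ^ k ≡⟨ cong (_* q ^ k) (trans (power-* t 2 (q ^ d)) (cong (2 ^ t *_) (^-*-assoc q d t))) ⟩
  2 ^ t * q ^ (d * t) * q ^ k ≡⟨ x₁ (2 ^ t) (q ^ (d * t)) (q ^ k) ⟩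
  2 ^ t * q ^ k * q ^ (d * t) ≡⟨ cong (λ s → 2 ^ t * s * q ^ (d * t)) (^-*-assoc 2 (suc j) k) ⟩
  2 ^ t * 2 ^ (suc j * k) * q ^ (d * t) ≡⟨ cong (_* q ^ (d * t)) (sym (^-distribˡ-+-* 2 t (suc j * k))) ⟩
  2 ^ (t + suc j * k) * q ^ (d * t) ∎))
  where
  open ≤-Reasoning
  d = 2 ^ j
  q = 2 * d
  x₁ : ∀ a b c → a * b * c ≡ a * c * b
  x₁ = solve-∀
  q-nonZero : NonZero q
  q-nonZero = m^n≢0 2 (suc j)
  instance
    q^-nonZero : NonZero (q ^ (d * t))
    q^-nonZero = m^n≢0 q (d * t) ⦃ q-nonZero ⦄
  core : Bin (d * t) k * q ^ (d * t) ≤ suc q ^ (d * t) * q ^ k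
  core with Bin-bound q (d * t) k
  ... | inj₁ p = p
  ... | inj₂ z = ⊥-elim (≢-nonZero⁻¹ q ⦃ q-nonZero ⦄ z)

-- Counting by covering lists, and the orders of a triple.

module Enumeration where
 tails : ∀ {m} → Bool → List (Vec Bool (suc m)) → List (Vec Bool m)
 tails b [] = []
 tails true  ((true  ∷ s) ∷ L) = s ∷ tails true L
 tails true  ((false ∷ s) ∷ L) = tails true L
 tails false ((true  ∷ s) ∷ L) = tails false L
 tails false ((false ∷ s) ∷ L) = s ∷ tails false L

 tails-length : ∀ {m} (L : List (Vec Bool (suc m))) → length (tails true L) + length (tails false L) ≡ length L
 tails-length [] = refl
 tails-length ((true  ∷ s) ∷ L) = cong suc (tails-length L)
 tails-length ((false ∷ s) ∷ L) = trans (+-suc _ _) (cong suc (tails-length L))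

 ∈-tails : ∀ {m} b (s : Vec Bool m) L → (b ∷ s) ∈ₗ L → s ∈ₗ tails b L
 ∈-tails true  s ((true  ∷ _) ∷ L) (here refl) = here refl
 ∈-tails true  s ((true  ∷ _) ∷ L) (there p) = there (∈-tails true s L p)
 ∈-tails true  s ((false ∷ _) ∷ L) (there p) = ∈-tails true s L p
 ∈-tails false s ((true  ∷ _) ∷ L) (there p) = ∈-tails false s L p
 ∈-tails false s ((false ∷ _) ∷ L) (here refl) = here refl
 ∈-tails false s ((false ∷ _) ∷ L) (there p) = there (∈-tails false s L p)

 count-≤-length : ∀ m {P : Subset m → Set} P? L → (∀ s → P s → s ∈ₗ L) → count m P P? ≤ length L
 count-≤-length zero P? L cov with P? []
 ... | no _ = z≤n
 ... | yes p with L | cov [] p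
 ...   | _ ∷ _ | _ = s≤s z≤n
 count-≤-length (suc m) {P} P? L cov = ≤-trans
   (+-mono-≤ (count-≤-length m (λ s → P? (true ∷ s)) (tails true L) (λ s p → ∈-tails true s L (cov (true ∷ s) p)))
             (count-≤-length m (λ s → P? (false ∷ s)) (tails false L) (λ s p → ∈-tails false s L (cov (false ∷ s) p))))
   (≤-reflexive (tails-length L))

 enumerate : ∀ m {P : Subset m → Set} (P? : ∀ s → Dec (P s)) → Σ (List (Subset m)) λ L → length L ≡ count m P P? × (∀ s → P s → s ∈ₗ L)
 enumerate zero P? with P? []
 ... | yes p = [] ∷ [] , refl , λ { [] _ → here refl }
 ... | no ¬p = [] , refl , λ { [] p → ⊥-elim (¬p p) }
 enumerate (suc m) P? =
   let L , e , c = enumerate m (λ s → P? (true ∷ s))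
       L′ , e′ , c′ = enumerate m (λ s → P? (false ∷ s))
   in map (true ∷_) L ++ map (false ∷_) L′ ,
      trans (Listₚ.length-++ (map (true ∷_) L)) (cong₂ _+_ (trans (Listₚ.length-map _ L) e) (trans (Listₚ.length-map _ L′) e′)) ,
      λ { (true ∷ s) p → ∈-++ˡ (Memₚ.∈-map⁺ (true ∷_) (c s p)) ; (false ∷ s) p → ∈-++ʳ (map (true ∷_) L) (Memₚ.∈-map⁺ (false ∷_) (c′ s p)) }

 count-cube : ∀ m {P : Subset m → Set} P? (κ : Vec Kind m) → (∀ p → lookupᵥ κ p ≡ err → ⊥) → (∀ s → Agrees κ s → P s) → 2 ^ #free κ ≤ count m P P?
 count-cube zero P? [] ne sub with P? []
 ... | yes _ = ≤-reflexive (cong (2 ^_) (∑-empty _))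
 ... | no ¬p = ⊥-elim (¬p (sub [] (λ ())))
 count-cube (suc m) {P} P? (fixed true ∷ κ) ne sub = ≤-trans (≤-reflexive (cong (2 ^_) (∑-unfold _)))
   (≤-trans (count-cube m (λ s → P? (true ∷ s)) κ (λ p → ne (suc p)) (λ s a → sub (true ∷ s) (λ { zero b refl → refl ; (suc p) b e → a p b e }))) (m≤m+n _ _))
 count-cube (suc m) {P} P? (fixed false ∷ κ) ne sub = ≤-trans (≤-reflexive (cong (2 ^_) (∑-unfold _)))
   (≤-trans (count-cube m (λ s → P? (false ∷ s)) κ (λ p → ne (suc p)) (λ s a → sub (false ∷ s) (λ { zero b refl → refl ; (suc p) b e → a p b e }))) (m≤n+m _ _))
 count-cube (suc m) {P} P? (free ∷ κ) ne sub = ≤-trans (≤-reflexive (trans (cong (2 ^_) (∑-unfold _)) (cong (2 ^ #free κ +_) (+-identityʳ _))))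
   (+-mono-≤ (count-cube m (λ s → P? (true ∷ s)) κ (λ p → ne (suc p)) (λ s a → sub (true ∷ s) (λ { zero b () ; (suc p) b e → a p b e })))
             (count-cube m (λ s → P? (false ∷ s)) κ (λ p → ne (suc p)) (λ s a → sub (false ∷ s) (λ { zero b () ; (suc p) b e → a p b e }))))
 count-cube (suc m) P? (err ∷ κ) ne sub = ⊥-elim (ne zero refl)

 count-≤-+ : ∀ m {P Q R : Subset m → Set} P? Q? R? → (∀ s → R s → P s ⊎ Q s) → count m R R? ≤ count m P P? + count m Q Q?
 count-≤-+ m P? Q? R? split =
   let L , e , c = enumerate m P?
       L′ , e′ , c′ = enumerate m Q?
   in ≤-trans (count-≤-length m R? (L ++ L′) (λ s r → case split s r of λ { (inj₁ p) → ∈-++ˡ (c s p) ; (inj₂ q) → ∈-++ʳ L (c′ s q) }))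
              (≤-reflexive (trans (Listₚ.length-++ L) (cong₂ _+_ e e′)))

 count-+-≤ : ∀ m {P Q R : Subset m → Set} P? Q? R? → (∀ s → P s → R s) → (∀ s → Q s → R s) → (∀ s → P s → Q s → ⊥) →
             count m P P? + count m Q Q? ≤ count m R R?
 count-+-≤ zero P? Q? R? p q d with P? [] | Q? [] | R? []
 ... | yes x | yes y | _ = ⊥-elim (d [] x y)
 ... | yes x | no _ | yes _ = s≤s z≤n
 ... | yes x | no _ | no ¬r = ⊥-elim (¬r (p [] x))
 ... | no _ | yes y | yes _ = s≤s z≤n
 ... | no _ | yes y | no ¬r = ⊥-elim (¬r (q [] y))
 ... | no _ | no _ | _ = z≤n
 count-+-≤ (suc m) P? Q? R? p q d = ≤-trans (≤-reflexive (+-interchange (count m _ (λ s → P? (true ∷ s))) (count m _ (λ s → P? (false ∷ s))) (count m _ (λ s → Q? (true ∷ s))) (count m _ (λ s → Q? (false ∷ s)))))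
   (+-mono-≤ (count-+-≤ m (λ s → P? (true ∷ s)) (λ s → Q? (true ∷ s)) (λ s → R? (true ∷ s)) (λ s → p (true ∷ s)) (λ s → q (true ∷ s)) (λ s → d (true ∷ s)))
             (count-+-≤ m (λ s → P? (false ∷ s)) (λ s → Q? (false ∷ s)) (λ s → R? (false ∷ s)) (λ s → p (false ∷ s)) (λ s → q (false ∷ s)) (λ s → d (false ∷ s))))

 -- Counting with lists instead of numbers lets unions, dependent choices and decoding compose by
 -- concatenation, and asks for no decision procedure for `P`.
 Cov : ∀ {A : Set} → (A → Set) → ℕ → Set
 Cov {A} P k = Σ (List A) λ L → length L ≤ k × (∀ s → P s → s ∈ₗ L)

 Cov-⊂ : ∀ {A : Set} {P Q : A → Set} {k} → (∀ s → Q s → P s) → Cov P k → Cov Q k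
 Cov-⊂ sub (L , l , c) = L , l , λ s q → c s (sub s q)

 Cov-≤ : ∀ {A : Set} {P : A → Set} {k l} → k ≤ l → Cov P k → Cov P l
 Cov-≤ le (L , p , c) = L , ≤-trans p le , c

 Cov-∅ : ∀ {A : Set} {P : A → Set} {k} → (∀ s → P s → ⊥) → Cov P k
 Cov-∅ emp = [] , z≤n , λ s p → ⊥-elim (emp s p)

 Cov-⊎ : ∀ {A : Set} {P Q : A → Set} {k l} → Cov P k → Cov Q l → Cov (λ s → P s ⊎ Q s) (k + l)
 Cov-⊎ (L , p , c) (L′ , p′ , c′) = L ++ L′ , ≤-trans (≤-reflexive (Listₚ.length-++ L)) (+-mono-≤ p p′) ,
   λ { s (inj₁ x) → ∈-++ˡ (c s x) ; s (inj₂ y) → ∈-++ʳ L (c′ s y) }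

 concat-bound : ∀ {A B : Set} (f : A → List B) {k} → (∀ x → length (f x) ≤ k) → ∀ xs → length (concatMap f xs) ≤ length xs * k
 concat-bound f b [] = z≤n
 concat-bound f b (x ∷ xs) = ≤-trans (≤-reflexive (Listₚ.length-++ (f x))) (+-mono-≤ (b x) (concat-bound f b xs))

 Cov-∃ : ∀ {A B : Set} {X : A → Set} {P : A → B → Set} {k l} → Cov X l → (∀ x → Cov (P x) k) → Cov (λ s → ∃ λ x → X x × P x s) (l * k)
 Cov-∃ {P = P} {k} (xs , lx , cx) f = concatMap (λ x → proj₁ (f x)) xs ,
   ≤-trans (concat-bound _ (λ x → proj₁ (proj₂ (f x))) xs) (*-monoˡ-≤ k lx) ,
   λ { s (x , m , p) → Memₚ.∈-concat⁺′ (proj₂ (proj₂ (f x)) s p) (Memₚ.∈-map⁺ (λ x → proj₁ (f x)) (cx x m)) }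

 Cov-× : ∀ {A B : Set} {k l} → Cov {A} (λ _ → ⊤) k → Cov {B} (λ _ → ⊤) l → Cov {A × B} (λ _ → ⊤) (k * l)
 Cov-× a (L , p , c) = Cov-⊂ (λ { (x , y) _ → x , tt , refl }) (Cov-∃ {P = λ x s → proj₁ s ≡ x} a
   (λ x → map (x ,_) L , ≤-trans (≤-reflexive (Listₚ.length-map _ L)) p , λ { (_ , y) refl → Memₚ.∈-map⁺ (x ,_) (c y tt) }))

 Cov-Fin : ∀ n → Cov {Fin n} (λ _ → ⊤) n
 Cov-Fin n = allFin n , ≤-reflexive (Listₚ.length-tabulate id) , λ i _ → Memₚ.∈-allFin i

 Cov-Bool : Cov {Bool} (λ _ → ⊤) 2
 Cov-Bool = true ∷ false ∷ [] , ≤-refl , λ { true _ → here refl ; false _ → there (here refl) }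

 Cov-Vec : ∀ {A : Set} {k} → Cov {A} (λ _ → ⊤) k → ∀ n → Cov {Vec A n} (λ _ → ⊤) (k ^ n)
 Cov-Vec a zero = [] ∷ [] , ≤-refl , λ { [] _ → here refl }
 Cov-Vec {k = k} a (suc n) = let L , p , c = Cov-× a (Cov-Vec a n) in
   map (λ { (x , xs) → x ∷ xs }) L , ≤-trans (≤-reflexive (Listₚ.length-map _ L)) p ,
   λ { (x ∷ xs) _ → Memₚ.∈-map⁺ (λ { (x , xs) → x ∷ xs }) (c (x , xs) tt) }

 Cov-count : ∀ m {P : Subset m → Set} P? {k} → Cov P k → count m P P? ≤ k
 Cov-count m P? (L , p , c) = ≤-trans (count-≤-length m P? L c) p

 _==ᶠ_ : ∀ {n} → Fin n → Fin n → Bool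
 i ==ᶠ j = does (i Finₚ.≟ j)

 ==ᶠ-true : ∀ {n} {i j : Fin n} → (i ==ᶠ j) ≡ true → i ≡ j
 ==ᶠ-true {i = i} {j} e = does-sound (i Finₚ.≟ j) e

 ==ᶠ-refl : ∀ {n} (i : Fin n) → (i ==ᶠ i) ≡ true
 ==ᶠ-refl i = dec-true (i Finₚ.≟ i) refl

 ==ᶠ-false : ∀ {n} {i j : Fin n} → i ≢ j → (i ==ᶠ j) ≡ false
 ==ᶠ-false {i = i} {j} p = dec-false (i Finₚ.≟ j) p

 ∑-δ : ∀ {n} (i : Fin n) (f : Fin n → ℕ) → ∑ (λ j → 𝟙 (i ==ᶠ j) * f j) ≡ f i
 ∑-δ zero f = trans (∑-unfold _) (trans (cong₂ _+_ (+-identityʳ (f zero)) (∑-zero (λ j → refl))) (+-identityʳ _))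
 ∑-δ (suc i) f = trans (∑-unfold _) (trans (∑-cong (λ j → cong (λ b → 𝟙 b * f (suc j)) (bool-ext {suc i ==ᶠ suc j} {i ==ᶠ j}
     (λ e → dec-true (i Finₚ.≟ j) (Finₚ.suc-injective (==ᶠ-true e))) (λ e → dec-true (suc i Finₚ.≟ suc j) (cong suc (==ᶠ-true e)))))) (∑-δ i (f ∘ suc)))

 data Order : (x<y y<x x=y : Bool) → Set where
   lt : Order true  false false
   eq : Order false false true
   gt : Order false true  false

 order : ∀ {n} (i j : Fin n) → Order (i <ᵇᶠ j) (j <ᵇᶠ i) (i ==ᶠ j)
 order i j with Finₚ.<-cmp i j
 ... | tri< a b c rewrite dec-true (i Finₚ.<? j) a | dec-false (j Finₚ.<? i) c | dec-false (i Finₚ.≟ j) b = lt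

 ... | tri≈ a b c rewrite dec-false (i Finₚ.<? j) a | dec-false (j Finₚ.<? i) c | dec-true (i Finₚ.≟ j) b = eq
 ... | tri> a b c rewrite dec-false (i Finₚ.<? j) a | dec-true (j Finₚ.<? i) c | dec-false (i Finₚ.≟ j) b = gt

 <ᵇᶠ-trans : ∀ {n} (i j k : Fin n) → (i <ᵇᶠ j) ≡ true → (j <ᵇᶠ k) ≡ true → (i <ᵇᶠ k) ≡ true
 <ᵇᶠ-trans i j k p q = dec-true (i Finₚ.<? k) (<-trans (does-sound (i Finₚ.<? j) p) (does-sound (j Finₚ.<? k) q))

 six : (f : Bool → Bool → ℕ) (ij ji jk kj ik ki : Bool) → ℕ
 six f ij ji jk kj ik ki = f ij jk + (f ji ik + (f jk ki + (f ik kj + (f ki ij + f kj ji))))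

 -- At most one of the six strict orders of three vertices holds. The two implications are
 -- transitivity, which rules out the cyclic comparisons.
 six-≤ : ∀ w {ij ji e jk kj e′ ik ki e″} → Order ij ji e → Order jk kj e′ → Order ik ki e″ →
         (ij ≡ true → jk ≡ true → ik ≡ true) → (kj ≡ true → ji ≡ true → ki ≡ true) → six (λ a b → 𝟙 ((a ∧ b) ∧ w)) ij ji jk kj ik ki ≤ 𝟙 w
 six-≤ false {ij} {ji} {_} {jk} {kj} {_} {ik} {ki} _ _ _ _ _ = ≤-reflexive (cong₂ _+_ (z ij jk) (cong₂ _+_ (z ji ik) (cong₂ _+_ (z jk ki) (cong₂ _+_ (z ik kj) (cong₂ _+_ (z ki ij) (z kj ji))))))
   where
   z : ∀ a b → 𝟙 ((a ∧ b) ∧ false) ≡ 0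
   z a b = cong 𝟙 (∧-zeroʳ (a ∧ b))
 six-≤ true lt lt lt _ _ = s≤s z≤n
 six-≤ true lt lt eq _ _ = s≤s z≤n
 six-≤ true lt lt gt t _ = case t refl refl of λ ()
 six-≤ true lt eq lt _ _ = z≤n
 six-≤ true lt eq eq _ _ = z≤n
 six-≤ true lt eq gt _ _ = s≤s z≤n
 six-≤ true lt gt lt _ _ = s≤s z≤n
 six-≤ true lt gt eq _ _ = z≤n
 six-≤ true lt gt gt _ _ = s≤s z≤n
 six-≤ true eq lt lt _ _ = z≤n
 six-≤ true eq lt eq _ _ = z≤n
 six-≤ true eq lt gt _ _ = s≤s z≤n
 six-≤ true eq eq lt _ _ = z≤n
 six-≤ true eq eq eq _ _ = z≤n
 six-≤ true eq eq gt _ _ = z≤n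
 six-≤ true eq gt lt _ _ = s≤s z≤n
 six-≤ true eq gt eq _ _ = z≤n
 six-≤ true eq gt gt _ _ = z≤n
 six-≤ true gt lt lt _ _ = s≤s z≤n
 six-≤ true gt lt eq _ _ = z≤n
 six-≤ true gt lt gt _ _ = s≤s z≤n
 six-≤ true gt eq lt _ _ = s≤s z≤n
 six-≤ true gt eq eq _ _ = z≤n
 six-≤ true gt eq gt _ _ = z≤n
 six-≤ true gt gt lt _ t = case t refl refl of λ ()
 six-≤ true gt gt eq _ _ = s≤s z≤n
 six-≤ true gt gt gt _ _ = s≤s z≤n

 -- If none of the six strict orders holds, two of the vertices coincide, and the equality terms
 -- take over.
 six-≥ : ∀ w {ij ji e jk kj e′ ik ki e″} → Order ij ji e → Order jk kj e′ → Order ik ki e″ →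
         𝟙 w ≤ six (λ a b → 𝟙 ((a ∧ b) ∧ w)) ij ji jk kj ik ki + (𝟙 e * 𝟙 w + (𝟙 e′ * 𝟙 w + 𝟙 e″ * 𝟙 w))
 six-≥ false _ _ _ = z≤n
 six-≥ true lt lt _ = s≤s z≤n
 six-≥ true lt gt lt = s≤s z≤n
 six-≥ true lt gt eq = s≤s z≤n
 six-≥ true lt gt gt = s≤s z≤n
 six-≥ true lt eq lt = s≤s z≤n
 six-≥ true lt eq eq = s≤s z≤n
 six-≥ true lt eq gt = s≤s z≤n
 six-≥ true eq lt lt = s≤s z≤n
 six-≥ true eq lt eq = s≤s z≤n
 six-≥ true eq lt gt = s≤s z≤n
 six-≥ true eq eq lt = s≤s z≤n
 six-≥ true eq eq eq = s≤s z≤n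
 six-≥ true eq eq gt = s≤s z≤n
 six-≥ true eq gt lt = s≤s z≤n
 six-≥ true eq gt eq = s≤s z≤n
 six-≥ true eq gt gt = s≤s z≤n
 six-≥ true gt lt lt = s≤s z≤n
 six-≥ true gt lt eq = s≤s z≤n
 six-≥ true gt lt gt = s≤s z≤n
 six-≥ true gt eq lt = s≤s z≤n
 six-≥ true gt eq eq = s≤s z≤n
 six-≥ true gt eq gt = s≤s z≤n
 six-≥ true gt gt lt = s≤s z≤n
 six-≥ true gt gt eq = s≤s z≤n
 six-≥ true gt gt gt = s≤s z≤n

 module _ {n : ℕ} (w : Fin n → Fin n → Fin n → Bool) (ws : Sym₃ w) where
   open Sym₃ ws

   private
     g : Fin n → Fin n → Fin n → ℕ
     g i j k = 𝟙 (sorted i j k ∧ w i j k)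

     P₁ : (π : (Fin n → Fin n → Fin n → Bool) → Fin n → Fin n → Fin n → Bool) → (∀ a b c → w a b c ≡ π w a b c) →
          ∑³ (λ a b c → 𝟙 (π sorted a b c ∧ π w a b c)) ≡ T₃ w → ∑³ (λ a b c → 𝟙 (π sorted a b c ∧ w a b c)) ≡ T₃ w
     P₁ π e q = trans (∑³-cong (λ a b c → cong (λ s → 𝟙 (π sorted a b c ∧ s)) (e a b c))) q

     six-sum : ∑³ (λ i j k → six (λ a b → 𝟙 ((a ∧ b) ∧ w i j k)) (i <ᵇᶠ j) (j <ᵇᶠ i) (j <ᵇᶠ k) (k <ᵇᶠ j) (i <ᵇᶠ k) (k <ᵇᶠ i)) ≡ 6 * T₃ w
     six-sum = trans (split6 _ _ _ _ _ _) (trans (cong (T₃ w +_) (cong₂ _+_ e₂ (cong₂ _+_ e₃ (cong₂ _+_ e₄ (cong₂ _+_ e₅ e₆))))) (x₃ (T₃ w)))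
       where
       x₃ : ∀ l → l + (l + (l + (l + (l + l)))) ≡ 6 * l
       x₃ = solve-∀
       split6 : ∀ (f₁ f₂ f₃ f₄ f₅ f₆ : Fin n → Fin n → Fin n → ℕ) →
         ∑³ (λ a b c → f₁ a b c + (f₂ a b c + (f₃ a b c + (f₄ a b c + (f₅ a b c + f₆ a b c))))) ≡
         ∑³ f₁ + (∑³ f₂ + (∑³ f₃ + (∑³ f₄ + (∑³ f₅ + ∑³ f₆))))
       split6 f₁ f₂ f₃ f₄ f₅ f₆ = trans (∑³-+ _ _) (cong (∑³ f₁ +_) (trans (∑³-+ _ _) (cong (∑³ f₂ +_)
         (trans (∑³-+ _ _) (cong (∑³ f₃ +_) (trans (∑³-+ _ _) (cong (∑³ f₄ +_) (∑³-+ _ _))))))))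
       e₂ = P₁ (λ f a b c → f b a c) s₁₂ (∑³-s₁₂ g)
       e₃ = P₁ (λ f a b c → f b c a) rot (trans (∑³-s₁₂ (λ a b c → g a c b)) (∑³-s₂₃ g))
       e₄ = P₁ (λ f a b c → f a c b) s₂₃ (∑³-s₂₃ g)
       e₅ = P₁ (λ f a b c → f c a b) rot′ (trans (∑³-s₂₃ (λ a b c → g b a c)) (∑³-s₁₂ g))
       e₆ = P₁ (λ f a b c → f c b a) s₁₃ (trans (∑³-s₁₂ (λ a b c → g c a b)) (trans (∑³-s₂₃ (λ a b c → g b a c)) (∑³-s₁₂ g)))

   T₃-upper : 6 * T₃ w ≤ ∑³ (λ a b c → 𝟙 (w a b c))
   T₃-upper = ≤-trans (≤-reflexive (sym six-sum)) (∑³-mono (λ i j k →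
     six-≤ (w i j k) (order i j) (order j k) (order i k) (<ᵇᶠ-trans i j k) (<ᵇᶠ-trans k j i)))

   T₃-lower : ∑³ (λ a b c → 𝟙 (w a b c)) ≤ 6 * T₃ w + 3 * ∑² (λ a b → 𝟙 (w a a b))
   T₃-lower = begin
     ∑³ (λ a b c → 𝟙 (w a b c)) ≤⟨ ∑³-mono (λ i j k → six-≥ (w i j k) (order i j) (order j k) (order i k)) ⟩
     ∑³ (λ i j k → s i j k + (d₁ i j k + (d₂ i j k + d₃ i j k))) ≡⟨ trans (∑³-+ s _) (cong₂ _+_ six-sum (trans (∑³-+ d₁ _) (cong₂ _+_ δ₁ (trans (∑³-+ d₂ d₃) (cong₂ _+_ δ₂ δ₃))))) ⟩
     6 * T₃ w + (Δ + (Δ + Δ)) ≡⟨ cong (6 * T₃ w +_) (x Δ) ⟩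
     6 * T₃ w + 3 * Δ ∎
     where
     open ≤-Reasoning
     Δ = ∑² (λ a b → 𝟙 (w a a b))
     x : ∀ d → d + (d + d) ≡ 3 * d
     x = solve-∀
     s d₁ d₂ d₃ : Fin n → Fin n → Fin n → ℕ
     s i j k = six (λ a b → 𝟙 ((a ∧ b) ∧ w i j k)) (i <ᵇᶠ j) (j <ᵇᶠ i) (j <ᵇᶠ k) (k <ᵇᶠ j) (i <ᵇᶠ k) (k <ᵇᶠ i)
     d₁ i j k = 𝟙 (i ==ᶠ j) * 𝟙 (w i j k)
     d₂ i j k = 𝟙 (j ==ᶠ k) * 𝟙 (w i j k)
     d₃ i j k = 𝟙 (i ==ᶠ k) * 𝟙 (w i j k)
     δ₁ : ∑³ d₁ ≡ Δ
     δ₁ = ∑-cong (λ i → trans (∑-cong (λ j → ∑-*ˡ (𝟙 (i ==ᶠ j)) (λ k → 𝟙 (w i j k)))) (∑-δ i (λ j → ∑ (λ k → 𝟙 (w i j k)))))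
     δ₂ : ∑³ d₂ ≡ Δ
     δ₂ = trans (∑²-cong (λ i j → trans (∑-δ j (λ k → 𝟙 (w i j k))) (cong 𝟙 (trans (s₁₂ i j j) (s₂₃ j i j))))) (∑-swap (λ i j → 𝟙 (w j j i)))
     δ₃ : ∑³ d₃ ≡ Δ
     δ₃ = ∑²-cong (λ i j → trans (∑-δ i (λ k → 𝟙 (w i j k))) (cong 𝟙 (s₂₃ i j i)))

open Enumeration

-- Systems recovered from a vertex-deleted system and a link.

module Restriction where
 IN⇒F-free : ∀ {n} H → IndependentNeighborhoods n H → F-free (E H)
 IN⇒F-free H ind x y a b c p q r s = ind x y a b c (E⇒ H x y a p) (E⇒ H x y b q) (E⇒ H x y c r) (E⇒ H a b c s)

 F-free⇒IN : ∀ {n} H → F-free (E H) → IndependentNeighborhoods n H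
 F-free⇒IN H ff x y a b c p q r s = ff x y a b c (⇒E H x y a p) (⇒E H x y b q) (⇒E H x y c r) (⇒E H a b c s)

 module _ {n : ℕ} (v : Fin (suc n)) where
   restrict : TripleSystem (suc n) → TripleSystem n
   restrict H = system (λ a b c → E H (punchIn v a) (punchIn v b) (punchIn v c))

   private
     pulled : ∀ H → Sym₃ (λ a b c → E H (punchIn v a) (punchIn v b) (punchIn v c))
     pulled H = record { s₁₂ = λ a b c → Sym₃.s₁₂ (E-sym H) _ _ _ ; s₂₃ = λ a b c → Sym₃.s₂₃ (E-sym H) _ _ _ }

   E-restrict : ∀ H a b c → E (restrict H) a b c ≡ E H (punchIn v a) (punchIn v b) (punchIn v c)
   E-restrict H a b c = bool-ext (E-system⇒ _ (pulled H) a b c)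
     (λ e → let p , q , r , _ = E⇒ H _ _ _ e in ⇒E-system _ (pulled H) a b c (p ∘ cong _) (q ∘ cong _) (r ∘ cong _) e)

   restrict-IN : ∀ H → IndependentNeighborhoods (suc n) H → IndependentNeighborhoods n (restrict H)
   restrict-IN H ind = F-free⇒IN (restrict H) (λ x y a b c p q r s →
     IN⇒F-free H ind _ _ _ _ _ (trans (sym (E-restrict H x y a)) p) (trans (sym (E-restrict H x y b)) q)
       (trans (sym (E-restrict H x y c)) r) (trans (sym (E-restrict H a b c)) s))

   extend : TripleSystem n → Fin (suc n) → Fin (suc n) → Fin (suc n) → Bool
   extend H a b c with v Finₚ.≟ a | v Finₚ.≟ b | v Finₚ.≟ c
   ... | no p | no q | no r = E H (punchOut p) (punchOut q) (punchOut r)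
   ... | _ | _ | _ = false

   extend-restrict : ∀ H a b c → v ≢ a → v ≢ b → v ≢ c → extend (restrict H) a b c ≡ E H a b c
   extend-restrict H a b c p q r with v Finₚ.≟ a | v Finₚ.≟ b | v Finₚ.≟ c
   ... | no p | no q | no r = trans (E-restrict H _ _ _) (lemma (Finₚ.punchIn-punchOut p) (Finₚ.punchIn-punchOut q) (Finₚ.punchIn-punchOut r))
     where
     lemma : ∀ {a b c a′ b′ c′} → a ≡ a′ → b ≡ b′ → c ≡ c′ → E H a b c ≡ E H a′ b′ c′
     lemma refl refl refl = refl
   ... | yes e | _ | _ = ⊥-elim (p e)
   ... | no _ | yes e | _ = ⊥-elim (q e)
   ... | no _ | no _ | yes e = ⊥-elim (r e)

 -- Kinds of the triples of a system with a prescribed restriction off v whose link at v lies mostly in W.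
 linkKind : ∀ {n} (v : Fin n) (g : Fin n → Fin n → Fin n → Bool) (W : Fin n → Fin n → Bool) → Fin n → Fin n → Fin n → Kind
 linkKind v g W a b c = if v ==ᶠ a then pairKind (W b c) else (if v ==ᶠ b then pairKind (W a c) else (if v ==ᶠ c then pairKind (W a b) else fixed (g a b c)))
   where
   pairKind : Bool → Kind
   pairKind w = if w then free else err

 T₂ : ∀ {n} → (Fin n → Fin n → Bool) → ℕ
 T₂ W = ∑² (λ x y → 𝟙 ((x <ᵇᶠ y) ∧ W x y))

 T₂-upper : ∀ {n} (W : Fin n → Fin n → Bool) → (∀ x y → W x y ≡ W y x) → 2 * T₂ W ≤ ∑² (λ x y → 𝟙 (W x y))
 T₂-upper W sy = begin
   2 * T₂ W ≡⟨ cong (T₂ W +_) (+-identityʳ _) ⟩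
   T₂ W + T₂ W ≡⟨ cong (T₂ W +_) (trans (∑-swap (λ x y → 𝟙 ((x <ᵇᶠ y) ∧ W x y))) (∑²-cong (λ x y → cong (λ s → 𝟙 ((y <ᵇᶠ x) ∧ s)) (sy y x)))) ⟩
   T₂ W + ∑² (λ x y → 𝟙 ((y <ᵇᶠ x) ∧ W x y)) ≡⟨ sym (∑²-+ _ _) ⟩
   ∑² (λ x y → 𝟙 ((x <ᵇᶠ y) ∧ W x y) + 𝟙 ((y <ᵇᶠ x) ∧ W x y)) ≤⟨ ∑²-mono (λ x y → pt (W x y) (order x y)) ⟩
   ∑² (λ x y → 𝟙 (W x y)) ∎
   where
   open ≤-Reasoning
   pt : ∀ w {a b e} → Order a b e → 𝟙 (a ∧ w) + 𝟙 (b ∧ w) ≤ 𝟙 w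
   pt w lt = ≤-reflexive (+-identityʳ _)
   pt w eq = z≤n
   pt w gt = ≤-refl

 module _ {n : ℕ} (v : Fin n) (f : Fin n → Fin n → Bool) where
   through : Fin n → Fin n → Fin n → ℕ
   through i j k = 𝟙 (v ==ᶠ i) * 𝟙 (sorted i j k ∧ f j k) + (𝟙 (v ==ᶠ j) * 𝟙 (sorted i j k ∧ f i k) + 𝟙 (v ==ᶠ k) * 𝟙 (sorted i j k ∧ f i j))

   -- A 3-set through `v` corresponds to the pair of its other vertices, whichever place `v` takes
   -- in the increasing order.
   through-≤ : ∑³ through ≤ T₂ f
   through-≤ = begin
     ∑³ through ≡⟨ trans (∑³-+ _ _) (cong₂ _+_ δ₁ (trans (∑³-+ _ _) (cong₂ _+_ δ₂ δ₃))) ⟩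
     ∑² (λ x y → 𝟙 (sorted v x y ∧ f x y)) + (∑² (λ x y → 𝟙 (sorted x v y ∧ f x y)) + ∑² (λ x y → 𝟙 (sorted x y v ∧ f x y)))
       ≡⟨ sym (trans (∑²-+ _ _) (cong (∑² (λ x y → 𝟙 (sorted v x y ∧ f x y)) +_) (∑²-+ _ _))) ⟩
     ∑² (λ x y → 𝟙 (sorted v x y ∧ f x y) + (𝟙 (sorted x v y ∧ f x y) + 𝟙 (sorted x y v ∧ f x y)))
       ≤⟨ ∑²-mono (λ x y → pt (f x y) (order v x) (order v y) (x <ᵇᶠ y) (<ᵇᶠ-trans x v y) (<ᵇᶠ-trans x y v)) ⟩
     T₂ f ∎
     where
     open ≤-Reasoning
     δ₁ : ∑³ (λ i j k → 𝟙 (v ==ᶠ i) * 𝟙 (sorted i j k ∧ f j k)) ≡ ∑² (λ x y → 𝟙 (sorted v x y ∧ f x y))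
     δ₁ = trans (∑-cong (λ i → ∑²-*ˡ (𝟙 (v ==ᶠ i)) _)) (∑-δ v (λ i → ∑² (λ j k → 𝟙 (sorted i j k ∧ f j k))))
     δ₂ : ∑³ (λ i j k → 𝟙 (v ==ᶠ j) * 𝟙 (sorted i j k ∧ f i k)) ≡ ∑² (λ x y → 𝟙 (sorted x v y ∧ f x y))
     δ₂ = ∑-cong (λ i → trans (∑-cong (λ j → ∑-*ˡ (𝟙 (v ==ᶠ j)) _)) (∑-δ v (λ j → ∑ (λ k → 𝟙 (sorted i j k ∧ f i k)))))
     δ₃ : ∑³ (λ i j k → 𝟙 (v ==ᶠ k) * 𝟙 (sorted i j k ∧ f i j)) ≡ ∑² (λ x y → 𝟙 (sorted x y v ∧ f x y))
     δ₃ = ∑²-cong (λ i j → ∑-δ v (λ k → 𝟙 (sorted i j k ∧ f i j)))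
     pt : ∀ w {vx xv e vy yv e′} → Order vx xv e → Order vy yv e′ → ∀ xy → (xv ≡ true → vy ≡ true → xy ≡ true) →
          (xy ≡ true → yv ≡ true → xv ≡ true) →
          𝟙 ((vx ∧ xy) ∧ w) + (𝟙 ((xv ∧ vy) ∧ w) + 𝟙 ((xy ∧ yv) ∧ w)) ≤ 𝟙 (xy ∧ w)
     pt w lt lt false t _ = z≤n
     pt w lt lt true t _ = ≤-reflexive (+-identityʳ _)
     pt w lt eq false t _ = z≤n
     pt w lt eq true t _ = ≤-reflexive (+-identityʳ _)
     pt w lt gt false t _ = z≤n
     pt w lt gt true t u = case u refl refl of λ ()
     pt w eq lt false t _ = z≤n
     pt w eq lt true t _ = z≤n
     pt w eq eq false t _ = z≤n
     pt w eq eq true t _ = z≤n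
     pt w eq gt false t _ = z≤n
     pt w eq gt true t _ = ≤-refl
     pt w gt lt false t _ = case t refl refl of λ ()
     pt w gt lt true t _ = ≤-reflexive (+-identityʳ _)
     pt w gt eq false t _ = z≤n
     pt w gt eq true t _ = z≤n
     pt w gt gt false t _ = z≤n
     pt w gt gt true t _ = ≤-refl

 module _ {n : ℕ} (v : Fin n) (g : Fin n → Fin n → Fin n → Bool) (W : Fin n → Fin n → Bool) where
   linkSpec : Vec Kind (N3 n)
   linkSpec = tabulateᵥ (λ p → let i , j , k = triple p in linkKind v g W i j k)

   private
     at-spec : ∀ p → lookupᵥ linkSpec p ≡ (let i , j , k = triple p in linkKind v g W i j k)
     at-spec p = Vecₚ.lookup∘tabulate _ p

   -- Only triples through `v` have a kind that is not fixed, so any count of triples by kind that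
   -- ignores the fixed ones is a count of pairs in the link.
   spec-sum : ∀ (q : Kind → Bool) (s : Fin n → Fin n → Fin n → Bool) (f : Fin n → Fin n → Bool) →
     (∀ b → q (fixed b) ≡ false) → (∀ x y → q (if W x y then free else err) ≡ true → s v x y ≡ true → f x y ≡ true) → Sym₃ s →
     ∑ (λ p → 𝟙 (q (lookupᵥ linkSpec p) ∧ (let i , j , k = triple p in s i j k))) ≤ T₂ f
   spec-sum q s f q-fixed qf ss = begin
     ∑ (λ p → 𝟙 (q (lookupᵥ linkSpec p) ∧ (let i , j , k = triple p in s i j k)))
       ≡⟨ ∑-cong (λ p → cong (λ κ → 𝟙 (q κ ∧ (let i , j , k = triple p in s i j k))) (at-spec p)) ⟩
     ∑ (λ p → 𝟙 (let i , j , k = triple p in q (linkKind v g W i j k) ∧ s i j k)) ≡⟨ ∑-triple (λ i j k → q (linkKind v g W i j k) ∧ s i j k) ⟩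
     ∑³ (λ i j k → 𝟙 (sorted i j k ∧ (q (linkKind v g W i j k) ∧ s i j k))) ≤⟨ ∑³-mono pt ⟩
     ∑³ (through v f) ≤⟨ through-≤ v f ⟩
     T₂ f ∎
     where
     open ≤-Reasoning
     open Sym₃ ss
     imp : ∀ {a b c d} → (b ≡ true → c ≡ true → d ≡ true) → 𝟙 (a ∧ (b ∧ c)) ≤ 𝟙 (a ∧ d)
     imp {a} {b} {c} {d} h = 𝟙-mono (λ e → let p , q = ∧-true {a} e
                                               r , t = ∧-true {b} q
                                           in ∧-intro p (h r t))
     pt : ∀ i j k → 𝟙 (sorted i j k ∧ (q (linkKind v g W i j k) ∧ s i j k)) ≤ through v f i j k
     pt i j k with v Finₚ.≟ i
     ... | yes refl = ≤-trans (imp {sorted v j k} {q (if W j k then free else err)} (qf j k)) (≤-trans (≤-reflexive (sym (+-identityʳ _))) (m≤m+n _ _))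
     ... | no _ with v Finₚ.≟ j
     ...   | yes refl = ≤-trans (imp {sorted i v k} {q (if W i k then free else err)} (λ a b → qf i k a (trans (s₁₂ v i k) b))) (≤-trans (≤-reflexive (sym (+-identityʳ _))) (m≤m+n _ _))
     ...   | no _ with v Finₚ.≟ k
     ...     | yes refl = ≤-trans (imp {sorted i j v} {q (if W i j then free else err)} (λ a b → qf i j a (trans (rot v i j) b))) (≤-reflexive (sym (+-identityʳ _)))
     ...     | no _ = ≤-reflexive (cong 𝟙 (trans (cong (λ t → sorted i j k ∧ (t ∧ s i j k)) (q-fixed (g i j k))) (∧-zeroʳ (sorted i j k))))

   link-free : #free linkSpec ≤ T₂ W
   link-free = ≤-trans (≤-reflexive (∑-cong (λ p → cong 𝟙 (sym (∧-identityʳ (isFree (lookupᵥ linkSpec p)))))))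
     (spec-sum isFree (λ _ _ _ → true) W (λ _ → refl) (λ x y e _ → free-W (W x y) e) (record { s₁₂ = λ _ _ _ → refl ; s₂₃ = λ _ _ _ → refl }))
     where
     free-W : ∀ w → isFree (if w then free else err) ≡ true → w ≡ true
     free-W true _ = refl

   link-err : #err linkSpec ≤ n * n
   link-err = ≤-trans (≤-reflexive (∑-cong (λ p → cong 𝟙 (sym (∧-identityʳ (isErr (lookupᵥ linkSpec p)))))))
     (≤-trans (spec-sum isErr (λ _ _ _ → true) (λ _ _ → true) (λ _ → refl) (λ _ _ _ _ → refl) (record { s₁₂ = λ _ _ _ → refl ; s₂₃ = λ _ _ _ → refl }))
       (≤-trans (∑²-≤const 1 (λ x y → 𝟙≤1 _)) (≤-reflexive (*-identityʳ _))))

   link-errors : ∀ H → errors linkSpec H ≤ ∑² (λ x y → 𝟙 (E H v x y ∧ not (W x y)))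
   link-errors H = ≤-trans (≤-reflexive (∑-cong (λ p → cong (λ b → 𝟙 (isErr (lookupᵥ linkSpec p) ∧ b)) (E-at H p))))
     (≤-trans (spec-sum isErr (E H) (λ x y → E H v x y ∧ not (W x y)) (λ _ → refl) (λ x y e m → ∧-intro m (err-W (W x y) e)) (E-sym H))
       (∑²-mono (λ x y → 𝟙-mono (λ e → proj₂ (∧-true {x <ᵇᶠ y} e)))))
     where
     err-W : ∀ w → isErr (if w then free else err) ≡ true → not w ≡ true
     err-W false _ = refl

   link-agrees : ∀ H → (∀ a b c → v ≢ a → v ≢ b → v ≢ c → g a b c ≡ E H a b c) → Agrees linkSpec H
   link-agrees H off p b e = trans (E-at H p) (lemma _ _ _ (trans (sym (at-spec p)) e))
     where
     not-fixed : ∀ w {b} → (if w then free else err) ≡ fixed b → ⊥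
     not-fixed true ()
     not-fixed false ()
     lemma : ∀ i j k → linkKind v g W i j k ≡ fixed b → E H i j k ≡ b
     lemma i j k e with v Finₚ.≟ i
     ... | yes _ = ⊥-elim (not-fixed (W j k) e)
     ... | no v≢i with v Finₚ.≟ j
     ...   | yes _ = ⊥-elim (not-fixed (W i k) e)
     ...   | no v≢j with v Finₚ.≟ k
     ...     | yes _ = ⊥-elim (not-fixed (W i j) e)
     ...     | no v≢k with e
     ...       | refl = sym (off i j k v≢i v≢j v≢k)

 module LossyCount {Code : Set} {n : ℕ} (decode : Code → (v : Fin (suc n)) → (Fin (suc n) → Fin (suc n) → Fin (suc n) → Bool) → Fin (suc n) → Fin (suc n) → Bool) where
   Lossy : ℕ → ℕ → TripleSystem (suc n) → Set
   Lossy w k H = ∃ λ v → ∃ λ c → let W = decode c v (extend v (restrict v H)) in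
     T₂ W ≤ w × ∑² (λ x y → 𝟙 (E H v x y ∧ not (W x y))) ≤ k

   -- The restriction off `v` again has independent neighbourhoods, hence `I n` choices. It
   -- determines `W` together with the code, so `W` is known before the link is chosen. The link is
   -- then free on `W` and has at most `k` pairs elsewhere.
   lossy-cover : ∀ {C} → Cov {Code} (λ _ → ⊤) C → ∀ w k → Cov (λ H → IndependentNeighborhoods (suc n) H × Lossy w k H)
     (suc n * (I n * (C * (2 ^ w * Bin (suc n * suc n) k))))
   lossy-cover codes w k = Cov-⊂ (λ { H (ind , v , c , tw , er) → v , tt , restrict v H , restrict-IN v H ind , c , tt , tw , er ,
                               link-agrees v (extend v (restrict v H)) (decode c v (extend v (restrict v H))) H (extend-restrict v H) })
     (Cov-∃ (Cov-Fin (suc n)) (λ v → Cov-∃ all-IN (λ H′ → Cov-∃ codes (λ c → one v H′ c))))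
     where
     all-IN : Cov (IndependentNeighborhoods n) (I n)
     all-IN = let L , e , c = enumerate (N3 n) (IndependentNeighborhoods? n) in L , ≤-reflexive e , c
     one : ∀ v H′ c → let W = decode c v (extend v H′) in
       Cov (λ H → T₂ W ≤ w × ∑² (λ x y → 𝟙 (E H v x y ∧ not (W x y))) ≤ k × Agrees (linkSpec v (extend v H′) W) H) (2 ^ w * Bin (suc n * suc n) k)
     one v H′ c with T₂ (decode c v (extend v H′)) Data.Nat.≤? w
     ... | no ¬p = Cov-∅ (λ s q → ¬p (proj₁ q))
     ... | yes p = family (linkSpec v g W) k ,
           ≤-trans (≤-reflexive (family-length (linkSpec v g W) k)) (*-mono-≤ (^-monoʳ-≤ 2 (≤-trans (link-free v g W) p)) (Bin-mono k (link-err v g W))) ,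
           λ { H (_ , er , ag) → family-complete (linkSpec v g W) k H ag (≤-trans (link-errors v g W H) er) }
       where
       g = extend v H′
       W = decode c v g

open Restriction

-- Decodable restrictions on a link.

o₂ : ∀ {n} → (Fin n → Fin n → Bool) → ℕ
o₂ W = ∑² (λ p q → 𝟙 (W p q))

-- The pairs that may form an edge with a vertex outside X (true) or inside X (false).
base : ∀ {n} → Bool → (Fin n → Bool) → Fin n → Fin n → Bool
base true  X p q = X p ∧ X q
base false X p q = X p xor X q

base-sym : ∀ {n} t (X : Fin n → Bool) p q → base t X p q ≡ base t X q p
base-sym true X p q = ∧-comm (X p) (X q)
base-sym false X p q = xor-comm (X p) (X q)
  where
  xor-comm : ∀ a b → a xor b ≡ b xor a
  xor-comm true true = refl
  xor-comm true false = refl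
  xor-comm false true = refl
  xor-comm false false = refl

-- The ways in which a link can fall short of its base. Inside X it may avoid the square of A
-- (`inner`); the pairs of A with X may be traded for the fewer pairs of A with the complement
-- (`cross`); it may avoid the pairs common to two other links (`common`), or in each row of A an
-- excluded set (`rows`), or all rows of A (`outer`), or be nearly void (`empty`).
data Shape : Set where
  empty inner cross common rows outer : Shape

-- All that a decoder for the link of z may look at: the system without the edges through z.
off : ∀ {n} → Fin n → (Fin n → Fin n → Fin n → Bool) → Fin n → Fin n → Fin n → Bool
off z h a b c = (not (z ==ᶠ a) ∧ (not (z ==ᶠ b) ∧ not (z ==ᶠ c))) ∧ h a b c

module Decode {n : ℕ} (T : ℕ) (t : Bool) (X A : Fin n → Bool) (u w : Fin n) (r : Fin n → Fin (suc n)) (z : Fin n) (g : Fin n → Fin n → Fin n → Bool) where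
  U : Fin n → Bool
  U q = if t then X q else not (X q)

  G : Fin n → Fin n → Bool
  G a q = g u a q ∧ (U a ∧ U q)

  Vh : Fin n → Bool
  Vh q = U q ∧ (n ≤ᵇ T * ∑ (λ p → 𝟙 (G q p)))

  excluded : Fin (suc n) → Fin n → Bool
  excluded zero    q = Vh q
  excluded (suc b) q = G b q

  decode : Shape → Fin n → Fin n → Bool
  decode empty  p q = false
  decode inner  p q = base true X p q ∧ not (A p ∧ A q)
  decode cross  p q = (base false X p q ∧ not (A p ∨ A q)) ∨ ((not (X p) ∧ not (X q)) ∧ (A p ∨ A q))
  decode common p q = (base t X p q ∧ not ((z ==ᶠ p) ∨ (z ==ᶠ q))) ∧ not (g u p q ∧ g w p q)
  decode rows   p q = base t X p q ∧ (not (A p ∧ excluded (r p) q) ∧ not (A q ∧ excluded (r q) p))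
  decode outer  p q = base t X p q ∧ not (A p ∨ A q)

  decode-sym : (∀ x p q → g x p q ≡ g x q p) → ∀ s p q → decode s p q ≡ decode s q p
  decode-sym gs empty p q = refl
  decode-sym gs inner p q = cong₂ _∧_ (base-sym true X p q) (cong not (∧-comm (A p) (A q)))
  decode-sym gs cross p q = cong₂ _∨_ (cong₂ _∧_ (base-sym false X p q) (cong not (∨-comm (A p) (A q))))
                                      (cong₂ _∧_ (∧-comm (not (X p)) (not (X q))) (∨-comm (A p) (A q)))
  decode-sym gs common p q = cong₂ _∧_ (cong₂ _∧_ (base-sym t X p q) (cong not (∨-comm (z ==ᶠ p) (z ==ᶠ q))))
                                       (cong not (cong₂ _∧_ (gs u p q) (gs w p q)))
  decode-sym gs rows p q = cong₂ _∧_ (base-sym t X p q) (∧-comm (not (A p ∧ excluded (r p) q)) _)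
  decode-sym gs outer p q = cong₂ _∧_ (base-sym t X p q) (cong not (∨-comm (A p) (A q)))

decode-cong : ∀ {n} T t {X X′ A A′ : Fin n → Bool} u w {r r′ : Fin n → Fin (suc n)} z {g g′} →
  (∀ p → X p ≡ X′ p) → (∀ p → A p ≡ A′ p) → (∀ p → r p ≡ r′ p) → (∀ a b c → g a b c ≡ g′ a b c) →
  ∀ s p q → Decode.decode T t X A u w r z g s p q ≡ Decode.decode T t X′ A′ u w r′ z g′ s p q
decode-cong {n} T t {X} {X′} {A} {A′} u w {r} {r′} z {g} {g′} ex ea er eg = go
  where
  module D₁ = Decode T t X A u w r z g
  module D₂ = Decode T t X′ A′ u w r′ z g′
  eb : ∀ t p q → base t X p q ≡ base t X′ p q
  eb true  p q = cong₂ _∧_ (ex p) (ex q)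
  eb false p q = cong₂ _xor_ (ex p) (ex q)
  eU : ∀ q → D₁.U q ≡ D₂.U q
  eU q = cong (λ b → if t then b else not b) (ex q)
  eG : ∀ a q → D₁.G a q ≡ D₂.G a q
  eG a q = cong₂ _∧_ (eg u a q) (cong₂ _∧_ (eU a) (eU q))
  eE : ∀ i q → D₁.excluded i q ≡ D₂.excluded i q
  eE zero q = cong₂ _∧_ (eU q) (cong (λ m → n ≤ᵇ T * m) (∑-cong (λ p → cong 𝟙 (eG q p))))
  eE (suc b) q = eG b q
  eRow : ∀ p q → not (A p ∧ D₁.excluded (r p) q) ≡ not (A′ p ∧ D₂.excluded (r′ p) q)
  eRow p q = cong not (cong₂ _∧_ (ea p) (trans (eE (r p) q) (cong (λ i → D₂.excluded i q) (er p))))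
  go : ∀ s p q → D₁.decode s p q ≡ D₂.decode s p q
  go empty p q = refl
  go inner p q = cong₂ _∧_ (eb true p q) (cong not (cong₂ _∧_ (ea p) (ea q)))
  go cross p q = cong₂ _∨_ (cong₂ _∧_ (eb false p q) (cong not (cong₂ _∨_ (ea p) (ea q))))
                           (cong₂ _∧_ (cong₂ (λ a b → not a ∧ not b) (ex p) (ex q)) (cong₂ _∨_ (ea p) (ea q)))
  go common p q = cong₂ _∧_ (cong (_∧ not ((z ==ᶠ p) ∨ (z ==ᶠ q))) (eb t p q)) (cong not (cong₂ _∧_ (eg u p q) (eg w p q)))
  go rows p q = cong₂ _∧_ (eb t p q) (cong₂ _∧_ (eRow p q) (eRow q p))
  go outer p q = cong₂ _∧_ (eb t p q) (cong not (cong₂ _∨_ (ea p) (ea q)))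

linkError : ∀ {n} → (Fin n → Fin n → Fin n → Bool) → Fin n → (Fin n → Fin n → Bool) → ℕ
linkError h v W = ∑² (λ p q → 𝟙 (h v p q ∧ not (W p q)))

-- Some vertex z has a link that, up to n²/E pairs, lies in a decodable set of density below 4/9 - 1/(9D).
record Lossy {n} (T D E : ℕ) (h : Fin n → Fin n → Fin n → Bool) : Set where
  field
    z u w : Fin n
    t     : Bool
    X A   : Fin n → Bool
    r     : Fin n → Fin (suc n)
    s     : Shape
  W : Fin n → Fin n → Bool
  W = Decode.decode T t X A u w r z (off z h) s
  field
    gap   : D * (9 * o₂ W) + n * n ≤ D * (4 * (n * n))
    error : E * linkError h z W ≤ n * n

Code : ℕ → Set
Code n = Shape × Bool × Fin n × Fin n × Vec Bool n × Vec Bool n × Vec (Fin (suc n)) n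

decodeCode : ∀ {n} → ℕ → Code n → (v : Fin n) → (Fin n → Fin n → Fin n → Bool) → Fin n → Fin n → Bool
decodeCode T (s , t , u , w , X , A , r) z g = Decode.decode T t (lookupᵥ X) (lookupᵥ A) u w (lookupᵥ r) z g s

Cov-Shape : Cov {Shape} (λ _ → ⊤) 6
Cov-Shape = empty ∷ inner ∷ cross ∷ common ∷ rows ∷ outer ∷ [] , ≤-refl , λ
  { empty _ → here refl ; inner _ → there (here refl) ; cross _ → there (there (here refl)) ; common _ → there (there (there (here refl)))
  ; rows _ → there (there (there (there (here refl)))) ; outer _ → there (there (there (there (there (here refl))))) }

codes : ℕ → ℕ
codes n = 6 * (2 * (n * (n * (2 ^ n * (2 ^ n * suc n ^ n)))))

Cov-Code : ∀ n → Cov {Code n} (λ _ → ⊤) (codes n)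
Cov-Code n = Cov-× Cov-Shape (Cov-× Cov-Bool (Cov-× (Cov-Fin n) (Cov-× (Cov-Fin n) (Cov-× (Cov-Vec Cov-Bool n) (Cov-× (Cov-Vec Cov-Bool n) (Cov-Vec (Cov-Fin (suc n)) n))))))

off-sym : ∀ {n} z (h : Fin n → Fin n → Fin n → Bool) → Sym₃ h → ∀ x p q → off z h x p q ≡ off z h x q p
off-sym z h hs x p q = cong₂ _∧_ (cong (not (z ==ᶠ x) ∧_) (∧-comm (not (z ==ᶠ p)) (not (z ==ᶠ q)))) (Sym₃.s₂₃ hs x p q)

extend-off : ∀ {n} (v : Fin (suc n)) H a b c → extend v (restrict v H) a b c ≡ off v (E H) a b c
extend-off v H a b c with v Finₚ.≟ a | v Finₚ.≟ b | v Finₚ.≟ c | extend-restrict v H a b c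
... | yes _ | _ | _ | _ = refl
... | no _ | yes _ | _ | _ = refl
... | no _ | no _ | yes _ | _ = refl
... | no p | no q | no r | e = e p q r

-- Here `T₂` counts unordered pairs and `o₂` ordered ones, so the 9 of `gap` becomes 18. The code
-- stores tables in place of the functions of the record; both decode to the same set of pairs.
Lossy⇒code : ∀ {n} T D E′ → 1 ≤ D → ∀ {w k} →
  (∀ m → D * (18 * m) + suc n * suc n ≤ D * (4 * (suc n * suc n)) → m ≤ w) → (∀ m → E′ * m ≤ suc n * suc n → m ≤ k) →
  (H : TripleSystem (suc n)) → Lossy T D E′ (E H) → LossyCount.Lossy {Code (suc n)} {n} (decodeCode T) w k H
Lossy⇒code {n} T D E′ 1≤D toW toK H L = z , (s , t , u , w , tabulateᵥ X , tabulateᵥ A , tabulateᵥ r) ,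
    toW (T₂ W′) (≤-trans (+-monoˡ-≤ _ (*-monoʳ-≤ D (≤-trans (≤-reflexive (e₁ (T₂ W′))) (*-monoʳ-≤ 9 (≤-trans (T₂-upper W′ symW′) (≤-reflexive (∑²-cong (λ p q → cong 𝟙 (same p q))))))))) gap) ,
    toK _ (≤-trans (≤-reflexive (cong (E′ *_) (∑²-cong (λ p q → cong (λ b → 𝟙 (E H z p q ∧ not b)) (same p q))))) error)
  where
  open Lossy L
  W′ = decodeCode T (s , t , u , w , tabulateᵥ X , tabulateᵥ A , tabulateᵥ r) z (extend {n} z (restrict {n} z H))
  e₁ : ∀ m → 18 * m ≡ 9 * (2 * m)
  e₁ = solve-∀
  same : ∀ p q → W′ p q ≡ W p q
  same p q = decode-cong T t u w z (Vecₚ.lookup∘tabulate X) (Vecₚ.lookup∘tabulate A) (Vecₚ.lookup∘tabulate r) (extend-off {n} z H) s p q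
  symW′ : ∀ p q → W′ p q ≡ W′ q p
  symW′ p q = trans (same p q) (trans (Decode.decode-sym T t X A u w r z (off z (E H)) (off-sym z (E H) (E-sym {suc n} H)) s p q) (sym (same q p)))

-- Gaps in links forced by independent neighbourhoods.

module Gaps {n : ℕ} (R : ℕ) where
  -- When |X| is close to 2n/3, both |X|² and 2|X|(n - |X|) are close to 4n²/9. So neither base
  -- exceeds the density 4/9 by more than 1/(9R).
  Balanced : (Fin n → Bool) → Set
  Balanced X = ∀ t → R * (9 * o₂ (base t X)) ≤ R * (4 * (n * n)) + n * n

  -- Removing n²/D pairs lowers nine times the density by 9/D, and the slack 1/R in the balance
  -- takes back at most 1/D of this.
  gap-from : ∀ {D} → D ≤ R → 1 ≤ D → ∀ {X} → Balanced X → ∀ t w rem → w + rem ≤ o₂ (base t X) → n * n ≤ D * rem → D * (9 * w) + n * n ≤ D * (4 * (n * n))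
  gap-from {D} D≤R 1≤D {X} bal t w rem le big = *-cancelˡ-≤ R ⦃ >-nonZero (≤-trans 1≤D D≤R) ⦄ (+-cancelʳ-≤ (R * (8 * (n * n))) _ _ (begin
    R * (D * (9 * w) + n * n) + R * (8 * (n * n)) ≡⟨ e₁ R D w (n * n) ⟩
    R * (9 * (D * w)) + R * (9 * (n * n)) ≤⟨ +-monoʳ-≤ (R * (9 * (D * w))) (*-monoʳ-≤ R (*-monoʳ-≤ 9 big)) ⟩
    R * (9 * (D * w)) + R * (9 * (D * rem)) ≡⟨ e₂ R D w rem ⟩
    D * (R * (9 * (w + rem))) ≤⟨ *-monoʳ-≤ D (≤-trans (*-monoʳ-≤ R (*-monoʳ-≤ 9 le)) (bal t)) ⟩
    D * (R * (4 * (n * n)) + n * n) ≡⟨ e₃ D R (n * n) ⟩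
    R * (D * (4 * (n * n))) + D * (n * n) ≤⟨ +-monoʳ-≤ (R * (D * (4 * (n * n)))) (≤-trans (*-monoˡ-≤ (n * n) D≤R) (*-monoʳ-≤ R (m≤n*m (n * n) 8))) ⟩
    R * (D * (4 * (n * n))) + R * (8 * (n * n)) ∎))
    where
    open ≤-Reasoning
    e₁ : ∀ R D w m → R * (D * (9 * w) + m) + R * (8 * m) ≡ R * (9 * (D * w)) + R * (9 * m)
    e₁ = solve-∀
    e₂ : ∀ R D w r → R * (9 * (D * w)) + R * (9 * (D * r)) ≡ D * (R * (9 * (w + r)))
    e₂ = solve-∀
    e₃ : ∀ D R m → D * (R * (4 * m) + m) ≡ R * (D * (4 * m)) + D * m
    e₃ = solve-∀

o₂-remove : ∀ {n} (W Q B : Fin n → Fin n → Bool) → (∀ p q → W p q ≡ true → B p q ≡ true) → (∀ p q → Q p q ≡ true → B p q ≡ true × W p q ≡ false) →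
            o₂ W + o₂ Q ≤ o₂ B
o₂-remove W Q B wb qb = ≤-trans (≤-reflexive (sym (∑²-+ _ _))) (∑²-mono pt)
  where
  pt : ∀ p q → 𝟙 (W p q) + 𝟙 (Q p q) ≤ 𝟙 (B p q)
  pt p q with W p q in ew | Q p q in eq′
  ... | false | false = z≤n
  ... | true  | false = ≤-reflexive (cong 𝟙 (sym (wb p q ew)))
  ... | false | true  = ≤-reflexive (cong 𝟙 (sym (proj₁ (qb p q eq′))))
  ... | true  | true  = ⊥-elim (true≢false ew (proj₂ (qb p q eq′)))

linkError-≤ : ∀ {n} (h : Fin n → Fin n → Fin n → Bool) v W B → (∀ p q → h v p q ≡ true → B p q ≡ true → W p q ≡ true) → linkError h v W ≤ linkError h v B
linkError-≤ h v W B imp = ∑²-mono (λ p q → 𝟙-mono (λ e → let a , b = ∧-true {h v p q} e in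
  ∧-intro a (bool-case (B p q) (λ c → ⊥-elim (true≢false (imp p q a c) (not-true b))) (λ c → cong not c))))

all-Bool : (Bool → Bool) → Bool
all-Bool f = f true ∧ f false

all-Bool-sound : ∀ f → all-Bool f ≡ true → ∀ b → f b ≡ true
all-Bool-sound f e true = proj₁ (∧-true {f true} e)
all-Bool-sound f e false = proj₂ (∧-true {f true} e)

tautology₅ : (f : Bool → Bool → Bool → Bool → Bool → Bool) →
  all-Bool (λ a → all-Bool (λ b → all-Bool (λ c → all-Bool (λ d → all-Bool (f a b c d))))) ≡ true → ∀ a b c d e → f a b c d e ≡ true
tautology₅ f p a b c d e = all-Bool-sound (f a b c d) (all-Bool-sound (λ d → all-Bool (f a b c d)) (all-Bool-sound (λ c → all-Bool (λ d → all-Bool (f a b c d)))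
  (all-Bool-sound (λ b → all-Bool (λ c → all-Bool (λ d → all-Bool (f a b c d)))) (all-Bool-sound (λ a → all-Bool (λ b → all-Bool (λ c → all-Bool (λ d → all-Bool (f a b c d))))) p a) b) c) d) e

bounded₅ : (f g : Bool → Bool → Bool → Bool → Bool → ℕ) →
  all-Bool (λ a → all-Bool (λ b → all-Bool (λ c → all-Bool (λ d → all-Bool (λ e → f a b c d e ≤ᵇ g a b c d e))))) ≡ true →
  ∀ a b c d e → f a b c d e ≤ g a b c d e
bounded₅ f g p a b c d e = ≤ᵇ-true (tautology₅ (λ a b c d e → f a b c d e ≤ᵇ g a b c d e) p a b c d e)

scale : ∀ {a b m q} → a ≤ b → b * m ≤ q → a * m ≤ q
scale {m = m} a≤b p = ≤-trans (*-monoˡ-≤ m a≤b) p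

two-parts : ∀ E x a b {m} → x ≤ a + b → 2 * E * a ≤ m → 2 * E * b ≤ m → E * x ≤ m
two-parts E x a b {m} le pa pb = *-cancelˡ-≤ 2 (begin
  2 * (E * x) ≤⟨ *-monoʳ-≤ 2 (*-monoʳ-≤ E le) ⟩
  2 * (E * (a + b)) ≡⟨ e E a b ⟩
  2 * E * a + 2 * E * b ≤⟨ +-mono-≤ pa pb ⟩
  m + m ≡⟨ cong (m +_) (sym (+-identityʳ m)) ⟩
  2 * m ∎)
  where
  open ≤-Reasoning
  e : ∀ E a b → 2 * (E * (a + b)) ≡ 2 * E * a + 2 * E * b
  e = solve-∀

four-parts : ∀ E x a b c d {m} → x ≤ a + b + c + d → 4 * E * a ≤ m → 4 * E * b ≤ m → 4 * E * c ≤ m → 4 * E * d ≤ m → E * x ≤ m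
four-parts E x a b c d {m} le pa pb pc pd = *-cancelˡ-≤ 4 (begin
  4 * (E * x) ≤⟨ *-monoʳ-≤ 4 (*-monoʳ-≤ E le) ⟩
  4 * (E * (a + b + c + d)) ≡⟨ e E a b c d ⟩
  4 * E * a + 4 * E * b + 4 * E * c + 4 * E * d ≤⟨ +-mono-≤ (+-mono-≤ (+-mono-≤ pa pb) pc) pd ⟩
  m + m + m + m ≡⟨ e′ m ⟩
  4 * m ∎)
  where
  open ≤-Reasoning
  e : ∀ E a b c d → 4 * (E * (a + b + c + d)) ≡ 4 * E * a + 4 * E * b + 4 * E * c + 4 * E * d
  e = solve-∀
  e′ : ∀ m → m + m + m + m ≡ 4 * m
  e′ = solve-∀

rows-≤ : ∀ {n} d (f : Fin n → Fin n → Bool) → (∀ p → d * ∣ f p ∣ₚ ≤ n) → d * o₂ f ≤ n * n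
rows-≤ {n} d f r = ≤-trans (≤-reflexive (sym (∑-*ˡ d (λ p → ∣ f p ∣ₚ)))) (∑-≤const n r)

o₂-prod : ∀ {n} (A B : Fin n → Bool) → o₂ (λ p q → A p ∧ B q) ≡ ∣ A ∣ₚ * ∣ B ∣ₚ
o₂-prod A B = trans (∑²-cong (λ p q → 𝟙-∧ (A p) (B q))) (∑²-prod _ _)

o₂-transpose : ∀ {n} (f : Fin n → Fin n → Bool) → o₂ (λ p q → f q p) ≡ o₂ f
o₂-transpose f = ∑-swap (λ p q → 𝟙 (f q p))

-- Rows shorter than n/2k carry at most half of the n²/k pairs, and every other row has at most n.
popular : ∀ {n} k (f : Fin n → Fin n → Bool) → n * n ≤ k * o₂ f → n ≤ 2 * k * ∣ (λ a → n ≤ᵇ 2 * k * ∣ f a ∣ₚ) ∣ₚ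
popular {n} k f dense with n Data.Nat.≟ 0
... | yes refl = z≤n
... | no n≢0 = *-cancelʳ-≤ _ _ n ⦃ ≢-nonZero n≢0 ⦄ (+-cancelʳ-≤ (n * n) _ _ (begin
    n * n + n * n ≤⟨ +-mono-≤ dense dense ⟩
    k * o₂ f + k * o₂ f ≡⟨ e₁ k (o₂ f) ⟩
    2 * k * o₂ f ≡⟨ sym (∑-*ˡ (2 * k) (λ a → ∣ f a ∣ₚ)) ⟩
    ∑ (λ a → 2 * k * ∣ f a ∣ₚ) ≤⟨ ∑-mono pt ⟩
    ∑ (λ a → 2 * k * n * 𝟙 (n ≤ᵇ 2 * k * ∣ f a ∣ₚ) + n) ≡⟨ trans (∑-+ _ _) (cong₂ _+_ (∑-*ˡ (2 * k * n) _) (∑-const {n} n)) ⟩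
    2 * k * n * S₀ + n * n ≡⟨ cong (_+ n * n) (e₂ k n S₀) ⟩
    2 * k * S₀ * n + n * n ∎))
  where
  open ≤-Reasoning
  S₀ = ∣ (λ a → n ≤ᵇ 2 * k * ∣ f a ∣ₚ) ∣ₚ
  e₁ : ∀ k s → k * s + k * s ≡ 2 * k * s
  e₁ = solve-∀
  e₂ : ∀ k n s → 2 * k * n * s ≡ 2 * k * s * n
  e₂ = solve-∀
  pt : ∀ a → 2 * k * ∣ f a ∣ₚ ≤ 2 * k * n * 𝟙 (n ≤ᵇ 2 * k * ∣ f a ∣ₚ) + n
  pt a = bool-case (n ≤ᵇ 2 * k * ∣ f a ∣ₚ)
    (λ e → ≤-trans (*-monoʳ-≤ (2 * k) (∣∣ₚ-≤ (f a))) (≤-trans (≤-reflexive (sym (trans (cong (λ b → 2 * k * n * 𝟙 b) e) (*-identityʳ _)))) (m≤m+n _ n)))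
    (λ e → ≤-trans (<⇒≤ (≤ᵇ-false e)) (m≤n+m n _))

∣∣ₚ-escape : ∀ {n} k (A B : Fin n → Bool) → n ≤ k * ∣ A ∣ₚ → k * ∣ B ∣ₚ < n → ∃[ v ] A v ≡ true × B v ≡ false
∣∣ₚ-escape k A B big few =
  let v , p = ∑-<⇒∃ (λ v → 𝟙 (B v)) (λ v → 𝟙 (A v)) (*-cancelˡ-< k _ _ (<-≤-trans few big)) in v , conv (A v) (B v) p
  where
  conv : ∀ a b → 𝟙 b < 𝟙 a → a ≡ true × b ≡ false
  conv true  false _ = refl , refl
  conv true  true  (s≤s ())
  conv false b ()

module Structure {n : ℕ} (h : Fin n → Fin n → Fin n → Bool) (hs : Sym₃ h) (irr : ∀ a b → h a a b ≡ false) (ff : F-free h) (T R : ℕ) where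
  open Sym₃ hs
  open Gaps {n} R

  off-agree : ∀ {z a b c} → z ≢ a → z ≢ b → z ≢ c → off z h a b c ≡ h a b c
  off-agree {z} p q r rewrite ==ᶠ-false p | ==ᶠ-false q | ==ᶠ-false r = refl

  -- The whole square of A is missing from the link of b, which is n²/k² pairs of the base.
  inner-lossy : ∀ {X} → Balanced X → ∀ k E b (A : Fin n → Bool) → 1 ≤ k → k * k ≤ R → (∀ p → A p ≡ true → X p ≡ true) →
    (∀ p q → A p ≡ true → A q ≡ true → h b p q ≡ true → ⊥) → n ≤ k * ∣ A ∣ₚ → E * linkError h b (base true X) ≤ n * n → Lossy T (k * k) E h
  inner-lossy {X} bal k E b A 1≤k kk AX none big er = record
    { z = b ; u = b ; w = b ; t = true ; X = X ; A = A ; r = λ _ → zero ; s = inner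
    ; gap = gap-from kk (*-mono-≤ 1≤k 1≤k) bal true _ (∣ A ∣ₚ * ∣ A ∣ₚ) (subst (λ s → o₂ W + s ≤ o₂ (base true X)) (o₂-prod A A)
              (o₂-remove W (λ p q → A p ∧ A q) (base true X) (λ p q e → proj₁ (∧-true e))
                (λ p q e → let x , y = ∧-true {A p} e in ∧-intro (AX p x) (AX q y) , wf p q e)))
              (≤-trans (*-mono-≤ big big) (≤-reflexive (e₁ k ∣ A ∣ₚ)))
    ; error = ≤-trans (*-monoʳ-≤ E (linkError-≤ h b W (base true X) (λ p q m c → ∧-intro c (cong not (¬true⇒false (λ e → let x , y = ∧-true {A p} e in none p q x y m)))))) er }
    where
    W : Fin n → Fin n → Bool
    W p q = base true X p q ∧ not (A p ∧ A q)
    e₁ : ∀ k a → k * a * (k * a) ≡ k * k * (a * a)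
    e₁ = solve-∀
    wf : ∀ p q → A p ∧ A q ≡ true → W p q ≡ false
    wf p q e rewrite e = ∧-zeroʳ (X p ∧ X q)

  typical : ℕ → (Fin n → Bool) → Fin n → Bool
  typical E X v = E * linkError h v (base (not (X v)) X) ≤ᵇ n * n

  typical-error : ∀ {E X v} → typical E X v ≡ true → ∀ t → X v ≡ not t → E * linkError h v (base t X) ≤ n * n
  typical-error {E} {X} {v} e t xv = subst (λ s → E * linkError h v (base s X) ≤ n * n) (trans (cong not xv) (not-involutive t)) (≤ᵇ-true e)

  module _ (X : Fin n → Bool) (bal : Balanced X) (n>0 : 1 ≤ n) where
    side : Bool → Fin n → Bool
    side t q = if t then X q else not (X q)

    -- The rows of the link of z over D avoid neighbourhoods in the dense graph G, the link of v on one side.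
    rows-lossy : ∀ t z v k l E → T ≡ 2 * k → 1 ≤ k → 1 ≤ l → l * (2 * k) ≤ R → side t z ≡ false →
      n * n ≤ k * o₂ (λ a q → h v a q ∧ (side t a ∧ side t q)) → n ≤ l * ∣ (λ p → h v z p ∧ X p) ∣ₚ →
      E * linkError h z (base t X) ≤ n * n → Lossy T (l * (2 * k)) E h
    rows-lossy t z v k l E T≡ 1≤k 1≤l lk uz dense big er = record
      { z = z ; u = v ; w = v ; t = t ; X = X ; A = D₀ ; r = r ; s = rows
      ; gap = gap-from lk (*-mono-≤ 1≤l (*-mono-≤ {1} {2} (s≤s z≤n) 1≤k)) bal t _ (o₂ Q) (o₂-remove W Q (base t X) (λ p q e → proj₁ (∧-true {base t X p q} e)) Q⊂) large
      ; error = ≤-trans (*-monoʳ-≤ E (linkError-≤ h z W (base t X) avoids)) er }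
      where
      D₀ : Fin n → Bool
      D₀ p = h v z p ∧ X p
      G₀ : Fin n → Fin n → Bool
      G₀ a q = h v a q ∧ (side t a ∧ side t q)
      z≢v : z ≢ v
      z≢v refl = ≤⇒≯ (≤-reflexive (trans (cong (l *_) (∑-zero (λ p → cong (λ b → 𝟙 (b ∧ X p)) (irr z p)))) (*-zeroʳ l))) (≤-trans n>0 big)
      z≢ : ∀ {a} → side t a ≡ true → z ≢ a
      z≢ e refl = true≢false e uz
      P₀ : Fin n → Bool
      P₀ a = n ≤ᵇ 2 * k * ∣ G₀ a ∣ₚ
      -- If some popular b makes {p, z, b} an edge, the row of p avoids all G-neighbours q of b:
      -- otherwise v, b, q would all be neighbours of {p, z} and form an edge. If there is no such
      -- b, the row avoids the popular vertices themselves. Either way it misses at least n/2k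
      -- vertices.
      choose : Fin n → Fin (suc n)
      choose p with Finₚ.any? (λ b → (P₀ b ∧ h p z b) Data.Bool.≟ true)
      ... | yes (b , _) = suc b
      ... | no _ = zero
      r : Fin n → Fin (suc n)
      r = choose
      open Decode T t X D₀ v v r z (off z h) using (G; Vh; excluded; decode)
      W : Fin n → Fin n → Bool
      W = decode rows
      G≡ : ∀ a q → G a q ≡ G₀ a q
      G≡ a q = bool-case (side t a ∧ side t q)
        (λ e → let x , y = ∧-true {side t a} e in cong (_∧ (side t a ∧ side t q)) (off-agree z≢v (z≢ x) (z≢ y)))
        (λ e → trans (cong (off z h v a q ∧_) e) (trans (∧-zeroʳ (off z h v a q)) (sym (trans (cong (h v a q ∧_) e) (∧-zeroʳ (h v a q))))))
      deg≡ : ∀ b → ∑ (λ p → 𝟙 (G b p)) ≡ ∣ G₀ b ∣ₚ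
      deg≡ b = ∑-cong (λ p → cong 𝟙 (G≡ b p))
      Vh⇒ : ∀ q → Vh q ≡ true → side t q ≡ true × P₀ q ≡ true
      Vh⇒ q e = let x , y = ∧-true {side t q} e in x , subst₂ (λ T d → (n ≤ᵇ T * d) ≡ true) T≡ (deg≡ q) y
      P⇒Vh : ∀ q → P₀ q ≡ true → Vh q ≡ true
      P⇒Vh q e = ∧-intro inU (subst₂ (λ T d → (n ≤ᵇ T * d) ≡ true) (sym T≡) (sym (deg≡ q)) e)
        where
        inU : side t q ≡ true
        inU = bool-case (side t q) id (λ f → ⊥-elim (≤⇒≯ (≤-reflexive (trans (cong (2 * k *_) (∑-zero (λ p → cong 𝟙 (trans (cong (λ b → h v q p ∧ (b ∧ side t p)) f) (∧-zeroʳ (h v q p)))))) (*-zeroʳ (2 * k)))) (≤-trans n>0 (≤ᵇ-true e))))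
      excluded-side : ∀ i q → excluded i q ≡ true → side t q ≡ true
      excluded-side zero q e = proj₁ (Vh⇒ q e)
      excluded-side (suc b) q e = proj₂ (∧-true {side t b} (proj₂ (∧-true {off z h v b q} e)))
      clash : ∀ p q → D₀ p ≡ true → excluded (r p) q ≡ true → h z p q ≡ true → ⊥
      clash p q d x m with Finₚ.any? (λ b → (P₀ b ∧ h p z b) Data.Bool.≟ true)
      ... | no ¬b = ¬b (q , ∧-intro (proj₂ (Vh⇒ q x)) (trans (s₁₂ p z q) m))
      ... | yes (b , e) = ff p z v b q (trans (sym (s₁₃ v z p)) hvzp) (proj₂ (∧-true {P₀ b} e)) (trans (s₁₂ p z q) m)
                            (proj₁ (∧-true {h v b q} (trans (sym (G≡ b q)) x)))
        where
        hvzp = proj₁ (∧-true {h v z p} d)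
      avoids : ∀ p q → h z p q ≡ true → base t X p q ≡ true → W p q ≡ true
      avoids p q m c = ∧-intro c (∧-intro (cong not (¬true⇒false (λ e → let a , b = ∧-true {D₀ p} e in clash p q a b m)))
                                          (cong not (¬true⇒false (λ e → let a , b = ∧-true {D₀ q} e in clash q p a b (trans (s₂₃ z q p) m)))))
      Q : Fin n → Fin n → Bool
      Q p q = D₀ p ∧ excluded (r p) q
      in-base : ∀ t p q → X p ≡ true → (if t then X q else not (X q)) ≡ true → base t X p q ≡ true
      in-base true p q x y = ∧-intro x y
      in-base false p q x y = subst (λ b → b xor X q ≡ true) (sym x) y
      Q⊂ : ∀ p q → Q p q ≡ true → base t X p q ≡ true × W p q ≡ false
      Q⊂ p q e = let d , x = ∧-true {D₀ p} e in in-base t p q (proj₂ (∧-true {h v z p} d)) (excluded-side (r p) q x) , wf p q e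
        where
        wf : ∀ p q → Q p q ≡ true → W p q ≡ false
        wf p q e rewrite e = ∧-zeroʳ (base t X p q)
      row-size : ∀ p → n ≤ 2 * k * ∣ excluded (r p) ∣ₚ
      row-size p with Finₚ.any? (λ b → (P₀ b ∧ h p z b) Data.Bool.≟ true)
      ... | yes (b , e) = ≤-trans (≤ᵇ-true (proj₁ (∧-true {P₀ b} e))) (*-monoʳ-≤ (2 * k) (≤-reflexive (sym (deg≡ b))))
      ... | no _ = ≤-trans (popular k G₀ dense) (*-monoʳ-≤ (2 * k) (∑-mono (λ q → 𝟙-mono (P⇒Vh q))))
      large : n * n ≤ l * (2 * k) * o₂ Q
      large = begin
        n * n ≤⟨ *-monoʳ-≤ n big ⟩
        n * (l * ∣ D₀ ∣ₚ) ≡⟨ e₁ n l ∣ D₀ ∣ₚ ⟩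
        l * (n * ∣ D₀ ∣ₚ) ≡⟨ cong (l *_) (sym (∑-*ˡ n _)) ⟩
        l * ∑ (λ p → n * 𝟙 (D₀ p)) ≤⟨ *-monoʳ-≤ l (∑-mono pt) ⟩
        l * ∑ (λ p → 2 * k * ∣ Q p ∣ₚ) ≡⟨ cong (l *_) (∑-*ˡ (2 * k) _) ⟩
        l * (2 * k * o₂ Q) ≡⟨ sym (*-assoc l (2 * k) (o₂ Q)) ⟩
        l * (2 * k) * o₂ Q ∎
        where
        open ≤-Reasoning
        e₁ : ∀ n l d → n * (l * d) ≡ l * (n * d)
        e₁ = solve-∀
        pt : ∀ p → n * 𝟙 (D₀ p) ≤ 2 * k * ∣ Q p ∣ₚ
        pt p = bool-case (D₀ p)
          (λ e → ≤-trans (≤-reflexive (trans (cong (λ b → n * 𝟙 b) e) (*-identityʳ n))) (≤-trans (row-size p) (*-monoʳ-≤ (2 * k) (≤-reflexive (∑-cong (λ q → cong (λ b → 𝟙 (b ∧ excluded (r p) q)) (sym e)))))))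
          (λ e → ≤-trans (≤-reflexive (trans (cong (λ b → n * 𝟙 b) e) (*-zeroʳ n))) z≤n)

    atypical : ℕ → Fin n → Bool
    atypical E v = not (typical E X v)

    -- The pairs between the opposite side and X supply many z there such that {v, z} has many
    -- neighbours in X. Few vertices are atypical, so some such z has a link close to `base t`, and
    -- the pairs of the link of v inside `side t` break its rows.
    mixed-lossy : ∀ t v k E → T ≡ 2 * k → 1 ≤ k → 2 * k * (2 * k) ≤ R → 2 * k * ∣ atypical E ∣ₚ < n →
      n * n ≤ k * o₂ (λ a q → h v a q ∧ (side t a ∧ side t q)) → n * n ≤ k * o₂ (λ e d → h v e d ∧ (side (not t) e ∧ X d)) → Lossy T (2 * k * (2 * k)) E h
    mixed-lossy t v k E T≡ 1≤k kk few dense dense′ =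
      let z , pz , az = ∣∣ₚ-escape (2 * k) (λ a → n ≤ᵇ 2 * k * ∣ (λ d → h v a d ∧ (side (not t) a ∧ X d)) ∣ₚ) (atypical E) (popular k _ dense′) few
          sz = on-side z (≤ᵇ-true pz)
      in rows-lossy t z v k (2 * k) E T≡ 1≤k (*-mono-≤ {1} {2} (s≤s z≤n) 1≤k) kk (other t z sz) dense
           (≤-trans (≤ᵇ-true pz) (*-monoʳ-≤ (2 * k) (∑-mono (λ d → 𝟙-mono (λ e → let x , y = ∧-true {h v z d} e in ∧-intro x (proj₂ (∧-true {side (not t) z} y)))))))
           (typical-error {E} {X} {z} (un az) t (X-of t z sz))
      where
      un : ∀ {b} → not b ≡ false → b ≡ true
      un {true} _ = refl
      on-side : ∀ z → n ≤ 2 * k * ∣ (λ d → h v z d ∧ (side (not t) z ∧ X d)) ∣ₚ → side (not t) z ≡ true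
      on-side z p = bool-case (side (not t) z) id (λ f → ⊥-elim (≤⇒≯ (≤-reflexive (trans (cong (2 * k *_) (∑-zero (λ d → cong 𝟙 (trans (cong (λ b → h v z d ∧ (b ∧ X d)) f) (∧-zeroʳ (h v z d)))))) (*-zeroʳ (2 * k)))) (≤-trans n>0 p)))
      other : ∀ t z → side (not t) z ≡ true → side t z ≡ false
      other true z e = not-true e
      other false z e = cong not e
      X-of : ∀ t z → side (not t) z ≡ true → X z ≡ not t
      X-of true z e = not-true e
      X-of false z e = e

    -- Choose a typical b outside X among the neighbours of {v, e}. No edge joins b to two
    -- neighbours of {v, e} in X, as it would lie inside this neighbourhood; so a large square is
    -- missing from the link of b.
    both-sides-lossy : ∀ v e k E → 1 ≤ k → k * k ≤ R → k * ∣ atypical E ∣ₚ < n →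
      n ≤ k * ∣ (λ d → h v e d ∧ X d) ∣ₚ → n ≤ k * ∣ (λ d → h v e d ∧ not (X d)) ∣ₚ → Lossy T (k * k) E h
    both-sides-lossy v e k E 1≤k kk few bigX bigY =
      let b , pb , ab = ∣∣ₚ-escape k (λ d → h v e d ∧ not (X d)) (atypical E) bigY few
          hb , xb = ∧-true {h v e b} pb
      in inner-lossy bal k E b (λ d → h v e d ∧ X d) 1≤k kk (λ p m → proj₂ (∧-true {h v e p} m))
           (λ p q x y m → ff v e b p q hb (proj₁ (∧-true {h v e p} x)) (proj₁ (∧-true {h v e q} y)) m) bigX
           (typical-error {E} {X} {b} (un ab) true (not-true xb))
      where
      un : ∀ {b} → not b ≡ false → b ≡ true
      un {true} _ = refl

    -- A link mostly between the two sides but with many pairs outside X: the vertices outside X of large degree inside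
    -- the complement of X have small degree into X, and X is larger than its complement.
    outside-lossy : 13 * n ≤ 20 * ∣ X ∣ₚ → ∀ v k d E E′ → 1 ≤ k → 2 * k ≤ d → d * d ≤ R → 4 * k ≤ R → 4 * E ≤ d → d * ∣ atypical E′ ∣ₚ < n →
      n * n ≤ k * o₂ (λ e q → h v e q ∧ (side false e ∧ side false q)) → 4 * E * o₂ (λ p q → h v p q ∧ base true X p q) ≤ n * n →
      Lossy T (d * d) E′ h ⊎ Lossy T (4 * k) E h
    outside-lossy lo v k d E E′ 1≤k 2k≤d dd≤R 4k≤R 4E≤d few dense inX
      with Finₚ.any? (λ e → ((n ≤ᵇ d * ∣ (λ q → h v e q ∧ (side false e ∧ side false q)) ∣ₚ) ∧ (n ≤ᵇ d * ∣ (λ q → h v e q ∧ X q) ∣ₚ)) Data.Bool.≟ true)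
    ... | yes (e , p) = let a , b = ∧-true {n ≤ᵇ d * ∣ (λ q → h v e q ∧ (side false e ∧ side false q)) ∣ₚ} p in
          inj₁ (both-sides-lossy v e d E′ (≤-trans 1≤k (≤-trans (m≤m+n k _) 2k≤d)) dd≤R few (≤ᵇ-true b)
            (≤-trans (≤ᵇ-true a) (*-monoʳ-≤ d (∑-mono (λ q → 𝟙-mono (λ m → let x , y = ∧-true {h v e q} m in ∧-intro x (proj₂ (∧-true {side false e} y))))))))
    ... | no none = inj₂ record
        { z = v ; u = v ; w = v ; t = true ; X = X ; A = A ; r = λ _ → zero ; s = cross
        ; gap = gap-from 4k≤R (≤-trans 1≤k (m≤n*m k 4)) bal false (o₂ W) (2 * (a * g)) sizes big
        ; error = four-parts E (linkError h v W) _ (o₂ B) (o₂ B) (o₂ C) errs inX (scale 4E≤d rowsB) (scale 4E≤d rowsB) (scale 4E≤d rowsC) }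
      where
      open ≤-Reasoning
      f : Fin n → Fin n → Bool
      f e q = h v e q ∧ (side false e ∧ side false q)
      P A : Fin n → Bool
      P e = n ≤ᵇ d * ∣ f e ∣ₚ
      A e = side false e ∧ P e
      W B C : Fin n → Fin n → Bool
      W p q = (base false X p q ∧ not (A p ∨ A q)) ∨ ((not (X p) ∧ not (X q)) ∧ (A p ∨ A q))
      B p q = h v p q ∧ (A p ∧ X q)
      C p q = f p q ∧ not (P p)
      x = ∣ X ∣ₚ
      y = ∣ side false ∣ₚ
      a = ∣ A ∣ₚ
      g = x ∸ y
      errs : linkError h v W ≤ o₂ (λ p q → h v p q ∧ base true X p q) + o₂ B + o₂ B + o₂ C
      errs = begin
        linkError h v W ≤⟨ ∑²-mono (λ p q → pt (h v p q) (X p) (X q) (P p) (P q)) ⟩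
        ∑² (λ p q → 𝟙 (h v p q ∧ base true X p q) + 𝟙 (B p q) + 𝟙 (h v p q ∧ (A q ∧ X p)) + 𝟙 (C p q))
          ≡⟨ trans (∑²-+ _ _) (cong (_+ o₂ C) (trans (∑²-+ _ _) (cong₂ _+_ (∑²-+ _ _) (trans (∑²-cong (λ p q → cong (λ b → 𝟙 (b ∧ (A q ∧ X p))) (s₂₃ v p q))) (o₂-transpose B))))) ⟩
        o₂ (λ p q → h v p q ∧ base true X p q) + o₂ B + o₂ B + o₂ C ∎
        where
        pt = bounded₅ (λ m xp xq pp pq → 𝟙 (m ∧ not (((xp xor xq) ∧ not ((not xp ∧ pp) ∨ (not xq ∧ pq))) ∨ ((not xp ∧ not xq) ∧ ((not xp ∧ pp) ∨ (not xq ∧ pq)))))) (λ m xp xq pp pq → 𝟙 (m ∧ (xp ∧ xq)) + 𝟙 (m ∧ ((not xp ∧ pp) ∧ xq)) + 𝟙 (m ∧ ((not xq ∧ pq) ∧ xp)) + 𝟙 ((m ∧ (not xp ∧ not xq)) ∧ not pp)) refl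
      rowsB : d * o₂ B ≤ n * n
      rowsB = rows-≤ d B (λ p → bool-case (n ≤ᵇ d * ∣ (λ q → h v p q ∧ X q) ∣ₚ)
        (λ b → bool-case (P p) (λ c → ⊥-elim (none (p , ∧-intro c b)))
          (λ c → ≤-trans (≤-reflexive (trans (cong (d *_) (∑-zero (λ q → cong 𝟙 (killed (h v p q) (side false p) (X q) c)))) (*-zeroʳ d))) z≤n))
        (λ b → ≤-trans (*-monoʳ-≤ d (∑-mono (λ q → 𝟙-mono (λ m → let i , j = ∧-true {h v p q} m in ∧-intro i (proj₂ (∧-true {A p} j)))))) (<⇒≤ (≤ᵇ-false b))))
        where
        killed : ∀ {c} a b e → c ≡ false → a ∧ ((b ∧ c) ∧ e) ≡ false
        killed true true true refl = refl
        killed true true false refl = refl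
        killed true false e refl = refl
        killed false b e refl = refl
      rowsC : d * o₂ C ≤ n * n
      rowsC = rows-≤ d C (λ p → bool-case (P p)
        (λ c → ≤-trans (≤-reflexive (trans (cong (d *_) (∑-zero (λ q → cong 𝟙 (killed (f p q) c)))) (*-zeroʳ d))) z≤n)
        (λ c → ≤-trans (*-monoʳ-≤ d (∑-mono (λ q → 𝟙-mono (λ m → proj₁ (∧-true {f p q} m))))) (<⇒≤ (≤ᵇ-false c))))
        where
        killed : ∀ {c} a → c ≡ true → a ∧ not c ≡ false
        killed true refl = refl
        killed false refl = refl
      x+y : x + y ≡ n
      x+y = trans (sym (∑-+ _ _)) (trans (∑-cong (λ i → one (X i))) (trans (∑-const {n} 1) (*-identityʳ n)))
        where
        one : ∀ b → 𝟙 b + 𝟙 (not b) ≡ 1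
        one true = refl
        one false = refl
      -- From x ≥ 13n/20 follows y ≤ 7n/20, so the sides differ by at least 6n/20.
      4g : n ≤ 4 * g
      4g = +-cancelʳ-≤ (4 * y) _ _ (begin
        n + 4 * y ≤⟨ *-cancelˡ-≤ 20 (begin
          20 * (n + 4 * y) ≤⟨ +-cancelʳ-≤ (80 * x) _ _ (begin
            20 * (n + 4 * y) + 80 * x ≡⟨ e₁ n x y ⟩
            20 * n + 80 * (x + y) ≡⟨ cong (λ m → 20 * n + 80 * m) x+y ⟩
            20 * n + 80 * n ≤⟨ ≤-trans (≤-reflexive (e₂ n)) (*-monoˡ-≤ n {100} {104} (m≤m+n 100 4)) ⟩
            104 * n ≡⟨ e₃ n ⟩
            8 * (13 * n) ≤⟨ *-monoʳ-≤ 8 lo ⟩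
            8 * (20 * x) ≡⟨ e₄ x ⟩
            20 * (4 * x) + 80 * x ∎) ⟩
          20 * (4 * x) ∎) ⟩
        4 * x ≤⟨ *-monoʳ-≤ 4 (≤-trans (m≤n+m∸n x y) (≤-reflexive (+-comm y g))) ⟩
        4 * (g + y) ≡⟨ *-distribˡ-+ 4 g y ⟩
        4 * g + 4 * y ∎)
        where
        e₁ : ∀ n x y → 20 * (n + 4 * y) + 80 * x ≡ 20 * n + 80 * (x + y)
        e₁ = solve-∀
        e₂ : ∀ n → 20 * n + 80 * n ≡ 100 * n
        e₂ = solve-∀
        e₃ : ∀ n → 104 * n ≡ 8 * (13 * n)
        e₃ = solve-∀
        e₄ : ∀ x → 8 * (20 * x) ≡ 20 * (4 * x) + 80 * x
        e₄ = solve-∀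
      an : n ≤ 2 * k * a
      an = ≤-trans (popular k f dense) (*-monoʳ-≤ (2 * k) (∑-mono (λ e → 𝟙-mono (λ p → ∧-intro (side-P e (≤ᵇ-true {n} {2 * k * ∣ f e ∣ₚ} p)) (≤ᵇ-intro {n} {d * ∣ f e ∣ₚ} (≤-trans (≤ᵇ-true {n} {2 * k * ∣ f e ∣ₚ} p) (*-monoˡ-≤ ∣ f e ∣ₚ 2k≤d)))))))
        where
        side-P : ∀ e → n ≤ 2 * k * ∣ f e ∣ₚ → side false e ≡ true
        side-P e p = bool-case (side false e) id (λ c → ⊥-elim (≤⇒≯ (≤-reflexive (trans (cong (2 * k *_) (∑-zero (λ q → cong 𝟙 (∧f (h v e q) (side false q) c)))) (*-zeroʳ (2 * k)))) (≤-trans n>0 p)))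
          where
          ∧f : ∀ {c} b e → c ≡ false → b ∧ (c ∧ e) ≡ false
          ∧f true _ refl = refl
          ∧f false _ refl = refl
      big : n * n ≤ 4 * k * (2 * (a * g))
      big = ≤-trans (*-mono-≤ an 4g) (≤-reflexive (e₁ k a g))
        where
        e₁ : ∀ k a g → 2 * k * a * (4 * g) ≡ 4 * k * (2 * (a * g))
        e₁ = solve-∀
      y+g : y + g ≡ x
      y+g = m+[n∸m]≡n {y} {x} (≮⇒≥ (λ x<y → ≤⇒≯ 4g (subst (_< n) (sym (trans (cong (4 *_) (m≤n⇒m∸n≡0 (<⇒≤ x<y))) refl)) n>0)))
      -- Each vertex of A exchanges x pairs for at most y, in both orders, which saves 2a(x - y) in
      -- total.
      sizes : o₂ W + 2 * (a * g) ≤ o₂ (base false X)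
      sizes = +-cancelʳ-≤ (2 * (a * y)) _ _ (begin
        o₂ W + 2 * (a * g) + 2 * (a * y) ≡⟨ trans (e₁ (o₂ W) a g y) (cong (λ x → o₂ W + (a * x + a * x)) y+g) ⟩
        o₂ W + (a * x + a * x) ≡⟨ cong (o₂ W +_) (sym (cong₂ _+_ (o₂-prod A X) (trans (o₂-transpose (λ p q → A p ∧ X q)) (o₂-prod A X)))) ⟩
        o₂ W + (o₂ (λ p q → A p ∧ X q) + o₂ (λ p q → A q ∧ X p)) ≡⟨ sym (trans (∑²-+ _ _) (cong (o₂ W +_) (∑²-+ _ _))) ⟩
        ∑² (λ p q → 𝟙 (W p q) + (𝟙 (A p ∧ X q) + 𝟙 (A q ∧ X p))) ≤⟨ ∑²-mono (λ p q → pt (X p) (X q) (P p) (P q)) ⟩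
        ∑² (λ p q → 𝟙 (base false X p q) + (𝟙 (A p ∧ side false q) + 𝟙 (A q ∧ side false p))) ≡⟨ trans (∑²-+ _ _) (cong (o₂ (base false X) +_) (∑²-+ _ _)) ⟩
        o₂ (base false X) + (o₂ (λ p q → A p ∧ side false q) + o₂ (λ p q → A q ∧ side false p))
          ≡⟨ cong (o₂ (base false X) +_) (cong₂ _+_ (o₂-prod A (side false)) (trans (o₂-transpose (λ p q → A p ∧ side false q)) (o₂-prod A (side false)))) ⟩
        o₂ (base false X) + (a * y + a * y) ≡⟨ cong (o₂ (base false X) +_) (cong (a * y +_) (sym (+-identityʳ _))) ⟩
        o₂ (base false X) + 2 * (a * y) ∎)
        where
        e₁ : ∀ w a g y → w + 2 * (a * g) + 2 * (a * y) ≡ w + (a * (y + g) + a * (y + g))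
        e₁ = solve-∀
        pt = bounded₅ (λ _ xp xq pp pq → 𝟙 (((xp xor xq) ∧ not ((not xp ∧ pp) ∨ (not xq ∧ pq))) ∨ ((not xp ∧ not xq) ∧ ((not xp ∧ pp) ∨ (not xq ∧ pq)))) + (𝟙 ((not xp ∧ pp) ∧ xq) + 𝟙 ((not xq ∧ pq) ∧ xp))) (λ _ xp xq pp pq → 𝟙 (xp xor xq) + (𝟙 ((not xp ∧ pp) ∧ not xq) + 𝟙 ((not xq ∧ pq) ∧ not xp))) refl true

    -- In `base t` each vertex of A has a row of length |X|, at least n/2, but in the link of z
    -- these rows are nearly empty. Dropping them from the base costs few errors.
    outer-lossy : n ≤ 2 * ∣ X ∣ₚ → ∀ z t A s′ s E → 1 ≤ s′ → 2 * s′ ≤ R → 4 * E ≤ s → (∀ p → A p ≡ true → X p ≡ t) → n ≤ s′ * ∣ A ∣ₚ →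
      (∀ p → A p ≡ true → s * ∣ (λ q → h z p q ∧ base t X p q) ∣ₚ ≤ n) → 4 * E * linkError h z (base t X) ≤ n * n → Lossy T (2 * s′) E h
    outer-lossy half z t A s′ s E 1≤s′ sR 4E≤s At big meagre er = record
      { z = z ; u = z ; w = z ; t = t ; X = X ; A = A ; r = λ _ → zero ; s = outer
      ; gap = gap-from sR (*-mono-≤ {1} {2} (s≤s z≤n) 1≤s′) bal t (o₂ W) (∣ A ∣ₚ * ∣ X ∣ₚ) (subst (λ m → o₂ W + m ≤ o₂ (base t X)) (o₂-prod A X)
          (o₂-remove W (λ p q → A p ∧ X q) (base t X) (λ p q e → proj₁ (∧-true e)) (λ p q e → let a , b = ∧-true {A p} e in in-base t p q (At p a) b , killed (base t X p q) (A q) a)))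
          (≤-trans (*-mono-≤ big half) (≤-reflexive (e₁ s′ ∣ A ∣ₚ ∣ X ∣ₚ)))
      ; error = four-parts E (linkError h z W) (linkError h z (base t X)) (o₂ B) (o₂ B) 0 errs er (scale 4E≤s rowsB) (scale 4E≤s rowsB) (≤-trans (≤-reflexive (*-zeroʳ (4 * E))) z≤n) }
      where
      open ≤-Reasoning
      W B : Fin n → Fin n → Bool
      W p q = base t X p q ∧ not (A p ∨ A q)
      B p q = (h z p q ∧ base t X p q) ∧ A p
      e₁ : ∀ s a x → s * a * (2 * x) ≡ 2 * s * (a * x)
      e₁ = solve-∀
      in-base : ∀ t p q → X p ≡ t → X q ≡ true → base t X p q ≡ true
      in-base true p q a b = ∧-intro a b
      in-base false p q a b = cong₂ _xor_ a b
      killed : ∀ {a} b c → a ≡ true → b ∧ not (a ∨ c) ≡ false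
      killed true c refl = refl
      killed false c refl = refl
      errs : linkError h z W ≤ linkError h z (base t X) + o₂ B + o₂ B + 0
      errs = begin
        linkError h z W ≤⟨ ∑²-mono (λ p q → pt (h z p q) (base t X p q) (A p) (A q)) ⟩
        ∑² (λ p q → 𝟙 (h z p q ∧ not (base t X p q)) + 𝟙 (B p q) + 𝟙 ((h z p q ∧ base t X p q) ∧ A q))
          ≡⟨ trans (∑²-+ _ _) (cong₂ _+_ (∑²-+ _ _) (trans (∑²-cong (λ p q → cong (λ b → 𝟙 (b ∧ A q)) (cong₂ _∧_ (s₂₃ z p q) (base-sym t X p q)))) (o₂-transpose B))) ⟩
        linkError h z (base t X) + o₂ B + o₂ B ≡⟨ sym (+-identityʳ _) ⟩
        linkError h z (base t X) + o₂ B + o₂ B + 0 ∎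
        where
        pt = bounded₅ (λ _ m b a c → 𝟙 (m ∧ not (b ∧ not (a ∨ c)))) (λ _ m b a c → 𝟙 (m ∧ not b) + 𝟙 ((m ∧ b) ∧ a) + 𝟙 ((m ∧ b) ∧ c)) refl true
      rowsB : s * o₂ B ≤ n * n
      rowsB = rows-≤ s B (λ p → bool-case (A p)
        (λ e → ≤-trans (*-monoʳ-≤ s (∑-mono (λ q → 𝟙-mono (λ m → proj₁ (∧-true {h z p q ∧ base t X p q} m))))) (meagre p e))
        (λ e → ≤-trans (≤-reflexive (trans (cong (s *_) (∑-zero (λ q → cong 𝟙 (∧f (h z p q ∧ base t X p q) e)))) (*-zeroʳ s))) z≤n))
        where
        ∧f : ∀ {c} b → c ≡ false → b ∧ c ≡ false
        ∧f true refl = refl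
        ∧f false refl = refl

    both : Bool → Fin n → Fin n → Fin n → Fin n → Bool
    both t u w p q = base t X p q ∧ (h u p q ∧ h w p q)

    -- The pairs through z are left out of `W` because the decoder cannot see the edges there; this
    -- costs nothing, since no such pair lies in the link of z.
    common-lossy : ∀ t z u w D E → z ≢ u → z ≢ w → 1 ≤ D → D ≤ R → n * n ≤ D * o₂ (both t u w) →
      2 * E * linkError h z (base t X) ≤ n * n → 2 * E * o₂ (λ p q → h z p q ∧ both t u w p q) ≤ n * n → Lossy T D E h
    common-lossy t z u w D E z≢u z≢w 1≤D D≤R big er er′ = record
      { z = z ; u = u ; w = w ; t = t ; X = X ; A = X ; r = λ _ → zero ; s = common
      ; gap = gap-from D≤R 1≤D bal t (o₂ W) (o₂ (both t u w)) (o₂-remove W (both t u w) (base t X)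
                (λ p q e → proj₁ (∧-true (proj₁ (∧-true {base t X p q ∧ not ((z ==ᶠ p) ∨ (z ==ᶠ q))} e)))) (λ p q e → proj₁ (∧-true e) , excl p q e)) big
      ; error = two-parts E _ _ _ errs er er′ }
      where
      g = off z h
      W : Fin n → Fin n → Bool
      W p q = (base t X p q ∧ not ((z ==ᶠ p) ∨ (z ==ᶠ q))) ∧ not (g u p q ∧ g w p q)
      excl : ∀ p q → both t u w p q ≡ true → W p q ≡ false
      excl p q e = bool-case ((z ==ᶠ p) ∨ (z ==ᶠ q)) (λ c → near (base t X p q) _ c) (λ c → far (base t X p q ∧ not ((z ==ᶠ p) ∨ (z ==ᶠ q)))
          (trans (off-agree z≢u (left c) (right c)) (proj₁ (∧-true {h u p q} (proj₂ (∧-true {base t X p q} e)))))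
          (trans (off-agree z≢w (left c) (right c)) (proj₂ (∧-true {h u p q} (proj₂ (∧-true {base t X p q} e))))))
        where
        near : ∀ b d {c} → c ≡ true → (b ∧ not c) ∧ d ≡ false
        near true d refl = refl
        near false d refl = refl
        far : ∀ b {c d} → c ≡ true → d ≡ true → b ∧ not (c ∧ d) ≡ false
        far true refl refl = refl
        far false refl refl = refl
        ∨-false : ∀ {a b} → a ∨ b ≡ false → a ≡ false × b ≡ false
        ∨-false {false} e = refl , e
        left : (z ==ᶠ p) ∨ (z ==ᶠ q) ≡ false → z ≢ p
        left c z≡p = true≢false (subst (λ p → (z ==ᶠ p) ≡ true) z≡p (==ᶠ-refl z)) (proj₁ (∨-false {z ==ᶠ p} c))
        right : (z ==ᶠ p) ∨ (z ==ᶠ q) ≡ false → z ≢ q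
        right c z≡q = true≢false (subst (λ q → (z ==ᶠ q) ≡ true) z≡q (==ᶠ-refl z)) (proj₂ (∨-false {z ==ᶠ p} c))
      errs : linkError h z W ≤ linkError h z (base t X) + o₂ (λ p q → h z p q ∧ both t u w p q)
      errs = ≤-trans (∑²-mono (λ p q → pt p q)) (≤-reflexive (∑²-+ _ _))
        where
        off-h : ∀ a p q → g a p q ≡ true → h a p q ≡ true
        off-h a p q e = proj₂ (∧-true {not (z ==ᶠ a) ∧ (not (z ==ᶠ p) ∧ not (z ==ᶠ q))} e)
        logic : ∀ {m b e gu gw hu hw} → (m ≡ true → e ≡ false) → (gu ≡ true → hu ≡ true) → (gw ≡ true → hw ≡ true) →
          𝟙 (m ∧ not ((b ∧ not e) ∧ not (gu ∧ gw))) ≤ 𝟙 (m ∧ not b) + 𝟙 (m ∧ (b ∧ (hu ∧ hw)))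
        logic {false} _ _ _ = z≤n
        logic {true} {false} _ _ _ = ≤-refl
        logic {true} {true} {true} f _ _ = case f refl of λ ()
        logic {true} {true} {false} {false} _ _ _ = z≤n
        logic {true} {true} {false} {true} {false} _ _ _ = z≤n
        logic {true} {true} {false} {true} {true} _ i j rewrite i refl | j refl = ≤-refl
        pt : ∀ p q → 𝟙 (h z p q ∧ not (W p q)) ≤ 𝟙 (h z p q ∧ not (base t X p q)) + 𝟙 (h z p q ∧ both t u w p q)
        pt p q = logic {h z p q} {base t X p q} {(z ==ᶠ p) ∨ (z ==ᶠ q)} {g u p q} {g w p q} (λ m → distinct m) (off-h u p q) (off-h w p q)
          where
          distinct : h z p q ≡ true → (z ==ᶠ p) ∨ (z ==ᶠ q) ≡ false
          distinct m with z Finₚ.≟ p | z Finₚ.≟ q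
          ... | yes refl | _ = ⊥-elim (true≢false m (irr z q))
          ... | no _ | yes refl = ⊥-elim (true≢false m (trans (s₂₃ z p z) (irr z p)))
          ... | no z≢p | no z≢q = refl

-- A system without lossy links is thin around its best partition.

module Rigidity where
 one : Bool → Bool → Bool → Bool
 one x y z = two (not x) (not y) (not z)

 base-if : ∀ {n} t (X : Fin n → Bool) p q → base t X p q ≡ (if t then X p ∧ X q else X p xor X q)
 base-if true X p q = refl
 base-if false X p q = refl

 two-base : ∀ {n} (X : Fin n → Bool) v p q → two (X v) (X p) (X q) ≡ base (not (X v)) X p q
 two-base X v p q = trans (lemma (X v) (X p) (X q)) (sym (base-if (not (X v)) X p q))
   where
   lemma : ∀ a b c → two a b c ≡ (if not a then b ∧ c else b xor c)
   lemma true b c = refl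
   lemma false b c = refl

 -- The graph G of the overview. In an edge with exactly one vertex in X, both pairs through that
 -- vertex are crossing.
 crossing : ∀ {n} → (Fin n → Fin n → Fin n → Bool) → (Fin n → Bool) → Fin n → Fin n → Bool
 crossing h X a b = (X a xor X b) ∧ does (Finₚ.any? (λ c → (not (X c) ∧ h a b c) Data.Bool.≟ true))

 record Thin {n} (h : Fin n → Fin n → Fin n → Bool) (X : Fin n → Bool) (s s′ : ℕ) : Set where
   field
     shape    : ∀ a b c → h a b c ≡ true → two (X a) (X b) (X c) ∨ one (X a) (X b) (X c) ≡ true
     degree   : ∀ a → s′ * ∣ crossing h X a ∣ₚ ≤ n
     codegree : ∀ a b → crossing h X a b ≡ true → s * ∣ (λ q → h a b q ∧ X q) ∣ₚ ≤ n

 -- Thresholds, to be chosen in the order s′, s, c₁, c₂, F, k₃, d, k, R, E₀; 𝓔 D is the accuracy required at density gap 1/(9D).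
 record Constants : Set where
   field
     𝓔 : ℕ → ℕ
     s′ s c₁ c₂ F k₃ d k R E₀ θ : ℕ
     T≡ : θ ≡ 2 * (2 * k)
     1≤s′ : 1 ≤ s′
     1≤s : 1 ≤ s
     1≤c₁ : 1 ≤ c₁
     1≤c₂ : 1 ≤ c₂
     1≤k₃ : 1 ≤ k₃
     1≤k : 1 ≤ k
     R₁ : 2 * (2 * k) * (2 * (2 * k)) ≤ R
     R₂ : d * d ≤ R
     R₃ : 4 * k₃ ≤ R
     R₄ : c₂ ≤ R
     R₅ : c₁ ≤ R
     R₇ : s * s ≤ R
     R₈ : 2 * s′ ≤ R
     d₁ : 2 * k₃ ≤ d
     d₂ : 4 * 𝓔 (4 * k₃) ≤ d
     k-k₃ : k₃ ≤ 2 * k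
     k-𝓔 : 4 * 𝓔 (4 * k₃) ≤ k
     k-F : 2 * F ≤ k
     k₃-F : 2 * F ≤ k₃
     F₁ : 2 * 𝓔 c₂ ≤ F
     F₂ : 2 * 𝓔 c₁ ≤ F
     F₃ : 2 * 𝓔 1 ≤ F
     F₄ : 𝓔 (s * s) ≤ F
     F₅ : 4 * 𝓔 (2 * s′) ≤ F
     c₂-𝓔 : 2 * 𝓔 c₁ ≤ c₂
     c₁-𝓔 : 2 * 𝓔 1 ≤ c₁
     s-𝓔 : 4 * 𝓔 (2 * s′) ≤ s
     E₁ : 2 * (2 * k) * 𝓔 (2 * (2 * k) * (2 * (2 * k))) < E₀
     E₂ : d * 𝓔 (d * d) < E₀

   levels : List ℕ
   levels = 2 * (2 * k) * (2 * (2 * k)) ∷ d * d ∷ 4 * k₃ ∷ c₂ ∷ c₁ ∷ 1 ∷ s * s ∷ 2 * s′ ∷ []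

 module Rigid (K : Constants) {n : ℕ} (h : Fin n → Fin n → Fin n → Bool) (hs : Sym₃ h) (irr : ∀ a b → h a a b ≡ false) (ff : F-free h)
   (X : Fin n → Bool) (bal : Gaps.Balanced {n} (Constants.R K) X) (lo : 13 * n ≤ 20 * ∣ X ∣ₚ) (n>0 : 1 ≤ n)
   (opt : ∀ v → linkError h v (base (not (X v)) X) ≤ linkError h v (base (X v) X))
   (total : Constants.E₀ K * ∑ (λ v → linkError h v (base (not (X v)) X)) ≤ n * n * n)
   (nl : ∀ {D} → D ∈ₗ Constants.levels K → Lossy (Constants.θ K) D (Constants.𝓔 K D) h → ⊥) where
   open Constants K
   open Sym₃ hs
   open Structure h hs irr ff θ R

   own : Fin n → ℕ
   own v = linkError h v (base (not (X v)) X)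

   -- Markov's inequality: every atypical vertex accounts for more than n²/E of the bad triples
   -- counted in `total`.
   few : ∀ c E → c * E < E₀ → c * ∣ atypical X bal n>0 E ∣ₚ < n
   few c E small-E = ≰⇒> (λ large → <⇒≱ small-E (*-cancelˡ-≤ (n * n * n) ⦃ m*n≢0 (n * n) n ⦃ m*n≢0 n n ⦄ ⦄ (begin
     n * n * n * E₀ ≤⟨ *-monoˡ-≤ E₀ (*-monoʳ-≤ (n * n) large) ⟩
     n * n * (c * a) * E₀ ≡⟨ e₁ (n * n) c a E₀ ⟩
     E₀ * (c * (n * n * a)) ≤⟨ *-monoʳ-≤ E₀ (*-monoʳ-≤ c (≤-trans (≤-reflexive (sym (∑-*ˡ (n * n) _))) (≤-trans (∑-mono pt) (≤-reflexive (∑-*ˡ E own))))) ⟩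
     E₀ * (c * (E * ∑ own)) ≡⟨ e₂ E₀ c E (∑ own) ⟩
     c * E * (E₀ * ∑ own) ≤⟨ *-monoʳ-≤ (c * E) total ⟩
     c * E * (n * n * n) ≡⟨ *-comm (c * E) _ ⟩
     n * n * n * (c * E) ∎)))
     where
     open ≤-Reasoning
     instance
       nz : NonZero n
       nz = >-nonZero n>0
     a = ∣ atypical X bal n>0 E ∣ₚ
     e₁ : ∀ m c a e → m * (c * a) * e ≡ e * (c * (m * a))
     e₁ = solve-∀
     e₂ : ∀ e c E s → e * (c * (E * s)) ≡ c * E * (e * s)
     e₂ = solve-∀
     pt : ∀ v → n * n * 𝟙 (atypical X bal n>0 E v) ≤ E * own v
     pt v = bool-case (typical E X v) (λ e → ≤-trans (≤-reflexive (trans (cong (λ b → n * n * 𝟙 (not b)) e) (*-zeroʳ (n * n)))) z≤n)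
       (λ e → ≤-trans (≤-reflexive (trans (cong (λ b → n * n * 𝟙 (not b)) e) (*-identityʳ _))) (<⇒≤ (≤ᵇ-false e)))

   XX XY YX YY : Fin n → ℕ
   XX v = o₂ (λ p q → h v p q ∧ base true X p q)
   XY v = o₂ (λ p q → h v p q ∧ base false X p q)
   YX v = o₂ (λ e q → h v e q ∧ (not (X e) ∧ X q))
   YY v = o₂ (λ e q → h v e q ∧ (not (X e) ∧ not (X q)))

   XY≤2YX : ∀ v → XY v ≤ 2 * YX v
   XY≤2YX v = begin
     XY v ≤⟨ ∑²-mono (λ p q → pt (h v p q) (X p) (X q)) ⟩
     ∑² (λ p q → 𝟙 (h v p q ∧ (not (X p) ∧ X q)) + 𝟙 (h v p q ∧ (not (X q) ∧ X p)))
       ≡⟨ trans (∑²-+ _ _) (cong (YX v +_) (trans (∑²-cong (λ p q → cong (λ b → 𝟙 (b ∧ (not (X q) ∧ X p))) (s₂₃ v p q))) (trans (o₂-transpose (λ e q → h v e q ∧ (not (X e) ∧ X q))) (sym (+-identityʳ _))))) ⟩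
     2 * YX v ∎
     where
     open ≤-Reasoning
     pt = bounded₅ (λ _ _ m x y → 𝟙 (m ∧ (x xor y))) (λ _ _ m x y → 𝟙 (m ∧ (not x ∧ y)) + 𝟙 (m ∧ (not y ∧ x))) refl true true

   -- Moving v across the partition does not help, so its own side gives the smaller of the two link
   -- errors.
   own-≤ : ∀ v t → own v ≤ linkError h v (base t X)
   own-≤ v t = go t (X v) refl
     where
     go : ∀ t x → X v ≡ x → own v ≤ linkError h v (base t X)
     go true false e = ≤-reflexive (cong (λ x → linkError h v (base (not x) X)) e)
     go false true e = ≤-reflexive (cong (λ x → linkError h v (base (not x) X)) e)
     go true true e = ≤-trans (opt v) (≤-reflexive (cong (λ x → linkError h v (base x X)) e))
     go false false e = ≤-trans (opt v) (≤-reflexive (cong (λ x → linkError h v (base x X)) e))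

   own-XX : ∀ v → own v ≤ XX v + YY v
   own-XX v = ≤-trans (own-≤ v false) (≤-trans (∑²-mono (λ p q → pt (h v p q) (X p) (X q))) (≤-reflexive (∑²-+ _ _)))
     where
     pt = bounded₅ (λ _ _ m x y → 𝟙 (m ∧ not (x xor y))) (λ _ _ m x y → 𝟙 (m ∧ (x ∧ y)) + 𝟙 (m ∧ (not x ∧ not y))) refl true true

   own-XY : ∀ v → own v ≤ XY v + YY v
   own-XY v = ≤-trans (own-≤ v true) (≤-trans (∑²-mono (λ p q → pt (h v p q) (X p) (X q))) (≤-reflexive (∑²-+ _ _)))
     where
     pt = bounded₅ (λ _ _ m x y → 𝟙 (m ∧ not (x ∧ y))) (λ _ _ m x y → 𝟙 (m ∧ (x xor y)) + 𝟙 (m ∧ (not x ∧ not y))) refl true true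

   1≤2k : 1 ≤ 2 * k
   1≤2k = *-mono-≤ {1} {2} (s≤s z≤n) 1≤k

   few₁ = few (2 * (2 * k)) (𝓔 (2 * (2 * k) * (2 * (2 * k)))) E₁

   double : ∀ x → n * n ≤ k * x → n * n ≤ 2 * k * x
   double x p = ≤-trans p (*-monoˡ-≤ x (m≤m+n k _))

   -- Many link pairs outside X make a link lossy. If there are also many inside X, the two kinds
   -- conflict through a third vertex, by `mixed-lossy` with `t = false`; if there are few inside X,
   -- `outside-lossy` applies.
   YY-small : ∀ v → k₃ * YY v < n * n
   YY-small v = ≰⇒> (λ big → case n * n Data.Nat.≤? k * XX v of λ
     { (yes bigX) → nl (here refl) (mixed-lossy X bal n>0 false v (2 * k) _ T≡ 1≤2k R₁ few₁ (≤-trans big (*-monoˡ-≤ (YY v) k-k₃)) (double (XX v) bigX))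
     ; (no smallX) → case outside-lossy X bal n>0 lo v k₃ d (𝓔 (4 * k₃)) (𝓔 (d * d)) 1≤k₃ d₁ R₂ R₃ d₂ (few d (𝓔 (d * d)) E₂) big (scale k-𝓔 (<⇒≤ (≰⇒> smallX))) of λ
         { (inj₁ l) → nl (there (here refl)) l ; (inj₂ l) → nl (there (there (here refl))) l } })

   -- If the link has few pairs inside X or few pairs across, it fits one of the two bases up to the
   -- small `YY`. If it has many of both, `mixed-lossy` with `t = true` applies.
   typical-all : ∀ v → F * own v ≤ n * n
   typical-all v = case n * n Data.Nat.≤? k * XX v of λ
     { (no ¬x) → two-parts F (own v) (XX v) (YY v) (own-XX v) (scale k-F (<⇒≤ (≰⇒> ¬x))) Y
     ; (yes x) → case n * n Data.Nat.≤? k * XY v of λ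
       { (no ¬y) → two-parts F (own v) (XY v) (YY v) (own-XY v) (scale k-F (<⇒≤ (≰⇒> ¬y))) Y
       ; (yes y) → ⊥-elim (nl (here refl) (mixed-lossy X bal n>0 true v (2 * k) _ T≡ 1≤2k R₁ few₁ (double (XX v) x)
           (≤-trans y (≤-trans (*-monoʳ-≤ k (XY≤2YX v)) (≤-reflexive (e k (YX v))))))) } }
     where
     Y = scale k₃-F (<⇒≤ (YY-small v))
     e : ∀ k y → k * (2 * y) ≡ 2 * k * y
     e = solve-∀

   typical-link : ∀ v t → X v ≡ not t → F * linkError h v (base t X) ≤ n * n
   typical-link v true e = subst (λ x → F * linkError h v (base (not x) X) ≤ n * n) e (typical-all v)
   typical-link v false e = subst (λ x → F * linkError h v (base (not x) X) ≤ n * n) e (typical-all v)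

   distinct : ∀ {a b c} → h a b c ≡ true → a ≢ b
   distinct {a} {b} {c} e a≡b = true≢false (subst (λ b → h a b c ≡ true) (sym a≡b) e) (irr a c)

   private
     B₂ = both X bal n>0

   -- No pair lies in the links of a, b and c, since it would form F with the edge a b c. So the
   -- link of c avoids the pairs common to those of a and b, which must therefore be few. Then the
   -- link of b avoids nearly all of the link of a, which must therefore be small as well. But a
   -- link that is almost void is lossy.
   same-type : ∀ t a b c → X a ≡ not t → X b ≡ not t → X c ≡ not t → h a b c ≡ true → ⊥
   same-type t a b c xa xb xc e = nl (there (there (there (there (there (here refl)))))) alone
     where
     open ≤-Reasoning
     step₁ : c₂ * o₂ (B₂ t a b) < n * n
     step₁ = ≰⇒> (λ big → nl (there (there (there (here refl)))) (common-lossy X bal n>0 t c a b c₂ (𝓔 c₂)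
       (λ c≡a → distinct (trans (sym (rot′ a b c)) e) c≡a) (λ c≡b → distinct (trans (sym (s₁₃ a b c)) e) c≡b) 1≤c₂ R₄ big
       (scale F₁ (typical-link c t xc)) (≤-trans (≤-reflexive (trans (cong (2 * 𝓔 c₂ *_) (∑-zero (λ p → ∑-zero (λ q → cong 𝟙 (¬true⇒false (λ m →
         let m₁ , m₂ = ∧-true {h c p q} m
             _ , m₃ = ∧-true {base t X p q} m₂
             m₄ , m₅ = ∧-true {h a p q} m₃
         in ff p q a b c (trans (sym (rot a p q)) m₄) (trans (sym (rot b p q)) m₅) (trans (sym (rot c p q)) m₁) e)))))) (*-zeroʳ (2 * 𝓔 c₂)))) z≤n)))
     step₂ : c₁ * o₂ (B₂ t a a) < n * n
     step₂ = ≰⇒> (λ big → nl (there (there (there (there (here refl))))) (common-lossy X bal n>0 t b a a c₁ (𝓔 c₁)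
       (λ b≡a → distinct e (sym b≡a)) (λ b≡a → distinct e (sym b≡a)) 1≤c₁ R₅ big (scale F₂ (typical-link b t xb))
       (scale c₂-𝓔 (≤-trans (*-monoʳ-≤ c₂ (∑²-mono (λ p q → 𝟙-mono (λ m →
         let m₁ , m₂ = ∧-true {h b p q} m
             m₃ , m₄ = ∧-true {base t X p q} m₂
         in ∧-intro m₃ (∧-intro (proj₁ (∧-true {h a p q} m₄)) m₁))))) (<⇒≤ step₁)))))
     alone : Lossy θ 1 (𝓔 1) h
     alone = record
       { z = a ; u = a ; w = a ; t = t ; X = X ; A = X ; r = λ _ → zero ; s = empty
       ; gap = ≤-trans (≤-reflexive (trans (cong (λ m → 1 * (9 * m) + n * n) (∑-zero (λ p → ∑-zero {n} (λ q → refl)))) refl)) (≤-trans (m≤n*m (n * n) 4) (≤-reflexive (sym (*-identityˡ _))))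
       ; error = two-parts (𝓔 1) _ _ _ errs (scale F₃ (typical-link a t xa)) (scale c₁-𝓔 (<⇒≤ step₂)) }
       where
       errs : ∑² (λ p q → 𝟙 (h a p q ∧ true)) ≤ linkError h a (base t X) + o₂ (B₂ t a a)
       errs = ≤-trans (∑²-mono (λ p q → pt (h a p q) (base t X p q))) (≤-reflexive (∑²-+ _ _))
         where
         pt : ∀ m b → 𝟙 (m ∧ true) ≤ 𝟙 (m ∧ not b) + 𝟙 (b ∧ (m ∧ m))
         pt true true = ≤-refl
         pt true false = ≤-refl
         pt false b = z≤n

   private
     G = crossing h X

   crossing⇒ : ∀ a b → G a b ≡ true → (X a xor X b) ≡ true × ∃[ c ] (X c ≡ false × h a b c ≡ true)
   crossing⇒ a b e = let p , q = ∧-true {X a xor X b} e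
                         c , m = does-sound (Finₚ.any? (λ c → (not (X c) ∧ h a b c) Data.Bool.≟ true)) q
                         x , y = ∧-true {not (X c)} m
                     in p , c , not-true x , y

   -- Let c outside X be the third vertex that makes a b crossing. No edge joins c to two further
   -- neighbours of {a, b}, so the neighbours in X span a square missing from the link of c.
   codegree : ∀ a b → G a b ≡ true → s * ∣ (λ q → h a b q ∧ X q) ∣ₚ ≤ n
   codegree a b e = <⇒≤ (≰⇒> (λ big → let _ , c , xc , m = crossing⇒ a b e in
     nl (there (there (there (there (there (there (here refl)))))))
       (inner-lossy bal s (𝓔 (s * s)) c (λ q → h a b q ∧ X q) 1≤s R₇ (λ p i → proj₂ (∧-true {h a b p} i))
         (λ p q i j k → ff a b c p q m (proj₁ (∧-true {h a b p} i)) (proj₁ (∧-true {h a b q} j)) k) big (scale F₄ (typical-link c true xc)))))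

   -- By `codegree`, the row of every crossing neighbour in the link of a is short. Many of them
   -- would make a lossy by `outer-lossy`.
   degree : ∀ a → s′ * ∣ G a ∣ₚ ≤ n
   degree a = <⇒≤ (≰⇒> (λ big → nl (there (there (there (there (there (there (there (here refl))))))))
     (outer-lossy X bal n>0 half a (not (X a)) (G a) s′ s (𝓔 (2 * s′)) 1≤s′ R₈ s-𝓔 (λ p i → flip (X a) (X p) (proj₁ (∧-true {X a xor X p} i))) big
       (λ p i → ≤-trans (*-monoʳ-≤ s (∑-mono (λ q → 𝟙-mono (λ m → let x , y = ∧-true {h a p q} m in
          ∧-intro x (second (X a) (X p) (X q) (proj₁ (∧-true {X a xor X p} i)) (trans (sym (base-if (not (X a)) X p q)) y)))))) (codegree a p i))
       (scale F₅ (typical-link a (not (X a)) (sym (not-involutive (X a))))))))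
     where
     flip : ∀ x y → (x xor y) ≡ true → y ≡ not x
     flip true false _ = refl
     flip false true _ = refl
     second : ∀ x y z → (x xor y) ≡ true → (if not x then y ∧ z else y xor z) ≡ true → z ≡ true
     second true false true _ _ = refl
     second false true true _ _ = refl
     half : n ≤ 2 * ∣ X ∣ₚ
     half = *-cancelˡ-≤ 10 (≤-trans (*-monoˡ-≤ n {10} {13} (m≤m+n 10 3)) (≤-trans lo (≤-reflexive (e ∣ X ∣ₚ))))
       where
       e : ∀ x → 20 * x ≡ 10 * (2 * x)
       e = solve-∀

   thin : Thin h X s s′
   thin = record { shape = λ a b c m → go a b c m (X a) (X b) (X c) refl refl refl ; degree = degree ; codegree = codegree }
     where
     go : ∀ a b c → h a b c ≡ true → ∀ x y z → X a ≡ x → X b ≡ y → X c ≡ z → two (X a) (X b) (X c) ∨ one (X a) (X b) (X c) ≡ true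
     go a b c m true true true p q r = ⊥-elim (same-type false a b c p q r m)
     go a b c m false false false p q r = ⊥-elim (same-type true a b c p q r m)
     go a b c m true true false p q r rewrite p | q | r = refl
     go a b c m true false true p q r rewrite p | q | r = refl
     go a b c m true false false p q r rewrite p | q | r = refl
     go a b c m false true true p q r rewrite p | q | r = refl
     go a b c m false true false p q r rewrite p | q | r = refl
     go a b c m false false true p q r rewrite p | q | r = refl

open Rigidity

-- Optimal partitions and their balance.

module Partitions where
 minimal : ∀ n (f : Vec Bool n → ℕ) → ∃[ X ] (∀ Y → f X ≤ f Y)
 minimal zero f = [] , λ { [] → ≤-refl }
 minimal (suc n) f = let X , p = minimal n (λ v → f (true ∷ v))
                         Y , q = minimal n (λ v → f (false ∷ v))
   in case ≤-total (f (true ∷ X)) (f (false ∷ Y)) of λ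
     { (inj₁ le) → true ∷ X , λ { (true ∷ v) → p v ; (false ∷ v) → ≤-trans le (q v) }
     ; (inj₂ le) → false ∷ Y , λ { (true ∷ v) → ≤-trans le (p v) ; (false ∷ v) → q v } }

 maximal : ∀ n (f : Vec Bool n → ℕ) → ∃[ X ] (∀ Y → f Y ≤ f X)
 maximal zero f = [] , λ { [] → ≤-refl }
 maximal (suc n) f = let X , p = maximal n (λ v → f (true ∷ v))
                         Y , q = maximal n (λ v → f (false ∷ v))
   in case ≤-total (f (true ∷ X)) (f (false ∷ Y)) of λ
     { (inj₂ le) → true ∷ X , λ { (true ∷ v) → p v ; (false ∷ v) → ≤-trans (q v) le }
     ; (inj₁ le) → false ∷ Y , λ { (true ∷ v) → ≤-trans (p v) le ; (false ∷ v) → q v } }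

 twos : ∀ {n} → (Fin n → Bool) → Fin n → Fin n → Fin n → Bool
 twos X a b c = two (X a) (X b) (X c)

 twos-sym : ∀ {n} (X : Fin n → Bool) → Sym₃ (twos X)
 twos-sym X = record { s₁₂ = λ a b c → l₁ (X a) (X b) (X c) ; s₂₃ = λ a b c → l₂ (X a) (X b) (X c) }
   where
   l₁ : ∀ x y z → two x y z ≡ two y x z
   l₁ true true z = refl
   l₁ true false z = refl
   l₁ false true z = refl
   l₁ false false z = refl
   l₂ : ∀ x y z → two x y z ≡ two x z y
   l₂ true true true = refl
   l₂ true true false = refl
   l₂ true false true = refl
   l₂ true false false = refl
   l₂ false true true = refl
   l₂ false true false = refl
   l₂ false false true = refl
   l₂ false false false = refl

 T₃-cong : ∀ {n} {v w : Fin n → Fin n → Fin n → Bool} → (∀ a b c → v a b c ≡ w a b c) → T₃ v ≡ T₃ w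
 T₃-cong e = ∑³-cong (λ a b c → cong (λ s → 𝟙 (sorted a b c ∧ s)) (e a b c))

 abstract
   -- The number of edges of the largest complete semi-bipartite system. Its subsystems already
   -- number 2 to this power, which is the unit in which everything else is measured.
   largest : ℕ → ℕ
   largest n = T₃ (twos (lookupᵥ (proj₁ (maximal n (λ X → T₃ (twos (lookupᵥ X)))))))

   largest-upper : ∀ {n} (X : Fin n → Bool) → T₃ (twos X) ≤ largest n
   largest-upper {n} X = ≤-trans (≤-reflexive (T₃-cong (λ a b c → trans (cong₂ (λ x y → two x y (X c)) (sym (lk a)) (sym (lk b))) (cong (two (lookupᵥ (tabulateᵥ X) a) (lookupᵥ (tabulateᵥ X) b)) (sym (lk c))))))
     (proj₂ (maximal n (λ X → T₃ (twos (lookupᵥ X)))) (tabulateᵥ X))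
     where
     lk : ∀ i → lookupᵥ (tabulateᵥ X) i ≡ X i
     lk = Vecₚ.lookup∘tabulate X

   largest-attained : ∀ n → ∃ λ (X : Fin n → Bool) → T₃ (twos X) ≡ largest n
   largest-attained n = lookupᵥ (proj₁ (maximal n (λ X → T₃ (twos (lookupᵥ X))))) , refl

 ∣∣ₚ-complement : ∀ {n} (X : Fin n → Bool) → ∣ X ∣ₚ + ∣ (λ i → not (X i)) ∣ₚ ≡ n
 ∣∣ₚ-complement {n} X = trans (sym (∑-+ _ _)) (trans (∑-cong (λ i → e (X i))) (trans (∑-const {n} 1) (*-identityʳ n)))
   where
   e : ∀ b → 𝟙 b + 𝟙 (not b) ≡ 1
   e true = refl
   e false = refl

 module _ {n : ℕ} (X : Fin n → Bool) where
   private
     x = ∣ X ∣ₚ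
     y = ∣ (λ i → not (X i)) ∣ₚ

   o₂-base-true : o₂ (base true X) ≡ x * x
   o₂-base-true = o₂-prod X X

   o₂-base-false : o₂ (base false X) ≡ 2 * (x * y)
   o₂-base-false = begin
     o₂ (base false X) ≡⟨ ∑²-cong (λ p q → e (X p) (X q)) ⟩
     ∑² (λ p q → 𝟙 (X p ∧ not (X q)) + 𝟙 (X q ∧ not (X p))) ≡⟨ ∑²-+ _ _ ⟩
     o₂ (λ p q → X p ∧ not (X q)) + o₂ (λ p q → X q ∧ not (X p)) ≡⟨ cong₂ _+_ (o₂-prod X _) (trans (o₂-transpose (λ p q → X p ∧ not (X q))) (o₂-prod X _)) ⟩
     x * y + x * y ≡⟨ cong (x * y +_) (sym (+-identityʳ _)) ⟩
     2 * (x * y) ∎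
     where
     open ≡-Reasoning
     e : ∀ p q → 𝟙 (p xor q) ≡ 𝟙 (p ∧ not q) + 𝟙 (q ∧ not p)
     e true true = refl
     e true false = refl
     e false true = refl
     e false false = refl

   ∑³-twos : ∑³ (λ a b c → 𝟙 (twos X a b c)) ≡ 3 * (x * x * y)
   ∑³-twos = begin
     ∑³ (λ a b c → 𝟙 (twos X a b c)) ≡⟨ ∑-cong (λ a → trans (∑²-cong (λ b c → cong 𝟙 (two-base X a b c))) (by (X a))) ⟩
     ∑ (λ a → 𝟙 (X a) * (2 * (x * y)) + 𝟙 (not (X a)) * (x * x)) ≡⟨ trans (∑-+ _ _) (cong₂ _+_ (∑-*ʳ _ _) (∑-*ʳ _ _)) ⟩
     x * (2 * (x * y)) + y * (x * x) ≡⟨ e x y ⟩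
     3 * (x * x * y) ∎
     where
     open ≡-Reasoning
     by : ∀ b → o₂ (base (not b) X) ≡ 𝟙 b * (2 * (x * y)) + 𝟙 (not b) * (x * x)
     by true = trans o₂-base-false (sym (trans (+-identityʳ _) (+-identityʳ _)))
     by false = trans o₂-base-true (sym (+-identityʳ _))
     e : ∀ x y → x * (2 * (x * y)) + y * (x * x) ≡ 3 * (x * x * y)
     e = solve-∀

 -- 4 (x + y)³ - 27 x² y = (x - 2 y)² (4 x + y), so a large number of pairs forces x ≈ 2 y.
 module Balance (q x y : ℕ) (dense : q * q * (4 * cub (x + y)) ≤ q * q * (27 * (x * x * y)) + cub (x + y)) where
   private
     n = x + y

     from-square : ∀ a b → a * a ≤ b * b → a ≤ b
     from-square a b p = ≮⇒≥ (λ b<a → <⇒≱ (*-mono-< b<a b<a) p)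

   close : ∀ e → (x ≡ 2 * y + e ⊎ 2 * y ≡ x + e) → q * e ≤ n
   close e split with n Data.Nat.≟ 0
   ... | yes n≡0 = ≤-trans (≤-reflexive (trans (cong (q *_) (e≡0 split)) (*-zeroʳ q))) z≤n
     where
     e≡0 : (x ≡ 2 * y + e ⊎ 2 * y ≡ x + e) → e ≡ 0
     e≡0 (inj₁ p) = m+n≡0⇒n≡0 (2 * y) (trans (sym p) (m+n≡0⇒m≡0 x n≡0))
     e≡0 (inj₂ p) = m+n≡0⇒n≡0 x (trans (sym p) (cong (2 *_) (m+n≡0⇒n≡0 x n≡0)))
   ... | no n≢0 = from-square (q * e) n (*-cancelʳ-≤ _ _ n ⦃ ≢-nonZero n≢0 ⦄ (+-cancelˡ-≤ (q * q * (27 * (x * x * y))) _ _ (begin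
     q * q * (27 * (x * x * y)) + q * e * (q * e) * n ≤⟨ +-monoʳ-≤ (q * q * (27 * (x * x * y))) (*-monoʳ-≤ (q * e * (q * e)) (+-monoˡ-≤ y (m≤n*m x 4))) ⟩
     q * q * (27 * (x * x * y)) + q * e * (q * e) * (4 * x + y) ≡⟨ sym (identity split) ⟩
     q * q * (4 * cub n) ≤⟨ dense ⟩
     q * q * (27 * (x * x * y)) + n * n * n ∎)))
     where
     open ≤-Reasoning
     identity : (x ≡ 2 * y + e ⊎ 2 * y ≡ x + e) → q * q * (4 * cub n) ≡ q * q * (27 * (x * x * y)) + q * e * (q * e) * (4 * x + y)
     identity (inj₁ refl) = i₁ q y e
       where
       i₁ : ∀ q y e → q * q * (4 * ((2 * y + e + y) * (2 * y + e + y) * (2 * y + e + y))) ≡ q * q * (27 * ((2 * y + e) * (2 * y + e) * y)) + q * e * (q * e) * (4 * (2 * y + e) + y)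
       i₁ = solve-∀
     identity (inj₂ p) = *-cancelˡ-≡ _ _ 2 (begin-equality
       2 * (q * q * (4 * cub n)) ≡⟨ i₁ q x y ⟩
       q * q * ((2 * x + 2 * y) * (2 * x + 2 * y) * (2 * x + 2 * y)) ≡⟨ cong (λ z → q * q * ((2 * x + z) * (2 * x + z) * (2 * x + z))) p ⟩
       q * q * ((2 * x + (x + e)) * (2 * x + (x + e)) * (2 * x + (x + e))) ≡⟨ i₂ q x e ⟩
       q * q * (27 * (x * x * (x + e))) + q * e * (q * e) * (8 * x + (x + e)) ≡⟨ cong (λ z → q * q * (27 * (x * x * z)) + q * e * (q * e) * (8 * x + z)) (sym p) ⟩
       q * q * (27 * (x * x * (2 * y))) + q * e * (q * e) * (8 * x + 2 * y) ≡⟨ i₃ q x y e ⟩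
       2 * (q * q * (27 * (x * x * y)) + q * e * (q * e) * (4 * x + y)) ∎)
       where
       i₁ : ∀ q x y → 2 * (q * q * (4 * ((x + y) * (x + y) * (x + y)))) ≡ q * q * ((2 * x + 2 * y) * (2 * x + 2 * y) * (2 * x + 2 * y))
       i₁ = solve-∀
       i₂ : ∀ q x e → q * q * ((2 * x + (x + e)) * (2 * x + (x + e)) * (2 * x + (x + e))) ≡ q * q * (27 * (x * x * (x + e))) + q * e * (q * e) * (8 * x + (x + e))
       i₂ = solve-∀
       i₃ : ∀ q x y e → q * q * (27 * (x * x * (2 * y))) + q * e * (q * e) * (8 * x + 2 * y) ≡ 2 * (q * q * (27 * (x * x * y)) + q * e * (q * e) * (4 * x + y))
       i₃ = solve-∀

   offset : ∃[ e ] (x ≡ 2 * y + e ⊎ 2 * y ≡ x + e)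
   offset = case ≤-total (2 * y) x of λ
     { (inj₁ p) → x ∸ 2 * y , inj₁ (sym (m+[n∸m]≡n p)) ; (inj₂ p) → 2 * y ∸ x , inj₂ (sym (m+[n∸m]≡n p)) }

   -- If x falls short of 2y by e ≤ n/20, then x = (2n - e)/3 is at least (2 - 1/20) n/3, which is
   -- 13n/20.
   two-thirds : 20 ≤ q → 13 * n ≤ 20 * x
   two-thirds 20≤q = let e , split = offset in *-cancelˡ-≤ 3 (go e split (≤-trans (*-monoˡ-≤ e 20≤q) (close e split)))
     where
     open ≤-Reasoning
     go : ∀ e → (x ≡ 2 * y + e ⊎ 2 * y ≡ x + e) → 20 * e ≤ n → 3 * (13 * n) ≤ 3 * (20 * x)
     go e (inj₁ refl) _ = ≤-trans (m≤m+n _ (3 * y + 21 * e)) (≤-reflexive (i y e))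
       where
       i : ∀ y e → 3 * (13 * (2 * y + e + y)) + (3 * y + 21 * e) ≡ 3 * (20 * (2 * y + e))
       i = solve-∀
     go e (inj₂ p) small = +-cancelʳ-≤ n _ _ (begin
       3 * (13 * n) + n ≡⟨ i₁ x y ⟩
       40 * x + 20 * (2 * y) ≡⟨ cong (λ z → 40 * x + 20 * z) p ⟩
       40 * x + 20 * (x + e) ≡⟨ i₂ x e ⟩
       3 * (20 * x) + 20 * e ≤⟨ +-monoʳ-≤ (3 * (20 * x)) small ⟩
       3 * (20 * x) + n ∎)
       where
       i₁ : ∀ x y → 3 * (13 * (x + y)) + (x + y) ≡ 40 * x + 20 * (2 * y)
       i₁ = solve-∀
       i₂ : ∀ x e → 40 * x + 20 * (x + e) ≡ 3 * (20 * x) + 20 * e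
       i₂ = solve-∀

   square-lower : q * (4 * (n * n)) ≤ q * (9 * (x * x)) + 4 * (n * n)
   square-lower = let e , split = offset in go e split (close e split)
     where
     open ≤-Reasoning
     go : ∀ e → (x ≡ 2 * y + e ⊎ 2 * y ≡ x + e) → q * e ≤ n → q * (4 * (n * n)) ≤ q * (9 * (x * x)) + 4 * (n * n)
     go e (inj₁ refl) _ = ≤-trans (*-monoʳ-≤ q (≤-trans (m≤m+n _ (12 * (y * e) + 5 * (e * e))) (≤-reflexive (i y e)))) (m≤m+n _ _)
       where
       i : ∀ y e → 4 * ((2 * y + e + y) * (2 * y + e + y)) + (12 * (y * e) + 5 * (e * e)) ≡ 9 * ((2 * y + e) * (2 * y + e))
       i = solve-∀
     go e (inj₂ p) small = begin
       q * (4 * (n * n)) ≤⟨ *-monoʳ-≤ q 4nn ⟩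
       q * (9 * (x * x) + 4 * (n * e)) ≡⟨ i₁ q (x * x) n e ⟩
       q * (9 * (x * x)) + 4 * (n * (q * e)) ≤⟨ +-monoʳ-≤ (q * (9 * (x * x))) (*-monoʳ-≤ 4 (*-monoʳ-≤ n small)) ⟩
       q * (9 * (x * x)) + 4 * (n * n) ∎
       where
       i₁ : ∀ q m n e → q * (9 * m + 4 * (n * e)) ≡ q * (9 * m) + 4 * (n * (q * e))
       i₁ = solve-∀
       4nn : 4 * (n * n) ≤ 9 * (x * x) + 4 * (n * e)
       4nn = begin
         4 * (n * n) ≡⟨ j₁ x y ⟩
         (2 * x + 2 * y) * (2 * x + 2 * y) ≡⟨ cong (λ z → (2 * x + z) * (2 * x + z)) p ⟩
         (2 * x + (x + e)) * (2 * x + (x + e)) ≤⟨ ≤-trans (m≤m+n _ (e * e)) (≤-reflexive (j₂ x e)) ⟩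
         9 * (x * x) + 2 * ((2 * x + (x + e)) * e) ≡⟨ cong (λ z → 9 * (x * x) + 2 * ((2 * x + z) * e)) (sym p) ⟩
         9 * (x * x) + 2 * ((2 * x + 2 * y) * e) ≡⟨ cong (9 * (x * x) +_) (j₃ x y e) ⟩
         9 * (x * x) + 4 * (n * e) ∎
         where
         j₁ : ∀ x y → 4 * ((x + y) * (x + y)) ≡ (2 * x + 2 * y) * (2 * x + 2 * y)
         j₁ = solve-∀
         j₂ : ∀ x e → (2 * x + (x + e)) * (2 * x + (x + e)) + e * e ≡ 9 * (x * x) + 2 * ((2 * x + (x + e)) * e)
         j₂ = solve-∀
         j₃ : ∀ x y e → 2 * ((2 * x + 2 * y) * e) ≡ 4 * ((x + y) * e)
         j₃ = solve-∀

   module _ (R : ℕ) (9R≤q : 9 * R ≤ q) where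
     private
       gap : ∀ m e → 9 * m ≤ 4 * (n * n) + 9 * (n * e) → q * e ≤ n → R * (9 * m) ≤ R * (4 * (n * n)) + n * n
       gap m e le small = begin
         R * (9 * m) ≤⟨ *-monoʳ-≤ R le ⟩
         R * (4 * (n * n) + 9 * (n * e)) ≡⟨ i R (n * n) n e ⟩
         R * (4 * (n * n)) + n * (9 * R * e) ≤⟨ +-monoʳ-≤ (R * (4 * (n * n))) (*-monoʳ-≤ n (≤-trans (*-monoˡ-≤ e 9R≤q) small)) ⟩
         R * (4 * (n * n)) + n * n ∎
         where
         open ≤-Reasoning
         i : ∀ R m n e → R * (4 * m + 9 * (n * e)) ≡ R * (4 * m) + n * (9 * R * e)
         i = solve-∀

       both-bounds : ∀ e → (x ≡ 2 * y + e ⊎ 2 * y ≡ x + e) → 9 * (x * x) ≤ 4 * (n * n) + 9 * (n * e) × 9 * (2 * (x * y)) ≤ 4 * (n * n) + 9 * (n * e)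
       both-bounds e (inj₁ refl) = ≤-trans (m≤m+n _ (15 * (y * e) + 4 * (e * e))) (≤-reflexive (i₁ y e)) , ≤-trans (m≤m+n _ (33 * (y * e) + 13 * (e * e))) (≤-reflexive (i₂ y e))
         where
         i₁ : ∀ y e → 9 * ((2 * y + e) * (2 * y + e)) + (15 * (y * e) + 4 * (e * e)) ≡ 4 * ((2 * y + e + y) * (2 * y + e + y)) + 9 * ((2 * y + e + y) * e)
         i₁ = solve-∀
         i₂ : ∀ y e → 9 * (2 * ((2 * y + e) * y)) + (33 * (y * e) + 13 * (e * e)) ≡ 4 * ((2 * y + e + y) * (2 * y + e + y)) + 9 * ((2 * y + e + y) * e)
         i₂ = solve-∀
       both-bounds e (inj₂ p) = ≤-trans (m≤m+n _ (6 * (x * e) + e * e)) (≤-trans (≤-reflexive (trans (i₁ x e) (sym 4nn))) (m≤m+n _ _)) ,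
         ≤-trans (≤-reflexive (trans (i₂ x y) (cong (λ z → 9 * (x * z)) p))) (≤-trans (m≤m+n _ (e * e)) (≤-trans (≤-reflexive (i₃ x e)) (+-mono-≤ (≤-reflexive (sym 4nn)) (*-mono-≤ {3} {9} (m≤m+n 3 6) (*-monoˡ-≤ e (m≤m+n x y))))))
         where
         4nn : 4 * (n * n) ≡ (3 * x + e) * (3 * x + e)
         4nn = trans (j₁ x y) (trans (cong (λ z → (2 * x + z) * (2 * x + z)) p) (j₂ x e))
           where
           j₁ : ∀ x y → 4 * ((x + y) * (x + y)) ≡ (2 * x + 2 * y) * (2 * x + 2 * y)
           j₁ = solve-∀
           j₂ : ∀ x e → (2 * x + (x + e)) * (2 * x + (x + e)) ≡ (3 * x + e) * (3 * x + e)
           j₂ = solve-∀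
         i₁ : ∀ x e → 9 * (x * x) + (6 * (x * e) + e * e) ≡ (3 * x + e) * (3 * x + e)
         i₁ = solve-∀
         i₂ : ∀ x y → 9 * (2 * (x * y)) ≡ 9 * (x * (2 * y))
         i₂ = solve-∀
         i₃ : ∀ x e → 9 * (x * (x + e)) + e * e ≡ (3 * x + e) * (3 * x + e) + 3 * (x * e)
         i₃ = solve-∀

     square-bound : R * (9 * (x * x)) ≤ R * (4 * (n * n)) + n * n
     square-bound = let e , split = offset in gap (x * x) e (proj₁ (both-bounds e split)) (close e split)

     cross-bound : R * (9 * (2 * (x * y))) ≤ R * (4 * (n * n)) + n * n
     cross-bound = let e , split = offset in gap (2 * (x * y)) e (proj₂ (both-bounds e split)) (close e split)

 dense⇒balanced : ∀ {n} (X : Fin n → Bool) R q → 9 * R ≤ q → 20 ≤ q →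
   q * q * (4 * cub n) ≤ q * q * (9 * ∑³ (λ a b c → 𝟙 (twos X a b c))) + cub n → Gaps.Balanced {n} R X × 13 * n ≤ 20 * ∣ X ∣ₚ
 dense⇒balanced {n} X R q 9R≤q 20≤q dense = bal , subst (λ m → 13 * m ≤ 20 * x) x+y (B.two-thirds 20≤q)
   where
   x = ∣ X ∣ₚ
   y = ∣ (λ i → not (X i)) ∣ₚ
   x+y : x + y ≡ n
   x+y = ∣∣ₚ-complement X
   e : ∀ s → 9 * (3 * s) ≡ 27 * s
   e = solve-∀
   module B = Balance q x y (subst (λ m → q * q * (4 * cub m) ≤ q * q * (27 * (x * x * y)) + cub m) (sym x+y)
     (≤-trans dense (≤-reflexive (cong (λ s → q * q * s + cub n) (trans (cong (9 *_) (∑³-twos X)) (e (x * x * y)))))))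
   bal : Gaps.Balanced {n} R X
   bal true = subst₂ (λ o m → R * (9 * o) ≤ R * (4 * (m * m)) + m * m) (sym (o₂-base-true X)) x+y (B.square-bound R 9R≤q)
   bal false = subst₂ (λ o m → R * (9 * o) ≤ R * (4 * (m * m)) + m * m) (sym (o₂-base-false X)) x+y (B.cross-bound R 9R≤q)

 bad : ∀ {n} → (Fin n → Fin n → Fin n → Bool) → (Fin n → Bool) → ℕ
 bad h X = ∑³ (λ a b c → 𝟙 (h a b c ∧ not (twos X a b c)))

 bad-own : ∀ {n} (h : Fin n → Fin n → Fin n → Bool) X → bad h X ≡ ∑ (λ v → linkError h v (base (not (X v)) X))
 bad-own h X = ∑³-cong (λ v p q → cong (λ b → 𝟙 (h v p q ∧ not b)) (two-base X v p q))

 module Optimal {n : ℕ} (h : Fin n → Fin n → Fin n → Bool) (hs : Sym₃ h) (irr : ∀ a b → h a a b ≡ false) where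
   open Sym₃ hs

   away : Fin n → Fin n → Fin n → Fin n → Bool
   away v a b c = not ((v ==ᶠ a) ∨ ((v ==ᶠ b) ∨ (v ==ᶠ c)))

   -- The summand away from v does not change when v changes sides. The factor 3 is for the place
   -- that v takes in an ordered triple, all three being equivalent by symmetry.
   split-at : ∀ v X → bad h X ≡ ∑³ (λ a b c → 𝟙 (away v a b c ∧ (h a b c ∧ not (twos X a b c)))) + 3 * linkError h v (base (not (X v)) X)
   split-at v X = begin
     bad h X ≡⟨ ∑³-cong (λ a b c → pt a b c) ⟩
     ∑³ (λ a b c → 𝟙 (away v a b c ∧ g a b c) + (𝟙 (v ==ᶠ a) * 𝟙 (g a b c) + (𝟙 (v ==ᶠ b) * 𝟙 (g a b c) + 𝟙 (v ==ᶠ c) * 𝟙 (g a b c))))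
       ≡⟨ trans (∑³-+ _ _) (cong (∑³ (λ a b c → 𝟙 (away v a b c ∧ g a b c)) +_) (trans (∑³-+ _ _) (cong₂ _+_ δ₁ (trans (∑³-+ _ _) (cong₂ _+_ δ₂ δ₃))))) ⟩
     ∑³ (λ a b c → 𝟙 (away v a b c ∧ g a b c)) + (L + (L + L)) ≡⟨ cong (∑³ (λ a b c → 𝟙 (away v a b c ∧ g a b c)) +_) (trans (i L) (cong (3 *_) (∑²-cong (λ p q → cong (λ b → 𝟙 (h v p q ∧ not b)) (two-base X v p q))))) ⟩
     ∑³ (λ a b c → 𝟙 (away v a b c ∧ g a b c)) + 3 * linkError h v (base (not (X v)) X) ∎
     where
     open ≡-Reasoning
     g : Fin n → Fin n → Fin n → Bool
     g a b c = h a b c ∧ not (twos X a b c)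
     L = ∑² (λ p q → 𝟙 (g v p q))
     i : ∀ l → l + (l + l) ≡ 3 * l
     i = solve-∀
     δ₁ : ∑³ (λ a b c → 𝟙 (v ==ᶠ a) * 𝟙 (g a b c)) ≡ L
     δ₁ = trans (∑-cong (λ a → ∑²-*ˡ (𝟙 (v ==ᶠ a)) _)) (∑-δ v (λ a → ∑² (λ b c → 𝟙 (g a b c))))
     δ₂ : ∑³ (λ a b c → 𝟙 (v ==ᶠ b) * 𝟙 (g a b c)) ≡ L
     δ₂ = ∑-cong (λ a → trans (∑-cong (λ b → ∑-*ˡ (𝟙 (v ==ᶠ b)) _)) (trans (∑-δ v (λ b → ∑ (λ c → 𝟙 (g a b c)))) (∑-cong (λ c → cong 𝟙 (cong₂ (λ p q → p ∧ not q) (s₁₂ a v c) (Sym₃.s₁₂ (twos-sym X) a v c))))))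
     δ₃ : ∑³ (λ a b c → 𝟙 (v ==ᶠ c) * 𝟙 (g a b c)) ≡ L
     δ₃ = ∑²-cong (λ a b → trans (∑-δ v (λ c → 𝟙 (g a b c))) (cong 𝟙 (cong₂ (λ p q → p ∧ not q) (rot′ a b v) (Sym₃.rot′ (twos-sym X) a b v))))
     pt : ∀ a b c → 𝟙 (g a b c) ≡ 𝟙 (away v a b c ∧ g a b c) + (𝟙 (v ==ᶠ a) * 𝟙 (g a b c) + (𝟙 (v ==ᶠ b) * 𝟙 (g a b c) + 𝟙 (v ==ᶠ c) * 𝟙 (g a b c)))
     pt a b c = logic (g a b c) {v ==ᶠ a} {v ==ᶠ b} {v ==ᶠ c} (λ m p q → no-ab m (trans (sym (==ᶠ-true {i = v} p)) (==ᶠ-true {i = v} q)))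
         (λ m p q → true≢false (proj₁ (∧-true {h a b c} m)) (trans (cong (λ z → h z b c) (trans (sym (==ᶠ-true {i = v} p)) (==ᶠ-true {i = v} q))) (trans (s₂₃ c b c) (irr c b))))
         (λ m p q → true≢false (proj₁ (∧-true {h a b c} m)) (trans (cong (λ z → h a z c) (trans (sym (==ᶠ-true {i = v} p)) (==ᶠ-true {i = v} q))) (trans (rot a c c) (irr c a))))
       where
       no-ab : g a b c ≡ true → a ≡ b → ⊥
       no-ab m refl = true≢false (proj₁ (∧-true {h a a c} m)) (irr a c)
       logic : ∀ m {x y z} → (m ≡ true → x ≡ true → y ≡ true → ⊥) → (m ≡ true → x ≡ true → z ≡ true → ⊥) → (m ≡ true → y ≡ true → z ≡ true → ⊥) →
         𝟙 m ≡ 𝟙 (not (x ∨ (y ∨ z)) ∧ m) + (𝟙 x * 𝟙 m + (𝟙 y * 𝟙 m + 𝟙 z * 𝟙 m))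
       logic false {true} {true} {true} _ _ _ = refl
       logic false {true} {true} {false} _ _ _ = refl
       logic false {true} {false} {true} _ _ _ = refl
       logic false {true} {false} {false} _ _ _ = refl
       logic false {false} {true} {true} _ _ _ = refl
       logic false {false} {true} {false} _ _ _ = refl
       logic false {false} {false} {true} _ _ _ = refl
       logic false {false} {false} {false} _ _ _ = refl
       logic true {true} {true} p _ _ = ⊥-elim (p refl refl refl)
       logic true {true} {false} {true} _ p _ = ⊥-elim (p refl refl refl)
       logic true {true} {false} {false} _ _ _ = refl
       logic true {false} {true} {true} _ _ p = ⊥-elim (p refl refl refl)
       logic true {false} {true} {false} _ _ _ = refl
       logic true {false} {false} {true} _ _ _ = refl
       logic true {false} {false} {false} _ _ _ = refl

   opt : ∀ X → (∀ Y → bad h X ≤ bad h Y) → ∀ v → linkError h v (base (not (X v)) X) ≤ linkError h v (base (X v) X)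
   opt X best v = *-cancelˡ-≤ 3 (+-cancelˡ-≤ rest _ _ (subst₂ _≤_ (split-at v X) (trans (split-at v Y) (cong₂ _+_ rest≡ (cong (3 *_) own≡))) (best Y)))
     where
     Y : Fin n → Bool
     Y p = if v ==ᶠ p then not (X p) else X p
     Yv : Y v ≡ not (X v)
     Yv = cong (λ b → if b then not (X v) else X v) (==ᶠ-refl v)
     Y≡ : ∀ {p} → (v ==ᶠ p) ≡ false → Y p ≡ X p
     Y≡ {p} e = cong (λ b → if b then not (X p) else X p) e
     rest = ∑³ (λ a b c → 𝟙 (away v a b c ∧ (h a b c ∧ not (twos X a b c))))
     ∨-false : ∀ {a b} → not (a ∨ b) ≡ true → a ≡ false × not b ≡ true
     ∨-false {false} e = refl , e
     rest≡ : ∑³ (λ a b c → 𝟙 (away v a b c ∧ (h a b c ∧ not (twos Y a b c)))) ≡ rest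
     rest≡ = ∑³-cong (λ a b c → bool-case (away v a b c)
       (λ e → let p , q = ∨-false {v ==ᶠ a} e
                  r , s = ∨-false {v ==ᶠ b} q
              in cong (λ t → 𝟙 (away v a b c ∧ (h a b c ∧ not t))) (trans (cong₂ (λ x y → two x y (Y c)) (Y≡ p) (Y≡ r)) (cong (two (X a) (X b)) (Y≡ (not-true s)))))
       (λ e → trans (cong (λ t → 𝟙 (t ∧ (h a b c ∧ not (twos Y a b c)))) e) (cong (λ t → 𝟙 (t ∧ (h a b c ∧ not (twos X a b c)))) (sym e))))
     own≡ : linkError h v (base (not (Y v)) Y) ≡ linkError h v (base (X v) X)
     own≡ = ∑²-cong (λ p q → bool-case (h v p q)
       (λ m → cong (λ b → 𝟙 (h v p q ∧ not b)) (trans (cong (λ t → base t Y p q) (trans (cong not Yv) (not-involutive (X v))))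
          (trans (base-if (X v) Y p q) (trans (cong₂ (λ y z → if X v then y ∧ z else y xor z) (Y≡ (==ᶠ-false (left m))) (Y≡ (==ᶠ-false (right m)))) (sym (base-if (X v) X p q))))))
       (λ m → trans (cong (λ t → 𝟙 (t ∧ not (base (not (Y v)) Y p q))) m) (cong (λ t → 𝟙 (t ∧ not (base (X v) X p q))) (sym m))))
       where
       left : ∀ {p q} → h v p q ≡ true → v ≢ p
       left {q = q} m refl = true≢false m (irr v q)
       right : ∀ {p q} → h v p q ≡ true → v ≢ q
       right {p} m refl = true≢false m (trans (s₂₃ v p v) (irr v p))

   best-partition : ∃ λ (V : Vec Bool n) → ∀ Y → bad h (lookupᵥ V) ≤ bad h Y
   best-partition = let V , m = minimal n (λ V → bad h (lookupᵥ V)) in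
     V , λ Y → ≤-trans (m (tabulateᵥ Y)) (≤-reflexive (∑³-cong (λ a b c → cong (λ t → 𝟙 (h a b c ∧ not t))
       (trans (cong₂ (λ x y → two x y (lookupᵥ (tabulateᵥ Y) c)) (Vecₚ.lookup∘tabulate Y a) (Vecₚ.lookup∘tabulate Y b)) (cong (two (Y a) (Y b)) (Vecₚ.lookup∘tabulate Y c))))))

open Partitions

-- Counting thin systems that are not semi-bipartite.

module ThinSystems where
 quotient : ∀ d m → 1 ≤ d → ∃[ k ] (d * k ≤ m × (∀ e → d * e ≤ m → e ≤ k))
 quotient d zero 1≤d = 0 , ≤-trans (≤-reflexive (*-zeroʳ d)) z≤n , λ { zero _ → z≤n ; (suc e) p → ⊥-elim (≤⇒≯ p (*-mono-≤ {1} {d} {1} {suc e} 1≤d (s≤s z≤n))) }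
 quotient d (suc m) 1≤d = let k , p , q = quotient d m 1≤d in case d * suc k Data.Nat.≤? suc m of λ
   { (yes r) → suc k , r , λ { zero _ → z≤n ; (suc e) s → s≤s (q e (≤-pred (≤-trans (≤-trans (+-monoˡ-≤ (d * e) 1≤d) (≤-reflexive (sym (*-suc d e)))) s))) }
   ; (no r) → k , ≤-trans p (n≤1+n m) , λ e s → ≮⇒≥ (λ k<e → r (≤-trans (*-monoʳ-≤ d k<e) s)) }

 module _ {n : ℕ} where
   pairs : List (Fin n × Fin n)
   pairs = concatMap (λ i → map (i ,_) (allFin n)) (allFin n)

   listed : List (Fin n × Fin n) → Fin n → Fin n → Bool
   listed [] a b = false
   listed ((p , q) ∷ L) a b = ((p ==ᶠ a) ∧ (q ==ᶠ b)) ∨ listed L a b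

   private
     ∨-true : ∀ {a b} → a ∨ b ≡ true → a ≡ true ⊎ b ≡ true
     ∨-true {true} _ = inj₁ refl
     ∨-true {false} e = inj₂ e

     ∨-right : ∀ a {b} → b ≡ true → a ∨ b ≡ true
     ∨-right true _ = refl
     ∨-right false e = e

     listed⇒ : ∀ L {a b} → listed L a b ≡ true → (a , b) ∈ₗ L
     listed⇒ ((p , q) ∷ L) {a} {b} e with ∨-true {(p ==ᶠ a) ∧ (q ==ᶠ b)} e
     ... | inj₁ f = let x , y = ∧-true {p ==ᶠ a} f in here (cong₂ _,_ (sym (==ᶠ-true {i = p} x)) (sym (==ᶠ-true {i = q} y)))
     ... | inj₂ f = there (listed⇒ L f)

     ⇒listed : ∀ L {a b} → (a , b) ∈ₗ L → listed L a b ≡ true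
     ⇒listed ((p , q) ∷ L) (here refl) rewrite ==ᶠ-refl p | ==ᶠ-refl q = refl
     ⇒listed ((p , q) ∷ L) {a} {b} (there m) = ∨-right ((p ==ᶠ a) ∧ (q ==ᶠ b)) (⇒listed L m)

   -- The crossing graph is coded by listing its ordered pairs, at 2 log n bits each. This is cheap
   -- next to the order of n free triples that a pair costs.
   elements : (g : Fin n → Fin n → Bool) → ∃[ L ] (length L ≡ o₂ g × ∀ a b → listed L a b ≡ g a b)
   elements g = L , len , λ a b → bool-ext
       (λ e → proj₂ (Memₚ.∈-filter⁻ P? {xs = pairs} (listed⇒ L e)))
       (λ e → ⇒listed L (Memₚ.∈-filter⁺ P? (all-pairs a b) e))
     where
     P? : ∀ x → Dec (g (proj₁ x) (proj₂ x) ≡ true)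
     P? (a , b) = g a b Data.Bool.≟ true
     L = filter P? pairs
     all-pairs : ∀ a b → (a , b) ∈ₗ pairs
     all-pairs a b = Memₚ.∈-concat⁺′ (Memₚ.∈-map⁺ (a ,_) (Memₚ.∈-allFin b)) (Memₚ.∈-map⁺ (λ i → map (i ,_) (allFin n)) (Memₚ.∈-allFin a))
     length≡ : ∀ {A : Set} (xs : List A) → length xs ≡ sumₗ (𝟙 ∘ (λ _ → true)) xs
     length≡ [] = refl
     length≡ (x ∷ xs) = cong suc (length≡ xs)
     w : ∀ b → does (b Data.Bool.≟ true) ∧ true ≡ b
     w true = refl
     w false = refl
     len : length L ≡ o₂ g
     len = trans (length≡ L) (trans (sumₗ-filter P? (λ _ → true) pairs) (trans (sumₗ-concatMap _ _ (allFin n)) (trans (sumₗ-tabulate _ id)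
       (∑-cong (λ i → trans (sumₗ-map _ (i ,_) (allFin n)) (trans (sumₗ-tabulate _ id) (∑-cong (λ j → cong 𝟙 (w (g i j))))))))))

 Cov-List : ∀ {A : Set} {k} → Cov {A} (λ _ → ⊤) k → ∀ m → Cov {List A} (λ L → length L ≡ m) (k ^ m)
 Cov-List a zero = [] ∷ [] , ≤-refl , λ { [] _ → here refl }
 Cov-List {k = k} a (suc m) = Cov-⊂ (λ { [] () ; (x ∷ xs) e → x , tt , xs , suc-injective e , refl })
   (Cov-∃ {P = λ x L → ∃ λ xs → length xs ≡ m × L ≡ x ∷ xs} a (λ x → Cov-≤ (≤-reflexive (*-identityʳ _)) (Cov-∃ {P = λ xs L → L ≡ x ∷ xs} (Cov-List a m) (λ xs → (x ∷ xs) ∷ [] , ≤-refl , λ { _ refl → here refl }))))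

 any₂ : Bool → Bool → Bool → Bool
 any₂ x y z = (x ∧ y) ∨ ((y ∧ z) ∨ (x ∧ z))

 -- What X and G leave open. A triple with two vertices in X is free unless it contains a pair of G;
 -- then it is rarely an edge, because crossing pairs have few neighbours in X. A triple with one
 -- vertex in X can be an edge only if at least two of its pairs belong to G.
 module Spec {n : ℕ} (X : Fin n → Bool) (g : Fin n → Fin n → Bool) where
   touching inside₂ : Fin n → Fin n → Fin n → Bool
   touching a b c = two (X a) (X b) (X c) ∧ (g a b ∨ (g b c ∨ g a c))
   inside₂ a b c = one (X a) (X b) (X c) ∧ any₂ (g a b) (g b c) (g a c)

   kind : Fin n → Fin n → Fin n → Kind
   kind a b c = if two (X a) (X b) (X c) then (if g a b ∨ (g b c ∨ g a c) then err else free)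
                else (if one (X a) (X b) (X c) ∧ any₂ (g a b) (g b c) (g a c) then free else fixed false)

   spec : Vec Kind (N3 n)
   spec = tabulateᵥ (λ p → let i , j , k = triple p in kind i j k)

   at-spec : ∀ p → lookupᵥ spec p ≡ (let i , j , k = triple p in kind i j k)
   at-spec p = Vecₚ.lookup∘tabulate _ p

   private
     sum-spec : (q : Kind → Bool) → ∑ (λ p → 𝟙 (q (lookupᵥ spec p))) ≡ T₃ (λ i j k → q (kind i j k))
     sum-spec q = trans (∑-cong (λ p → cong (λ κ → 𝟙 (q κ)) (at-spec p))) (∑-triple (λ i j k → q (kind i j k)))

     T₃-mono : ∀ {v w : Fin n → Fin n → Fin n → Bool} → (∀ a b c → v a b c ≡ true → w a b c ≡ true) → T₃ v ≤ T₃ w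
     T₃-mono f = ∑³-mono (λ a b c → 𝟙-mono (λ e → let p , q = ∧-true {sorted a b c} e in ∧-intro p (f a b c q)))

   #err-spec : #err spec ≤ T₃ touching
   #err-spec = ≤-trans (≤-reflexive (sum-spec isErr)) (T₃-mono (λ a b c → logic (two (X a) (X b) (X c)) (g a b ∨ (g b c ∨ g a c)) (one (X a) (X b) (X c) ∧ any₂ (g a b) (g b c) (g a c))))
     where
     logic : ∀ t u v → isErr (if t then (if u then err else free) else (if v then free else fixed false)) ≡ true → t ∧ u ≡ true
     logic true true v e = refl
     logic false u true ()
     logic false u false ()

   #free-spec : #free spec + T₃ touching ≤ T₃ (twos X) + T₃ inside₂
   #free-spec = begin
     #free spec + T₃ touching ≡⟨ cong (_+ T₃ touching) (sum-spec isFree) ⟩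
     T₃ (λ i j k → isFree (kind i j k)) + T₃ touching ≡⟨ sym (∑³-+ _ _) ⟩
     ∑³ (λ a b c → 𝟙 (sorted a b c ∧ isFree (kind a b c)) + 𝟙 (sorted a b c ∧ touching a b c))
       ≤⟨ ∑³-mono (λ a b c → logic (sorted a b c) (two (X a) (X b) (X c)) (g a b ∨ (g b c ∨ g a c)) (one (X a) (X b) (X c) ∧ any₂ (g a b) (g b c) (g a c))) ⟩
     ∑³ (λ a b c → 𝟙 (sorted a b c ∧ twos X a b c) + 𝟙 (sorted a b c ∧ inside₂ a b c)) ≡⟨ ∑³-+ _ _ ⟩
     T₃ (twos X) + T₃ inside₂ ∎
     where
     open ≤-Reasoning
     logic : ∀ s t u v → 𝟙 (s ∧ isFree (if t then (if u then err else free) else (if v then free else fixed false))) + 𝟙 (s ∧ (t ∧ u)) ≤ 𝟙 (s ∧ t) + 𝟙 (s ∧ v)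
     logic false t u v = z≤n
     logic true true true v = s≤s z≤n
     logic true true false v = s≤s z≤n
     logic true false u true = s≤s z≤n
     logic true false u false = z≤n

   module Sizes (gs : ∀ a b → g a b ≡ g b a) (gx : ∀ a b → g a b ≡ true → (X a xor X b) ≡ true) (s′ : ℕ) (deg : ∀ a → s′ * ∣ g a ∣ₚ ≤ n) where
     open ≤-Reasoning
     M = o₂ g
     x = ∣ X ∣ₚ
     Q = ∑³ (λ b a c → 𝟙 (g b a ∧ g b c))

     -- Q counts walks of two steps in G by their middle vertex, and G has maximum degree at most
     -- n/s′.
     paths : s′ * Q ≤ n * M
     paths = begin
       s′ * Q ≡⟨ cong (s′ *_) (∑-cong (λ b → o₂-prod (g b) (g b))) ⟩
       s′ * ∑ (λ b → ∣ g b ∣ₚ * ∣ g b ∣ₚ) ≡⟨ sym (∑-*ˡ s′ _) ⟩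
       ∑ (λ b → s′ * (∣ g b ∣ₚ * ∣ g b ∣ₚ)) ≤⟨ ∑-mono (λ b → ≤-trans (≤-reflexive (sym (*-assoc s′ _ _))) (*-monoˡ-≤ ∣ g b ∣ₚ (deg b))) ⟩
       ∑ (λ b → n * ∣ g b ∣ₚ) ≡⟨ ∑-*ˡ n _ ⟩
       n * M ∎

     two-pairs : ∑³ (λ a b c → 𝟙 (g a b ∧ g b c) + (𝟙 (g b c ∧ g a c) + 𝟙 (g a b ∧ g a c))) ≡ 3 * Q
     two-pairs = trans (∑³-+ _ _) (trans (cong₂ _+_ c₁ (trans (∑³-+ _ _) (cong (_+ Q) c₂))) (cong (λ m → Q + (Q + m)) (sym (+-identityʳ Q))))
       where
       c₁ : ∑³ (λ a b c → 𝟙 (g a b ∧ g b c)) ≡ Q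
       c₁ = trans (∑³-cong (λ a b c → cong (λ m → 𝟙 (m ∧ g b c)) (gs a b))) (∑³-s₁₂ (λ b a c → 𝟙 (g b a ∧ g b c)))
       c₂ : ∑³ (λ a b c → 𝟙 (g b c ∧ g a c)) ≡ Q
       c₂ = trans (∑³-cong (λ a b c → cong 𝟙 (cong₂ _∧_ (gs b c) (gs a c))))
            (trans (∑³-s₁₂ (λ b a c → 𝟙 (g c b ∧ g c a))) (trans (∑³-s₂₃ (λ b c a → 𝟙 (g c b ∧ g c a))) (∑³-s₁₂ (λ c b a → 𝟙 (g c b ∧ g c a)))))

     -- A pair of G has exactly one end in X, so a triple containing it has two vertices in X
     -- precisely when the third one lies in X.
     touched-pairs : ∀ (w : Fin n → Fin n → Fin n → Bool) → Sym₃ w → ∑³ (λ a b c → 𝟙 (w a b c ∧ (two (X a) (X b) (X c) ∧ g a b)) + (𝟙 (w a b c ∧ (two (X a) (X b) (X c) ∧ g b c)) + 𝟙 (w a b c ∧ (two (X a) (X b) (X c) ∧ g a c)))) ≡ 3 * ∑³ (λ a b c → 𝟙 (g a b ∧ (w a b c ∧ X c)))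
     touched-pairs w ws = trans (∑³-+ _ _) (trans (cong₂ _+_ c₁ (trans (∑³-+ _ _) (cong₂ _+_ (trans c₂ c₁) (trans c₃ c₁)))) (cong (λ m → P + (P + m)) (sym (+-identityʳ P))))
       where
       P = ∑³ (λ a b c → 𝟙 (g a b ∧ (w a b c ∧ X c)))
       f : Fin n → Fin n → Fin n → ℕ
       f a b c = 𝟙 (w a b c ∧ (two (X a) (X b) (X c) ∧ g a b))
       c₁ : ∑³ f ≡ P
       c₁ = ∑³-cong (λ a b c → cong 𝟙 (logic (g a b) (w a b c) (X a) (X b) (X c) (gx a b)))
         where
         logic : ∀ m w x y z → (m ≡ true → (x xor y) ≡ true) → w ∧ (two x y z ∧ m) ≡ m ∧ (w ∧ z)
         logic false true x y z _ = ∧-zeroʳ (two x y z)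
         logic false false x y z _ = refl
         logic true false x y z _ = refl
         logic true true true true z e = case e refl of λ ()
         logic true true true false true e = refl
         logic true true true false false e = refl
         logic true true false true true e = refl
         logic true true false true false e = refl
         logic true true false false z e = case e refl of λ ()
       c₃ : ∑³ (λ a b c → 𝟙 (w a b c ∧ (two (X a) (X b) (X c) ∧ g a c))) ≡ ∑³ f
       c₃ = trans (∑³-cong (λ a b c → cong₂ (λ u t → 𝟙 (u ∧ (t ∧ g a c))) (Sym₃.s₂₃ ws a b c) (Sym₃.s₂₃ (twos-sym X) a b c))) (∑³-s₂₃ f)
       c₂ : ∑³ (λ a b c → 𝟙 (w a b c ∧ (two (X a) (X b) (X c) ∧ g b c))) ≡ ∑³ f
       c₂ = trans (∑³-cong (λ a b c → cong₂ (λ u t → 𝟙 (u ∧ (t ∧ g b c))) (Sym₃.s₁₂ ws a b c) (Sym₃.s₁₂ (twos-sym X) a b c)))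
              (trans (∑³-s₁₂ (λ b a c → 𝟙 (w b a c ∧ (two (X b) (X a) (X c) ∧ g b c)))) c₃)

     pairs-with-X : ∑³ (λ a b c → 𝟙 (g a b ∧ (true ∧ X c))) ≡ M * x
     pairs-with-X = trans (∑²-cong (λ a b → trans (∑-cong (λ c → 𝟙-∧ (g a b) (X c))) (∑-*ˡ (𝟙 (g a b)) _))) (trans (∑-cong (λ a → ∑-*ʳ x _)) (∑-*ʳ x _))

     all-sym : Sym₃ {n} (λ _ _ _ → true)
     all-sym = record { s₁₂ = λ _ _ _ → refl ; s₂₃ = λ _ _ _ → refl }

     touching-sym : Sym₃ touching
     touching-sym = record
       { s₁₂ = λ a b c → cong₂ _∧_ (Sym₃.s₁₂ (twos-sym X) a b c) (trans (cong₂ _∨_ (gs a b) (∨-comm (g b c) (g a c))) refl)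
       ; s₂₃ = λ a b c → cong₂ _∧_ (Sym₃.s₂₃ (twos-sym X) a b c) (trans (turn (g a b) (g b c) (g a c)) (cong (λ m → g a c ∨ (m ∨ g a b)) (gs b c))) }
       where
       turn : ∀ x y z → x ∨ (y ∨ z) ≡ z ∨ (y ∨ x)
       turn true true true = refl
       turn true true false = refl
       turn true false true = refl
       turn true false false = refl
       turn false true true = refl
       turn false true false = refl
       turn false false true = refl
       turn false false false = refl

     inside-sym : Sym₃ inside₂
     inside-sym = record
       { s₁₂ = λ a b c → cong₂ _∧_ (one-s₁₂ a b c) (trans (turn₁ (g a b) (g b c) (g a c)) (cong (λ m → any₂ m (g a c) (g b c)) (gs a b)))
       ; s₂₃ = λ a b c → cong₂ _∧_ (one-s₂₃ a b c) (trans (turn₂ (g a b) (g b c) (g a c)) (cong (λ m → any₂ (g a c) m (g a b)) (gs b c))) }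
       where
       one-s₁₂ : ∀ a b c → one (X a) (X b) (X c) ≡ one (X b) (X a) (X c)
       one-s₁₂ a b c = Sym₃.s₁₂ (twos-sym (λ i → not (X i))) a b c
       one-s₂₃ : ∀ a b c → one (X a) (X b) (X c) ≡ one (X a) (X c) (X b)
       one-s₂₃ a b c = Sym₃.s₂₃ (twos-sym (λ i → not (X i))) a b c
       turn₁ : ∀ x y z → any₂ x y z ≡ any₂ x z y
       turn₁ true true true = refl
       turn₁ true true false = refl
       turn₁ true false true = refl
       turn₁ true false false = refl
       turn₁ false true true = refl
       turn₁ false true false = refl
       turn₁ false false true = refl
       turn₁ false false false = refl
       turn₂ : ∀ x y z → any₂ x y z ≡ any₂ z y x
       turn₂ true true true = refl
       turn₂ true true false = refl
       turn₂ true false true = refl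
       turn₂ true false false = refl
       turn₂ false true true = refl
       turn₂ false true false = refl
       turn₂ false false true = refl
       turn₂ false false false = refl

     -- Count the pairs of G with a third vertex in X. A triple that contains several pairs of G is
     -- counted too often, which the term Q repairs as in the Bonferroni inequality; the term M
     -- covers the degenerate triples.
     touching-lower : M * x ≤ 2 * T₃ touching + M + Q
     touching-lower = *-cancelˡ-≤ 3 (begin
       3 * (M * x) ≡⟨ cong (3 *_) (sym pairs-with-X) ⟩
       3 * ∑³ (λ a b c → 𝟙 (g a b ∧ (true ∧ X c))) ≡⟨ sym (touched-pairs (λ _ _ _ → true) all-sym) ⟩
       ∑³ (λ a b c → 𝟙 (two (X a) (X b) (X c) ∧ g a b) + (𝟙 (two (X a) (X b) (X c) ∧ g b c) + 𝟙 (two (X a) (X b) (X c) ∧ g a c)))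
         ≤⟨ ∑³-mono (λ a b c → pt (two (X a) (X b) (X c)) (g a b) (g b c) (g a c)) ⟩
       ∑³ (λ a b c → 𝟙 (touching a b c) + (𝟙 (g a b ∧ g b c) + (𝟙 (g b c ∧ g a c) + 𝟙 (g a b ∧ g a c)))) ≡⟨ trans (∑³-+ _ _) (cong (∑³ (λ a b c → 𝟙 (touching a b c)) +_) two-pairs) ⟩
       ∑³ (λ a b c → 𝟙 (touching a b c)) + 3 * Q ≤⟨ +-monoˡ-≤ (3 * Q) (T₃-lower touching touching-sym) ⟩
       6 * T₃ touching + 3 * ∑² (λ a b → 𝟙 (touching a a b)) + 3 * Q ≤⟨ +-monoˡ-≤ (3 * Q) (+-monoʳ-≤ (6 * T₃ touching) (*-monoʳ-≤ 3 (∑²-mono (λ a b → 𝟙-mono (diag a b))))) ⟩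
       6 * T₃ touching + 3 * M + 3 * Q ≡⟨ e (T₃ touching) M Q ⟩
       3 * (2 * T₃ touching + M + Q) ∎)
       where
       e : ∀ t m q → 6 * t + 3 * m + 3 * q ≡ 3 * (2 * t + m + q)
       e = solve-∀
       pt = bounded₅ (λ _ t x y z → 𝟙 (t ∧ x) + (𝟙 (t ∧ y) + 𝟙 (t ∧ z))) (λ _ t x y z → 𝟙 (t ∧ (x ∨ (y ∨ z))) + (𝟙 (x ∧ y) + (𝟙 (y ∧ z) + 𝟙 (x ∧ z)))) refl true
       diag : ∀ a b → touching a a b ≡ true → g a b ≡ true
       diag a b m = logic (g a a) (g a b) (X a) (gx a a) (proj₂ (∧-true {two (X a) (X a) (X b)} m))
         where
         logic : ∀ u v x → (u ≡ true → (x xor x) ≡ true) → u ∨ (v ∨ v) ≡ true → v ≡ true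
         logic true v true f _ = case f refl of λ ()
         logic true v false f _ = case f refl of λ ()
         logic false true x f e = refl

     touching-upper : 2 * T₃ touching ≤ n * M
     touching-upper = *-cancelˡ-≤ 3 (begin
       3 * (2 * T₃ touching) ≡⟨ sym (*-assoc 3 2 (T₃ touching)) ⟩
       6 * T₃ touching ≤⟨ T₃-upper touching touching-sym ⟩
       ∑³ (λ a b c → 𝟙 (touching a b c)) ≤⟨ ∑³-mono (λ a b c → pt (two (X a) (X b) (X c)) (g a b) (g b c) (g a c)) ⟩
       ∑³ (λ a b c → 𝟙 (two (X a) (X b) (X c) ∧ g a b) + (𝟙 (two (X a) (X b) (X c) ∧ g b c) + 𝟙 (two (X a) (X b) (X c) ∧ g a c))) ≡⟨ touched-pairs (λ _ _ _ → true) all-sym ⟩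
       3 * ∑³ (λ a b c → 𝟙 (g a b ∧ (true ∧ X c))) ≡⟨ cong (3 *_) pairs-with-X ⟩
       3 * (M * x) ≤⟨ *-monoʳ-≤ 3 (≤-trans (*-monoʳ-≤ M (∣∣ₚ-≤ X)) (≤-reflexive (*-comm M n))) ⟩
       3 * (n * M) ∎)
       where
       pt = bounded₅ (λ _ t x y z → 𝟙 (t ∧ (x ∨ (y ∨ z)))) (λ _ t x y z → 𝟙 (t ∧ x) + (𝟙 (t ∧ y) + 𝟙 (t ∧ z))) refl true

     inside-upper : 2 * T₃ inside₂ ≤ Q
     inside-upper = *-cancelˡ-≤ 3 (begin
       3 * (2 * T₃ inside₂) ≡⟨ sym (*-assoc 3 2 (T₃ inside₂)) ⟩
       6 * T₃ inside₂ ≤⟨ T₃-upper inside₂ inside-sym ⟩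
       ∑³ (λ a b c → 𝟙 (inside₂ a b c)) ≤⟨ ∑³-mono (λ a b c → pt (one (X a) (X b) (X c)) (g a b) (g b c) (g a c)) ⟩
       ∑³ (λ a b c → 𝟙 (g a b ∧ g b c) + (𝟙 (g b c ∧ g a c) + 𝟙 (g a b ∧ g a c))) ≡⟨ two-pairs ⟩
       3 * Q ∎)
       where
       pt = bounded₅ (λ _ t x y z → 𝟙 (t ∧ any₂ x y z)) (λ _ t x y z → 𝟙 (x ∧ y) + (𝟙 (y ∧ z) + 𝟙 (x ∧ z))) refl true

     -- Every ordered pair of G takes about x/2 triples out of the free ones. Through `paths`, both
     -- the overlaps and the newly freed triples with one vertex in X stay within the term with nM.
     free-bound : s′ * (2 * #free spec + M * x) ≤ s′ * (2 * largest n + M) + 2 * (n * M)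
     free-bound = begin
       s′ * (2 * #free spec + M * x) ≤⟨ *-monoʳ-≤ s′ (+-cancelʳ-≤ (2 * t) _ _ (begin
         2 * #free spec + M * x + 2 * t ≤⟨ +-monoˡ-≤ (2 * t) (+-monoʳ-≤ (2 * #free spec) touching-lower) ⟩
         2 * #free spec + (2 * t + M + Q) + 2 * t ≡⟨ e₁ (#free spec) t M Q ⟩
         2 * (#free spec + t) + 2 * t + M + Q ≤⟨ +-monoˡ-≤ Q (+-monoˡ-≤ M (+-monoˡ-≤ (2 * t) (*-monoʳ-≤ 2 (≤-trans #free-spec (+-monoˡ-≤ (T₃ inside₂) (largest-upper X)))))) ⟩
         2 * (largest n + T₃ inside₂) + 2 * t + M + Q ≡⟨ e₂ (largest n) (T₃ inside₂) t M Q ⟩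
         2 * largest n + M + 2 * T₃ inside₂ + Q + 2 * t ≤⟨ +-monoˡ-≤ (2 * t) (+-monoˡ-≤ Q (+-monoʳ-≤ (2 * largest n + M) inside-upper)) ⟩
         2 * largest n + M + Q + Q + 2 * t ∎)) ⟩
       s′ * (2 * largest n + M + Q + Q) ≡⟨ e₃ s′ (2 * largest n + M) Q ⟩
       s′ * (2 * largest n + M) + 2 * (s′ * Q) ≤⟨ +-monoʳ-≤ (s′ * (2 * largest n + M)) (*-monoʳ-≤ 2 paths) ⟩
       s′ * (2 * largest n + M) + 2 * (n * M) ∎
       where
       t = T₃ touching
       e₁ : ∀ f t m q → 2 * f + (2 * t + m + q) + 2 * t ≡ 2 * (f + t) + 2 * t + m + q
       e₁ = solve-∀
       e₂ : ∀ l i t m q → 2 * (l + i) + 2 * t + m + q ≡ 2 * l + m + 2 * i + q + 2 * t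
       e₂ = solve-∀
       e₃ : ∀ s l q → s * (l + q + q) ≡ s * l + 2 * (s * q)
       e₃ = solve-∀

     errors-bound : ∀ s H → (∀ a b → g a b ≡ true → s * ∣ (λ q → E H a b q ∧ X q) ∣ₚ ≤ n) → 2 * s * errors spec H ≤ n * M
     errors-bound s H cod = *-cancelˡ-≤ 3 (begin
       3 * (2 * s * errors spec H) ≤⟨ *-monoʳ-≤ 3 (*-monoʳ-≤ (2 * s) errs) ⟩
       3 * (2 * s * T₃ w) ≡⟨ e₁ s (T₃ w) ⟩
       s * (6 * T₃ w) ≤⟨ *-monoʳ-≤ s (≤-trans (T₃-upper w w-sym) (∑³-mono (λ a b c → pt (E H a b c) (two (X a) (X b) (X c)) (g a b) (g b c) (g a c)))) ⟩
       s * ∑³ (λ a b c → 𝟙 (E H a b c ∧ (two (X a) (X b) (X c) ∧ g a b)) + (𝟙 (E H a b c ∧ (two (X a) (X b) (X c) ∧ g b c)) + 𝟙 (E H a b c ∧ (two (X a) (X b) (X c) ∧ g a c))))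
         ≡⟨ cong (s *_) (touched-pairs (E H) (E-sym H)) ⟩
       s * (3 * ∑³ (λ a b c → 𝟙 (g a b ∧ (E H a b c ∧ X c)))) ≡⟨ e₂ s _ ⟩
       3 * (s * ∑³ (λ a b c → 𝟙 (g a b ∧ (E H a b c ∧ X c)))) ≤⟨ *-monoʳ-≤ 3 (≤-trans (≤-reflexive (sym (∑²-*ˡ s (λ a b → ∑ (λ c → 𝟙 (g a b ∧ (E H a b c ∧ X c))))))) (∑²-mono row)) ⟩
       3 * ∑² (λ a b → n * 𝟙 (g a b)) ≡⟨ cong (3 *_) (∑²-*ˡ n (λ a b → 𝟙 (g a b))) ⟩
       3 * (n * M) ∎)
       where
       w : Fin n → Fin n → Fin n → Bool
       w a b c = E H a b c ∧ touching a b c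
       w-sym : Sym₃ w
       w-sym = record { s₁₂ = λ a b c → cong₂ _∧_ (Sym₃.s₁₂ (E-sym H) a b c) (Sym₃.s₁₂ touching-sym a b c)
                      ; s₂₃ = λ a b c → cong₂ _∧_ (Sym₃.s₂₃ (E-sym H) a b c) (Sym₃.s₂₃ touching-sym a b c) }
       e₁ : ∀ s t → 3 * (2 * s * t) ≡ s * (6 * t)
       e₁ = solve-∀
       e₂ : ∀ s t → s * (3 * t) ≡ 3 * (s * t)
       e₂ = solve-∀
       errs : errors spec H ≤ T₃ w
       errs = ≤-trans (≤-reflexive (trans (∑-cong (λ p → cong₂ (λ κ b → 𝟙 (isErr κ ∧ b)) (at-spec p) (E-at H p))) (∑-triple (λ i j k → isErr (kind i j k) ∧ E H i j k))))
         (T₃-mono (λ a b c e → let p , q = ∧-true {isErr (kind a b c)} e in ∧-intro q (logic (two (X a) (X b) (X c)) (g a b ∨ (g b c ∨ g a c)) (one (X a) (X b) (X c) ∧ any₂ (g a b) (g b c) (g a c)) p)))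
         where
         logic : ∀ t u v → isErr (if t then (if u then err else free) else (if v then free else fixed false)) ≡ true → t ∧ u ≡ true
         logic true true v e = refl
         logic false u true ()
         logic false u false ()
       pt = bounded₅ (λ h t x y z → 𝟙 (h ∧ (t ∧ (x ∨ (y ∨ z))))) (λ h t x y z → 𝟙 (h ∧ (t ∧ x)) + (𝟙 (h ∧ (t ∧ y)) + 𝟙 (h ∧ (t ∧ z)))) refl
       row : ∀ a b → s * ∑ (λ c → 𝟙 (g a b ∧ (E H a b c ∧ X c))) ≤ n * 𝟙 (g a b)
       row a b = bool-case (g a b)
         (λ e → ≤-trans (*-monoʳ-≤ s (∑-mono (λ c → 𝟙-mono (λ m → proj₂ (∧-true {g a b} m))))) (≤-trans (cod a b e) (≤-reflexive (sym (trans (cong (λ b → n * 𝟙 b) e) (*-identityʳ n))))))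
         (λ e → ≤-trans (≤-reflexive (trans (cong (s *_) (∑-zero (λ c → cong (λ m → 𝟙 (m ∧ (E H a b c ∧ X c))) e))) (*-zeroʳ s))) z≤n)

 module _ {n : ℕ} (H : TripleSystem n) (X : Fin n → Bool) where
   private
     h : Fin n → Fin n → Fin n → Bool
     h = E {n} H
     hs : Sym₃ h
     hs = E-sym {n} H

   crossing-intro : ∀ a b c → (X a xor X b) ≡ true → X c ≡ false → h a b c ≡ true → crossing h X a b ≡ true
   crossing-intro a b c p q r = ∧-intro p (dec-true (Finₚ.any? (λ c → (not (X c) ∧ h a b c) Data.Bool.≟ true)) (c , ∧-intro (cong not q) r))

   crossing-elim : ∀ a b → crossing h X a b ≡ true → (X a xor X b) ≡ true × ∃[ c ] (X c ≡ false × h a b c ≡ true)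
   crossing-elim a b e = let p , q = ∧-true {X a xor X b} e
                             c , m = does-sound (Finₚ.any? (λ c → (not (X c) ∧ h a b c) Data.Bool.≟ true)) q
                             x , y = ∧-true {not (X c)} m
                         in p , c , not-true x , y

   crossing-sym : ∀ a b → crossing h X a b ≡ crossing h X b a
   crossing-sym a b = bool-ext (dir a b) (dir b a)
     where
     xor-comm : ∀ x y → (x xor y) ≡ (y xor x)
     xor-comm true true = refl
     xor-comm true false = refl
     xor-comm false true = refl
     xor-comm false false = refl
     dir : ∀ a b → crossing h X a b ≡ true → crossing h X b a ≡ true
     dir a b e = let p , c , q , r = crossing-elim a b e in crossing-intro b a c (trans (xor-comm (X b) (X a)) p) q (trans (Sym₃.s₁₂ hs b a c) r)

   private
     vals : ∀ {a b c x y z} → X a ≡ x → X b ≡ y → X c ≡ z → ∀ {A : Set} (f : Bool → Bool → Bool → A) → f (X a) (X b) (X c) ≡ f x y z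
     vals refl refl refl f = refl

     ∨r : ∀ a b → a ∨ (b ∨ true) ≡ true
     ∨r true b = refl
     ∨r false true = refl
     ∨r false false = refl

   inside-pairs : ∀ a b c → h a b c ≡ true → one (X a) (X b) (X c) ≡ true → any₂ (crossing h X a b) (crossing h X b c) (crossing h X a c) ≡ true
   inside-pairs a b c m o = go (X a) (X b) (X c) refl refl refl
     where
     G = crossing h X
     go : ∀ x y z → X a ≡ x → X b ≡ y → X c ≡ z → any₂ (G a b) (G b c) (G a c) ≡ true
     go true true true p q r = case trans (sym o) (vals p q r one) of λ ()
     go true true false p q r = case trans (sym o) (vals p q r one) of λ ()
     go true false true p q r = case trans (sym o) (vals p q r one) of λ ()
     go false true true p q r = case trans (sym o) (vals p q r one) of λ ()
     go false false false p q r = case trans (sym o) (vals p q r one) of λ ()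
     go true false false p q r = lemma (crossing-intro a b c (cong₂ _xor_ p q) r m) (crossing-intro a c b (cong₂ _xor_ p r) q (trans (Sym₃.s₂₃ hs a c b) m))
       where
       lemma : G a b ≡ true → G a c ≡ true → any₂ (G a b) (G b c) (G a c) ≡ true
       lemma u v rewrite u | v = ∨r (G b c) (G b c ∧ true)
     go false true false p q r = lemma (crossing-intro a b c (cong₂ _xor_ p q) r m) (crossing-intro b c a (cong₂ _xor_ q r) p (trans (sym (Sym₃.rot hs a b c)) m))
       where
       lemma : G a b ≡ true → G b c ≡ true → any₂ (G a b) (G b c) (G a c) ≡ true
       lemma u v rewrite u | v = refl
     go false false true p q r = lemma (crossing-intro b c a (cong₂ _xor_ q r) p (trans (sym (Sym₃.rot hs a b c)) m)) (crossing-intro a c b (cong₂ _xor_ p r) q (trans (Sym₃.s₂₃ hs a c b) m))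
       where
       lemma : G b c ≡ true → G a c ≡ true → any₂ (G a b) (G b c) (G a c) ≡ true
       lemma u v rewrite u | v = ∨-zeroʳ (G a b ∧ true)

   thin-agrees : ∀ {s s′ g} → Thin h X s s′ → (∀ a b → g a b ≡ crossing h X a b) → Agrees (Spec.spec X g) H
   thin-agrees {s} {s′} {g} th e p b q = trans (E-at H p) (lemma _ _ _ (trans (sym (Spec.at-spec X g p)) q))
     where
     logic : ∀ t u v b → (if t then (if u then err else free) else (if v then free else fixed false)) ≡ fixed b → b ≡ false × t ≡ false × v ≡ false
     logic true true v b ()
     logic true false v b ()
     logic false u true b ()
     logic false u false b refl = refl , refl , refl
     lemma : ∀ i j k → Spec.kind X g i j k ≡ fixed b → h i j k ≡ b
     lemma i j k κ≡ = let b≡ , t≡ , v≡ = logic (two (X i) (X j) (X k)) (g i j ∨ (g j k ∨ g i k)) (one (X i) (X j) (X k) ∧ any₂ (g i j) (g j k) (g i k)) b κ≡ in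
       trans (¬true⇒false (λ m → true≢false
         (∧-intro (subst (λ t → t ∨ one (X i) (X j) (X k) ≡ true) t≡ (Thin.shape th i j k m))
           (trans (trans (cong₂ (λ x y → any₂ x y (g i k)) (e i j) (e j k)) (cong (any₂ (crossing h X i j) (crossing h X j k)) (e i k)))
                  (inside-pairs i j k m (subst (λ t → t ∨ one (X i) (X j) (X k) ≡ true) t≡ (Thin.shape th i j k m))))) v≡)) (sym b≡)

 -- Every pair of G forces about 2n/3 triples across X out of the free choice, against 2 log n for specifying the pair.
 thin-exponent : ∀ {n M x L f k τ ℓ u} → 128 * (2 * f + M * x) ≤ 128 * (2 * L + M) + 2 * (n * M) → 896 * k ≤ n * M → 128 * τ ≤ n + 128 →
   13 * n ≤ 20 * x → 4 ≤ M → 192 + 256 * ℓ ≤ n → 128 * u ≤ 20 * n → f + (M * τ + 7 * k) + 2 * ℓ * M + (n + u) ≤ L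
 thin-exponent {n} {M} {x} {L} {f} {k} {τ} {ℓ} {u} A K T lo 4≤M size U = *-cancelˡ-≤ 256 (+-cancelʳ-≤ (83 * (n * M)) _ _ (begin
   256 * (f + (M * τ + 7 * k) + 2 * ℓ * M + (n + u)) + 83 * (n * M) ≤⟨ +-monoʳ-≤ _ 83x ⟩
   256 * (f + (M * τ + 7 * k) + 2 * ℓ * M + (n + u)) + M * (128 * x) ≡⟨ e₁ f M τ k ℓ n u x ⟩
   128 * (2 * f + M * x) + 2 * (M * (128 * τ)) + 2 * (896 * k) + 2 * (M * (256 * ℓ)) + (256 * n + 2 * (128 * u))
     ≤⟨ +-mono-≤ (+-mono-≤ (+-mono-≤ (+-mono-≤ A (*-monoʳ-≤ 2 (*-monoʳ-≤ M T))) (*-monoʳ-≤ 2 K)) ≤-refl) (+-monoʳ-≤ (256 * n) (*-monoʳ-≤ 2 U)) ⟩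
   128 * (2 * L + M) + 2 * (n * M) + 2 * (M * (n + 128)) + 2 * (n * M) + 2 * (M * (256 * ℓ)) + (256 * n + 2 * (20 * n)) ≡⟨ e₂ L M n ℓ ⟩
   256 * L + 6 * (n * M) + 2 * (M * (192 + 256 * ℓ)) + 74 * (n * 4) ≤⟨ +-mono-≤ (+-monoʳ-≤ (256 * L + 6 * (n * M)) (*-monoʳ-≤ 2 (*-monoʳ-≤ M size))) (*-monoʳ-≤ 74 (*-monoʳ-≤ n 4≤M)) ⟩
   256 * L + 6 * (n * M) + 2 * (M * n) + 74 * (n * M) ≤⟨ ≤-trans (m≤m+n _ (n * M)) (≤-reflexive (e₃ L M n)) ⟩
   256 * L + 83 * (n * M) ∎))
   where
   open ≤-Reasoning
   83x : 83 * (n * M) ≤ M * (128 * x)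
   83x = *-cancelˡ-≤ 20 (begin
     20 * (83 * (n * M)) ≤⟨ m≤m+n _ (4 * (n * M)) ⟩
     20 * (83 * (n * M)) + 4 * (n * M) ≡⟨ i₁ n M ⟩
     128 * (M * (13 * n)) ≤⟨ *-monoʳ-≤ 128 (*-monoʳ-≤ M lo) ⟩
     128 * (M * (20 * x)) ≡⟨ i₂ M x ⟩
     20 * (M * (128 * x)) ∎)
     where
     i₁ : ∀ n M → 20 * (83 * (n * M)) + 4 * (n * M) ≡ 128 * (M * (13 * n))
     i₁ = solve-∀
     i₂ : ∀ M x → 128 * (M * (20 * x)) ≡ 20 * (M * (128 * x))
     i₂ = solve-∀
   e₁ : ∀ f M τ k ℓ n u x → 256 * (f + (M * τ + 7 * k) + 2 * ℓ * M + (n + u)) + M * (128 * x) ≡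
        128 * (2 * f + M * x) + 2 * (M * (128 * τ)) + 2 * (896 * k) + 2 * (M * (256 * ℓ)) + (256 * n + 2 * (128 * u))
   e₁ = solve-∀
   e₂ : ∀ L M n ℓ → 128 * (2 * L + M) + 2 * (n * M) + 2 * (M * (n + 128)) + 2 * (n * M) + 2 * (M * (256 * ℓ)) + (256 * n + 2 * (20 * n)) ≡
        256 * L + 6 * (n * M) + 2 * (M * (192 + 256 * ℓ)) + 74 * (n * 4)
   e₂ = solve-∀
   e₃ : ∀ L M n → 256 * L + 6 * (n * M) + 2 * (M * n) + 74 * (n * M) + n * M ≡ 256 * L + 83 * (n * M)
   e₃ = solve-∀

 ThinCase : ∀ {n} → ℕ → (Fin n → Bool) → TripleSystem n → Set
 ThinCase {n} s X H = Thin (E H) X s 128 × 13 * n ≤ 20 * ∣ X ∣ₚ × 4 ≤ o₂ (crossing (E H) X)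

 -- A system is recovered from the number m of its crossing pairs, the list of these pairs, and its
 -- place in the family of `Spec`. The factor `suc (n * n)` is the choice of m.
 thin-cover : ∀ {n s ℓ u} → 448 ≤ s → n ≤ 2 ^ ℓ → 192 + 256 * ℓ ≤ n → 128 * u ≤ 20 * n → ∀ (X : Fin n → Bool) →
   Cov (ThinCase s X) (suc (n * n) * 2 ^ (largest n ∸ (n + u)))
 thin-cover {n} {s} {ℓ} {u} 448≤s n≤ size U X = Cov-⊂ (λ H th → let L , len , e = elements (crossing (E H) X) in
       fromℕ< {o₂ (crossing (E H) X)} (s≤s (≤-trans (∑²-≤const 1 (λ a b → 𝟙≤1 _)) (≤-reflexive (*-identityʳ _)))) , tt , L , trans len (sym (Finₚ.toℕ-fromℕ< _)) , th , e , sym (Finₚ.toℕ-fromℕ< _))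
   (Cov-∃ {X = λ _ → ⊤} {P = λ m H → ∃ λ L → length L ≡ toℕ m × Valid (toℕ m) L H} (Cov-Fin (suc (n * n))) (λ m → level (toℕ m)))
   where
   Valid : ℕ → List (Fin n × Fin n) → TripleSystem n → Set
   Valid m L H = ThinCase s X H × (∀ a b → listed L a b ≡ crossing (E H) X a b) × o₂ (crossing (E H) X) ≡ m
   Λ = largest n
   module At (m : ℕ) where
     -- By `errors-bound` with s ≥ 448, at most nm/(2 · 448) of the triples touching G are edges.
     kq = quotient 896 (n * m) (s≤s z≤n)
     k = proj₁ kq
     τq = quotient 128 n (s≤s z≤n)
     τ = suc (proj₁ τq)
     128τ : 128 * τ ≤ n + 128
     128τ = ≤-trans (≤-reflexive (trans (*-suc 128 (proj₁ τq)) (+-comm 128 _))) (+-monoˡ-≤ 128 (proj₁ (proj₂ τq)))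
     n≤128τ : n ≤ 128 * τ
     n≤128τ = <⇒≤ (≰⇒> (λ p → 1+n≰n (proj₂ (proj₂ τq) τ p)))
     module _ {L : List (Fin n × Fin n)} {H : TripleSystem n} (v : Valid m L H) where
       g = listed L
       th = proj₁ (proj₁ v)
       g≡ = proj₁ (proj₂ v)
       M≡ : o₂ g ≡ m
       M≡ = trans (∑²-cong (λ a b → cong 𝟙 (g≡ a b))) (proj₂ (proj₂ v))
       module Z = Spec.Sizes X g (λ a b → trans (g≡ a b) (trans (crossing-sym {n} H X a b) (sym (g≡ b a))))
         (λ a b e → proj₁ (crossing-elim {n} H X a b (trans (sym (g≡ a b)) e))) 128 (λ a → ≤-trans (*-monoʳ-≤ 128 (≤-reflexive (∑-cong (λ b → cong 𝟙 (g≡ a b))))) (Thin.degree th a))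
       -- At most nm/2 ≤ 64 m τ triples touch G, so `Bin-≤` is applied with 2^6; its exponent
       -- charges seven bits to each error.
       size-≤ : 2 ^ #free (Spec.spec X g) * Bin (#err (Spec.spec X g)) k ≤ 2 ^ (#free (Spec.spec X g) + (m * τ + 7 * k))
       size-≤ = ≤-trans (*-monoʳ-≤ (2 ^ #free (Spec.spec X g)) (Bin-≤ 6 _ (m * τ) k err-≤)) (≤-reflexive (sym (^-distribˡ-+-* 2 (#free (Spec.spec X g)) (m * τ + 7 * k))))
         where
         open ≤-Reasoning
         e₁ : ∀ m τ → 128 * τ * m ≡ 2 * (64 * (m * τ))
         e₁ = solve-∀
         err-≤ : #err (Spec.spec X g) ≤ 2 ^ 6 * (m * τ)
         err-≤ = *-cancelˡ-≤ 2 (begin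
           2 * #err (Spec.spec X g) ≤⟨ *-monoʳ-≤ 2 (Spec.#err-spec X g) ⟩
           2 * T₃ (Spec.touching X g) ≤⟨ Z.touching-upper ⟩
           n * o₂ g ≡⟨ cong (n *_) M≡ ⟩
           n * m ≤⟨ *-monoˡ-≤ m n≤128τ ⟩
           128 * τ * m ≡⟨ e₁ m τ ⟩
           2 * (64 * (m * τ)) ∎)
       exponent : #free (Spec.spec X g) + (m * τ + 7 * k) + 2 * ℓ * m + (n + u) ≤ Λ
       exponent = thin-exponent {n} {m} {∣ X ∣ₚ} {Λ} {#free (Spec.spec X g)} {k} {τ} {ℓ} {u}
         (subst (λ o → 128 * (2 * #free (Spec.spec X g) + o * ∣ X ∣ₚ) ≤ 128 * (2 * Λ + o) + 2 * (n * o)) {x = o₂ g} M≡ Z.free-bound)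
         (proj₁ (proj₂ kq)) 128τ (proj₁ (proj₂ (proj₁ v))) (subst (4 ≤_) (proj₂ (proj₂ v)) (proj₂ (proj₂ (proj₁ v)))) size U
       within : H ∈ₗ family (Spec.spec X g) k
       within = family-complete (Spec.spec X g) k H (thin-agrees {n} H X th g≡)
         (proj₂ (proj₂ kq) _ (≤-trans (*-monoˡ-≤ _ (*-monoʳ-≤ 2 448≤s)) (subst (λ o → 2 * s * errors (Spec.spec X g) H ≤ n * o) M≡
            (Z.errors-bound s H (λ a b e → Thin.codegree th a b (trans (sym (g≡ a b)) e))))))
   level : ∀ m → Cov (λ H → ∃ λ L → length L ≡ m × Valid m L H) (2 ^ (Λ ∸ (n + u)))
   -- The inequality between the exponents is proved from a system with m crossing pairs. If the
   -- numbers violate it, there is no such system and the empty list covers.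
   level m with 2 * ℓ * m + (n + u) Data.Nat.≤? Λ
   ... | no ¬p = Cov-∅ (λ { H (L , _ , v) → ¬p (≤-trans (+-monoˡ-≤ (n + u) (m≤n+m (2 * ℓ * m) (#free (Spec.spec X (listed L)) + (m * At.τ m + 7 * At.k m)))) (At.exponent m {L} {H} v)) })
   ... | yes p = Cov-≤ bound (Cov-∃ (Cov-List (Cov-× (Cov-Fin n) (Cov-Fin n)) m) family-of)
     where
     K = Λ ∸ (n + u) ∸ 2 * ℓ * m
     bound : (n * n) ^ m * 2 ^ K ≤ 2 ^ (Λ ∸ (n + u))
     bound = begin
       (n * n) ^ m * 2 ^ K ≤⟨ *-monoˡ-≤ (2 ^ K) (^-monoˡ-≤ m (≤-trans (*-mono-≤ n≤ n≤) (≤-reflexive (trans (sym (^-distribˡ-+-* 2 ℓ ℓ)) (cong (λ z → 2 ^ (ℓ + z)) (sym (+-identityʳ ℓ))))))) ⟩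
       (2 ^ (2 * ℓ)) ^ m * 2 ^ K ≡⟨ cong (_* 2 ^ K) (^-*-assoc 2 (2 * ℓ) m) ⟩
       2 ^ (2 * ℓ * m) * 2 ^ K ≡⟨ sym (^-distribˡ-+-* 2 (2 * ℓ * m) K) ⟩
       2 ^ (2 * ℓ * m + K) ≡⟨ cong (2 ^_) (m+[n∸m]≡n (m+n≤o⇒m≤o∸n (2 * ℓ * m) p)) ⟩
       2 ^ (Λ ∸ (n + u)) ∎
       where
       open ≤-Reasoning
     family-of : ∀ L → Cov (Valid m L) (2 ^ K)
     family-of L with 2 ^ #free (Spec.spec X (listed L)) * Bin (#err (Spec.spec X (listed L))) (At.k m) Data.Nat.≤? 2 ^ K
     ... | yes q = family (Spec.spec X (listed L)) (At.k m) , ≤-trans (≤-reflexive (family-length (Spec.spec X (listed L)) (At.k m))) q , λ H v → At.within m {L} {H} v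
     ... | no ¬q = Cov-∅ (λ H v → ¬q (≤-trans (At.size-≤ m {L} {H} v) (^-monoʳ-≤ 2
             (m+n≤o⇒m≤o∸n (#free (Spec.spec X (listed L)) + (m * At.τ m + 7 * At.k m)) (m+n≤o⇒m≤o∸n (#free (Spec.spec X (listed L)) + (m * At.τ m + 7 * At.k m) + 2 * ℓ * m) (At.exponent m {L} {H} v))))))

open ThinSystems

-- Semi-bipartite systems, and many systems that are not.

module SemiBipartiteCounts where
 module TripleSpec {n : ℕ} (κ : Fin n → Fin n → Fin n → Kind) where
   specᵗ : Vec Kind (N3 n)
   specᵗ = tabulateᵥ (λ p → let i , j , k = triple p in κ i j k)

   at-specᵗ : ∀ p → lookupᵥ specᵗ p ≡ (let i , j , k = triple p in κ i j k)
   at-specᵗ p = Vecₚ.lookup∘tabulate _ p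

   sum-specᵗ : (q : Kind → Bool) → ∑ (λ p → 𝟙 (q (lookupᵥ specᵗ p))) ≡ T₃ (λ i j k → q (κ i j k))
   sum-specᵗ q = trans (∑-cong (λ p → cong (λ κ → 𝟙 (q κ)) (at-specᵗ p))) (∑-triple (λ i j k → q (κ i j k)))

   agreesᵗ : ∀ H → (∀ a b c s → κ a b c ≡ fixed s → E H a b c ≡ s) → Agrees specᵗ H
   agreesᵗ H f p b e = trans (E-at H p) (f _ _ _ b (trans (sym (at-specᵗ p)) e))

   errorsᵗ : ∀ H → errors specᵗ H ≤ ∑³ (λ a b c → 𝟙 (isErr (κ a b c) ∧ E H a b c))
   errorsᵗ H = ≤-trans (≤-reflexive (trans (∑-cong (λ p → cong₂ (λ κ b → 𝟙 (isErr κ ∧ b)) (at-specᵗ p) (E-at H p))) (∑-triple (λ i j k → isErr (κ i j k) ∧ E H i j k))))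
     (∑³-mono (λ a b c → 𝟙-mono (λ e → proj₂ (∧-true {sorted a b c} e))))

 Semi : ∀ {n} → TripleSystem n → (Fin n → Bool) → Set
 Semi H X = ∀ a b c → E H a b c ≡ true → twos X a b c ≡ true

 SB⇒Semi : ∀ {n} H → SemiBipartite n H → ∃ (Semi H)
 SB⇒Semi H (X , f) = (λ a → does (a Subₚ.∈? X)) , λ a b c e → logic (does (a Subₚ.∈? X)) (does (b Subₚ.∈? X)) (does (c Subₚ.∈? X)) (f a b c (E⇒ H a b c e))
   where
   logic : ∀ x y z → (if x then 1 else 0) + (if y then 1 else 0) + (if z then 1 else 0) ≡ 2 → two x y z ≡ true
   logic true true false _ = refl
   logic true false true _ = refl
   logic false true true _ = refl
   logic true true true ()
   logic true false false ()
   logic false true false ()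
   logic false false true ()
   logic false false false ()

 Semi⇒SB : ∀ {n} H X → Semi H X → SemiBipartite n H
 Semi⇒SB H X f = tabulateᵥ X , λ a b c e → trans (cong₂ _+_ (cong₂ _+_ (val a) (val b)) (val c)) (logic (X a) (X b) (X c) (f a b c (⇒E H a b c e)))
   where
   Y = tabulateᵥ X
   logic : ∀ x y z → two x y z ≡ true → 𝟙 x + 𝟙 y + 𝟙 z ≡ 2
   logic true true false _ = refl
   logic true false true _ = refl
   logic false true true _ = refl
   val : ∀ a → [ a ∈ Y ] ≡ 𝟙 (X a)
   val a = bool-case (X a)
     (λ e → trans (cong (λ b → if b then 1 else 0) (dec-true (a Subₚ.∈? Y) (Vecₚ.lookup⇒[]= a Y (trans (Vecₚ.lookup∘tabulate X a) e)))) (cong 𝟙 (sym e)))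
     (λ e → trans (cong (λ b → if b then 1 else 0) (dec-false (a Subₚ.∈? Y) (λ m → true≢false (trans (sym (Vecₚ.lookup∘tabulate X a)) (Vecₚ.[]=⇒lookup m)) e))) (cong 𝟙 (sym e)))

 -- The sides of two vertices determine the side of every common neighbour, so a neighbourhood lies
 -- on one side, and no edge does.
 Semi⇒F-free : ∀ {n} H (X : Fin n → Bool) → Semi H X → F-free (E H)
 Semi⇒F-free H X f x y a b c p q r s = logic (X x) (X y) (X a) (X b) (X c) (f x y a p) (f x y b q) (f x y c r) (f a b c s)
   where
   logic : ∀ x y a b c → two x y a ≡ true → two x y b ≡ true → two x y c ≡ true → two a b c ≡ true → ⊥
   logic true true false false false _ _ _ ()
   logic true true true _ _ ()
   logic true true false true _ _ ()
   logic true true false false true _ _ ()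
   logic true false true true true _ _ _ ()
   logic true false false _ _ ()
   logic true false true false _ _ ()
   logic true false true true false _ _ ()
   logic false true true true true _ _ _ ()
   logic false true false _ _ ()
   logic false true true false _ _ ()
   logic false true true true false _ _ ()
   logic false false _ _ _ ()

 module _ {n : ℕ} (X : Fin n → Bool) where
   splitKind : Fin n → Fin n → Fin n → Kind
   splitKind a b c = if twos X a b c then free else fixed false

   open TripleSpec splitKind public using () renaming (specᵗ to splitSpec)
   private
     module Z = TripleSpec splitKind

     kind-free : ∀ t → isFree (if t then free else fixed false) ≡ t
     kind-free true = refl
     kind-free false = refl
     kind-err : ∀ t → isErr (if t then free else fixed false) ≡ false
     kind-err true = refl
     kind-err false = refl

   split-free : #free splitSpec ≡ T₃ (twos X)
   split-free = trans (Z.sum-specᵗ isFree) (T₃-cong (λ a b c → kind-free (twos X a b c)))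

   split-no-err : ∀ p → lookupᵥ splitSpec p ≡ err → ⊥
   split-no-err p e = true≢false (cong isErr (trans (sym (Z.at-specᵗ p)) e)) (kind-err (let i , j , k = triple p in twos X i j k))

   split-agrees : ∀ H → Semi H X → Agrees splitSpec H
   split-agrees H f = Z.agreesᵗ H (λ a b c s e → trans (¬true⇒false (λ m → clash (twos X a b c) e (f a b c m))) (sym (value (twos X a b c) e)))
     where
     clash : ∀ t {s} → (if t then free else fixed false) ≡ fixed s → t ≡ true → ⊥
     clash true () _
     value : ∀ t {s} → (if t then free else fixed false) ≡ fixed s → s ≡ false
     value false refl = refl

   split-errors : ∀ H → errors splitSpec H ≤ 0
   split-errors H = ≤-trans (Z.errorsᵗ H) (≤-reflexive (∑-zero (λ a → ∑-zero (λ b → ∑-zero (λ c → cong (λ e → 𝟙 (e ∧ E H a b c)) (kind-err (twos X a b c)))))))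

 distinct-triples : ∀ {n} (P : Fin n → Fin n → Fin n → Set) → (∀ {a b c} → P a b c → P b a c) → (∀ {a b c} → P a b c → P a c b) →
   (∀ p → let i , j , k = triple p in P i j k) → ∀ a b c → a ≢ b → b ≢ c → a ≢ c → P a b c
 distinct-triples {n} P s₁₂ s₂₃ f a b c a≢b b≢c a≢c with Finₚ.<-cmp a b | Finₚ.<-cmp b c | Finₚ.<-cmp a c
 ... | tri≈ _ e _ | _ | _ = ⊥-elim (a≢b e)
 ... | tri< _ _ _ | tri≈ _ e _ | _ = ⊥-elim (b≢c e)
 ... | tri> _ _ _ | tri≈ _ e _ | _ = ⊥-elim (b≢c e)
 ... | tri< _ _ _ | tri< _ _ _ | tri≈ _ e _ = ⊥-elim (a≢c e)
 ... | tri< _ _ _ | tri> _ _ _ | tri≈ _ e _ = ⊥-elim (a≢c e)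
 ... | tri> _ _ _ | tri< _ _ _ | tri≈ _ e _ = ⊥-elim (a≢c e)
 ... | tri> _ _ _ | tri> _ _ _ | tri≈ _ e _ = ⊥-elim (a≢c e)
 ... | tri< p _ _ | tri< q _ _ | _ = listed-triple a b c p q
   where
   listed-triple : ∀ i j k → i Data.Fin.< j → j Data.Fin.< k → P i j k
   listed-triple i j k p q = let r , e = position i j k p q in subst (λ { (i , j , k) → P i j k }) e (f r)
 ... | tri< p _ _ | tri> _ _ q | tri< r _ _ = s₂₃ (let t , e = position a c b r q in subst (λ { (i , j , k) → P i j k }) e (f t))
 ... | tri< p _ _ | tri> _ _ q | tri> _ _ r = s₂₃ (s₁₂ (let t , e = position c a b r p in subst (λ { (i , j , k) → P i j k }) e (f t)))
 ... | tri> _ _ p | tri< q _ _ | tri< r _ _ = s₁₂ (let t , e = position b a c p r in subst (λ { (i , j , k) → P i j k }) e (f t))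
 ... | tri> _ _ p | tri< q _ _ | tri> _ _ r = s₁₂ (s₂₃ (let t , e = position b c a q r in subst (λ { (i , j , k) → P i j k }) e (f t)))
 ... | tri> _ _ p | tri> _ _ q | _ = s₁₂ (s₂₃ (s₁₂ (let t , e = position c b a q p in subst (λ { (i , j , k) → P i j k }) e (f t))))

 member : ∀ {n} → List (Fin n) → Fin n → Bool
 member [] v = false
 member (u ∷ L) v = (u ==ᶠ v) ∨ member L v

 member-count : ∀ {n} (L : List (Fin n)) → ∣ member L ∣ₚ ≤ length L
 member-count [] = ≤-reflexive (∑-zero (λ _ → refl))
 member-count (u ∷ L) = ≤-trans (∑-mono (λ v → 𝟙-∨ (u ==ᶠ v) (member L v))) (≤-trans (≤-reflexive (∑-+ _ _)) (+-mono-≤ (≤-reflexive one-u) (member-count L)))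
   where
   one-u : ∑ (λ v → 𝟙 (u ==ᶠ v)) ≡ 1
   one-u = trans (∑-cong (λ v → sym (*-identityʳ _))) (∑-δ u (λ _ → 1))

 fresh : ∀ {n} (A : Fin n → Bool) (L : List (Fin n)) → length L < ∣ A ∣ₚ → ∃[ v ] (A v ≡ true × member L v ≡ false)
 fresh A L p = let v , q = ∑-<⇒∃ (λ v → 𝟙 (member L v)) (λ v → 𝟙 (A v)) (≤-<-trans (member-count L) p) in v , conv (A v) (member L v) q
   where
   conv : ∀ a b → 𝟙 b < 𝟙 a → a ≡ true × b ≡ false
   conv true false _ = refl , refl
   conv true true (s≤s ())
   conv false b ()

 -- An edge {x, y, y′} together with all edges joining two of a, b, c to y or y′ rules out every partition.
 module Obstruction {n : ℕ} (X : Fin n → Bool) (x y y′ a b c : Fin n)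
   (Xx : X x ≡ true) (Xa : X a ≡ true) (Xb : X b ≡ true) (Xc : X c ≡ true) (Xy : X y ≡ false) (Xy′ : X y′ ≡ false)
   (y≢y′ : y ≢ y′) (a≢b : a ≢ b) (b≢c : b ≢ c) (a≢c : a ≢ c) (a≢x : a ≢ x) (b≢x : b ≢ x) (c≢x : c ≢ x) where
   s t : Fin n → Bool
   s = member (x ∷ y ∷ y′ ∷ [])
   t = member (a ∷ b ∷ c ∷ y ∷ y′ ∷ [])

   three : (Fin n → Bool) → Fin n → Fin n → Fin n → Bool
   three f i j k = f i ∧ (f j ∧ f k)

   has : Fin n → Fin n → Fin n → Fin n → Bool
   has v i j k = (v ==ᶠ i) ∨ ((v ==ᶠ j) ∨ (v ==ᶠ k))

   -- The apex edge and the six wings are forced. All further triples through x and one of y, y′ are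
   -- excluded, so that {x, y} and {x, y′} keep one neighbour each; this is what prevents copies of
   -- F. Every other triple with two vertices in X is free.
   κ-of : Bool → Bool → Bool → Bool → Kind
   κ-of e p q f = if e then fixed true else (if p then (if q then fixed true else (if f then fixed false else free)) else fixed false)

   κ : Fin n → Fin n → Fin n → Kind
   κ i j k = κ-of (three s i j k) (twos X i j k) (three t i j k) (has x i j k ∧ (has y i j k ∨ has y′ i j k))

   open TripleSpec κ

   specᵒ : Vec Kind (N3 n)
   specᵒ = specᵗ

   private
     ∧₃-s₁₂ : ∀ p q r → p ∧ (q ∧ r) ≡ q ∧ (p ∧ r)
     ∧₃-s₁₂ true q r = refl
     ∧₃-s₁₂ false true r = refl
     ∧₃-s₁₂ false false r = refl
     ∨₃-s₁₂ : ∀ p q r → p ∨ (q ∨ r) ≡ q ∨ (p ∨ r)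
     ∨₃-s₁₂ false q r = refl
     ∨₃-s₁₂ true true r = refl
     ∨₃-s₁₂ true false r = refl

     three-sym : ∀ f → Sym₃ (three f)
     three-sym f = record { s₁₂ = λ i j k → ∧₃-s₁₂ (f i) (f j) (f k) ; s₂₃ = λ i j k → cong (f i ∧_) (∧-comm (f j) (f k)) }

     has-sym : ∀ v → Sym₃ (has v)
     has-sym v = record { s₁₂ = λ i j k → ∨₃-s₁₂ (v ==ᶠ i) (v ==ᶠ j) (v ==ᶠ k) ; s₂₃ = λ i j k → cong ((v ==ᶠ i) ∨_) (∨-comm (v ==ᶠ j) (v ==ᶠ k)) }

     κ-cong : ∀ {p p′ q q′ r r′ u u′ v v′ w w′} → p ≡ p′ → q ≡ q′ → r ≡ r′ → u ≡ u′ → v ≡ v′ → w ≡ w′ →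
       (κ-of p q r (u ∧ (v ∨ w))) ≡
       (κ-of p′ q′ r′ (u′ ∧ (v′ ∨ w′)))
     κ-cong refl refl refl refl refl refl = refl

     κ-s₁₂ : ∀ i j k → κ i j k ≡ κ j i k
     κ-s₁₂ i j k = κ-cong (Sym₃.s₁₂ (three-sym s) i j k) (Sym₃.s₁₂ (twos-sym X) i j k) (Sym₃.s₁₂ (three-sym t) i j k) (Sym₃.s₁₂ (has-sym x) i j k) (Sym₃.s₁₂ (has-sym y) i j k) (Sym₃.s₁₂ (has-sym y′) i j k)
     κ-s₂₃ : ∀ i j k → κ i j k ≡ κ i k j
     κ-s₂₃ i j k = κ-cong (Sym₃.s₂₃ (three-sym s) i j k) (Sym₃.s₂₃ (twos-sym X) i j k) (Sym₃.s₂₃ (three-sym t) i j k) (Sym₃.s₂₃ (has-sym x) i j k) (Sym₃.s₂₃ (has-sym y) i j k) (Sym₃.s₂₃ (has-sym y′) i j k)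

   no-errᵒ : ∀ p → lookupᵥ specᵗ p ≡ err → ⊥
   no-errᵒ p e = let i , j , k = triple p in logic (three s i j k) (twos X i j k) (three t i j k) (has x i j k ∧ (has y i j k ∨ has y′ i j k)) (trans (sym (at-specᵗ p)) e)
     where
     logic : ∀ p q r u → (κ-of p q r u) ≡ err → ⊥
     logic true q r u ()
     logic false true true u ()
     logic false true false true ()
     logic false true false false ()
     logic false false r u ()

   module Agreeing (H : TripleSystem n) (ag : Agrees specᵗ H) where
     private
       h : Fin n → Fin n → Fin n → Bool
       h = E {n} H
       hs : Sym₃ h
       hs = E-sym {n} H
       open Sym₃ hs

     value : ∀ u → ∀ i j k → i ≢ j → j ≢ k → i ≢ k → κ i j k ≡ fixed u → h i j k ≡ u
     value u = distinct-triples (λ i j k → κ i j k ≡ fixed u → h i j k ≡ u)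
       (λ {i} {j} {k} f e → trans (s₁₂ j i k) (f (trans (κ-s₁₂ i j k) e))) (λ {i} {j} {k} f e → trans (s₂₃ i k j) (f (trans (κ-s₂₃ i j k) e)))
       (λ p e → trans (sym (E-at H p)) (ag p u (trans (at-specᵗ p) e)))

     distinct₁ : ∀ {i j k} → h i j k ≡ true → i ≢ j
     distinct₁ {i} {j} {k} m i≡j = true≢false (subst (λ j → h i j k ≡ true) (sym i≡j) m) (E-irrefl {n} H i k)
     distinct₂ : ∀ {i j k} → h i j k ≡ true → j ≢ k
     distinct₂ {i} {j} {k} m = distinct₁ (trans (sym (rot i j k)) m)
     distinct₃ : ∀ {i j k} → h i j k ≡ true → i ≢ k
     distinct₃ {i} {j} {k} m = distinct₁ (trans (s₂₃ i k j) m)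

     edge-kind : ∀ i j k → h i j k ≡ true → κ i j k ≡ fixed false → ⊥
     edge-kind i j k m e = true≢false m (value false i j k (distinct₁ m) (distinct₂ m) (distinct₃ m) e)

     edges : ∀ i j k → h i j k ≡ true → three s i j k ≡ true ⊎ (twos X i j k ≡ true × has x i j k ∧ (has y i j k ∨ has y′ i j k) ≡ false)
     edges i j k m = logic (three s i j k) (twos X i j k) (three t i j k) (has x i j k ∧ (has y i j k ∨ has y′ i j k)) t-ok (edge-kind i j k m)
       where
       logic : ∀ p q r u → (r ≡ true → u ≡ false) → ((κ-of p q r u) ≡ fixed false → ⊥) → p ≡ true ⊎ (q ≡ true × u ≡ false)
       logic true q r u _ _ = inj₁ refl
       logic false true true u g _ = inj₂ (refl , g refl)
       logic false true false true _ f = ⊥-elim (f refl)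
       logic false true false false _ _ = inj₂ (refl , refl)
       logic false false r u _ f = ⊥-elim (f refl)
       tx : t x ≡ false
       tx rewrite ==ᶠ-false a≢x | ==ᶠ-false b≢x | ==ᶠ-false c≢x | ==ᶠ-false {i = y} {x} (λ e → true≢false (trans (cong X e) Xx) Xy) | ==ᶠ-false {i = y′} {x} (λ e → true≢false (trans (cong X e) Xx) Xy′) = refl
       t-ok : three t i j k ≡ true → has x i j k ∧ (has y i j k ∨ has y′ i j k) ≡ false
       t-ok e = let p , q = ∧-true {t i} e
                    q , r = ∧-true {t j} q
                in cong (_∧ (has y i j k ∨ has y′ i j k)) (trans (cong₂ _∨_ (away p) (cong₂ _∨_ (away q) (away r))) refl)
         where
         away : ∀ {v} → t v ≡ true → (x ==ᶠ v) ≡ false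
         away {v} p = ==ᶠ-false (λ x≡v → true≢false (trans (cong t x≡v) p) tx)

     private
       data In : Fin n → Set where
         inx : In x
         iny : In y
         iny′ : In y′

       member⇒ : ∀ v → s v ≡ true → In v
       member⇒ v e with x Finₚ.≟ v | y Finₚ.≟ v | y′ Finₚ.≟ v
       ... | yes refl | _ | _ = inx
       ... | no _ | yes refl | _ = iny
       ... | no _ | no _ | yes refl = iny′
       member⇒ v () | no _ | no _ | no _

       has₁ : ∀ u j k → has u u j k ≡ true
       has₁ u j k = cong (_∨ ((u ==ᶠ j) ∨ (u ==ᶠ k))) (==ᶠ-refl u)
       has₂ : ∀ u i k → has u i u k ≡ true
       has₂ u i k = trans (Sym₃.s₁₂ (has-sym u) i u k) (has₁ u i k)

       x≢y : x ≢ y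
       x≢y e = true≢false (trans (cong X (sym e)) Xx) Xy
       x≢y′ : x ≢ y′
       x≢y′ e = true≢false (trans (cong X (sym e)) Xx) Xy′


       pair-edge : ∀ {u v} i → In u → X u ≡ true → In v → X v ≡ false → h u v i ≡ true → s i ≡ true
       pair-edge i iny xu _ _ m = ⊥-elim (true≢false xu Xy)
       pair-edge i iny′ xu _ _ m = ⊥-elim (true≢false xu Xy′)
       pair-edge i inx xu inx xv m = ⊥-elim (true≢false Xx xv)
       pair-edge i inx xu iny xv m = case edges x y i m of λ
         { (inj₁ e) → proj₂ (∧-true {s y} (proj₂ (∧-true {s x} e)))
         ; (inj₂ (_ , e)) → ⊥-elim (true≢false (∧-intro (has₁ x y i) (cong (_∨ has y′ x y i) (has₂ y x i))) e) }
       pair-edge i inx xu iny′ xv m = case edges x y′ i m of λ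
         { (inj₁ e) → proj₂ (∧-true {s y′} (proj₂ (∧-true {s x} e)))
         ; (inj₂ (_ , e)) → ⊥-elim (true≢false (∧-intro (has₁ x y′ i) (trans (cong (has y x y′ i ∨_) (has₂ y′ x i)) (∨-zeroʳ _))) e) }

       last : ∀ {u v} i j → In u → X u ≡ true → In v → X v ≡ false → h u v i ≡ true → h u v j ≡ true → i ≡ j
       last {u} {v} i j iu xu iv xv m m′ = go iu iv xu xv (member⇒ i (pair-edge i iu xu iv xv m)) (member⇒ j (pair-edge j iu xu iv xv m′)) m m′
         where
         go : ∀ {u v i j} → In u → In v → X u ≡ true → X v ≡ false → In i → In j → h u v i ≡ true → h u v j ≡ true → i ≡ j
         go iny _ xu _ _ _ _ _ = ⊥-elim (true≢false xu Xy)
         go iny′ _ xu _ _ _ _ _ = ⊥-elim (true≢false xu Xy′)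
         go inx inx _ xv _ _ _ _ = ⊥-elim (true≢false Xx xv)
         go inx _ _ _ inx _ m _ = ⊥-elim (distinct₃ m refl)
         go inx _ _ _ _ inx _ m = ⊥-elim (distinct₃ m refl)
         go inx iny _ _ iny _ m _ = ⊥-elim (distinct₂ m refl)
         go inx iny _ _ iny′ iny _ m = ⊥-elim (distinct₂ m refl)
         go inx iny _ _ iny′ iny′ _ _ = refl
         go inx iny′ _ _ iny′ _ m _ = ⊥-elim (distinct₂ m refl)
         go inx iny′ _ _ iny iny′ _ m = ⊥-elim (distinct₂ m refl)
         go inx iny′ _ _ iny iny _ _ = refl

       third : ∀ u v i → X u ≡ true → X v ≡ false → h u v i ≡ true → X i ≡ true ⊎ (In u × In v)
       third u v i xu xv m with edges u v i m
       ... | inj₁ e = inj₂ (member⇒ u (proj₁ (∧-true {s u} e)) , member⇒ v (proj₁ (∧-true {s v} (proj₂ (∧-true {s u} e)))))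
       ... | inj₂ (e , _) = inj₁ (trans (sym (trans (cong₂ (λ p q → two p q (X i)) xu xv) refl)) e)

       some-X : ∀ i j k → h i j k ≡ true → X i ≡ false → X j ≡ false → X k ≡ false → ⊥
       some-X i j k m p q r with edges i j k m
       ... | inj₂ (e , _) = true≢false e (trans (cong₂ (λ u v → two u v (X k)) p q) refl)
       ... | inj₁ e = go (member⇒ i (proj₁ (∧-true {s i} e))) (member⇒ j (proj₁ (∧-true {s j} (proj₂ (∧-true {s i} e))))) (member⇒ k (proj₂ (∧-true {s j} (proj₂ (∧-true {s i} e))))) m p q r
         where
         go : ∀ {i j k} → In i → In j → In k → h i j k ≡ true → X i ≡ false → X j ≡ false → X k ≡ false → ⊥
         go inx _ _ _ p _ _ = true≢false Xx p
         go _ inx _ _ _ q _ = true≢false Xx q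
         go _ _ inx _ _ _ r = true≢false Xx r
         go iny iny _ m _ _ _ = distinct₁ m refl
         go iny iny′ iny m _ _ _ = distinct₃ m refl
         go iny iny′ iny′ m _ _ _ = distinct₂ m refl
         go iny′ iny′ _ m _ _ _ = distinct₁ m refl
         go iny′ iny iny m _ _ _ = distinct₂ m refl
         go iny′ iny iny′ m _ _ _ = distinct₃ m refl

       not-all-X : ∀ i j k → h i j k ≡ true → X i ≡ true → X j ≡ true → X k ≡ true → ⊥
       not-all-X i j k m p q r with edges i j k m
       ... | inj₂ (e , _) = true≢false e (trans (cong₂ (λ u v → two u v (X k)) p q) (cong not r))
       ... | inj₁ e = go (member⇒ i (proj₁ (∧-true {s i} e))) (member⇒ j (proj₁ (∧-true {s j} (proj₂ (∧-true {s i} e))))) m p q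
         where
         go : ∀ {i j} → In i → In j → h i j k ≡ true → X i ≡ true → X j ≡ true → ⊥
         go inx inx m _ _ = distinct₁ m refl
         go iny _ _ p _ = true≢false p Xy
         go iny′ _ _ p _ = true≢false p Xy′
         go inx iny _ _ q = true≢false q Xy
         go inx iny′ _ _ q = true≢false q Xy′

       outside-X : ∀ u v i → X u ≡ true → X v ≡ true → h u v i ≡ true → X i ≡ false
       outside-X u v i p q m = ¬true⇒false (not-all-X u v i m p q)

       only-x : ∀ u v i → X u ≡ false → X v ≡ false → h u v i ≡ true → i ≡ x
       only-x u v i p q m with edges u v i m
       ... | inj₂ (e , _) = ⊥-elim (true≢false e (trans (cong₂ (λ u v → two u v (X i)) p q) refl))
       ... | inj₁ e with member⇒ i (proj₂ (∧-true {s v} (proj₂ (∧-true {s u} e))))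
       ...   | inx = refl
       ...   | iny = ⊥-elim (some-X u v y m p q Xy)
       ...   | iny′ = ⊥-elim (some-X u v y′ m p q Xy′)

       crossing-free : ∀ u v i j k → X u ≡ true → X v ≡ false → h u v i ≡ true → h u v j ≡ true → h u v k ≡ true → h i j k ≡ true → ⊥
       crossing-free u v i j k xu xv p q r m = case third u v i xu xv p , third u v j xu xv q , third u v k xu xv r of λ
         { (inj₂ (iu , iv) , _) → distinct₁ m (last i j iu xu iv xv p q)
         ; (inj₁ _ , inj₂ (iu , iv) , _) → distinct₁ m (last i j iu xu iv xv p q)
         ; (inj₁ _ , inj₁ _ , inj₂ (iu , iv)) → distinct₁ m (last i j iu xu iv xv p q)
         ; (inj₁ xi , inj₁ xj , inj₁ xk) → not-all-X i j k m xi xj xk }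

     -- A pair inside X has its neighbours outside X, where there is no edge. A crossing pair has
     -- its neighbours in X, where there is none either, except that {x, y} and {x, y′} have a
     -- single neighbour. A pair outside X can only have x as neighbour.
     F-freeᵒ : F-free h
     F-freeᵒ u v i j k p q r m = bool-case (X u)
       (λ xu → bool-case (X v)
         (λ xv → some-X i j k m (outside-X u v i xu xv p) (outside-X u v j xu xv q) (outside-X u v k xu xv r))
         (λ xv → crossing-free u v i j k xu xv p q r m))
       (λ xu → bool-case (X v)
         (λ xv → crossing-free v u i j k xv xu (trans (s₁₂ v u i) p) (trans (s₁₂ v u j) q) (trans (s₁₂ v u k) r) m)
         (λ xv → distinct₁ m (trans (only-x u v i xu xv p) (sym (only-x u v j xu xv q)))))

     private
       ta : t a ≡ true
       ta = cong (_∨ member (b ∷ c ∷ y ∷ y′ ∷ []) a) (==ᶠ-refl a)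
       tb : t b ≡ true
       tb = trans (cong (λ z → (a ==ᶠ b) ∨ (z ∨ member (c ∷ y ∷ y′ ∷ []) b)) (==ᶠ-refl b)) (∨-zeroʳ _)
       tc : t c ≡ true
       tc = trans (cong (λ z → (a ==ᶠ c) ∨ ((b ==ᶠ c) ∨ (z ∨ member (y ∷ y′ ∷ []) c))) (==ᶠ-refl c)) (trans (cong ((a ==ᶠ c) ∨_) (∨-zeroʳ (b ==ᶠ c))) (∨-zeroʳ _))
       ty : t y ≡ true
       ty = trans (cong (λ z → (a ==ᶠ y) ∨ ((b ==ᶠ y) ∨ ((c ==ᶠ y) ∨ (z ∨ member (y′ ∷ []) y)))) (==ᶠ-refl y))
              (trans (cong (λ z → (a ==ᶠ y) ∨ ((b ==ᶠ y) ∨ z)) (∨-zeroʳ (c ==ᶠ y))) (trans (cong ((a ==ᶠ y) ∨_) (∨-zeroʳ (b ==ᶠ y))) (∨-zeroʳ _)))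
       ty′ : t y′ ≡ true
       ty′ = trans (cong (λ z → (a ==ᶠ y′) ∨ ((b ==ᶠ y′) ∨ ((c ==ᶠ y′) ∨ ((y ==ᶠ y′) ∨ (z ∨ false))))) (==ᶠ-refl y′))
              (trans (cong (λ z → (a ==ᶠ y′) ∨ ((b ==ᶠ y′) ∨ ((c ==ᶠ y′) ∨ z))) (∨-zeroʳ (y ==ᶠ y′))) (trans (cong (λ z → (a ==ᶠ y′) ∨ ((b ==ᶠ y′) ∨ z)) (∨-zeroʳ (c ==ᶠ y′))) (trans (cong ((a ==ᶠ y′) ∨_) (∨-zeroʳ (b ==ᶠ y′))) (∨-zeroʳ _))))
       sx : s x ≡ true
       sx = cong (_∨ member (y ∷ y′ ∷ []) x) (==ᶠ-refl x)
       sy : s y ≡ true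
       sy = trans (cong (λ z → (x ==ᶠ y) ∨ (z ∨ member (y′ ∷ []) y)) (==ᶠ-refl y)) (∨-zeroʳ _)
       sy′ : s y′ ≡ true
       sy′ = trans (cong (λ z → (x ==ᶠ y′) ∨ ((y ==ᶠ y′) ∨ (z ∨ false))) (==ᶠ-refl y′)) (trans (cong ((x ==ᶠ y′) ∨_) (∨-zeroʳ (y ==ᶠ y′))) (∨-zeroʳ _))

       apex : h x y y′ ≡ true
       apex = value true x y y′ x≢y y≢y′ x≢y′ (cong (λ p → κ-of p (twos X x y y′) (three t x y y′) (has x x y y′ ∧ (has y x y y′ ∨ has y′ x y y′))) (∧-intro sx (∧-intro sy sy′)))

       wing : ∀ p q v → p ≢ q → X p ≡ true → X q ≡ true → X v ≡ false → t p ≡ true → t q ≡ true → t v ≡ true → h p q v ≡ true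
       wing p q v p≢q xp xq xv tp tq tv = value true p q v p≢q (λ e → true≢false (trans (cong X (sym e)) xq) xv) (λ e → true≢false (trans (cong X (sym e)) xp) xv)
         (logic (three s p q v) (cong₂ (λ a b → two a b (X v)) xp xq ⨾ cong not xv) (∧-intro tp (∧-intro tq tv)))
         where
         _⨾_ : ∀ {A : Set} {a b c : A} → a ≡ b → b ≡ c → a ≡ c
         _⨾_ = trans
         logic : ∀ m {q r u} → q ≡ true → r ≡ true → (κ-of m q r u) ≡ fixed true
         logic true _ _ = refl
         logic false refl refl = refl

     -- If y were in Z, each two of a, b, c would have exactly one vertex in Z, which is impossible
     -- for three vertices. So neither y nor y′ is in Z, and the apex edge has at most one vertex
     -- there.
     not-Semi : ∀ Z → Semi H Z → ⊥
     not-Semi Z f = logic (Z x) (Z y) (Z y′) (Z a) (Z b) (Z c) (f _ _ _ apex)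
       (f _ _ _ (wing a b y a≢b Xa Xb Xy ta tb ty)) (f _ _ _ (wing b c y b≢c Xb Xc Xy tb tc ty)) (f _ _ _ (wing a c y a≢c Xa Xc Xy ta tc ty))
       (f _ _ _ (wing a b y′ a≢b Xa Xb Xy′ ta tb ty′)) (f _ _ _ (wing b c y′ b≢c Xb Xc Xy′ tb tc ty′)) (f _ _ _ (wing a c y′ a≢c Xa Xc Xy′ ta tc ty′))
       where
       low : ∀ y a b c → two a b y ≡ true → two b c y ≡ true → two a c y ≡ true → y ≡ false
       low false a b c _ _ _ = refl
       low true true false false p ()
       low true false true false p q ()
       low true true false true p q ()
       low true false true true p ()
       low true true true _ ()
       low true false false _ ()
       logic : ∀ x y y′ a b c → two x y y′ ≡ true → two a b y ≡ true → two b c y ≡ true → two a c y ≡ true →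
         two a b y′ ≡ true → two b c y′ ≡ true → two a c y′ ≡ true → ⊥
       logic x y y′ a b c e p q r p′ q′ r′ = bad′ x (trans (cong₂ (λ u v → two x u v) (sym (low y a b c p q r)) (sym (low y′ a b c p′ q′ r′))) e)
         where
         bad′ : ∀ x → two x false false ≡ true → ⊥
         bad′ true ()
         bad′ false ()

   -- The triples that are not free lie within three or within five special vertices, at most 27 +
   -- 125, or contain {x, y} or {x, y′}, at most n each.
   free-lower : T₃ (twos X) ≤ #free specᵗ + (2 * n + 152)
   free-lower = begin
     T₃ (twos X) ≤⟨ ∑³-mono (λ i j k → pt (sorted i j k) (three s i j k) (twos X i j k) (three t i j k) (has x i j k) (has y i j k) (has y′ i j k)) ⟩
     ∑³ (λ i j k → 𝟙 (sorted i j k ∧ isFree (κ i j k)) + (𝟙 (three s i j k) + (𝟙 (three t i j k) + (𝟙 (sorted i j k ∧ (has x i j k ∧ has y i j k)) + 𝟙 (sorted i j k ∧ (has x i j k ∧ has y′ i j k))))))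
       ≡⟨ trans (∑³-+ _ _) (cong₂ _+_ (sym (sum-specᵗ isFree)) (trans (∑³-+ _ _) (cong (∑³ (λ i j k → 𝟙 (three s i j k)) +_) (trans (∑³-+ _ _) (cong (∑³ (λ i j k → 𝟙 (three t i j k)) +_) (∑³-+ _ _)))))) ⟩
     #free specᵗ + (∑³ (λ i j k → 𝟙 (three s i j k)) + (∑³ (λ i j k → 𝟙 (three t i j k)) + (T₃ (λ i j k → has x i j k ∧ has y i j k) + T₃ (λ i j k → has x i j k ∧ has y′ i j k))))
       ≤⟨ +-monoʳ-≤ (#free specᵗ) (+-mono-≤ (cube s 3 (member-count (x ∷ y ∷ y′ ∷ []))) (+-mono-≤ (cube t 5 (member-count (a ∷ b ∷ c ∷ y ∷ y′ ∷ []))) (+-mono-≤ (codeg y x≢y₀) (codeg y′ x≢y₁)))) ⟩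
     #free specᵗ + (27 + (125 + (n + n))) ≡⟨ cong (#free specᵗ +_) (e n) ⟩
     #free specᵗ + (2 * n + 152) ∎
     where
     open ≤-Reasoning
     x≢y₀ : x ≢ y
     x≢y₀ e = true≢false (trans (cong X (sym e)) Xx) Xy
     x≢y₁ : x ≢ y′
     x≢y₁ e = true≢false (trans (cong X (sym e)) Xx) Xy′
     e : ∀ n → 27 + (125 + (n + n)) ≡ 2 * n + 152
     e = solve-∀
     pt : ∀ m p q r u v w → 𝟙 (m ∧ q) ≤ 𝟙 (m ∧ isFree (κ-of p q r (u ∧ (v ∨ w)))) +
          (𝟙 p + (𝟙 r + (𝟙 (m ∧ (u ∧ v)) + 𝟙 (m ∧ (u ∧ w)))))
     pt false p q r u v w = z≤n
     pt true true true r u v w = s≤s z≤n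
     pt true p false r u v w = z≤n
     pt true false true true u v w = s≤s z≤n
     pt true false true false false v w = s≤s z≤n
     pt true false true false true true w = s≤s z≤n
     pt true false true false true false true = s≤s z≤n
     pt true false true false true false false = s≤s z≤n
     cube : ∀ (f : Fin n → Bool) m → ∣ f ∣ₚ ≤ m → ∑³ (λ i j k → 𝟙 (three f i j k)) ≤ m * (m * m)
     cube f m p = ≤-trans (≤-reflexive (trans (∑-cong (λ i → trans (∑²-cong (λ j k → trans (𝟙-∧ (f i) _) (cong (𝟙 (f i) *_) (𝟙-∧ (f j) (f k))))) (trans (∑²-*ˡ (𝟙 (f i)) _) (cong (𝟙 (f i) *_) (∑²-prod _ _))))) (∑-*ʳ _ _)))
       (*-mono-≤ p (*-mono-≤ p p))
     codeg : ∀ v → x ≢ v → T₃ (λ i j k → has x i j k ∧ has v i j k) ≤ n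
     codeg v x≢v = *-cancelˡ-≤ 6 (begin
       6 * T₃ (λ i j k → has x i j k ∧ has v i j k) ≤⟨ T₃-upper _ (record { s₁₂ = λ i j k → cong₂ _∧_ (Sym₃.s₁₂ (has-sym x) i j k) (Sym₃.s₁₂ (has-sym v) i j k) ; s₂₃ = λ i j k → cong₂ _∧_ (Sym₃.s₂₃ (has-sym x) i j k) (Sym₃.s₂₃ (has-sym v) i j k) }) ⟩
       ∑³ (λ i j k → 𝟙 (has x i j k ∧ has v i j k)) ≤⟨ ∑³-mono (λ i j k → six-cases (apart i) (apart j) (apart k)) ⟩
       ∑³ (λ i j k → (D i j + D j i) + ((D i k + D k i) + (D j k + D k j)))
         ≡⟨ trans (∑³-+ _ _) (cong₂ _+_ (trans (∑³-+ _ _) (cong₂ _+_ d₁ (trans (∑³-s₁₂ (λ i j k → D i j)) d₁))) (trans (∑³-+ _ _) (cong₂ _+_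
              (trans (∑³-+ _ _) (cong₂ _+_ d₂ (trans (∑³-s₂₃ (λ i j k → D j i)) (trans (∑³-s₁₂ (λ i j k → D i j)) d₁)))) (trans (∑³-+ _ _) (cong₂ _+_ (trans (∑³-s₁₂ (λ i j k → D i k)) d₂) (trans (∑³-s₁₂ (λ i j k → D k i)) (trans (∑³-s₂₃ (λ i j k → D j i)) (trans (∑³-s₁₂ (λ i j k → D i j)) d₁)))))))) ⟩
       (n + n) + ((n + n) + (n + n)) ≡⟨ e₆ n ⟩
       6 * n ∎)
       where
       apart : ∀ i → (x ==ᶠ i) ≡ true → (v ==ᶠ i) ≡ true → ⊥
       apart i p q = x≢v (trans (==ᶠ-true p) (sym (==ᶠ-true q)))
       e₆ : ∀ n → (n + n) + ((n + n) + (n + n)) ≡ 6 * n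
       e₆ = solve-∀
       D : Fin n → Fin n → ℕ
       D i j = 𝟙 (x ==ᶠ i) * 𝟙 (v ==ᶠ j)
       δ1 : ∀ u → ∑ (λ i → 𝟙 (u ==ᶠ i)) ≡ 1
       δ1 u = trans (∑-cong (λ i → sym (*-identityʳ _))) (∑-δ u (λ _ → 1))
       d₁ : ∑³ (λ i j k → D i j) ≡ n
       d₁ = trans (∑²-cong (λ i j → ∑-const {n} (D i j))) (trans (∑²-*ˡ n D) (trans (cong (n *_) (trans (∑²-prod _ _) (cong₂ _*_ (δ1 x) (δ1 v)))) (*-identityʳ n)))
       d₂ : ∑³ (λ i j k → D i k) ≡ n
       d₂ = trans (∑³-s₂₃ (λ i j k → D i j)) d₁
       six-cases : ∀ {a a′ b b′ c c′} → (a ≡ true → a′ ≡ true → ⊥) → (b ≡ true → b′ ≡ true → ⊥) → (c ≡ true → c′ ≡ true → ⊥) →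
         𝟙 ((a ∨ (b ∨ c)) ∧ (a′ ∨ (b′ ∨ c′))) ≤ (𝟙 a * 𝟙 b′ + 𝟙 b * 𝟙 a′) + ((𝟙 a * 𝟙 c′ + 𝟙 c * 𝟙 a′) + (𝟙 b * 𝟙 c′ + 𝟙 c * 𝟙 b′))
       six-cases {true} {true} f _ _ = ⊥-elim (f refl refl)
       six-cases {_} {_} {true} {true} _ f _ = ⊥-elim (f refl refl)
       six-cases {_} {_} {_} {_} {true} {true} _ _ f = ⊥-elim (f refl refl)
       six-cases {false} {false} {false} {false} {false} {false} _ _ _ = z≤n
       six-cases {false} {false} {false} {false} {false} {true} _ _ _ = z≤n
       six-cases {false} {false} {false} {false} {true} {false} _ _ _ = z≤n
       six-cases {false} {false} {false} {true} {false} {false} _ _ _ = z≤n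
       six-cases {false} {false} {false} {true} {false} {true} _ _ _ = z≤n
       six-cases {false} {false} {false} {true} {true} {false} _ _ _ = s≤s z≤n
       six-cases {false} {false} {true} {false} {false} {false} _ _ _ = z≤n
       six-cases {false} {false} {true} {false} {false} {true} _ _ _ = s≤s z≤n
       six-cases {false} {false} {true} {false} {true} {false} _ _ _ = z≤n
       six-cases {false} {true} {false} {false} {false} {false} _ _ _ = z≤n
       six-cases {false} {true} {false} {false} {false} {true} _ _ _ = z≤n
       six-cases {false} {true} {false} {false} {true} {false} _ _ _ = s≤s z≤n
       six-cases {false} {true} {false} {true} {false} {false} _ _ _ = z≤n
       six-cases {false} {true} {false} {true} {false} {true} _ _ _ = z≤n
       six-cases {false} {true} {false} {true} {true} {false} _ _ _ = s≤s z≤n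
       six-cases {false} {true} {true} {false} {false} {false} _ _ _ = s≤s z≤n
       six-cases {false} {true} {true} {false} {false} {true} _ _ _ = s≤s z≤n
       six-cases {false} {true} {true} {false} {true} {false} _ _ _ = s≤s z≤n
       six-cases {true} {false} {false} {false} {false} {false} _ _ _ = z≤n
       six-cases {true} {false} {false} {false} {false} {true} _ _ _ = s≤s z≤n
       six-cases {true} {false} {false} {false} {true} {false} _ _ _ = z≤n
       six-cases {true} {false} {false} {true} {false} {false} _ _ _ = s≤s z≤n
       six-cases {true} {false} {false} {true} {false} {true} _ _ _ = s≤s z≤n
       six-cases {true} {false} {false} {true} {true} {false} _ _ _ = s≤s z≤n
       six-cases {true} {false} {true} {false} {false} {false} _ _ _ = z≤n
       six-cases {true} {false} {true} {false} {false} {true} _ _ _ = s≤s z≤n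
       six-cases {true} {false} {true} {false} {true} {false} _ _ _ = z≤n

 NonSemi : ∀ n → TripleSystem n → Set
 NonSemi n H = IndependentNeighborhoods n H × ¬ SemiBipartite n H

 NonSemi? : ∀ n H → Dec (NonSemi n H)
 NonSemi? n H = IndependentNeighborhoods? n H ×-dec ¬? (SemiBipartite? n H)

 excess : ℕ → ℕ
 excess n = count (N3 n) (NonSemi n) (NonSemi? n)

 I-split : ∀ n → I n ≤ S n + excess n
 I-split n = count-≤-+ (N3 n) (SemiBipartite? n) (NonSemi? n) (IndependentNeighborhoods? n) (λ H ind → case SemiBipartite? n H of λ
   { (yes p) → inj₁ p ; (no ¬p) → inj₂ (ind , ¬p) })

 S+excess : ∀ n → S n + excess n ≤ I n
 S+excess n = count-+-≤ (N3 n) (SemiBipartite? n) (NonSemi? n) (IndependentNeighborhoods? n)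
   (λ H sb → let X , f = SB⇒Semi H sb in F-free⇒IN H (Semi⇒F-free H X f)) (λ H → proj₁) (λ H sb p → proj₂ p sb)

 S-lower : ∀ n → 2 ^ largest n ≤ S n
 S-lower n = let X , e = largest-attained n in ≤-trans (≤-reflexive (cong (2 ^_) (trans (sym e) (sym (split-free X)))))
   (count-cube (N3 n) (SemiBipartite? n) (splitSpec X) (split-no-err X) (λ H ag → Semi⇒SB H X (agrees⇒Semi X H ag)))
   where
   agrees⇒Semi : ∀ (X : Fin n → Bool) H → Agrees (splitSpec X) H → Semi {n} H X
   agrees⇒Semi X H ag a b c m = bool-case (twos X a b c) id (λ f → ⊥-elim (true≢false m (distinct-triples (λ i j k → twos X i j k ≡ false → E {n} H i j k ≡ false)
       (λ {i} {j} {k} g e → trans (Sym₃.s₁₂ (E-sym {n} H) j i k) (g (trans (Sym₃.s₁₂ (twos-sym X) i j k) e)))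
       (λ {i} {j} {k} g e → trans (Sym₃.s₂₃ (E-sym {n} H) i k j) (g (trans (Sym₃.s₂₃ (twos-sym X) i j k) e)))
       (λ p e → trans (sym (E-at H p)) (ag p false (trans (TripleSpec.at-specᵗ (splitKind X) p) (cong (λ t → if t then free else fixed false) e))))
       a b c (proj₁ (E⇒ H a b c m)) (proj₁ (proj₂ (E⇒ H a b c m))) (proj₁ (proj₂ (proj₂ (E⇒ H a b c m)))) f)))

 S-upper : ∀ n → S n ≤ 2 ^ (n + largest n)
 S-upper n = Cov-count (N3 n) (SemiBipartite? n) (Cov-≤ (≤-reflexive (sym (^-distribˡ-+-* 2 n (largest n))))
   (Cov-⊂ (λ H sb → let X , f = SB⇒Semi H sb in tabulateᵥ X , tt , λ a b c m → trans (same X a b c) (f a b c m))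
     (Cov-∃ {P = λ X H → Semi {n} H (lookupᵥ X)} (Cov-Vec Cov-Bool n) (λ X → family (splitSpec (lookupᵥ X)) 0 ,
       ≤-trans (≤-reflexive (trans (family-length (splitSpec (lookupᵥ X)) 0) (cong (2 ^ #free (splitSpec (lookupᵥ X)) *_) (Bin-0 (#err (splitSpec (lookupᵥ X)))))))
         (≤-trans (≤-reflexive (*-identityʳ _)) (^-monoʳ-≤ 2 (≤-trans (≤-reflexive (split-free (lookupᵥ X))) (largest-upper (lookupᵥ X))))) ,
       λ H f → family-complete (splitSpec (lookupᵥ X)) 0 H (split-agrees (lookupᵥ X) H f) (split-errors (lookupᵥ X) H)))))
   where
   Bin-0 : ∀ r → Bin r 0 ≡ 1
   Bin-0 zero = refl
   Bin-0 (suc r) = Bin-0 r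
   same : ∀ (X : Fin n → Bool) a b c → twos (lookupᵥ (tabulateᵥ X)) a b c ≡ twos X a b c
   same X a b c = trans (cong₂ (λ x y → two x y (lookupᵥ (tabulateᵥ X) c)) (Vecₚ.lookup∘tabulate X a) (Vecₚ.lookup∘tabulate X b)) (cong (two (X a) (X b)) (Vecₚ.lookup∘tabulate X c))

 member-false : ∀ {n} {u v : Fin n} {L} → member (u ∷ L) v ≡ false → u ≢ v × member L v ≡ false
 member-false {u = u} {v} {L} e = (λ { refl → true≢false (cong (_∨ member L u) (==ᶠ-refl u)) e }) , right (u ==ᶠ v) e
   where
   right : ∀ a {b} → a ∨ b ≡ false → b ≡ false
   right false e = e

 excess-lower : ∀ {n} (X : Fin n → Bool) → T₃ (twos X) ≡ largest n → 4 ≤ ∣ X ∣ₚ → 2 ≤ ∣ (λ i → not (X i)) ∣ₚ →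
   ∃[ m ] (2 ^ m ≤ excess n × largest n ≤ m + (2 * n + 152))
 excess-lower {n} X e bigX bigY =
   let x , Xx , _ = fresh X [] (≤-trans (s≤s z≤n) bigX)
       a , Xa , ma = fresh X (x ∷ []) (≤-trans (s≤s (s≤s z≤n)) bigX)
       b , Xb , mb = fresh X (x ∷ a ∷ []) (≤-trans (s≤s (s≤s (s≤s z≤n))) bigX)
       c , Xc , mc = fresh X (x ∷ a ∷ b ∷ []) bigX
       y , Yy , _ = fresh (λ i → not (X i)) [] (≤-trans (s≤s z≤n) bigY)
       y′ , Yy′ , my = fresh (λ i → not (X i)) (y ∷ []) bigY
       x≢a , _ = member-false {u = x} {a} {[]} ma
       x≢b , mb′ = member-false {u = x} {b} {a ∷ []} mb
       a≢b , _ = member-false {u = a} {b} {[]} mb′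
       x≢c , mc′ = member-false {u = x} {c} {a ∷ b ∷ []} mc
       a≢c , mc″ = member-false {u = a} {c} {b ∷ []} mc′
       b≢c , _ = member-false {u = b} {c} {[]} mc″
       y≢y′ , _ = member-false {u = y} {y′} {[]} my
   in build x y y′ a b c Xx Xa Xb Xc (not-true Yy) (not-true Yy′) y≢y′ a≢b b≢c a≢c (x≢a ∘ sym) (x≢b ∘ sym) (x≢c ∘ sym)
   where
   build : ∀ x y y′ a b c → X x ≡ true → X a ≡ true → X b ≡ true → X c ≡ true → X y ≡ false → X y′ ≡ false →
     y ≢ y′ → a ≢ b → b ≢ c → a ≢ c → a ≢ x → b ≢ x → c ≢ x → ∃[ m ] (2 ^ m ≤ excess n × largest n ≤ m + (2 * n + 152))
   build x y y′ a b c Xx Xa Xb Xc Xy Xy′ y≢y′ a≢b b≢c a≢c a≢x b≢x c≢x =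
     #free O.specᵒ , count-cube (N3 n) (NonSemi? n) O.specᵒ O.no-errᵒ
       (λ H ag → F-free⇒IN H (O.Agreeing.F-freeᵒ H ag) , λ sb → let Z , f = SB⇒Semi H sb in O.Agreeing.not-Semi H ag Z f) ,
     ≤-trans (≤-reflexive (sym e)) O.free-lower
     where
     module O = Obstruction X x y y′ a b c Xx Xa Xb Xc Xy Xy′ y≢y′ a≢b b≢c a≢c a≢x b≢x c≢x

open SemiBipartiteCounts

-- Logarithms, and the growth of the extremal number.

n<2^n : ∀ p → suc p ≤ 2 ^ p
n<2^n zero = ≤-refl
n<2^n (suc p) = +-mono-≤ (m^n>0 2 p) (≤-trans (n<2^n p) (≤-reflexive (sym (+-identityʳ _))))

square-pow : ∀ p → suc p * suc p ≤ 2 ^ (p + p)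
square-pow p = ≤-trans (*-mono-≤ (n<2^n p) (n<2^n p)) (≤-reflexive (sym (^-distribˡ-+-* 2 p p)))

log-exists : ∀ n → ∃[ p ] (suc n ≤ 2 ^ (p + p) × (p ≡ 0 ⊎ ∃[ r ] (p ≡ suc r × 2 ^ (r + r) ≤ n)))
log-exists zero = 0 , ≤-refl , inj₁ refl
log-exists (suc n) = let p , up , low = log-exists n in case suc (suc n) Data.Nat.≤? 2 ^ (p + p) of λ
  { (yes q) → p , q , (case low of λ { (inj₁ e) → inj₁ e ; (inj₂ (r , e , l)) → inj₂ (r , e , ≤-trans l (n≤1+n n)) })
  ; (no q) → suc p , ≤-trans (s≤s up) (grow p) , inj₂ (p , refl , ≤-pred (≰⇒> q)) }
  where
  grow : ∀ p → suc (2 ^ (p + p)) ≤ 2 ^ (suc p + suc p)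
  grow p = ≤-trans (+-monoˡ-≤ (2 ^ (p + p)) (m^n>0 2 (p + p))) (≤-trans (≤-reflexive (cong (2 ^ (p + p) +_) (sym (+-identityʳ _)))) (^-monoʳ-≤ 2 (s≤s (+-monoʳ-≤ p (n≤1+n p)))))

-- The logarithm is taken as 2p, since (r + 1)² ≤ 2^(2r) ≤ n for r = p - 1 already beats 2K(r + 1)
-- once r + 1 ≥ 2K. For smaller p the threshold N suffices.
log-small : ∀ K → ∃[ N ] (∀ n → N ≤ n → ∃[ ℓ ] (suc n ≤ 2 ^ ℓ × K * ℓ ≤ n))
log-small K = 4 * K * (2 * K + 1) , λ n big → let p , up , low = log-exists n in p + p , up , go n p big low
  where
  open ≤-Reasoning
  go : ∀ n p → 4 * K * (2 * K + 1) ≤ n → (p ≡ 0 ⊎ ∃[ r ] (p ≡ suc r × 2 ^ (r + r) ≤ n)) → K * (p + p) ≤ n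
  go n p big (inj₁ refl) = ≤-trans (≤-reflexive (*-zeroʳ K)) z≤n
  go n p big (inj₂ (r , refl , low)) = case ≤-total (suc r) (2 * K) of λ
    { (inj₁ few) → begin
        K * (suc r + suc r) ≤⟨ *-monoʳ-≤ K (+-mono-≤ few few) ⟩
        K * (2 * K + 2 * K) ≤⟨ ≤-trans (m≤m+n _ (4 * K * K + 4 * K)) (≤-reflexive (e₁ K)) ⟩
        4 * K * (2 * K + 1) ≤⟨ big ⟩
        n ∎
    ; (inj₂ many) → begin
        K * (suc r + suc r) ≡⟨ e₂ K (suc r) ⟩
        2 * K * suc r ≤⟨ *-monoˡ-≤ (suc r) many ⟩
        suc r * suc r ≤⟨ square-pow r ⟩
        2 ^ (r + r) ≤⟨ low ⟩
        n ∎ }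
    where
    e₁ : ∀ K → K * (2 * K + 2 * K) + (4 * K * K + 4 * K) ≡ 4 * K * (2 * K + 1)
    e₁ = solve-∀
    e₂ : ∀ K r → K * (r + r) ≡ 2 * K * r
    e₂ = solve-∀

initial : ∀ n m → m ≤ n → ∣ (λ (i : Fin n) → toℕ i <ᵇ m) ∣ₚ ≡ m
initial zero zero _ = ∑-empty _
initial (suc n) zero _ = ∑-zero (λ i → refl)
initial (suc n) (suc m) (s≤s p) = trans (∑-unfold _) (cong suc (initial n m p))

twos-diagonal : ∀ {n} (X : Fin n → Bool) → ∑³ (λ a b c → 𝟙 (twos X a b c)) ≤ 6 * T₃ (twos X) + 3 * (n * n)
twos-diagonal {n} X = ≤-trans (T₃-lower (twos X) (twos-sym X)) (+-monoʳ-≤ (6 * T₃ (twos X)) (*-monoʳ-≤ 3 (≤-trans (∑²-≤const 1 (λ a b → 𝟙≤1 (twos X a a b))) (≤-reflexive (*-identityʳ (n * n))))))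

-- Let the complement of X have y = ⌊n/3⌋ elements, and n = 3y + r with r ≤ 2. Then 4n³ - 27x²y =
-- r²(9y + 4r) is at most 16n². The other 27n² come from degenerate triples.
largest-cubic : ∀ n → 4 * cub n ≤ 54 * largest n + 43 * (n * n)
largest-cubic n = begin
  4 * cub n ≤⟨ cubic ⟩
  27 * (x * x * y) + 16 * (n * n) ≤⟨ +-monoˡ-≤ (16 * (n * n)) (begin
    27 * (x * x * y) ≡⟨ *-assoc 9 3 (x * x * y) ⟩
    9 * (3 * (x * x * y)) ≡⟨ cong (9 *_) (trans (cong₂ (λ u v → 3 * (u * u * v)) (sym X≡) (sym Y≡)) (sym (∑³-twos X))) ⟩
    9 * ∑³ (λ a b c → 𝟙 (twos X a b c)) ≤⟨ *-monoʳ-≤ 9 (twos-diagonal X) ⟩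
    9 * (6 * T₃ (twos X) + 3 * (n * n)) ≤⟨ *-monoʳ-≤ 9 (+-monoˡ-≤ (3 * (n * n)) (*-monoʳ-≤ 6 (largest-upper X))) ⟩
    9 * (6 * largest n + 3 * (n * n)) ≡⟨ e₁ (largest n) (n * n) ⟩
    54 * largest n + 27 * (n * n) ∎) ⟩
  54 * largest n + 27 * (n * n) + 16 * (n * n) ≡⟨ e₂ (54 * largest n) (n * n) ⟩
  54 * largest n + 43 * (n * n) ∎
  where
  open ≤-Reasoning
  e₁ : ∀ l m → 9 * (6 * l + 3 * m) ≡ 54 * l + 27 * m
  e₁ = solve-∀
  e₂ : ∀ l m → l + 27 * m + 16 * m ≡ l + 43 * m
  e₂ = solve-∀
  qt = quotient 3 n (s≤s z≤n)
  y = proj₁ qt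
  3y≤n : 3 * y ≤ n
  3y≤n = proj₁ (proj₂ qt)
  y≤n : y ≤ n
  y≤n = ≤-trans (m≤n*m y 3) 3y≤n
  r = n ∸ 3 * y
  n≡ : 3 * y + r ≡ n
  n≡ = m+[n∸m]≡n 3y≤n
  r≤2 : r ≤ 2
  r≤2 = ≤-pred (≰⇒> (λ 3≤r → 1+n≰n (proj₂ (proj₂ qt) (suc y) (≤-trans (≤-reflexive (trans (*-suc 3 y) (+-comm 3 (3 * y)))) (≤-trans (+-monoʳ-≤ (3 * y) 3≤r) (≤-reflexive n≡))))))
  x = 2 * y + r
  X : Fin n → Bool
  X i = not (toℕ i <ᵇ y)
  Y≡ : ∣ (λ i → not (X i)) ∣ₚ ≡ y
  Y≡ = trans (∑-cong (λ i → cong 𝟙 (not-involutive (toℕ i <ᵇ y)))) (initial n y y≤n)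
  X≡ : ∣ X ∣ₚ ≡ x
  X≡ = +-cancelʳ-≡ y _ _ (trans (cong (∣ X ∣ₚ +_) (sym Y≡)) (trans (∣∣ₚ-complement X) (trans (sym n≡) (e y r))))
    where
    e : ∀ y r → 3 * y + r ≡ 2 * y + r + y
    e = solve-∀
  cubic : 4 * cub n ≤ 27 * (x * x * y) + 16 * (n * n)
  cubic = subst (λ n → 4 * cub n ≤ 27 * (x * x * y) + 16 * (n * n)) n≡ (begin
    4 * cub (3 * y + r) ≡⟨ e y r ⟩
    27 * (x * x * y) + r * r * (9 * y + 4 * r) ≤⟨ +-monoʳ-≤ (27 * (x * x * y)) (≤-trans (*-monoˡ-≤ (9 * y + 4 * r) (*-mono-≤ r≤2 r≤2)) (≤-trans (bound y r) (*-monoʳ-≤ 16 (m≤mm (3 * y + r))))) ⟩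
    27 * (x * x * y) + 16 * ((3 * y + r) * (3 * y + r)) ∎)
    where
    e : ∀ y r → 4 * ((3 * y + r) * (3 * y + r) * (3 * y + r)) ≡ 27 * ((2 * y + r) * (2 * y + r) * y) + r * r * (9 * y + 4 * r)
    e = solve-∀
    bound : ∀ y r → 4 * (9 * y + 4 * r) ≤ 16 * (3 * y + r)
    bound y r = ≤-trans (m≤m+n _ (12 * y)) (≤-reflexive (i y r))
      where
      i : ∀ y r → 4 * (9 * y + 4 * r) + 12 * y ≡ 16 * (3 * y + r)
      i = solve-∀
    m≤mm : ∀ m → m ≤ m * m
    m≤mm zero = z≤n
    m≤mm m@(suc _) = m≤m*n m m

largest-dense : ∀ c {n} → c * 43 ≤ n → c * (4 * cub n) ≤ c * (54 * largest n) + cub n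
largest-dense c {n} big = begin
  c * (4 * cub n) ≤⟨ *-monoʳ-≤ c (largest-cubic n) ⟩
  c * (54 * largest n + 43 * (n * n)) ≡⟨ e c (largest n) (n * n) ⟩
  c * (54 * largest n) + c * 43 * (n * n) ≤⟨ +-monoʳ-≤ (c * (54 * largest n)) (≤-trans (*-monoˡ-≤ (n * n) big) (≤-reflexive (*-comm n (n * n)))) ⟩
  c * (54 * largest n) + cub n ∎
  where
  open ≤-Reasoning
  e : ∀ c l m → c * (54 * l + 43 * m) ≡ c * (54 * l) + c * 43 * m
  e = solve-∀

T₂-lower : ∀ {n} (W : Fin n → Fin n → Bool) → (∀ x y → W x y ≡ W y x) → o₂ W ≤ 2 * T₂ W + n
T₂-lower {n} W sy = begin
  o₂ W ≤⟨ ∑²-mono (λ x y → pt (W x y) (order x y)) ⟩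
  ∑² (λ x y → 𝟙 ((x <ᵇᶠ y) ∧ W x y) + (𝟙 ((y <ᵇᶠ x) ∧ W x y) + 𝟙 (x ==ᶠ y) * 1)) ≡⟨ trans (∑²-+ _ _) (cong (T₂ W +_) (trans (∑²-+ _ _) (cong₂ _+_ flip diag))) ⟩
  T₂ W + (T₂ W + n) ≡⟨ e (T₂ W) n ⟩
  2 * T₂ W + n ∎
  where
  open ≤-Reasoning
  e : ∀ t n → t + (t + n) ≡ 2 * t + n
  e = solve-∀
  flip : ∑² (λ x y → 𝟙 ((y <ᵇᶠ x) ∧ W x y)) ≡ T₂ W
  flip = trans (∑-swap (λ x y → 𝟙 ((y <ᵇᶠ x) ∧ W x y))) (∑²-cong (λ x y → cong (λ s → 𝟙 ((x <ᵇᶠ y) ∧ s)) (sy y x)))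
  diag : ∑² (λ x y → 𝟙 (x ==ᶠ y) * 1) ≡ n
  diag = trans (∑-cong (λ x → ∑-δ x (λ _ → 1))) (trans (∑-const {n} 1) (*-identityʳ n))
  pt : ∀ w {a b q} → Order a b q → 𝟙 w ≤ 𝟙 (a ∧ w) + (𝟙 (b ∧ w) + 𝟙 q * 1)
  pt w lt = m≤m+n _ _
  pt w gt = m≤m+n _ _
  pt w eq = 𝟙≤1 w

T₃-unfold : ∀ {n} (w : Fin (suc n) → Fin (suc n) → Fin (suc n) → Bool) →
  T₂ (λ j k → w zero (suc j) (suc k)) + T₃ (λ i j k → w (suc i) (suc j) (suc k)) ≤ T₃ w
T₃-unfold w = ≤-trans (+-mono-≤ (part zero) (∑-mono (λ i → part (suc i)))) (≤-reflexive (sym (∑-unfold _)))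
  where
  part : ∀ i → ∑² (λ j k → 𝟙 (sorted i (suc j) (suc k) ∧ w i (suc j) (suc k))) ≤ ∑² (λ j k → 𝟙 (sorted i j k ∧ w i j k))
  part i = ≤-trans (∑-mono (λ j → tail (λ k → 𝟙 (sorted i (suc j) k ∧ w i (suc j) k)))) (tail (λ j → ∑ (λ k → 𝟙 (sorted i j k ∧ w i j k))))
    where
    tail : ∀ {n} (f : Fin (suc n) → ℕ) → ∑ (λ k → f (suc k)) ≤ ∑ f
    tail f = ≤-trans (m≤n+m _ (f zero)) (≤-reflexive (sym (∑-unfold f)))

-- A vertex added outside an optimal X gains all pairs inside X, that is about 2n²/9 triples.
largest-growth : ∀ c n → 1 ≤ c → 64 * c * c * 43 ≤ n → c * (9 * largest n) + c * (2 * (suc n * suc n)) ≤ c * (9 * largest (suc n)) + suc n * suc n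
largest-growth c n 1≤c big = *-cancelˡ-≤ 16 (+-cancelʳ-≤ (72 * c * n + 4 * (n * n)) _ _ (begin
  16 * (c * (9 * L) + c * (2 * (suc n * suc n))) + (72 * c * n + 4 * (n * n)) ≡⟨ e₁ c L n ⟩
  8 * c * (18 * L) + 8 * c * (4 * (n * n)) + (136 * c * n + 32 * c + 4 * (n * n)) ≤⟨ +-monoˡ-≤ _ main ⟩
  8 * c * (18 * L′) + 72 * c * n + 4 * (n * n) + (136 * c * n + 32 * c + 4 * (n * n)) ≤⟨ +-monoʳ-≤ (8 * c * (18 * L′) + 72 * c * n + 4 * (n * n)) (+-monoˡ-≤ (4 * (n * n)) small) ⟩
  8 * c * (18 * L′) + 72 * c * n + 4 * (n * n) + (12 * (n * n) + (32 * n + 16) + 4 * (n * n)) ≡⟨ e₂ c L′ n ⟩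
  16 * (c * (9 * L′) + suc n * suc n) + (72 * c * n + 4 * (n * n)) ∎))
  where
  open ≤-Reasoning
  L = largest n
  L′ = largest (suc n)
  e₁ : ∀ c L n → 16 * (c * (9 * L) + c * (2 * ((1 + n) * (1 + n)))) + (72 * c * n + 4 * (n * n)) ≡ 8 * c * (18 * L) + 8 * c * (4 * (n * n)) + (136 * c * n + 32 * c + 4 * (n * n))
  e₁ = solve-∀
  e₂ : ∀ c L n → 8 * c * (18 * L) + 72 * c * n + 4 * (n * n) + (12 * (n * n) + (32 * n + 16) + 4 * (n * n)) ≡ 16 * (c * (9 * L) + (1 + n) * (1 + n)) + (72 * c * n + 4 * (n * n))
  e₂ = solve-∀
  14c≤n : 64 * c * 43 ≤ n
  14c≤n = ≤-trans (*-monoˡ-≤ 43 (m≤m*n (64 * c) c ⦃ >-nonZero 1≤c ⦄)) big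
  small : 136 * c * n + 32 * c ≤ 12 * (n * n) + (32 * n + 16)
  small = +-mono-≤ (≤-trans (*-monoˡ-≤ n 136c) (≤-reflexive (*-assoc 12 n n))) (≤-trans (*-monoʳ-≤ 32 (≤-trans (≤-trans (m≤n*m c 64) (m≤m*n (64 * c) 43)) 14c≤n)) (m≤m+n _ 16))
    where
    136c : 136 * c ≤ 12 * n
    136c = ≤-trans (≤-trans (*-monoˡ-≤ c {136} {12 * (64 * 43)} (m≤m+n 136 32888)) (≤-reflexive (i c))) (*-monoʳ-≤ 12 14c≤n)
      where
      i : ∀ c → 12 * (64 * 43) * c ≡ 12 * (64 * c * 43)
      i = solve-∀
  X = proj₁ (largest-attained n)
  X≡ = proj₂ (largest-attained n)
  x = ∣ X ∣ₚ
  y = ∣ (λ i → not (X i)) ∣ₚ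
  x+y = ∣∣ₚ-complement X
  dense : 8 * c * (8 * c) * (4 * cub n) ≤ 8 * c * (8 * c) * (27 * (x * x * y)) + cub n
  dense = begin
    8 * c * (8 * c) * (4 * cub n) ≤⟨ largest-dense (8 * c * (8 * c)) (≤-trans (≤-reflexive (i₁ c)) big) ⟩
    8 * c * (8 * c) * (54 * L) + cub n ≤⟨ +-monoˡ-≤ (cub n) (*-monoʳ-≤ (8 * c * (8 * c)) (begin
      54 * L ≡⟨ trans (cong (54 *_) (sym X≡)) (*-assoc 9 6 (T₃ (twos X))) ⟩
      9 * (6 * T₃ (twos X)) ≤⟨ *-monoʳ-≤ 9 (T₃-upper (twos X) (twos-sym X)) ⟩
      9 * ∑³ (λ a b c → 𝟙 (twos X a b c)) ≡⟨ cong (9 *_) (∑³-twos X) ⟩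
      9 * (3 * (x * x * y)) ≡⟨ sym (*-assoc 9 3 (x * x * y)) ⟩
      27 * (x * x * y) ∎)) ⟩
    8 * c * (8 * c) * (27 * (x * x * y)) + cub n ∎
    where
    i₁ : ∀ c → 8 * c * (8 * c) * 43 ≡ 64 * c * c * 43
    i₁ = solve-∀
  module B = Balance (8 * c) x y (subst (λ m → 8 * c * (8 * c) * (4 * cub m) ≤ 8 * c * (8 * c) * (27 * (x * x * y)) + cub m) (sym x+y) dense)
  square₈ : 8 * c * (4 * (n * n)) ≤ 8 * c * (9 * (x * x)) + 4 * (n * n)
  square₈ = subst (λ m → 8 * c * (4 * (m * m)) ≤ 8 * c * (9 * (x * x)) + 4 * (m * m)) x+y B.square-lower
  X′ : Fin (suc n) → Bool
  X′ zero = false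
  X′ (suc i) = X i
  step : 2 * L + x * x ≤ 2 * L′ + n
  step = begin
    2 * L + x * x ≤⟨ +-monoʳ-≤ (2 * L) (≤-trans (≤-reflexive (sym (o₂-base-true X))) (T₂-lower (base true X) (base-sym true X))) ⟩
    2 * L + (2 * T₂ (base true X) + n) ≡⟨ i L (T₂ (base true X)) n ⟩
    2 * (T₂ (base true X) + L) + n ≤⟨ +-monoˡ-≤ n (*-monoʳ-≤ 2 (≤-trans (+-monoʳ-≤ (T₂ (base true X)) (≤-reflexive (sym X≡))) (≤-trans (T₃-unfold (twos X′)) (largest-upper X′)))) ⟩
    2 * L′ + n ∎
    where
    i : ∀ l t n → 2 * l + (2 * t + n) ≡ 2 * (t + l) + n
    i = solve-∀
  main : 8 * c * (18 * L) + 8 * c * (4 * (n * n)) ≤ 8 * c * (18 * L′) + 72 * c * n + 4 * (n * n)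
  main = begin
    8 * c * (18 * L) + 8 * c * (4 * (n * n)) ≤⟨ +-monoʳ-≤ (8 * c * (18 * L)) square₈ ⟩
    8 * c * (18 * L) + (8 * c * (9 * (x * x)) + 4 * (n * n)) ≡⟨ i₁ c L (x * x) (n * n) ⟩
    72 * c * (2 * L + x * x) + 4 * (n * n) ≤⟨ +-monoˡ-≤ (4 * (n * n)) (*-monoʳ-≤ (72 * c) step) ⟩
    72 * c * (2 * L′ + n) + 4 * (n * n) ≡⟨ i₂ c L′ n (n * n) ⟩
    8 * c * (18 * L′) + 72 * c * n + 4 * (n * n) ∎
    where
    i₁ : ∀ c l x m → 8 * c * (18 * l) + (8 * c * (9 * x) + 4 * m) ≡ 72 * c * (2 * l + x) + 4 * m
    i₁ = solve-∀
    i₂ : ∀ c l n m → 72 * c * (2 * l + n) + 4 * m ≡ 8 * c * (18 * l) + 72 * c * n + 4 * m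
    i₂ = solve-∀

-- Systems with a lossy link or near a sparse set of triples are few.

module LossyCounts where
 quotient-offset : ∀ d r m → 1 ≤ d → r ≤ m → ∃[ k ] (d * k + r ≤ m × (∀ e → d * e + r ≤ m → e ≤ k))
 quotient-offset d r m 1≤d r≤m = let k , p , q = quotient d (m ∸ r) 1≤d in
   k , ≤-trans (+-monoˡ-≤ r p) (≤-reflexive (m∸n+n≡m r≤m)) , λ e s → q e (m+n≤o⇒m≤o∸n (d * e) s)

 abstract
   -- With an error rate of 1/`accuracy D`, both terms in the exponent of `Bin-≤` are at most
   -- Z/(216D), up to rounding. This is small next to the Z/(18D) that a gap at level D saves on a
   -- link.
   accuracy : ℕ → ℕ
   accuracy D = 216 * D * suc (216 * D)

   accuracy≡ : ∀ D → accuracy D ≡ 216 * D * suc (216 * D)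
   accuracy≡ D = refl

 Bin-small : ∀ D Z k → 1 ≤ D → accuracy D * k ≤ Z → ∃[ e ] (Bin Z k ≤ 2 ^ e × 216 * D * e ≤ 2 * Z + 216 * D)
 Bin-small D Z k 1≤D small = t + suc j * k , Bin-≤ j Z t k (≤-trans Z≤ (*-monoˡ-≤ t (≤-trans (n≤1+n j) (n<2^n j)))) , (begin
   j * (t + suc j * k) ≡⟨ e₁ j q k ⟩
   j * q + j * suc j * k + j ≤⟨ +-monoˡ-≤ j (+-mono-≤ (proj₁ (proj₂ qt)) (subst (λ a → a * k ≤ Z) (accuracy≡ D) small)) ⟩
   Z + Z + j ≡⟨ cong (λ z → Z + z + j) (sym (+-identityʳ Z)) ⟩
   2 * Z + j ∎)
   where
   open ≤-Reasoning
   j = 216 * D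
   1≤j : 1 ≤ j
   1≤j = *-mono-≤ {1} {216} (s≤s z≤n) 1≤D
   qt = quotient j Z 1≤j
   q = proj₁ qt
   t = suc q
   Z≤ : Z ≤ j * t
   Z≤ = <⇒≤ (≰⇒> (λ p → 1+n≰n (proj₂ (proj₂ qt) t p)))
   e₁ : ∀ j q k → j * (1 + q + (1 + j) * k) ≡ j * q + j * (1 + j) * k + j
   e₁ = solve-∀

 product-≤ : ∀ {a b} k m → a ≤ 2 ^ k → b ≤ 2 ^ m → a * b ≤ 2 ^ (k + m)
 product-≤ k m p q = ≤-trans (*-mono-≤ p q) (≤-reflexive (sym (^-distribˡ-+-* 2 k m)))

 codes-≤ : ∀ {N ℓ} → suc N ≤ 2 ^ ℓ → codes N ≤ 2 ^ (3 + (1 + (ℓ + (ℓ + (N + (N + ℓ * N))))))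
 codes-≤ {N} {ℓ} le = product-≤ 3 (1 + (ℓ + (ℓ + (N + (N + ℓ * N))))) (m≤m+n 6 2) (product-≤ {2} 1 (ℓ + (ℓ + (N + (N + ℓ * N)))) ≤-refl (product-≤ ℓ (ℓ + (N + (N + ℓ * N))) N≤ (product-≤ ℓ (N + (N + ℓ * N)) N≤ (product-≤ N (N + ℓ * N) ≤-refl (product-≤ N (ℓ * N) ≤-refl (≤-trans (^-monoˡ-≤ N le) (≤-reflexive (^-*-assoc 2 ℓ N))))))))
   where
   N≤ : N ≤ 2 ^ ℓ
   N≤ = ≤-trans (n≤1+n N) le

 lossy-cover-≤ : ∀ θ D → 1 ≤ D → ∀ {n ℓ v C} → suc (suc n) ≤ 2 ^ ℓ → 216 * D * ℓ ≤ suc n → 216 * D * 3 ≤ suc n → v ≤ 2 + n →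
   64 * (12 * D) * (12 * D) * 43 ≤ n → I n ≤ 2 ^ (C + (2 * n + largest n)) →
   Cov (λ H → IndependentNeighborhoods (suc n) H × Lossy θ D (accuracy D) (E H)) (2 ^ (C + (largest (suc n) ∸ (v + 4))))
 lossy-cover-≤ θ D 1≤D {n} {ℓ} {v} {C} le Dℓ D3 v≤ big In =
   Cov-≤ total (Cov-⊂ (λ { H (ind , L) → ind , Lossy⇒code {n} θ D (accuracy D) 1≤D toW toK H L })
     (LossyCount.lossy-cover {Code (suc n)} {n} (decodeCode θ) (Cov-Code (suc n)) w k))
   where
   open ≤-Reasoning
   N = suc n
   e₁ : ∀ D m → D * (18 * m) ≡ 18 * D * m
   e₁ = solve-∀
   NN≤ : N * N ≤ D * (4 * (N * N))
   NN≤ = ≤-trans (m≤n*m (N * N) 4) (m≤n*m (4 * (N * N)) D ⦃ >-nonZero 1≤D ⦄)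
   wq = quotient-offset (18 * D) (N * N) (D * (4 * (N * N))) (*-mono-≤ {1} {18} (s≤s z≤n) 1≤D) NN≤
   w = proj₁ wq
   toW : ∀ m → D * (18 * m) + N * N ≤ D * (4 * (N * N)) → m ≤ w
   toW m p = proj₂ (proj₂ wq) m (subst (λ z → z + N * N ≤ D * (4 * (N * N))) (e₁ D m) p)
   1≤acc : 1 ≤ accuracy D
   1≤acc = subst (1 ≤_) (sym (accuracy≡ D)) (*-mono-≤ {1} {216 * D} {1} {suc (216 * D)} (*-mono-≤ {1} {216} (s≤s z≤n) 1≤D) (s≤s z≤n))
   kq = quotient (accuracy D) (N * N) 1≤acc
   k = proj₁ kq
   toK : ∀ m → accuracy D * m ≤ N * N → m ≤ k
   toK = proj₂ (proj₂ kq)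
   bs = Bin-small D (N * N) k 1≤D (proj₁ (proj₂ kq))
   e = proj₁ bs
   cs = 3 + (1 + (ℓ + (ℓ + (N + (N + ℓ * N)))))
   -- In units of N²/(216D), the gap saves 12, the errors cost 2, and the growth of `largest` is
   -- known up to 2. The remaining 8 pay for the code and the other O(N log N) terms.
   exponent : ℓ + ((2 * n + largest n) + (cs + (w + e))) + (v + 4) ≤ largest N
   exponent = *-cancelˡ-≤ (216 * D) ⦃ m*n≢0 216 D ⦃ _ ⦄ ⦃ >-nonZero 1≤D ⦄ ⦄ (+-cancelʳ-≤ (48 * (D * (N * N)) + 12 * (N * N)) _ _ (begin
     216 * D * (ℓ + ((2 * n + largest n) + (cs + (w + e))) + (v + 4)) + (48 * (D * (N * N)) + 12 * (N * N))
       ≡⟨ i₁ D ℓ n (largest n) cs w e v (N * N) ⟩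
     2 * (12 * D * (9 * largest n) + 12 * D * (2 * (N * N))) + 12 * (18 * D * w + N * N) + 216 * D * e + 216 * D * (ℓ + 2 * n + cs + (v + 4))
       ≤⟨ +-mono-≤ (+-mono-≤ (+-mono-≤ (*-monoʳ-≤ 2 (largest-growth (12 * D) n (*-mono-≤ {1} {12} (s≤s z≤n) 1≤D) big)) (*-monoʳ-≤ 12 (proj₁ (proj₂ wq)))) (proj₂ (proj₂ bs))) ≤-refl ⟩
     2 * (12 * D * (9 * largest N) + N * N) + 12 * (D * (4 * (N * N))) + (2 * (N * N) + 216 * D) + 216 * D * (ℓ + 2 * n + cs + (v + 4))
       ≡⟨ i₂ D (largest N) (N * N) (ℓ + 2 * n + cs + (v + 4)) ⟩
     216 * D * largest N + 48 * (D * (N * N)) + 4 * (N * N) + 216 * D * (ℓ + 2 * n + cs + (v + 4) + 1) ≤⟨ +-monoʳ-≤ (216 * D * largest N + 48 * (D * (N * N)) + 4 * (N * N)) rest ⟩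
     216 * D * largest N + 48 * (D * (N * N)) + 4 * (N * N) + 8 * (N * N) ≡⟨ i₃ (216 * D * largest N) (48 * (D * (N * N))) (N * N) ⟩
     216 * D * largest N + (48 * (D * (N * N)) + 12 * (N * N)) ∎))
     where
     i₁ : ∀ D ℓ n L cs w e v M → 216 * D * (ℓ + ((2 * n + L) + (cs + (w + e))) + (v + 4)) + (48 * (D * M) + 12 * M) ≡
       2 * (12 * D * (9 * L) + 12 * D * (2 * M)) + 12 * (18 * D * w + M) + 216 * D * e + 216 * D * (ℓ + 2 * n + cs + (v + 4))
     i₁ = solve-∀
     i₂ : ∀ D L M r → 2 * (12 * D * (9 * L) + M) + 12 * (D * (4 * M)) + (2 * M + 216 * D) + 216 * D * r ≡ 216 * D * L + 48 * (D * M) + 4 * M + 216 * D * (r + 1)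
     i₂ = solve-∀
     i₃ : ∀ a b M → a + b + 4 * M + 8 * M ≡ a + (b + 12 * M)
     i₃ = solve-∀
     ℓ≤N : ℓ ≤ N
     ℓ≤N = ≤-trans (m≤n*m ℓ (216 * D) ⦃ m*n≢0 216 D ⦃ _ ⦄ ⦃ >-nonZero 1≤D ⦄ ⦄) Dℓ
     rest : 216 * D * (ℓ + 2 * n + cs + (v + 4) + 1) ≤ 8 * (N * N)
     rest = begin
       216 * D * (ℓ + 2 * n + cs + (v + 4) + 1) ≤⟨ *-monoʳ-≤ (216 * D) inner-rest ⟩
       216 * D * (ℓ * N + 21 * N) ≡⟨ j₁ D ℓ N ⟩
       216 * D * ℓ * N + 7 * (216 * D * 3 * N) ≤⟨ +-mono-≤ (*-monoˡ-≤ N Dℓ) (*-monoʳ-≤ 7 (*-monoˡ-≤ N D3)) ⟩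
       N * N + 7 * (N * N) ∎
       where
       j₁ : ∀ D ℓ N → 216 * D * (ℓ * N + 21 * N) ≡ 216 * D * ℓ * N + 7 * (216 * D * 3 * N)
       j₁ = solve-∀
       inner-rest : ℓ + 2 * n + cs + (v + 4) + 1 ≤ ℓ * N + 21 * N
       inner-rest = begin
         ℓ + 2 * n + cs + (v + 4) + 1 ≡⟨ j₂ ℓ n (ℓ * N) v ⟩
         3 * ℓ + 4 * n + v + 11 + ℓ * N ≤⟨ +-monoˡ-≤ (ℓ * N) (+-monoˡ-≤ 11 (+-mono-≤ (+-monoˡ-≤ (4 * n) (*-monoʳ-≤ 3 ℓ≤N)) v≤)) ⟩
         3 * N + 4 * n + (2 + n) + 11 + ℓ * N ≤⟨ ≤-trans (m≤m+n _ (13 * n + 5)) (≤-reflexive (j₃ n (ℓ * N))) ⟩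
         ℓ * N + 21 * N ∎
         where
         j₂ : ∀ ℓ n m v → ℓ + 2 * n + (3 + (1 + (ℓ + (ℓ + ((1 + n) + ((1 + n) + m)))))) + (v + 4) + 1 ≡ 3 * ℓ + 4 * n + v + 11 + m
         j₂ = solve-∀
         j₃ : ∀ n m → 3 * (1 + n) + 4 * n + (2 + n) + 11 + m + (13 * n + 5) ≡ m + 21 * (1 + n)
         j₃ = solve-∀
   total : N * (I n * (codes N * (2 ^ w * Bin (N * N) k))) ≤ 2 ^ (C + (largest N ∸ (v + 4)))
   total = begin
     N * (I n * (codes N * (2 ^ w * Bin (N * N) k))) ≤⟨ product-≤ ℓ (C + (2 * n + largest n) + (cs + (w + e))) (≤-trans (n≤1+n N) le) (product-≤ (C + (2 * n + largest n)) (cs + (w + e)) In (product-≤ cs (w + e) (codes-≤ {N} {ℓ} le) (product-≤ w e ≤-refl (proj₁ (proj₂ bs))))) ⟩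
     2 ^ (ℓ + (C + (2 * n + largest n) + (cs + (w + e)))) ≡⟨ cong (2 ^_) (i ℓ C (2 * n + largest n) (cs + (w + e))) ⟩
     2 ^ (C + (ℓ + ((2 * n + largest n) + (cs + (w + e))))) ≤⟨ ^-monoʳ-≤ 2 (+-monoʳ-≤ C (m+n≤o⇒m≤o∸n (ℓ + ((2 * n + largest n) + (cs + (w + e)))) exponent)) ⟩
     2 ^ (C + (largest N ∸ (v + 4))) ∎
     where
     i : ∀ ℓ C a b → ℓ + (C + a + b) ≡ C + (ℓ + (a + b))
     i = solve-∀

 module _ {n : ℕ} {Code′ : Set} (decode : Code′ → Fin n → Fin n → Fin n → Bool) (dsym : ∀ c → Sym₃ (decode c)) (D : ℕ) (1≤D : 1 ≤ D) where
   -- Systems that nearly lie in a coded set of triples of density at most 4/9 - 1/(9D). This serves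
   -- both for containers that are too sparse and for partitions that are too unbalanced.
   Sparse′ : TripleSystem n → Set
   Sparse′ H = ∃ λ c → D * (9 * ∑³ (λ x y z → 𝟙 (decode c x y z))) + cub n ≤ D * (4 * cub n) ×
                       accuracy D * ∑³ (λ x y z → 𝟙 (E H x y z ∧ not (decode c x y z))) ≤ cub n

   sparse-cover : ∀ {K κ v} → Cov {Code′} (λ _ → ⊤) K → K ≤ 2 ^ (κ * (n * n)) → 1 ≤ n → v ≤ suc n → 216 * D * (κ + 7) ≤ n → 4 * D * 43 ≤ n →
     Cov Sparse′ (2 ^ (largest n ∸ (v + 4)))
   sparse-cover {K} {κ} {v} codes K≤ 1≤n v≤ big big′ = Cov-≤ total (Cov-⊂ (λ { H (c , p) → c , tt , p }) (Cov-∃ codes one-code))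
     where
     open ≤-Reasoning
     cub≤ : cub n ≤ D * (4 * cub n)
     cub≤ = ≤-trans (m≤n*m (cub n) 4) (m≤n*m (4 * cub n) D ⦃ >-nonZero 1≤D ⦄)
     wq = quotient-offset (54 * D) (cub n) (D * (4 * cub n)) (*-mono-≤ {1} {54} (s≤s z≤n) 1≤D) cub≤
     w = proj₁ wq
     1≤acc : 1 ≤ accuracy D
     1≤acc = subst (1 ≤_) (sym (accuracy≡ D)) (*-mono-≤ {1} {216 * D} {1} {suc (216 * D)} (*-mono-≤ {1} {216} (s≤s z≤n) 1≤D) (s≤s z≤n))
     kq = quotient (accuracy D) (cub n) 1≤acc
     k = proj₁ kq
     bs = Bin-small D (cub n) k 1≤D (proj₁ (proj₂ kq))
     e = proj₁ bs
     one-code : ∀ c → Cov (λ H → D * (9 * ∑³ (λ x y z → 𝟙 (decode c x y z))) + cub n ≤ D * (4 * cub n) × accuracy D * ∑³ (λ x y z → 𝟙 (E H x y z ∧ not (decode c x y z))) ≤ cub n) (2 ^ w * Bin (cub n) k)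
     one-code c with D * (9 * ∑³ (λ x y z → 𝟙 (decode c x y z))) + cub n Data.Nat.≤? D * (4 * cub n)
     ... | no ¬p = Cov-∅ (λ H q → ¬p (proj₁ q))
     ... | yes p = family specᵗ k , ≤-trans (≤-reflexive (family-length specᵗ k)) (*-mono-≤ (^-monoʳ-≤ 2 free≤) (Bin-mono k err≤)) ,
         λ H q → family-complete specᵗ k H (agreesᵗ H (λ x y z s r → ⊥-elim (not-fixed (decode c x y z) r)))
           (proj₂ (proj₂ kq) _ (≤-trans (*-monoʳ-≤ (accuracy D) (≤-trans (errorsᵗ H) (∑³-mono (λ x y z → 𝟙-mono (λ m → let a , b = ∧-true {isErr (kind (decode c x y z))} m in ∧-intro b (err⇒ (decode c x y z) a)))))) (proj₂ q)))
       where
       kind : Bool → Kind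
       kind b = if b then free else err
       open TripleSpec (λ x y z → kind (decode c x y z))
       not-fixed : ∀ b {s} → kind b ≡ fixed s → ⊥
       not-fixed true ()
       not-fixed false ()
       err⇒ : ∀ b → isErr (kind b) ≡ true → not b ≡ true
       err⇒ false _ = refl
       free-kind : ∀ b → isFree (kind b) ≡ b
       free-kind true = refl
       free-kind false = refl
       free≤ : #free specᵗ ≤ w
       free≤ = proj₂ (proj₂ wq) _ (≤-trans (+-monoˡ-≤ (cub n) (begin
         54 * D * #free specᵗ ≡⟨ cong (54 * D *_) (trans (sum-specᵗ isFree) (T₃-cong (λ x y z → free-kind (decode c x y z)))) ⟩
         54 * D * T₃ (decode c) ≡⟨ i D (T₃ (decode c)) ⟩
         D * (9 * (6 * T₃ (decode c))) ≤⟨ *-monoʳ-≤ D (*-monoʳ-≤ 9 (T₃-upper (decode c) (dsym c))) ⟩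
         D * (9 * ∑³ (λ x y z → 𝟙 (decode c x y z))) ∎)) p)
         where
         i : ∀ D t → 54 * D * t ≡ D * (9 * (6 * t))
         i = solve-∀
       err≤ : #err specᵗ ≤ cub n
       err≤ = ≤-trans (≤-reflexive (sum-specᵗ isErr)) (≤-trans (∑-≤const (n * n * 1) (λ x → ∑²-≤const 1 (λ y z → 𝟙≤1 _))) (≤-reflexive (trans (cong (n *_) (*-identityʳ (n * n))) (sym (*-assoc n n n)))))
     -- In units of n³/(216D), the gap saves 4, the errors cost 2, and the density of `largest` is
     -- known up to 1. The last unit pays for the code of O(n²) bits.
     exponent : κ * (n * n) + (w + e) + (v + 4) ≤ largest n
     exponent = *-cancelˡ-≤ (216 * D) ⦃ m*n≢0 216 D ⦃ _ ⦄ ⦃ >-nonZero 1≤D ⦄ ⦄ (+-cancelʳ-≤ (16 * (D * cub n) + 4 * cub n) _ _ (begin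
       216 * D * (κ * (n * n) + (w + e) + (v + 4)) + (16 * (D * cub n) + 4 * cub n) ≡⟨ i₁ D (κ * (n * n)) w e v (cub n) ⟩
       4 * (54 * D * w + cub n) + 4 * D * (4 * cub n) + 216 * D * e + 216 * D * (κ * (n * n) + (v + 4))
         ≤⟨ +-monoˡ-≤ _ (+-mono-≤ (+-mono-≤ (*-monoʳ-≤ 4 (proj₁ (proj₂ wq))) (largest-dense (4 * D) big′)) (proj₂ (proj₂ bs))) ⟩
       4 * (D * (4 * cub n)) + (4 * D * (54 * largest n) + cub n) + (2 * cub n + 216 * D) + 216 * D * (κ * (n * n) + (v + 4))
         ≡⟨ i₂ D (largest n) (cub n) (κ * (n * n) + (v + 4)) ⟩
       216 * D * largest n + 16 * (D * cub n) + 3 * cub n + 216 * D * (κ * (n * n) + (v + 4) + 1) ≤⟨ +-monoʳ-≤ (216 * D * largest n + 16 * (D * cub n) + 3 * cub n) rest ⟩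
       216 * D * largest n + 16 * (D * cub n) + 3 * cub n + cub n ≡⟨ i₃ (216 * D * largest n) (16 * (D * cub n)) (cub n) ⟩
       216 * D * largest n + (16 * (D * cub n) + 4 * cub n) ∎))
       where
       i₁ : ∀ D κ w e v M → 216 * D * (κ + (w + e) + (v + 4)) + (16 * (D * M) + 4 * M) ≡ 4 * (54 * D * w + M) + 4 * D * (4 * M) + 216 * D * e + 216 * D * (κ + (v + 4))
       i₁ = solve-∀
       i₂ : ∀ D L M r → 4 * (D * (4 * M)) + (4 * D * (54 * L) + M) + (2 * M + 216 * D) + 216 * D * r ≡ 216 * D * L + 16 * (D * M) + 3 * M + 216 * D * (r + 1)
       i₂ = solve-∀
       i₃ : ∀ a b M → a + b + 3 * M + M ≡ a + (b + 4 * M)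
       i₃ = solve-∀
       n≤nn : n ≤ n * n
       n≤nn = m≤m*n n n ⦃ >-nonZero 1≤n ⦄
       rest : 216 * D * (κ * (n * n) + (v + 4) + 1) ≤ cub n
       rest = begin
         216 * D * (κ * (n * n) + (v + 4) + 1) ≤⟨ *-monoʳ-≤ (216 * D) (begin
           κ * (n * n) + (v + 4) + 1 ≡⟨ j₁ (κ * (n * n)) v ⟩
           κ * (n * n) + (v + 5) ≤⟨ +-monoʳ-≤ (κ * (n * n)) (+-monoˡ-≤ 5 v≤) ⟩
           κ * (n * n) + (1 + n + 5) ≡⟨ j₂ (κ * (n * n)) n ⟩
           κ * (n * n) + (n + 6 * 1) ≤⟨ +-monoʳ-≤ (κ * (n * n)) (+-mono-≤ n≤nn (*-monoʳ-≤ 6 (≤-trans 1≤n n≤nn))) ⟩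
           κ * (n * n) + (n * n + 6 * (n * n)) ≡⟨ j₃ κ (n * n) ⟩
           (κ + 7) * (n * n) ∎) ⟩
         216 * D * ((κ + 7) * (n * n)) ≡⟨ sym (*-assoc (216 * D) (κ + 7) (n * n)) ⟩
         216 * D * (κ + 7) * (n * n) ≤⟨ *-monoˡ-≤ (n * n) big ⟩
         n * (n * n) ≡⟨ sym (*-assoc n n n) ⟩
         cub n ∎
         where
         j₁ : ∀ a v → a + (v + 4) + 1 ≡ a + (v + 5)
         j₁ = solve-∀
         j₂ : ∀ a n → a + (1 + n + 5) ≡ a + (n + 6 * 1)
         j₂ = solve-∀
         j₃ : ∀ κ m → κ * m + (m + 6 * m) ≡ (κ + 7) * m
         j₃ = solve-∀
     total : K * (2 ^ w * Bin (cub n) k) ≤ 2 ^ (largest n ∸ (v + 4))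
     total = ≤-trans (product-≤ (κ * (n * n)) (w + e) K≤ (product-≤ w e ≤-refl (proj₁ (proj₂ bs)))) (^-monoʳ-≤ 2 (m+n≤o⇒m≤o∸n (κ * (n * n) + (w + e)) exponent))

open LossyCounts

-- Every system is lossy, sparse, semi-bipartite or thin.

module Dichotomies where
 cut-cong : ∀ {n M} D₁ {Ks Ks′ : Fin M → Fin n → Bool} {φ φ′ : Fin n → Fin n → Fin M} → (∀ x y v → Ks (φ x y) v ≡ Ks′ (φ′ x y) v) →
   ∀ a b c → Cut.cut D₁ Ks φ a b c ≡ Cut.cut D₁ Ks′ φ′ a b c
 cut-cong {n} D₁ e a b c = cong₂ (λ p m → p ∧ not (n * n ≤ᵇ D₁ * m))
   (cong₂ _∧_ (e a b c) (cong₂ _∧_ (e b a c) (cong₂ _∧_ (e a c b) (cong₂ _∧_ (e c a b) (cong₂ _∧_ (e b c a) (e c b a))))))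
   (∑²-cong (λ x y → cong 𝟙 (cong₂ _∧_ (e x y a) (cong₂ _∧_ (e x y b) (e x y c)))))

 CutCode : ℕ → ℕ → Set
 CutCode M n = Vec (Vec Bool n) (suc M) × Vec (Vec (Fin (suc M)) n) n

 cutOf : ∀ {n} D₁ M → CutCode M n → Fin n → Fin n → Fin n → Bool
 cutOf D₁ M (K , φ) = Cut.cut D₁ (λ i → lookupᵥ (lookupᵥ K i)) (λ x y → lookupᵥ (lookupᵥ φ x) y)

 -- M + 1 vertex sets and n² names of containers. As M does not depend on n, this is O(n²) bits.
 cut-codes-≤ : ∀ M n → 1 ≤ n → (2 ^ n) ^ suc M * (suc M ^ n) ^ n ≤ 2 ^ ((suc M + suc M) * (n * n))
 cut-codes-≤ M n 1≤n = ≤-trans (product-≤ (suc M * (n * n)) (suc M * (n * n)) first second) (≤-reflexive (cong (2 ^_) (sym (*-distribʳ-+ (n * n) (suc M) (suc M)))))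
   where
   first : (2 ^ n) ^ suc M ≤ 2 ^ (suc M * (n * n))
   first = ≤-trans (≤-reflexive (^-*-assoc 2 n (suc M))) (^-monoʳ-≤ 2 (≤-trans (≤-reflexive (*-comm n (suc M))) (*-monoʳ-≤ (suc M) (m≤m*n n n ⦃ >-nonZero 1≤n ⦄))))
   second : (suc M ^ n) ^ n ≤ 2 ^ (suc M * (n * n))
   second = ≤-trans (^-monoˡ-≤ n (^-monoˡ-≤ n (≤-trans (n≤1+n (suc M)) (n<2^n (suc M)))))
     (≤-reflexive (trans (cong (_^ n) (^-*-assoc 2 (suc M) n)) (trans (^-*-assoc 2 (suc M * n) n) (cong (2 ^_) (*-assoc (suc M) n n)))))

 -- Excluded middle for `P` is replaced by deciding membership in its covering list: a vector
 -- outside this list satisfies `¬ P`.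
 Cov-classical : ∀ {m} {P Q R : Vec Bool m → Set} {k l} → Cov P k → Cov Q l → (∀ s → R s → ¬ P s → Q s) → Cov R (k + l)
 Cov-classical {P = P} (L , p , c) (L′ , p′ , c′) f = L ++ L′ , ≤-trans (≤-reflexive (Listₚ.length-++ L)) (+-mono-≤ p p′) , λ s r →
   case Any.any? (λ t → Vecₚ.≡-dec Data.Bool._≟_ s t) L of λ
     { (yes m) → ∈-++ˡ m ; (no ¬m) → ∈-++ʳ L (c′ s (f s r (λ x → ¬m (c s x)))) }

 four-≤ : ∀ {n} (f : Fin n → ℕ) {p q r} → p ≢ q → p ≢ r → q ≢ r → 2 ≤ f p → 1 ≤ f q → 1 ≤ f r → 4 ≤ ∑ f
 four-≤ {n} f {p} {q} {r} p≢q p≢r q≢r fp fq fr = ≤-trans (≤-reflexive (sym (trans (∑-+ _ _) (cong₂ _+_ (∑-δ p (λ _ → 2)) (trans (∑-+ _ _) (cong₂ _+_ (∑-δ q (λ _ → 1)) (∑-δ r (λ _ → 1)))))))) (∑-mono pt)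
   where
   pt : ∀ a → 𝟙 (p ==ᶠ a) * 2 + (𝟙 (q ==ᶠ a) * 1 + 𝟙 (r ==ᶠ a) * 1) ≤ f a
   pt a with p Finₚ.≟ a | q Finₚ.≟ a | r Finₚ.≟ a
   ... | yes refl | yes refl | _ = ⊥-elim (p≢q refl)
   ... | yes refl | no _ | yes refl = ⊥-elim (p≢r refl)
   ... | yes refl | no _ | no _ = fp
   ... | no _ | yes refl | yes refl = ⊥-elim (q≢r refl)
   ... | no _ | yes refl | no _ = fq
   ... | no _ | no _ | yes refl = fr
   ... | no _ | no _ | no _ = z≤n

 two-≤ : ∀ {n} (f : Fin n → ℕ) {q r} → q ≢ r → 1 ≤ f q → 1 ≤ f r → 2 ≤ ∑ f
 two-≤ {n} f {q} {r} q≢r fq fr = ≤-trans (≤-reflexive (sym (trans (∑-+ _ _) (cong₂ _+_ (∑-δ q (λ _ → 1)) (∑-δ r (λ _ → 1)))))) (∑-mono pt)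
   where
   pt : ∀ a → 𝟙 (q ==ᶠ a) * 1 + 𝟙 (r ==ᶠ a) * 1 ≤ f a
   pt a with q Finₚ.≟ a | r Finₚ.≟ a
   ... | yes refl | yes refl = ⊥-elim (q≢r refl)
   ... | yes refl | no _ = fq
   ... | no _ | yes refl = fr
   ... | no _ | no _ = z≤n

 module _ {n : ℕ} (H : TripleSystem n) (X : Fin n → Bool) where
   private
     h : Fin n → Fin n → Fin n → Bool
     h = E {n} H
     hs : Sym₃ h
     hs = E-sym {n} H
     G = crossing h X

     1≤𝟙 : ∀ {b} → b ≡ true → 1 ≤ 𝟙 b
     1≤𝟙 refl = ≤-refl

     star : ∀ p q r → p ≢ q → p ≢ r → q ≢ r → G p q ≡ true → G p r ≡ true → 4 ≤ o₂ G
     star p q r p≢q p≢r q≢r x y = four-≤ (λ a → ∣ G a ∣ₚ) p≢q p≢r q≢r (two-≤ (λ b → 𝟙 (G p b)) q≢r (1≤𝟙 x) (1≤𝟙 y))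
       (≤-trans (1≤𝟙 (trans (crossing-sym {n} H X q p) x)) (term≤∑ (λ b → 𝟙 (G q b)) p)) (≤-trans (1≤𝟙 (trans (crossing-sym {n} H X r p) y)) (term≤∑ (λ b → 𝟙 (G r b)) p))

     ∨-true : ∀ {a b} → a ∨ b ≡ true → a ≡ true ⊎ b ≡ true
     ∨-true {true} _ = inj₁ refl
     ∨-true {false} e = inj₂ e

     distinct₁ : ∀ {i j k} → h i j k ≡ true → i ≢ j
     distinct₁ {i} {j} {k} m i≡j = true≢false (subst (λ j → h i j k ≡ true) (sym i≡j) m) (E-irrefl {n} H i k)

   -- An edge with only one vertex in X contributes two crossing pairs, each counted in both orders.
   crossing-≥4 : ∀ {s s′} → Thin h X s s′ → ¬ SemiBipartite n H → 4 ≤ o₂ G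
   crossing-≥4 th ¬sb with Finₚ.any? (λ a → Finₚ.any? (λ b → Finₚ.any? (λ c → (h a b c ∧ not (twos X a b c)) Data.Bool.≟ true)))
   ... | no none = ⊥-elim (¬sb (Semi⇒SB H X (λ a b c m → bool-case (twos X a b c) id (λ f → ⊥-elim (none (a , b , c , ∧-intro m (cong not f)))))))
   ... | yes (a , b , c , e) = case ∨-true {G a b ∧ G b c} pairs₂ of λ
       { (inj₁ p) → let x , y = ∧-true {G a b} p in star b a c (ab ∘ sym) bc ac (trans (crossing-sym {n} H X b a) x) y
       ; (inj₂ p) → case ∨-true {G b c ∧ G a c} p of λ
         { (inj₁ q) → let x , y = ∧-true {G b c} q in star c a b (ac ∘ sym) (bc ∘ sym) ab (trans (crossing-sym {n} H X c a) y) (trans (crossing-sym {n} H X c b) x)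
         ; (inj₂ q) → let x , y = ∧-true {G a b} q in star a b c ab ac bc x y } }
     where
     m = proj₁ (∧-true {h a b c} e)
     ab = distinct₁ m
     bc = distinct₁ (trans (sym (Sym₃.rot hs a b c)) m)
     ac = distinct₁ (trans (Sym₃.s₂₃ hs a c b) m)
     pairs₂ : any₂ (G a b) (G b c) (G a c) ≡ true
     pairs₂ = inside-pairs {n} H X a b c m (subst (λ t → t ∨ one (X a) (X b) (X c) ≡ true) (not-true (proj₂ (∧-true {h a b c} e))) (Thin.shape th a b c m))

 largest-≥ : ∀ {n} → 43 ≤ n → n * n ≤ largest n
 largest-≥ {n} 43≤n = *-cancelˡ-≤ 54 (+-cancelʳ-≤ (cub n) _ _ (begin
   54 * (n * n) + cub n ≡⟨ cong (_+ cub n) (e₁ (n * n)) ⟩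
   3 * (n * n * 18) + cub n ≤⟨ +-monoˡ-≤ (cub n) (*-monoʳ-≤ 3 (*-monoʳ-≤ (n * n) (≤-trans (m≤m+n 18 25) 43≤n))) ⟩
   3 * cub n + cub n ≡⟨ e₂ (cub n) ⟩
   1 * (4 * cub n) ≤⟨ largest-dense 1 43≤n ⟩
   1 * (54 * largest n) + cub n ≡⟨ cong (_+ cub n) (*-identityˡ _) ⟩
   54 * largest n + cub n ∎))
   where
   open ≤-Reasoning
   e₁ : ∀ m → 54 * m ≡ 3 * (m * 18)
   e₁ = solve-∀
   e₂ : ∀ m → 3 * m + m ≡ 1 * (4 * m)
   e₂ = solve-∀

 -- Dd and q² are the density levels at which cuts and partitions count as sparse.
 module Dichotomy (cert : Certifies cosets forbidden upper lower) (K : Constants) (𝓔≡ : ∀ D → Constants.𝓔 K D ≡ accuracy D) (s′≡ : Constants.s′ K ≡ 128) where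
   open Constants K
   q Ds G E′ Dd D₁ D₂ : ℕ
   q = 9 * R + 20
   Ds = q * q
   -- Sums stand in for maxima: this bound on the bad triples must serve rigidity, through `E₀`, and
   -- the dismissal of unbalanced partitions. It is doubled below because the errors of the
   -- container and of the flag partition add up.
   G = E₀ + accuracy Ds
   E′ = suc (2 * G)
   Dd = K₀ * E′
   D₁ = K₀ * E′ * (K₀ * E′)
   D₂ = 2 * G + accuracy Dd

   1≤Ds : 1 ≤ Ds
   1≤Ds = *-mono-≤ (≤-trans (s≤s z≤n) (m≤n+m 20 (9 * R))) (≤-trans (s≤s z≤n) (m≤n+m 20 (9 * R)))
   1≤Dd : 1 ≤ Dd
   1≤Dd = *-mono-≤ (≤-trans (s≤s z≤n) 2≤K₀) (s≤s z≤n)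
   1≤D₁ : 1 ≤ D₁
   1≤D₁ = *-mono-≤ 1≤Dd 1≤Dd

   abstract
     M : ℕ
     M = proj₁ (container D₁ D₂ 1≤D₁)

     contained : ∀ {n} (h : Fin n → Fin n → Fin n → Bool) → Sym₃ h → F-free h → Contained h M D₁ D₂
     contained = proj₂ (container D₁ D₂ 1≤D₁)

   SparseCut SparsePart : ∀ {n} → TripleSystem n → Set
   SparseCut {n} = Sparse′ {n} (cutOf D₁ M) (λ c → Cut.cut-sym D₁ (λ i → lookupᵥ (lookupᵥ (proj₁ c) i)) (λ x y → lookupᵥ (lookupᵥ (proj₂ c) x) y)) Dd 1≤Dd
   SparsePart {n} = Sparse′ {n} (λ V → twos (lookupᵥ V)) (λ V → twos-sym (lookupᵥ V)) Ds 1≤Ds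

   -- The partition A found by the flag argument is used only for comparison: it bounds the bad
   -- edges of the best partition X. X is then balanced, as the system would otherwise nearly lie in
   -- a sparse complete semi-bipartite system, and rigidity applies to it.
   thin-case : ∀ {n} → 1 ≤ n → (H : TripleSystem n) → IndependentNeighborhoods n H → ¬ SemiBipartite n H → ¬ SparseCut {n} H → ¬ SparsePart {n} H →
     (∀ {D} → D ∈ₗ levels → ¬ Lossy θ D (accuracy D) (E H)) → ∃ λ (V : Vec Bool n) → ThinCase s (lookupᵥ V) H
   thin-case {n} 1≤n H ind ¬sb ¬sc ¬sp nl = V , th , lo , crossing-≥4 {n} H X th ¬sb
     where
     open ≤-Reasoning
     h : Fin n → Fin n → Fin n → Bool
     h = E {n} H
     hs : Sym₃ h
     hs = E-sym {n} H
     ff = IN⇒F-free {n} H ind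
     module Cn = Contained (contained h hs ff)
     c : Fin n → Fin n → Fin n → Bool
     c = Cut.cut D₁ Cn.Ks Cn.φ
     code : CutCode M n
     code = tabulateᵥ (λ i → tabulateᵥ (Cn.Ks i)) , tabulateᵥ (λ x → tabulateᵥ (Cn.φ x))
     code-cut : ∀ x y z → cutOf D₁ M code x y z ≡ c x y z
     code-cut = cut-cong D₁ {λ i → lookupᵥ (lookupᵥ (proj₁ code) i)} {Cn.Ks} {λ x y → lookupᵥ (lookupᵥ (proj₂ code) x) y} {Cn.φ} (λ x y v → trans (cong (λ i → lookupᵥ (lookupᵥ (tabulateᵥ (λ i → tabulateᵥ (Cn.Ks i))) i) v) (trans (cong (λ w → lookupᵥ w y) (Vecₚ.lookup∘tabulate (λ x → tabulateᵥ (Cn.φ x)) x)) (Vecₚ.lookup∘tabulate (Cn.φ x) y)))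
       (trans (cong (λ w → lookupᵥ w v) (Vecₚ.lookup∘tabulate (λ i → tabulateᵥ (Cn.Ks i)) (Cn.φ x y))) (Vecₚ.lookup∘tabulate (Cn.Ks (Cn.φ x y)) v)))
     Σc = ∑³ (λ x y z → 𝟙 (c x y z))
     dense : Dd * (4 * cub n) ≤ Dd * (9 * Σc) + cub n
     dense = <⇒≤ (≰⇒> (λ p → ¬sc (witness p)))
       where
       witness : Dd * (9 * Σc) + cub n ≤ Dd * (4 * cub n) → SparseCut {n} H
       witness p = code , ≤-trans (≤-reflexive (cong (λ m → Dd * (9 * m) + cub n) (∑³-cong (λ x y z → cong 𝟙 (code-cut x y z))))) p ,
         ≤-trans (*-monoˡ-≤ (∑³ (λ x y z → 𝟙 (h x y z ∧ not (cutOf D₁ M code x y z)))) (m≤n+m (accuracy Dd) (2 * G)))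
           (≤-trans (≤-reflexive (cong (D₂ *_) (∑³-cong (λ x y z → cong (λ t → 𝟙 (h x y z ∧ not t)) (code-cut x y z))))) Cn.error)
     err₀ = 4 * cub n ∸ 9 * Σc
     small : K₀ * E′ * err₀ ≤ cub n
     small = ≤-trans (≤-reflexive (*-distribˡ-∸ Dd (4 * cub n) (9 * Σc))) (m≤n+o⇒m∸n≤o (Dd * (4 * cub n)) (Dd * (9 * Σc)) dense)
     stable = flag-stability cert E′ (s≤s z≤n) c (Cut.cut-sym D₁ Cn.Ks Cn.φ) (Cut.cut-F-count D₁ Cn.Ks Cn.φ) err₀ (m≤n+m∸n (4 * cub n) (9 * Σc)) small
     A = proj₁ stable
     badA : G * bad h A ≤ cub n
     badA = two-parts G (bad h A) (∑³ (λ x y z → 𝟙 (h x y z ∧ not (c x y z)))) (∑³ (λ x y z → 𝟙 (c x y z ∧ not (twos A x y z))))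
       (≤-trans (∑³-mono (λ x y z → pt (h x y z) (c x y z) (twos A x y z))) (≤-reflexive (∑³-+ _ _)))
       (scale (m≤m+n (2 * G) (accuracy Dd)) Cn.error) (scale (n≤1+n (2 * G)) (proj₂ stable))
       where
       pt : ∀ m c t → 𝟙 (m ∧ not t) ≤ 𝟙 (m ∧ not c) + 𝟙 (c ∧ not t)
       pt false c t = z≤n
       pt true false t = ≤-trans (𝟙≤1 (not t)) (m≤m+n 1 _)
       pt true true t = ≤-refl
     module O = Optimal h hs (E-irrefl {n} H)
     V = proj₁ O.best-partition
     X : Fin n → Bool
     X = lookupᵥ V
     badX : G * bad h X ≤ cub n
     badX = ≤-trans (*-monoʳ-≤ G (proj₂ O.best-partition A)) badA
     dense-part : q * q * (4 * cub n) ≤ q * q * (9 * ∑³ (λ x y z → 𝟙 (twos X x y z))) + cub n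
     dense-part = sparse-or (λ p → ¬sp (V , p , ≤-trans (*-monoˡ-≤ (bad h X) (m≤n+m (accuracy Ds) E₀)) badX))
       where
       Σt = ∑³ (λ x y z → 𝟙 (twos X x y z))
       sparse-or : ¬ (Ds * (9 * Σt) + cub n ≤ Ds * (4 * cub n)) → q * q * (4 * cub n) ≤ q * q * (9 * Σt) + cub n
       sparse-or ¬p = <⇒≤ (≰⇒> ¬p)
     balanced = dense⇒balanced X R q (m≤m+n (9 * R) 20) (m≤n+m 20 (9 * R)) dense-part
     lo = proj₂ balanced
     th : Thin h X s 128
     th = subst (Thin h X s) s′≡ (Rigid.thin K h hs (E-irrefl {n} H) ff X (proj₁ balanced) lo 1≤n (O.opt X (proj₂ O.best-partition))
       (≤-trans (≤-reflexive (cong (E₀ *_) (sym (bad-own h X)))) (≤-trans (*-monoˡ-≤ (bad h X) (m≤m+n E₀ (accuracy Ds))) badX))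
       (λ {D} d L → nl d (subst (λ e → Lossy θ D e h) (𝓔≡ D) L)))

open Dichotomies

-- The induction and the two bounds.

module Conclusions where
 -- In the `where` block every constant is computed from earlier ones only. Sums are used in place
 -- of maxima, so the inequalities select a summand.
 constants : Constants
 constants = record
   { 𝓔 = accuracy ; s′ = 128 ; s = s ; c₁ = c₁ ; c₂ = c₂ ; F = F ; k₃ = k₃ ; d = d ; k = k ; R = R ; E₀ = suc (e₁ + e₂) ; θ = 2 * (2 * k)
   ; T≡ = refl ; 1≤s′ = s≤s z≤n ; 1≤s = s≤s z≤n ; 1≤c₁ = s≤s z≤n ; 1≤c₂ = s≤s z≤n ; 1≤k₃ = s≤s z≤n ; 1≤k = s≤s z≤n
   ; R₁ = m≤m+n r₁ _ ; R₂ = ≤-trans (m≤m+n r₂ _) (m≤n+m _ r₁) ; R₃ = ≤-trans (≤-trans (m≤m+n r₃ _) (m≤n+m _ r₂)) (m≤n+m _ r₁)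
   ; R₄ = ≤-trans (≤-trans (≤-trans (m≤m+n c₂ _) (m≤n+m _ r₃)) (m≤n+m _ r₂)) (m≤n+m _ r₁)
   ; R₅ = ≤-trans (≤-trans (≤-trans (≤-trans (m≤m+n c₁ _) (m≤n+m _ c₂)) (m≤n+m _ r₃)) (m≤n+m _ r₂)) (m≤n+m _ r₁)
   ; R₇ = ≤-trans (≤-trans (≤-trans (≤-trans (≤-trans (m≤m+n (s * s) 256) (m≤n+m _ c₁)) (m≤n+m _ c₂)) (m≤n+m _ r₃)) (m≤n+m _ r₂)) (m≤n+m _ r₁)
   ; R₈ = ≤-trans (≤-trans (≤-trans (≤-trans (≤-trans (m≤n+m 256 (s * s)) (m≤n+m _ c₁)) (m≤n+m _ c₂)) (m≤n+m _ r₃)) (m≤n+m _ r₂)) (m≤n+m _ r₁)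
   ; d₁ = m≤m+n (2 * k₃) _ ; d₂ = m≤n+m _ (2 * k₃)
   ; k-k₃ = ≤-trans (≤-trans (m≤m+n k₃ a₃) (n≤1+n _)) (m≤m+n k _) ; k-𝓔 = ≤-trans (m≤n+m a₃ k₃) (n≤1+n _)
   ; k-F = ≤-trans (≤-trans (n≤1+n (2 * F)) (m≤m+n k₃ a₃)) (n≤1+n _) ; k₃-F = n≤1+n (2 * F)
   ; F₁ = m≤m+n f₁ _ ; F₂ = ≤-trans (m≤m+n f₂ _) (m≤n+m _ f₁) ; F₃ = ≤-trans (≤-trans (m≤m+n f₃ _) (m≤n+m _ f₂)) (m≤n+m _ f₁)
   ; F₄ = ≤-trans (≤-trans (≤-trans (m≤m+n f₄ f₅) (m≤n+m _ f₃)) (m≤n+m _ f₂)) (m≤n+m _ f₁)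
   ; F₅ = ≤-trans (≤-trans (≤-trans (m≤n+m f₅ f₄) (m≤n+m _ f₃)) (m≤n+m _ f₂)) (m≤n+m _ f₁)
   ; c₂-𝓔 = n≤1+n f₂ ; c₁-𝓔 = n≤1+n f₃ ; s-𝓔 = m≤n+m f₅ 448
   ; E₁ = s≤s (m≤m+n e₁ e₂) ; E₂ = s≤s (m≤n+m e₂ e₁) }
   where
   f₅ = 4 * accuracy 256
   s = 448 + f₅
   f₃ = 2 * accuracy 1
   c₁ = suc f₃
   f₂ = 2 * accuracy c₁
   c₂ = suc f₂
   f₁ = 2 * accuracy c₂
   f₄ = accuracy (s * s)
   F = f₁ + (f₂ + (f₃ + (f₄ + f₅)))
   k₃ = suc (2 * F)
   a₃ = 4 * accuracy (4 * k₃)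
   d = 2 * k₃ + a₃
   k = suc (k₃ + a₃)
   r₁ = 2 * (2 * k) * (2 * (2 * k))
   r₂ = d * d
   r₃ = 4 * k₃
   R = r₁ + (r₂ + (r₃ + (c₂ + (c₁ + (s * s + 256)))))
   e₁ = 2 * (2 * k) * accuracy (2 * (2 * k) * (2 * (2 * k)))
   e₂ = d * accuracy (d * d)

 levels-positive : All (1 ≤_) (Constants.levels constants)
 levels-positive = s≤s z≤n ∷ s≤s z≤n ∷ s≤s z≤n ∷ s≤s z≤n ∷ s≤s z≤n ∷ s≤s z≤n ∷ s≤s z≤n ∷ s≤s z≤n ∷ []

 sumOf : List ℕ → ℕ
 sumOf [] = 0
 sumOf (x ∷ L) = x + sumOf L

 sum-≥ : ∀ L {D : ℕ} → D ∈ₗ L → D ≤ sumOf L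
 sum-≥ (x ∷ L) (here refl) = m≤m+n x _
 sum-≥ (x ∷ L) (there m) = ≤-trans (sum-≥ L m) (m≤n+m _ x)

 module Count (cert : Certifies cosets forbidden upper lower) (K : Constants) (𝓔≡ : ∀ D → Constants.𝓔 K D ≡ accuracy D) (s′≡ : Constants.s′ K ≡ 128)
   (448≤s : 448 ≤ Constants.s K) (positive : All (1 ≤_) (Constants.levels K)) where
   open Constants K using (θ; s; levels)
   open Dichotomy cert K 𝓔≡ s′≡

   abstract
     Dm : ℕ
     Dm = sumOf levels

     Dm-≥ : ∀ {D} → D ∈ₗ levels → D ≤ Dm
     Dm-≥ = sum-≥ levels

   Kℓ = 216 * Dm + 2560
   t₁ = proj₁ (log-small Kℓ)
   t₂ = 216 * Dm * 3
   t₃ = 64 * (12 * Dm) * (12 * Dm) * 43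
   t₄ = 216 * Dd * ((suc M + suc M) + 7)
   t₅ = 4 * Dd * 43
   t₆ = 216 * Ds * (1 + 7)
   t₇ = 4 * Ds * 43

   abstract
     threshold : ℕ
     threshold = t₁ + (t₂ + (t₃ + (t₄ + (t₅ + (t₆ + (t₇ + 1000))))))

     threshold≡ : threshold ≡ t₁ + (t₂ + (t₃ + (t₄ + (t₅ + (t₆ + (t₇ + 1000))))))
     threshold≡ = refl

   Lossies : ∀ n → List ℕ → TripleSystem n → Set
   Lossies n L H = IndependentNeighborhoods n H × ∃ λ D → D ∈ₗ L × Lossy θ D (accuracy D) (E {n} H)

   Cov-levels : ∀ {n B} L → (∀ {D} → D ∈ₗ L → Cov (λ H → IndependentNeighborhoods n H × Lossy θ D (accuracy D) (E {n} H)) B) → Cov (Lossies n L) (length L * B)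
   Cov-levels {n} [] f = Cov-∅ (λ { H (_ , D , () , _) })
   Cov-levels {n} (D ∷ L) f = Cov-⊂ (λ { H (i , _ , here refl , l) → inj₁ (i , l) ; H (i , D , there m , l) → inj₂ (i , D , m , l) })
     (Cov-⊎ (f (here refl)) (Cov-levels {n} L (λ m → f (there m))))

   -- The saving `v` applies to all exceptional systems, and `C` is the same in hypothesis and
   -- conclusion. Without the latter the constant would grow with every vertex.
   step : ∀ n C → threshold ≤ n → I n ≤ 2 ^ (C + (2 * n + largest n)) →
     ∃[ v ] (suc n ≤ 10 * v × v ≤ largest (suc n) × excess (suc n) ≤ 2 ^ (C + (largest (suc n) ∸ v)))
   step n C big In = v , N≤10v , ≤-trans (m≤m+n v 4) v4≤Λ , ≤-trans (Cov-count (N3 N) (NonSemi? N) cover) total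
     where
     open ≤-Reasoning
     N = suc n
     Λ = largest N
     b₁ = subst (_≤ n) threshold≡ big
     b₂ = m+n≤o⇒n≤o t₁ b₁
     b₃ = m+n≤o⇒n≤o t₂ b₂
     b₄ = m+n≤o⇒n≤o t₃ b₃
     b₅ = m+n≤o⇒n≤o t₄ b₄
     b₆ = m+n≤o⇒n≤o t₅ b₅
     b₇ = m+n≤o⇒n≤o t₆ b₆
     1000≤n : 1000 ≤ n
     1000≤n = m+n≤o⇒n≤o t₇ b₇
     1000≤N = ≤-trans 1000≤n (n≤1+n n)
     up : ∀ {m} → m ≤ n → m ≤ N
     up p = ≤-trans p (n≤1+n n)
     logs = proj₂ (log-small Kℓ) N (up (m+n≤o⇒m≤o t₁ b₁))
     ℓ = proj₁ logs
     N<2^ℓ : suc N ≤ 2 ^ ℓ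
     N<2^ℓ = proj₁ (proj₂ logs)
     ℓ-small : Kℓ * ℓ ≤ N
     ℓ-small = proj₂ (proj₂ logs)
     2560ℓ : 2560 * ℓ ≤ N
     2560ℓ = ≤-trans (*-monoˡ-≤ ℓ (m≤n+m 2560 (216 * Dm))) ℓ-small
     -- Here v = ⌊N/10⌋ + 1 is the saving to be reached and u = ⌊20N/128⌋ the one that thin systems
     -- provide. Their difference absorbs the choice of m, which is at most 2ℓ bits, and the 4 bits
     -- for the number of cases.
     vq = quotient 10 N (s≤s z≤n)
     v₀ = proj₁ vq
     v = suc v₀
     N≤10v : N ≤ 10 * v
     N≤10v = <⇒≤ (≰⇒> (λ p → 1+n≰n (proj₂ (proj₂ vq) v p)))
     v₀≤N : v₀ ≤ N
     v₀≤N = ≤-trans (m≤n*m v₀ 10) (proj₁ (proj₂ vq))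
     uq = quotient 128 (20 * N) (s≤s z≤n)
     u = proj₁ uq
     v4ℓ≤u : v + 4 + (ℓ + ℓ) ≤ u
     v4ℓ≤u = proj₂ (proj₂ uq) (v + 4 + (ℓ + ℓ)) (*-cancelˡ-≤ 10 (begin
       10 * (128 * (v + 4 + (ℓ + ℓ))) ≡⟨ i₁ v₀ ℓ ⟩
       128 * (10 * v₀) + 6400 + 2560 * ℓ ≤⟨ +-mono-≤ (+-mono-≤ (*-monoʳ-≤ 128 (proj₁ (proj₂ vq))) (≤-trans (≤ᵇ-true {6400} {71 * 1000} refl) (*-monoʳ-≤ 71 1000≤N))) 2560ℓ ⟩
       128 * N + 71 * N + N ≡⟨ i₂ N ⟩
       10 * (20 * N) ∎))
       where
       i₁ : ∀ v ℓ → 10 * (128 * (1 + v + 4 + (ℓ + ℓ))) ≡ 128 * (10 * v) + 6400 + 2560 * ℓ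
       i₁ = solve-∀
       i₂ : ∀ N → 128 * N + 71 * N + N ≡ 10 * (20 * N)
       i₂ = solve-∀
     NN≤Λ : N * N ≤ Λ
     NN≤Λ = largest-≥ (≤-trans (m≤m+n 43 957) 1000≤N)
     2N≤Λ : N + N ≤ Λ
     2N≤Λ = ≤-trans (≤-reflexive (cong (N +_) (sym (+-identityʳ N)))) (≤-trans (*-monoˡ-≤ N (≤-trans (m≤m+n 2 998) 1000≤N)) NN≤Λ)
     Nu≤Λ : N + u ≤ Λ
     Nu≤Λ = ≤-trans (+-monoʳ-≤ N (*-cancelˡ-≤ 128 (≤-trans (proj₁ (proj₂ uq)) (*-monoˡ-≤ N (m≤m+n 20 108))))) 2N≤Λ
     v4≤Λ : v + 4 ≤ Λ
     v4≤Λ = ≤-trans (≤-trans (≤-trans (m≤m+n (v + 4) (ℓ + ℓ)) v4ℓ≤u) (m≤n+m u N)) Nu≤Λ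
     g = Λ ∸ (v + 4)
     lossy : ∀ {D} → D ∈ₗ levels → Cov (λ H → IndependentNeighborhoods N H × Lossy θ D (accuracy D) (E {N} H)) (2 ^ (C + g))
     lossy {D} m = lossy-cover-≤ θ D (All.lookup positive m) {n} {ℓ} {v} {C} N<2^ℓ
       (≤-trans (*-monoˡ-≤ ℓ (≤-trans (*-monoʳ-≤ 216 (Dm-≥ m)) (m≤m+n (216 * Dm) 2560))) ℓ-small)
       (≤-trans (*-monoˡ-≤ 3 (*-monoʳ-≤ 216 (Dm-≥ m))) (up (m+n≤o⇒m≤o t₂ b₂))) (s≤s v₀≤N)
       (≤-trans (*-monoˡ-≤ 43 (*-mono-≤ (*-monoʳ-≤ 64 (*-monoʳ-≤ 12 (Dm-≥ m))) (*-monoʳ-≤ 12 (Dm-≥ m)))) (m+n≤o⇒m≤o t₃ b₃)) In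
     sparse-cut : Cov (SparseCut {N}) (2 ^ g)
     sparse-cut = sparse-cover {N} (cutOf D₁ M) (λ c → Cut.cut-sym D₁ (λ i → lookupᵥ (lookupᵥ (proj₁ c) i)) (λ x y → lookupᵥ (lookupᵥ (proj₂ c) x) y)) Dd 1≤Dd {κ = suc M + suc M} {v}
       (Cov-× (Cov-Vec (Cov-Vec Cov-Bool N) (suc M)) (Cov-Vec (Cov-Vec (Cov-Fin (suc M)) N) N)) (cut-codes-≤ M N (s≤s z≤n)) (s≤s z≤n) (s≤s v₀≤N)
       (up (m+n≤o⇒m≤o t₄ b₄)) (up (m+n≤o⇒m≤o t₅ b₅))
     sparse-part : Cov (SparsePart {N}) (2 ^ g)
     sparse-part = sparse-cover {N} (λ V → twos (lookupᵥ V)) (λ V → twos-sym (lookupᵥ V)) Ds 1≤Ds {κ = 1} {v} (Cov-Vec Cov-Bool N)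
       (^-monoʳ-≤ 2 (≤-trans (m≤m*n N N) (≤-reflexive (sym (*-identityˡ (N * N)))))) (s≤s z≤n) (s≤s v₀≤N) (up (m+n≤o⇒m≤o t₆ b₆)) (up (m+n≤o⇒m≤o t₇ b₇))
     thin : Cov (λ H → ∃ λ (V : Vec Bool N) → ThinCase s (lookupᵥ V) H) (2 ^ g)
     thin = Cov-≤ size (Cov-⊂ (λ { H (V , t) → V , tt , t }) (Cov-∃ {P = λ V H → ThinCase s (lookupᵥ V) H} (Cov-Vec Cov-Bool N)
       (λ V → thin-cover {N} {s} {ℓ} {u} 448≤s (≤-trans (n≤1+n N) N<2^ℓ) ℓN (proj₁ (proj₂ uq)) (lookupᵥ V))))
       where
       ℓN : 192 + 256 * ℓ ≤ N
       ℓN = *-cancelˡ-≤ 10 (begin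
         10 * (192 + 256 * ℓ) ≡⟨ i₁ ℓ ⟩
         1920 + 2560 * ℓ ≤⟨ +-mono-≤ (≤-trans (≤ᵇ-true {1920} {9 * 1000} refl) (*-monoʳ-≤ 9 1000≤N)) 2560ℓ ⟩
         9 * N + N ≡⟨ i₂ N ⟩
         10 * N ∎)
         where
         i₁ : ∀ ℓ → 10 * (192 + 256 * ℓ) ≡ 1920 + 2560 * ℓ
         i₁ = solve-∀
         i₂ : ∀ N → 9 * N + N ≡ 10 * N
         i₂ = solve-∀
       NN : suc (N * N) ≤ 2 ^ (ℓ + ℓ)
       NN = ≤-trans (s≤s (*-monoʳ-≤ N (n≤1+n N))) (≤-trans (+-monoˡ-≤ (N * suc N) (s≤s (z≤n {N}))) (product-≤ {suc N} {suc N} ℓ ℓ N<2^ℓ N<2^ℓ))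
       g₀ = Λ ∸ (N + u)
       size : 2 ^ N * (suc (N * N) * 2 ^ g₀) ≤ 2 ^ g
       size = ≤-trans (product-≤ N (ℓ + ℓ + g₀) ≤-refl (product-≤ (ℓ + ℓ) g₀ NN ≤-refl)) (^-monoʳ-≤ 2 (m+n≤o⇒m≤o∸n (N + (ℓ + ℓ + g₀)) (begin
         N + (ℓ + ℓ + g₀) + (v + 4) ≡⟨ i N (ℓ + ℓ) g₀ (v + 4) ⟩
         g₀ + (N + (v + 4 + (ℓ + ℓ))) ≤⟨ +-monoʳ-≤ g₀ (+-monoʳ-≤ N v4ℓ≤u) ⟩
         g₀ + (N + u) ≡⟨ m∸n+n≡m Nu≤Λ ⟩
         Λ ∎)))
         where
         i : ∀ N a g b → N + (a + g) + b ≡ g + (N + (b + a))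
         i = solve-∀
     cover : Cov (NonSemi N) (8 * 2 ^ (C + g) + 2 ^ g + 2 ^ g + 2 ^ g)
     cover = Cov-classical {N3 N} {P = λ H → (Lossies N levels H ⊎ SparseCut {N} H) ⊎ SparsePart {N} H} (Cov-⊎ (Cov-⊎ (Cov-levels {N} levels lossy) sparse-cut) sparse-part) thin
       (λ { H (ind , ¬sb) ¬p → thin-case {N} (s≤s z≤n) H ind ¬sb (λ x → ¬p (inj₁ (inj₂ x))) (λ x → ¬p (inj₂ x)) (λ {D} m l → ¬p (inj₁ (inj₁ (ind , D , m , l)))) })
     -- Eight levels of lossy links, two sparse classes and the thin class make eleven lists, fewer
     -- than 2^4; the 4 was subtracted from the exponent in advance.
     total : 8 * 2 ^ (C + g) + 2 ^ g + 2 ^ g + 2 ^ g ≤ 2 ^ (C + (Λ ∸ v))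
     total = begin
       8 * B + 2 ^ g + 2 ^ g + 2 ^ g ≤⟨ +-mono-≤ (+-mono-≤ (+-monoʳ-≤ (8 * B) g≤) g≤) g≤ ⟩
       8 * B + B + B + B ≤⟨ ≤-trans (m≤m+n _ (5 * B)) (≤-reflexive (i B)) ⟩
       2 ^ 4 * B ≡⟨ sym (^-distribˡ-+-* 2 4 (C + g)) ⟩
       2 ^ (4 + (C + g)) ≤⟨ ^-monoʳ-≤ 2 (≤-trans (≤-reflexive (i′ C g)) (+-monoʳ-≤ C (m+n≤o⇒m≤o∸n (g + 4) (≤-reflexive (trans (i″ g v) (m∸n+n≡m v4≤Λ)))))) ⟩
       2 ^ (C + (Λ ∸ v)) ∎
       where
       B = 2 ^ (C + g)
       g≤ : 2 ^ g ≤ B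
       g≤ = ^-monoʳ-≤ 2 (m≤n+m g C)
       i : ∀ B → 8 * B + B + B + B + 5 * B ≡ 16 * B
       i = solve-∀
       i′ : ∀ C g → 4 + (C + g) ≡ C + (g + 4)
       i′ = solve-∀
       i″ : ∀ g v → g + 4 + v ≡ g + (v + 4)
       i″ = solve-∀

   abstract
     C₀ : ℕ
     C₀ = I threshold

     I-threshold : I threshold ≤ 2 ^ C₀
     I-threshold = ≤-trans (n≤1+n _) (n<2^n (I threshold))

   -- At the threshold m < 2^m suffices, whatever the value of `I`. In the step both summands of
   -- `I-split` are at most 2^(C₀ + N + `largest N`), and the doubling disappears in the second
   -- multiple of N.
   I-bound : ∀ k → I (k + threshold) ≤ 2 ^ (C₀ + (2 * (k + threshold) + largest (k + threshold)))
   I-bound zero = ≤-trans I-threshold (^-monoʳ-≤ 2 (m≤m+n C₀ _))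
   I-bound (suc k) = let v , _ , _ , ex = step (k + threshold) C₀ (m≤n+m threshold k) (I-bound k) in
     ≤-trans (I-split N) (≤-trans (+-mono-≤ (≤-trans (S-upper N) (^-monoʳ-≤ 2 (m≤n+m (N + Λ) C₀))) (≤-trans ex (^-monoʳ-≤ 2 (+-monoʳ-≤ C₀ (≤-trans (m∸n≤m Λ v) (m≤n+m Λ N))))))
       (≤-trans (≤-reflexive (cong (2 ^ (C₀ + (N + Λ)) +_) (sym (+-identityʳ _)))) (^-monoʳ-≤ 2 (≤-trans (m≤m+n (suc (C₀ + (N + Λ))) (k + threshold)) (≤-reflexive (e C₀ (k + threshold) Λ))))))
     where
     N = suc k + threshold
     Λ = largest N
     e : ∀ C n L → 1 + (C + ((1 + n) + L)) + n ≡ C + (2 * (1 + n) + L)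
     e = solve-∀

   excess-upper : ∀ N → suc threshold ≤ N → ∃[ v ] (N ≤ 10 * v × v ≤ largest N × excess N ≤ 2 ^ (C₀ + (largest N ∸ v)))
   excess-upper (suc n) (s≤s p) = step n C₀ p (subst (λ n → I n ≤ 2 ^ (C₀ + (2 * n + largest n))) (m∸n+n≡m p) (I-bound (n ∸ threshold)))

 -- An optimal X satisfies n² ≤ `largest n`, hence 6n² ≤ 3x²y, which fails for x ≤ 3 and for y ≤ 1.
 -- The sizes provide the six vertices of the obstruction.
 optimum-sizes : ∀ {n} (X : Fin n → Bool) → 43 ≤ n → T₃ (twos X) ≡ largest n → 4 ≤ ∣ X ∣ₚ × 2 ≤ ∣ (λ i → not (X i)) ∣ₚ
 optimum-sizes {n} X 43≤n e = ≰⇒> few-X , ≰⇒> few-Y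
   where
   open ≤-Reasoning
   x = ∣ X ∣ₚ
   y = ∣ (λ i → not (X i)) ∣ₚ
   1≤n : 1 ≤ n
   1≤n = ≤-trans (s≤s z≤n) 43≤n
   key : 6 * (n * n) ≤ 3 * (x * x * y)
   key = ≤-trans (*-monoʳ-≤ 6 (≤-trans (largest-≥ 43≤n) (≤-reflexive (sym e)))) (≤-trans (T₃-upper (twos X) (twos-sym X)) (≤-reflexive (∑³-twos X)))
   few-X : ¬ x ≤ 3
   few-X p = <⇒≱ (≤-trans (≤ᵇ-true {28} {6 * 43} refl) (*-monoʳ-≤ 6 43≤n)) (*-cancelʳ-≤ (6 * n) 27 n ⦃ >-nonZero 1≤n ⦄ (begin
     6 * n * n ≡⟨ *-assoc 6 n n ⟩
     6 * (n * n) ≤⟨ key ⟩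
     3 * (x * x * y) ≤⟨ *-monoʳ-≤ 3 (*-mono-≤ (*-mono-≤ p p) (∣∣ₚ-≤ (λ i → not (X i)))) ⟩
     3 * (9 * n) ≡⟨ sym (*-assoc 3 9 n) ⟩
     27 * n ∎))
   few-Y : ¬ y ≤ 1
   few-Y p = <⇒≱ (*-monoˡ-< (n * n) ⦃ m*n≢0 n n ⦃ >-nonZero 1≤n ⦄ ⦃ >-nonZero 1≤n ⦄ ⦄ (≤ᵇ-true {4} {6} refl)) (begin
     6 * (n * n) ≤⟨ key ⟩
     3 * (x * x * y) ≤⟨ *-monoʳ-≤ 3 (*-mono-≤ (*-mono-≤ (∣∣ₚ-≤ X) (∣∣ₚ-≤ X)) p) ⟩
     3 * (n * n * 1) ≡⟨ cong (3 *_) (*-identityʳ (n * n)) ⟩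
     3 * (n * n) ∎)

 S-positive : ∀ n → 1 ≤ S n
 S-positive n = ≤-trans (m^n>0 2 (largest n)) (S-lower n)

 -- The excess is at least 2^(L - 2n - 152) and `S n` at most 2^(n + L), where L is `largest n`; the
 -- latter overcounts by the choice of X. The ratio is at least 2^(-3n - 152), more than 2^(-4n) as
 -- soon as n exceeds 152.
 lower-bound : ∀ n → 153 ≤ n → 2 ^ (4 * n) * S n + S n < 2 ^ (4 * n) * I n
 lower-bound n big = begin-strict
   2 ^ (4 * n) * S n + S n <⟨ +-monoʳ-< (2 ^ (4 * n) * S n) (begin-strict
     S n ≤⟨ S-upper n ⟩
     2 ^ (n + largest n) <⟨ ^-monoʳ-< 2 ≤-refl exponents ⟩
     2 ^ (4 * n + m) ≡⟨ ^-distribˡ-+-* 2 (4 * n) m ⟩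
     2 ^ (4 * n) * 2 ^ m ≤⟨ *-monoʳ-≤ (2 ^ (4 * n)) (proj₁ (proj₂ ex)) ⟩
     2 ^ (4 * n) * excess n ∎) ⟩
   2 ^ (4 * n) * S n + 2 ^ (4 * n) * excess n ≡⟨ sym (*-distribˡ-+ (2 ^ (4 * n)) (S n) (excess n)) ⟩
   2 ^ (4 * n) * (S n + excess n) ≤⟨ *-monoʳ-≤ (2 ^ (4 * n)) (S+excess n) ⟩
   2 ^ (4 * n) * I n ∎
   where
   open ≤-Reasoning
   best = largest-attained n
   sizes = optimum-sizes (proj₁ best) (≤-trans (m≤m+n 43 110) big) (proj₂ best)
   ex = excess-lower (proj₁ best) (proj₂ best) (proj₁ sizes) (proj₂ sizes)
   m = proj₁ ex
   exponents : n + largest n < 4 * n + m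
   exponents = begin-strict
     n + largest n ≤⟨ +-monoʳ-≤ n (proj₂ (proj₂ ex)) ⟩
     n + (m + (2 * n + 152)) <⟨ +-monoʳ-< n (+-monoʳ-< m (+-monoʳ-< (2 * n) big)) ⟩
     n + (m + (2 * n + n)) ≡⟨ e n m ⟩
     4 * n + m ∎
     where
     e : ∀ n m → n + (m + (2 * n + n)) ≡ 4 * n + m
     e = solve-∀

 -- The tenth power clears the denominator of 2^(-n/10), and the saved factor 2^(10v) absorbs 2^n.
 -- The successor in the constant makes the inequality strict, as `S n` is positive.
 upper-bound : ∀ C n v → n ≤ 10 * v → v ≤ largest n → excess n ≤ 2 ^ (C + (largest n ∸ v)) → (I n ∸ S n) ^ 10 * 2 ^ n < (suc (2 ^ C) * S n) ^ 10
 upper-bound C n v n≤ v≤ ex = begin-strict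
   (I n ∸ S n) ^ 10 * 2 ^ n ≤⟨ *-mono-≤ (^-monoˡ-≤ 10 (≤-trans (m≤n+o⇒m∸n≤o (I n) (S n) (I-split n)) ex)) (^-monoʳ-≤ 2 n≤) ⟩
   (2 ^ (C + (L ∸ v))) ^ 10 * 2 ^ (10 * v) ≡⟨ cong₂ _*_ (^-*-assoc 2 (C + (L ∸ v)) 10) refl ⟩
   2 ^ ((C + (L ∸ v)) * 10) * 2 ^ (10 * v) ≡⟨ sym (^-distribˡ-+-* 2 ((C + (L ∸ v)) * 10) (10 * v)) ⟩
   2 ^ ((C + (L ∸ v)) * 10 + 10 * v) ≡⟨ cong (2 ^_) (trans (e C (L ∸ v) v) (cong (λ z → (C + z) * 10) (m∸n+n≡m v≤))) ⟩
   2 ^ ((C + L) * 10) ≡⟨ sym (^-*-assoc 2 (C + L) 10) ⟩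
   (2 ^ (C + L)) ^ 10 ≡⟨ cong (_^ 10) (^-distribˡ-+-* 2 C L) ⟩
   (2 ^ C * 2 ^ L) ^ 10 ≤⟨ ^-monoˡ-≤ 10 (*-monoʳ-≤ (2 ^ C) (S-lower n)) ⟩
   (2 ^ C * S n) ^ 10 <⟨ ^-monoˡ-< 10 (*-monoˡ-< (S n) ⦃ >-nonZero (S-positive n) ⦄ {2 ^ C} {suc (2 ^ C)} ≤-refl) ⟩
   (suc (2 ^ C) * S n) ^ 10 ∎
   where
   open ≤-Reasoning
   L = largest n
   e : ∀ C z v → (C + z) * 10 + 10 * v ≡ (C + (z + v)) * 10
   e = solve-∀

 conclusion : Certifies cosets forbidden upper lower → ∃[ C ] ∃[ n₀ ] ((n : ℕ) → n₀ ≤ n →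
                ((2 ^ (4 * n) * S n + S n < 2 ^ (4 * n) * I n) ×
                 ((I n ∸ S n) ^ 10 * 2 ^ n < (C * S n) ^ 10)))
 conclusion cert = suc (2 ^ Z.C₀) , suc Z.threshold + 153 , λ n big →
   lower-bound n (m+n≤o⇒n≤o (suc Z.threshold) big) ,
   (let v , p , q , r = Z.excess-upper n (m+n≤o⇒m≤o (suc Z.threshold) big) in upper-bound Z.C₀ n v p q r)
   where
   module Z = Count cert constants (λ _ → refl) refl (m≤m+n 448 _) levels-positive

open Conclusions

module Certificate where
 -- By evaluation of all 2^15 patterns: five colours and ten triples.
 check : everywhere 15 (inequality cosets forbidden upper lower) ≡ true
 check = refl

theorem1 : ∃[ C ] ∃[ n₀ ] ((n : ℕ) → n₀ ≤ n →
               ((2 ^ (4 * n) * S n + S n < 2 ^ (4 * n) * I n) ×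
                ((I n ∸ S n) ^ 10 * 2 ^ n < (C * S n) ^ 10)))
theorem1 = conclusion (certify Certificate.check)
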